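{- Let $n \geq 9$ and let $k \in \{1, 2, \dotsc, \lfloor n/2 \rfloor\}$. Then there exists a constant $a_k = \frac{n}{k} + \alpha_k$ with $|\alpha_k| \leq \frac{10}{n}$ such that \[ P_k^\circ - Z \;\subset\; T_n - Z \;\subset\; a_k\,(P_k^\circ - Z). \]
   Context: Let $N = n(n-1)/2$ and index the coordinates of $\mathbb{R}^N$ by unordered pairs $\{i,j\}$ of distinct elements of $\{1,\dotsc,n\}$. Let $X \subset \mathbb{R}^N$ be the set of incidence vectors of Hamiltonian cycles of $K_n$ ($x_{ij}=1$ if the cycle uses edge $\{i,j\}$, else $0$). The symmetric traveling salesman polytope is $T_n = \operatorname{conv}(X)$, and $Z$ is its barycenter, the vector with all coordinates equal to $\frac{2}{n-1}$. For a function $f:X\to\mathbb{R}$, let $q_f(h) = \frac{1}{|X|}\sum_{x\in X} f(x)h(x)^2$ be the associated quadratic form on the space of real polynomials of degree at most $k$ on $\mathbb{R}^N$. Let $P_k$ be the set of linear functions $g$ on $\mathbb{R}^N$ (considered via their restriction to $X$) with average value $1$ on $X$ such that $q_g$ is positive semidefinite on polynomials of degree at most $k$. Define $P_k^\circ$ to be the set of points $z$ in the affine span of $X$ such that $g(z) \ge 0$ for all $g \in P_k$. -}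

module Defs where

open import Algebra.Bundles.Raw using (RawMonoid; RawRing)
import Algebra.Definitions.RawMonoid as RawMonoidDefs
import Algebra.Definitions.RawSemiring as RawSemiringDefs
open import Algebra.Module.Bundles.Raw using (RawLeftModule)
import Algebra.Module.Construct.TensorUnit as TensorUnit
open import Algebra.Module.Morphism.Structures using (module LeftModuleMorphisms)
open import Data.Bool using (Bool; if_then_else_)
import Data.Bool.Properties as Bool
open import Data.Fin using (Fin; Fin′; zero; suc; toℕ; inject)
import Data.Fin.Properties as Fin
open import Data.Integer using (+_)
open import Data.List using (List; []; _∷_; map; filter; deduplicate; cartesianProductWith; allFin; length; lookup; foldr)
open import Data.List.Relation.Unary.All using (All)
open import Data.Nat as ℕ using (ℕ; zero; suc)
open import Data.Nat.DivMod using (_mod_)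
import Data.Nat.Properties as ℕ
open import Data.Product using (Σ; ∃; ∃-syntax; _×_; _,_)
open import Data.Rational as ℚ using (ℚ; 0ℚ; 1ℚ; ½)
import Data.Rational.Properties as ℚ
open import Data.Rational.Solver using (module +-*-Solver)
open import Data.Sum using (_⊎_; inj₁; inj₂)
open import Data.Vec as Vec using (Vec; []; _∷_)
open import Data.Vec.Relation.Unary.AllPairs using (allPairs?)
open import Function using (_∘_)
open import Level using (0ℓ)
open import Relation.Binary using (Decidable)
open import Relation.Binary.PropositionalEquality using (_≡_; refl; sym; trans; cong; subst)
open import Relation.Nullary using (Dec; ¬?; does)
open import Relation.Nullary.Decidable using (_×-dec_; _⊎-dec_)
open import Relation.Unary using (Pred)

-- Real numbers are Cauchy sequences of rationals with pointwise operations;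
-- _≈_ takes the place of the quotient.

IsCauchy : (ℕ → ℚ) → Set
IsCauchy s = ∀ ε → 0ℚ ℚ.< ε → ∃[ N ] ∀ m n → N ℕ.≤ m → N ℕ.≤ n → ℚ.∣ s m ℚ.- s n ∣ ℚ.≤ ε

record ℝ : Set where
  constructor mkℝ
  field
    seq    : ℕ → ℚ
    cauchy : IsCauchy seq

open ℝ public

infix 4 _≈_ _≤_

_≈_ : ℝ → ℝ → Set
x ≈ y = ∀ ε → 0ℚ ℚ.< ε → ∃[ N ] ∀ n → N ℕ.≤ n → ℚ.∣ seq x n ℚ.- seq y n ∣ ℚ.≤ ε

_≤_ : ℝ → ℝ → Set
x ≤ y = ∀ ε → 0ℚ ℚ.< ε → ∃[ N ] ∀ n → N ℕ.≤ n → seq x n ℚ.≤ seq y n ℚ.+ ε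

private
  half+half : ∀ ε → ½ ℚ.* ε ℚ.+ ½ ℚ.* ε ≡ ε
  half+half ε = trans (sym (ℚ.*-distribʳ-+ ε ½ ½)) (ℚ.*-identityˡ ε)

  half-pos : ∀ {ε} → 0ℚ ℚ.< ε → 0ℚ ℚ.< ½ ℚ.* ε
  half-pos {ε} 0<ε = subst (ℚ._< ½ ℚ.* ε) (ℚ.*-zeroʳ ½) (ℚ.*-monoʳ-<-pos ½ 0<ε)

  swap-dist : ∀ p q → ℚ.∣ p ℚ.- q ∣ ≡ ℚ.∣ q ℚ.- p ∣
  swap-dist p q = trans (cong ℚ.∣_∣ (identity p q)) (ℚ.∣-p∣≡∣p∣ (q ℚ.- p))
    where
    open +-*-Solver
    identity : ∀ p q → p ℚ.- q ≡ ℚ.- (q ℚ.- p)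
    identity = solve 2 (λ p q → p :- q := :- (q :- p)) refl

  ∣p∣-∣q∣≤ : ∀ p q → ℚ.∣ p ∣ ℚ.- ℚ.∣ q ∣ ℚ.≤ ℚ.∣ p ℚ.- q ∣
  ∣p∣-∣q∣≤ p q = begin
    ℚ.∣ p ∣ ℚ.- ℚ.∣ q ∣                        ≡⟨ cong (λ t → ℚ.∣ t ∣ ℚ.- ℚ.∣ q ∣) (split p q) ⟩
    ℚ.∣ (p ℚ.- q) ℚ.+ q ∣ ℚ.- ℚ.∣ q ∣          ≤⟨ ℚ.+-monoˡ-≤ (ℚ.- ℚ.∣ q ∣) (ℚ.∣p+q∣≤∣p∣+∣q∣ (p ℚ.- q) q) ⟩
    ℚ.∣ p ℚ.- q ∣ ℚ.+ ℚ.∣ q ∣ ℚ.- ℚ.∣ q ∣      ≡⟨ cancel ℚ.∣ p ℚ.- q ∣ ℚ.∣ q ∣ ⟩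
    ℚ.∣ p ℚ.- q ∣                              ∎
    where
    open ℚ.≤-Reasoning
    open +-*-Solver
    split : ∀ p q → p ≡ (p ℚ.- q) ℚ.+ q
    split = solve 2 (λ p q → p := (p :- q) :+ q) refl
    cancel : ∀ a b → a ℚ.+ b ℚ.- b ≡ a
    cancel = solve 2 (λ a b → a :+ b :- b := a) refl

  ∣∣p∣-∣q∣∣≤ : ∀ p q → ℚ.∣ ℚ.∣ p ∣ ℚ.- ℚ.∣ q ∣ ∣ ℚ.≤ ℚ.∣ p ℚ.- q ∣
  ∣∣p∣-∣q∣∣≤ p q with ℚ.∣p∣≡p∨∣p∣≡-p (ℚ.∣ p ∣ ℚ.- ℚ.∣ q ∣)
  ... | inj₁ eq = subst (ℚ._≤ ℚ.∣ p ℚ.- q ∣) (sym eq) (∣p∣-∣q∣≤ p q)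
  ... | inj₂ eq = subst (ℚ._≤ ℚ.∣ p ℚ.- q ∣) (sym (trans eq (flip ℚ.∣ p ∣ ℚ.∣ q ∣)))
                    (subst (ℚ.∣ q ∣ ℚ.- ℚ.∣ p ∣ ℚ.≤_) (swap-dist q p) (∣p∣-∣q∣≤ q p))
    where
    open +-*-Solver
    flip : ∀ a b → ℚ.- (a ℚ.- b) ≡ b ℚ.- a
    flip = solve 2 (λ a b → :- (a :- b) := b :- a) refl

  bounded : ∀ x → ∃[ N ] ∃[ B ] 0ℚ ℚ.< B × (∀ n → N ℕ.≤ n → ℚ.∣ seq x n ∣ ℚ.≤ B)
  bounded x with cauchy x 1ℚ (ℚ.positive⁻¹ 1ℚ)
  ... | N , close = N , ℚ.∣ seq x N ∣ ℚ.+ 1ℚ , 0<B , bound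
    where
    open ℚ.≤-Reasoning
    0<B : 0ℚ ℚ.< ℚ.∣ seq x N ∣ ℚ.+ 1ℚ
    0<B = ℚ.+-mono-≤-< (ℚ.0≤∣p∣ (seq x N)) (ℚ.positive⁻¹ 1ℚ)
    split : ∀ p q → p ≡ q ℚ.+ (p ℚ.- q)
    split = solve 2 (λ p q → p := q :+ (p :- q)) refl
      where open +-*-Solver
    bound : ∀ n → N ℕ.≤ n → ℚ.∣ seq x n ∣ ℚ.≤ ℚ.∣ seq x N ∣ ℚ.+ 1ℚ
    bound n N≤n = begin
      ℚ.∣ seq x n ∣                                  ≡⟨ cong ℚ.∣_∣ (split (seq x n) (seq x N)) ⟩
      ℚ.∣ seq x N ℚ.+ (seq x n ℚ.- seq x N) ∣        ≤⟨ ℚ.∣p+q∣≤∣p∣+∣q∣ (seq x N) (seq x n ℚ.- seq x N) ⟩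
      ℚ.∣ seq x N ∣ ℚ.+ ℚ.∣ seq x n ℚ.- seq x N ∣    ≤⟨ ℚ.+-monoʳ-≤ ℚ.∣ seq x N ∣ (close n N N≤n ℕ.≤-refl) ⟩
      ℚ.∣ seq x N ∣ ℚ.+ 1ℚ                           ∎

  divide : ∀ D ε → 0ℚ ℚ.< D → 0ℚ ℚ.< ε → ∃[ δ ] 0ℚ ℚ.< δ × D ℚ.* δ ≡ ε
  divide D ε 0<D 0<ε = 1/D ℚ.* ε , 0<δ , total
    where
    instance
      D-pos : ℚ.Positive D
      D-pos = ℚ.positive 0<D

      D-nonZero : ℚ.NonZero D
      D-nonZero = ℚ.pos⇒nonZero D

    1/D : ℚ
    1/D = ℚ.1/ D

    0<δ : 0ℚ ℚ.< 1/D ℚ.* ε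
    0<δ = subst (ℚ._< 1/D ℚ.* ε) (ℚ.*-zeroʳ 1/D) (ℚ.*-monoʳ-<-pos 1/D {{ℚ.1/pos⇒pos D}} 0<ε)

    total : D ℚ.* (1/D ℚ.* ε) ≡ ε
    total = trans (sym (ℚ.*-assoc D 1/D ε)) (trans (cong (ℚ._* ε) (ℚ.*-inverseʳ D)) (ℚ.*-identityˡ ε))

  product-bound : ∀ p q B δ → 0ℚ ℚ.< B → ℚ.∣ p ∣ ℚ.≤ B → ℚ.∣ q ∣ ℚ.≤ δ → ℚ.∣ p ℚ.* q ∣ ℚ.≤ B ℚ.* δ
  product-bound p q B δ 0<B p≤B q≤δ = begin
    ℚ.∣ p ℚ.* q ∣        ≡⟨ ℚ.∣p*q∣≡∣p∣*∣q∣ p q ⟩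
    ℚ.∣ p ∣ ℚ.* ℚ.∣ q ∣  ≤⟨ ℚ.*-monoʳ-≤-nonNeg ℚ.∣ q ∣ {{ℚ.∣-∣-nonNeg q}} p≤B ⟩
    B ℚ.* ℚ.∣ q ∣        ≤⟨ ℚ.*-monoˡ-≤-nonNeg B {{ℚ.nonNegative (ℚ.<⇒≤ 0<B)}} q≤δ ⟩
    B ℚ.* δ              ∎
    where open ℚ.≤-Reasoning

  +-pos : ∀ {p q} → 0ℚ ℚ.< p → 0ℚ ℚ.< q → 0ℚ ℚ.< p ℚ.+ q
  +-pos = ℚ.+-mono-<

  product-dist : ∀ a b c d B C δ ε → 0ℚ ℚ.< B → 0ℚ ℚ.< C → (B ℚ.+ C) ℚ.* δ ≡ ε →
    ℚ.∣ a ∣ ℚ.≤ B → ℚ.∣ d ∣ ℚ.≤ C → ℚ.∣ a ℚ.- c ∣ ℚ.≤ δ → ℚ.∣ b ℚ.- d ∣ ℚ.≤ δ →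
    ℚ.∣ a ℚ.* b ℚ.- c ℚ.* d ∣ ℚ.≤ ε
  product-dist a b c d B C δ ε 0<B 0<C total a≤B d≤C a-c≤δ b-d≤δ = begin
    ℚ.∣ a ℚ.* b ℚ.- c ℚ.* d ∣
      ≡⟨ cong ℚ.∣_∣ (rearrange a b c d) ⟩
    ℚ.∣ a ℚ.* (b ℚ.- d) ℚ.+ d ℚ.* (a ℚ.- c) ∣
      ≤⟨ ℚ.∣p+q∣≤∣p∣+∣q∣ (a ℚ.* (b ℚ.- d)) (d ℚ.* (a ℚ.- c)) ⟩
    ℚ.∣ a ℚ.* (b ℚ.- d) ∣ ℚ.+ ℚ.∣ d ℚ.* (a ℚ.- c) ∣
      ≤⟨ ℚ.+-mono-≤ (product-bound a (b ℚ.- d) B δ 0<B a≤B b-d≤δ)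
                    (product-bound d (a ℚ.- c) C δ 0<C d≤C a-c≤δ) ⟩
    B ℚ.* δ ℚ.+ C ℚ.* δ
      ≡⟨ ℚ.*-distribʳ-+ δ B C ⟨
    (B ℚ.+ C) ℚ.* δ
      ≡⟨ total ⟩
    ε ∎
    where
    open ℚ.≤-Reasoning
    rearrange : ∀ a b c d → a ℚ.* b ℚ.- c ℚ.* d ≡ a ℚ.* (b ℚ.- d) ℚ.+ d ℚ.* (a ℚ.- c)
    rearrange = solve 4 (λ a b c d → a :* b :- c :* d := a :* (b :- d) :+ d :* (a :- c)) refl
      where open +-*-Solver

fromℚ : ℚ → ℝ
fromℚ q = mkℝ (λ _ → q) λ ε 0<ε → 0 , λ _ _ _ _ →
  subst (ℚ._≤ ε) (sym (cong ℚ.∣_∣ (ℚ.+-inverseʳ q))) (ℚ.<⇒≤ 0<ε)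

0ℝ 1ℝ : ℝ
0ℝ = fromℚ 0ℚ
1ℝ = fromℚ 1ℚ

infix  8 -_
infixl 7 _*_
infixl 6 _+_ _-_

_+_ : ℝ → ℝ → ℝ
x + y = mkℝ (λ n → seq x n ℚ.+ seq y n) isCauchy
  where
  rearrange : ∀ a b c d → (a ℚ.+ b) ℚ.- (c ℚ.+ d) ≡ (a ℚ.- c) ℚ.+ (b ℚ.- d)
  rearrange = solve 4 (λ a b c d → (a :+ b) :- (c :+ d) := (a :- c) :+ (b :- d)) refl
    where open +-*-Solver

  abstract
    isCauchy : IsCauchy (λ n → seq x n ℚ.+ seq y n)
    isCauchy ε 0<ε with cauchy x (½ ℚ.* ε) (half-pos 0<ε) | cauchy y (½ ℚ.* ε) (half-pos 0<ε)
    ... | N , p | M , q = N ℕ.⊔ M , λ m n N⊔M≤m N⊔M≤n → begin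
      ℚ.∣ (seq x m ℚ.+ seq y m) ℚ.- (seq x n ℚ.+ seq y n) ∣
        ≡⟨ cong ℚ.∣_∣ (rearrange (seq x m) (seq y m) (seq x n) (seq y n)) ⟩
      ℚ.∣ (seq x m ℚ.- seq x n) ℚ.+ (seq y m ℚ.- seq y n) ∣
        ≤⟨ ℚ.∣p+q∣≤∣p∣+∣q∣ (seq x m ℚ.- seq x n) (seq y m ℚ.- seq y n) ⟩
      ℚ.∣ seq x m ℚ.- seq x n ∣ ℚ.+ ℚ.∣ seq y m ℚ.- seq y n ∣
        ≤⟨ ℚ.+-mono-≤ (p m n (ℕ.m⊔n≤o⇒m≤o N M N⊔M≤m) (ℕ.m⊔n≤o⇒m≤o N M N⊔M≤n))
                      (q m n (ℕ.m⊔n≤o⇒n≤o N M N⊔M≤m) (ℕ.m⊔n≤o⇒n≤o N M N⊔M≤n)) ⟩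
      ½ ℚ.* ε ℚ.+ ½ ℚ.* ε
        ≡⟨ half+half ε ⟩
      ε ∎
      where open ℚ.≤-Reasoning

-_ : ℝ → ℝ
- x = mkℝ (λ n → ℚ.- seq x n) λ ε 0<ε → let N , p = cauchy x ε 0<ε in
  N , λ m n N≤m N≤n → subst (ℚ._≤ ε) (sym (neg-dist (seq x m) (seq x n))) (p m n N≤m N≤n)
  where
  open +-*-Solver
  neg-dist : ∀ p q → ℚ.∣ (ℚ.- p) ℚ.- (ℚ.- q) ∣ ≡ ℚ.∣ p ℚ.- q ∣
  neg-dist p q = trans (cong ℚ.∣_∣ (solve 2 (λ p q → (:- p) :- (:- q) := :- (p :- q)) refl p q))
                       (ℚ.∣-p∣≡∣p∣ (p ℚ.- q))

_-_ : ℝ → ℝ → ℝ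
x - y = x + - y

_*_ : ℝ → ℝ → ℝ
x * y = mkℝ (λ n → seq x n ℚ.* seq y n) isCauchy
  where
  abstract
    isCauchy : IsCauchy (λ n → seq x n ℚ.* seq y n)
    isCauchy ε 0<ε =
      let N₁ , B , 0<B , x≤B = bounded x
          N₂ , C , 0<C , y≤C = bounded y
          δ , 0<δ , total    = divide (B ℚ.+ C) ε (+-pos 0<B 0<C) 0<ε
          N₃ , p             = cauchy x δ 0<δ
          N₄ , q             = cauchy y δ 0<δ
      in (N₁ ℕ.⊔ N₂) ℕ.⊔ (N₃ ℕ.⊔ N₄) , λ m n N≤m N≤n →
        let N₁₂≤m = ℕ.m⊔n≤o⇒m≤o (N₁ ℕ.⊔ N₂) (N₃ ℕ.⊔ N₄) N≤m
            N₁₂≤n = ℕ.m⊔n≤o⇒m≤o (N₁ ℕ.⊔ N₂) (N₃ ℕ.⊔ N₄) N≤n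
            N₃₄≤m = ℕ.m⊔n≤o⇒n≤o (N₁ ℕ.⊔ N₂) (N₃ ℕ.⊔ N₄) N≤m
            N₃₄≤n = ℕ.m⊔n≤o⇒n≤o (N₁ ℕ.⊔ N₂) (N₃ ℕ.⊔ N₄) N≤n
        in product-dist (seq x m) (seq y m) (seq x n) (seq y n) B C δ ε 0<B 0<C total
            (x≤B m (ℕ.m⊔n≤o⇒m≤o N₁ N₂ N₁₂≤m))
            (y≤C n (ℕ.m⊔n≤o⇒n≤o N₁ N₂ N₁₂≤n))
            (p m n (ℕ.m⊔n≤o⇒m≤o N₃ N₄ N₃₄≤m) (ℕ.m⊔n≤o⇒m≤o N₃ N₄ N₃₄≤n))
            (q m n (ℕ.m⊔n≤o⇒n≤o N₃ N₄ N₃₄≤m) (ℕ.m⊔n≤o⇒n≤o N₃ N₄ N₃₄≤n))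

∣_∣ : ℝ → ℝ
∣ x ∣ = mkℝ (λ n → ℚ.∣ seq x n ∣) λ ε 0<ε → let N , p = cauchy x ε 0<ε in
  N , λ m n N≤m N≤n → ℚ.≤-trans (∣∣p∣-∣q∣∣≤ (seq x m) (seq x n)) (p m n N≤m N≤n)

ℝ-rawRing : RawRing 0ℓ 0ℓ
ℝ-rawRing = record
  { _≈_ = _≈_
  ; _+_ = _+_
  ; _*_ = _*_
  ; -_  = -_
  ; 0#  = 0ℝ
  ; 1#  = 1ℝ
  }

open RawRing ℝ-rawRing using ()
  renaming (rawSemiring to ℝ-rawSemiring; *-rawMonoid to ℝ-*-rawMonoid)
open RawSemiringDefs ℝ-rawSemiring using (sum; _^_)

-- The empty list never arises in the averages over X below when n ≥ 3.
average : ∀ {A : Set} → List A → (A → ℝ) → ℝ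
average []         f = 0ℝ
average xs@(_ ∷ _) f = fromℚ (+ 1 ℚ./ length xs) * sum (f ∘ lookup xs)

-- (j , i) stands for the unordered pair {inject i , j}, where i < j.
Edge : ℕ → Set
Edge n = Σ (Fin n) Fin′

foldEdges : ∀ {n} (M : RawMonoid 0ℓ 0ℓ) → let open RawMonoid M in (Edge n → Carrier) → Carrier
foldEdges M f = big λ j → big λ i → f (j , i)
  where open RawMonoidDefs M using () renaming (sum to big)

Point : ℕ → Set
Point n = Edge n → ℝ

infix 4 _≋_

_≋_ : ∀ {n} → Point n → Point n → Set
x ≋ y = ∀ e → x e ≈ y e

Point-rawLeftModule : ℕ → RawLeftModule ℝ 0ℓ 0ℓ
Point-rawLeftModule n = record
  { Carrierᴹ = Point n
  ; _≈ᴹ_     = _≋_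
  ; _+ᴹ_     = λ x y e → x e + y e
  ; _*ₗ_     = λ a x e → a * x e
  ; 0ᴹ       = λ _ → 0ℝ
  ; -ᴹ_      = λ x e → - x e
  }

IsLinear : ∀ {n} → (Point n → ℝ) → Set
IsLinear {n} = IsLeftModuleHomomorphism
  where open LeftModuleMorphisms (Point-rawLeftModule n) (TensorUnit.rawLeftModule {R = ℝ-rawRing})

infixl 6 _⊖_
infixr 7 _⊙_

_⊖_ : ∀ {n} → Pred (Point n) 0ℓ → Point n → Pred (Point n) 0ℓ
(A ⊖ z) v = ∃[ u ] A u × v ≋ (λ e → u e - z e)

_⊙_ : ∀ {n} → ℝ → Pred (Point n) 0ℓ → Pred (Point n) 0ℓ
(a ⊙ A) v = ∃[ u ] A u × v ≋ (λ e → a * u e)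

combination : ∀ {n} (xs : List (Point n)) → (Fin (length xs) → ℝ) → Point n
combination xs w e = sum λ t → w t * lookup xs t e

AffineSpan : ∀ {n} → List (Point n) → Pred (Point n) 0ℓ
AffineSpan xs z = ∃[ w ] sum w ≈ 1ℝ × z ≋ combination xs w

ConvexHull : ∀ {n} → List (Point n) → Pred (Point n) 0ℓ
ConvexHull xs z = ∃[ w ] (∀ t → 0ℝ ≤ w t) × sum w ≈ 1ℝ × z ≋ combination xs w

sequences : ∀ n m → List (Vec (Fin n) m)
sequences n zero    = [] ∷ []
sequences n (suc m) = cartesianProductWith _∷_ (allFin n) (sequences n m)

-- Each Hamiltonian cycle occurs here once for every choice of starting vertex
-- and orientation; X removes these repetitions.
cyclicTours : ∀ n → List (Vec (Fin n) n)
cyclicTours n = filter (allPairs? λ i j → ¬? (i Fin.≟ j)) (sequences n n)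

next : ∀ {n} → Fin n → Fin n
next {n} t = (suc (toℕ t) mod n) {{Fin.nonZeroIndex t}}

Uses : ∀ {n} → Vec (Fin n) n → Edge n → Set
Uses σ (j , i) = ∃ λ t →
    (Vec.lookup σ t ≡ inject i × Vec.lookup σ (next t) ≡ j)
  ⊎ (Vec.lookup σ t ≡ j × Vec.lookup σ (next t) ≡ inject i)

uses? : ∀ {n} (σ : Vec (Fin n) n) (e : Edge n) → Dec (Uses σ e)
uses? σ (j , i) = Fin.any? λ t →
          (Vec.lookup σ t Fin.≟ inject i ×-dec Vec.lookup σ (next t) Fin.≟ j)
  ⊎-dec (Vec.lookup σ t Fin.≟ j ×-dec Vec.lookup σ (next t) Fin.≟ inject i)

sameEdges? : ∀ {n} → Decidable (λ (χ ψ : Edge n → Bool) → ∀ j i → χ (j , i) ≡ ψ (j , i))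
sameEdges? χ ψ = Fin.all? λ j → Fin.all? λ i → χ (j , i) Bool.≟ ψ (j , i)

X : ∀ n → List (Point n)
X n = map (λ χ e → if χ e then 1ℝ else 0ℝ)
        (deduplicate sameEdges? (map (λ σ e → does (uses? σ e)) (cyclicTours n)))

T : ∀ n → Pred (Point n) 0ℓ
T n = ConvexHull (X n)

-- There are no edges, hence no coordinates, when n < 2.
Z : ∀ n → Point n
Z (suc (suc m)) _          = fromℚ (+ 2 ℚ./ suc m)
Z (suc zero)    (zero , ())

Monomial : ℕ → Set
Monomial n = Edge n → ℕ

degree : ∀ {n} → Monomial n → ℕ
degree = foldEdges ℕ.+-0-rawMonoid

-- A polynomial is a formal sum of terms; a monomial may occur in several terms.
Polynomial : ℕ → Set
Polynomial n = List (ℝ × Monomial n)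

DegreeAtMost : ∀ {n} → ℕ → Pred (Polynomial n) 0ℓ
DegreeAtMost k = All λ (_ , μ) → degree μ ℕ.≤ k

eval : ∀ {n} → Polynomial n → Point n → ℝ
eval h x = foldr (λ (c , μ) acc → c * foldEdges ℝ-*-rawMonoid (λ e → x e ^ μ e) + acc) 0ℝ h

q : ∀ {n} → (Point n → ℝ) → Polynomial n → ℝ
q {n} f h = average (X n) λ x → f x * (eval h x * eval h x)

record P (n k : ℕ) (g : Point n → ℝ) : Set where
  field
    linear    : IsLinear g
    average-1 : average (X n) g ≈ 1ℝ
    psd       : ∀ (h : Polynomial n) → DegreeAtMost k h → 0ℝ ≤ q g h

P° : ∀ n k → Pred (Point n) 0ℓ
P° n k z = AffineSpan (X n) z × (∀ g → P n k g → 0ℝ ≤ g z)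

{-# OPTIONS --safe #-}
-- P° ⊂ T holds because T is a polytope with finitely many rational vertices: Fourier–Motzkin
-- elimination, valid over ℝ since its coefficients are rational, expresses a point z of the
-- affine span as a convex combination of vertices as soon as every functional that is
-- nonnegative on X is nonnegative at z, and such functionals, once normalised, lie in P.
--
-- For T - Z ⊂ a (P° - Z) with a = n/k + 10/n one shows g(x) ≥ 1 - a for g ∈ P and every tour x.
-- Take k of the alternate edges of x and let h be the product of their coordinates, the
-- indicator of the tours that contain these k edges. The tours containing a matching are
-- arrangements of blocks (matched pairs and single vertices), of which s + j blocks with j pairs
-- have 2^j (s + j)! orders, so 0 ≤ q_g(h) is an explicit linear inequality in the values
-- of g at the edges. Summed over all rotations of x and all choices of the k edges it
-- involves only the average of g and g(x), and yields g(x) ≥ 1 - n/k - 10/n.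
module Submission where

-- The order of Cauchy reals is undecidable, so no argument may branch on the sign of a real.
-- Elimination therefore branches only on rational coefficients, membership in `P°` is applied only
-- to functionals with rational coefficients, and the one choice of a real, between finitely many
-- bounds, is made by a maximum. No Farkas certificate is extracted: each vertex is trivially a
-- convex combination of itself, so every row derived from the system holds at every vertex, and
-- this is what makes its right-hand side nonnegative on `X`.
--
-- For the second inclusion, matchings are used because their blocks have at most two vertices, so
-- the number of tours through a prescribed step depends only on which ends are matched; `k` at most
-- n/2 is what allows `k` alternate edges to be chosen. A tour is a sequence, so a matched pair may
-- be split between its last and first entries; rotating such a tour by one place repairs this.
-- After averaging, the claim is a polynomial inequality in the numbers of selected and unselected
-- pairs. The constant 10 leaves room for it to hold coefficient by coefficient, separately for even
-- and odd `n`.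

-- Cauchy reals as an ordered commutative ring with maxima.

module Reals where

  open import Algebra.Bundles using (CommutativeRing)
  open import Data.Nat as ℕ using (ℕ)
  import Data.Nat.Properties as ℕ
  open import Data.Product using (∃-syntax; _×_; _,_)
  open import Data.Rational as ℚ using (ℚ; 0ℚ; 1ℚ; ½)
  import Data.Rational.Properties as ℚ
  open import Data.Rational.Solver using (module +-*-Solver)
  open import Data.Sum using (inj₁; inj₂)
  open import Level using (0ℓ)
  open import Relation.Binary.PropositionalEquality using (_≡_; refl; sym; trans; cong; subst)
  open import Defs

  half-pos : ∀ {ε} → 0ℚ ℚ.< ε → 0ℚ ℚ.< ½ ℚ.* ε
  half-pos {ε} 0<ε = subst (ℚ._< ½ ℚ.* ε) (ℚ.*-zeroʳ ½) (ℚ.*-monoʳ-<-pos ½ 0<ε)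

  half+half : ∀ ε → ½ ℚ.* ε ℚ.+ ½ ℚ.* ε ≡ ε
  half+half ε = trans (sym (ℚ.*-distribʳ-+ ε ½ ½)) (ℚ.*-identityˡ ε)

  p-q≤ε⇒p≤q+ε : ∀ p q {ε} → p ℚ.- q ℚ.≤ ε → p ℚ.≤ q ℚ.+ ε
  p-q≤ε⇒p≤q+ε p q {ε} h = subst (ℚ._≤ q ℚ.+ ε) (identity p q) (ℚ.+-monoʳ-≤ q h)
    where
    open +-*-Solver
    identity : ∀ p q → q ℚ.+ (p ℚ.- q) ≡ p
    identity = solve 2 (λ p q → q :+ (p :- q) := p) refl

  p≤q+ε⇒p-q≤ε : ∀ p q {ε} → p ℚ.≤ q ℚ.+ ε → p ℚ.- q ℚ.≤ ε
  p≤q+ε⇒p-q≤ε p q {ε} h = subst (p ℚ.- q ℚ.≤_) (identity q ε) (ℚ.+-monoˡ-≤ (ℚ.- q) h)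
    where
    open +-*-Solver
    identity : ∀ q e → q ℚ.+ e ℚ.- q ≡ e
    identity = solve 2 (λ q e → q :+ e :- q := e) refl

  neg-sub : ∀ p q → ℚ.- (p ℚ.- q) ≡ q ℚ.- p
  neg-sub = solve 2 (λ p q → :- (p :- q) := q :- p) refl
    where open +-*-Solver

  ∣p∣≤-intro : ∀ p {ε} → p ℚ.≤ ε → ℚ.- p ℚ.≤ ε → ℚ.∣ p ∣ ℚ.≤ ε
  ∣p∣≤-intro p p≤ε -p≤ε with ℚ.∣p∣≡p∨∣p∣≡-p p
  ... | inj₁ eq = subst (ℚ._≤ _) (sym eq) p≤ε
  ... | inj₂ eq = subst (ℚ._≤ _) (sym eq) -p≤ε

  p≤∣p∣ : ∀ p → p ℚ.≤ ℚ.∣ p ∣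
  p≤∣p∣ p with ℚ.≤-total 0ℚ p
  ... | inj₁ 0≤p = ℚ.≤-reflexive (sym (ℚ.0≤p⇒∣p∣≡p 0≤p))
  ... | inj₂ p≤0 = ℚ.≤-trans p≤0 (ℚ.0≤∣p∣ p)

  -p≤∣p∣ : ∀ p → ℚ.- p ℚ.≤ ℚ.∣ p ∣
  -p≤∣p∣ p = subst (ℚ.- p ℚ.≤_) (ℚ.∣-p∣≡∣p∣ p) (p≤∣p∣ (ℚ.- p))

  ∣p-q∣≤-intro : ∀ p q {ε} → p ℚ.≤ q ℚ.+ ε → q ℚ.≤ p ℚ.+ ε → ℚ.∣ p ℚ.- q ∣ ℚ.≤ ε
  ∣p-q∣≤-intro p q h h′ = ∣p∣≤-intro (p ℚ.- q) (p≤q+ε⇒p-q≤ε p q h)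
    (subst (ℚ._≤ _) (sym (neg-sub p q)) (p≤q+ε⇒p-q≤ε q p h′))

  ∣p-q∣≤⇒≤ : ∀ p q {ε} → ℚ.∣ p ℚ.- q ∣ ℚ.≤ ε → p ℚ.≤ q ℚ.+ ε
  ∣p-q∣≤⇒≤ p q h = p-q≤ε⇒p≤q+ε p q (ℚ.≤-trans (p≤∣p∣ (p ℚ.- q)) h)

  ∣p-q∣≤⇒≥ : ∀ p q {ε} → ℚ.∣ p ℚ.- q ∣ ℚ.≤ ε → q ℚ.≤ p ℚ.+ ε
  ∣p-q∣≤⇒≥ p q h = p-q≤ε⇒p≤q+ε q p
    (ℚ.≤-trans (subst (ℚ._≤ ℚ.∣ p ℚ.- q ∣) (neg-sub p q) (-p≤∣p∣ (p ℚ.- q))) h)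

  p≤p+ε : ∀ p {ε} → 0ℚ ℚ.< ε → p ℚ.≤ p ℚ.+ ε
  p≤p+ε p {ε} 0<ε = subst (ℚ._≤ p ℚ.+ ε) (ℚ.+-identityʳ p) (ℚ.+-monoʳ-≤ p (ℚ.<⇒≤ 0<ε))

  ≤-trans : ∀ {x y z} → x ≤ y → y ≤ z → x ≤ z
  ≤-trans {x} {y} {z} x≤y y≤z ε 0<ε =
    let N , p = x≤y (½ ℚ.* ε) (half-pos 0<ε)
        M , q = y≤z (½ ℚ.* ε) (half-pos 0<ε)
    in N ℕ.⊔ M , λ n N⊔M≤n → begin
      seq x n                              ≤⟨ p n (ℕ.m⊔n≤o⇒m≤o N M N⊔M≤n) ⟩
      seq y n ℚ.+ ½ ℚ.* ε                  ≤⟨ ℚ.+-monoˡ-≤ (½ ℚ.* ε) (q n (ℕ.m⊔n≤o⇒n≤o N M N⊔M≤n)) ⟩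
      seq z n ℚ.+ ½ ℚ.* ε ℚ.+ ½ ℚ.* ε      ≡⟨ ℚ.+-assoc (seq z n) (½ ℚ.* ε) (½ ℚ.* ε) ⟩
      seq z n ℚ.+ (½ ℚ.* ε ℚ.+ ½ ℚ.* ε)    ≡⟨ cong (seq z n ℚ.+_) (half+half ε) ⟩
      seq z n ℚ.+ ε                        ∎
    where open ℚ.≤-Reasoning

  ≤-antisym : ∀ {x y} → x ≤ y → y ≤ x → x ≈ y
  ≤-antisym {x} {y} x≤y y≤x ε 0<ε =
    let N , p = x≤y ε 0<ε
        M , q = y≤x ε 0<ε
    in N ℕ.⊔ M , λ n N⊔M≤n →
      ∣p-q∣≤-intro (seq x n) (seq y n) (p n (ℕ.m⊔n≤o⇒m≤o N M N⊔M≤n)) (q n (ℕ.m⊔n≤o⇒n≤o N M N⊔M≤n))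

  ≤-reflexive : ∀ x y → x ≈ y → x ≤ y
  ≤-reflexive x y x≈y ε 0<ε = let N , p = x≈y ε 0<ε in
    N , λ n N≤n → ∣p-q∣≤⇒≤ (seq x n) (seq y n) (p n N≤n)

  ≥-reflexive : ∀ x y → x ≈ y → y ≤ x
  ≥-reflexive x y x≈y ε 0<ε = let N , p = x≈y ε 0<ε in
    N , λ n N≤n → ∣p-q∣≤⇒≥ (seq x n) (seq y n) (p n N≤n)

  pointwise-≤ : ∀ x y → (∀ n → seq x n ℚ.≤ seq y n) → x ≤ y
  pointwise-≤ x y h ε 0<ε = 0 , λ n _ → ℚ.≤-trans (h n) (p≤p+ε (seq y n) 0<ε)

  pointwise-≈ : ∀ x y → (∀ n → seq x n ≡ seq y n) → x ≈ y
  pointwise-≈ x y h = ≤-antisym {x} {y} (pointwise-≤ x y λ n → ℚ.≤-reflexive (h n)) (pointwise-≤ y x λ n → ℚ.≤-reflexive (sym (h n)))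

  ≈-sym : ∀ x y → x ≈ y → y ≈ x
  ≈-sym x y x≈y = ≤-antisym {y} {x} (≥-reflexive x y x≈y) (≤-reflexive x y x≈y)

  ≈-trans : ∀ {x y z} → x ≈ y → y ≈ z → x ≈ z
  ≈-trans {x} {y} {z} p q = ≤-antisym {x} {z}
    (≤-trans {x} {y} {z} (≤-reflexive x y p) (≤-reflexive y z q))
    (≤-trans {z} {y} {x} (≥-reflexive y z q) (≥-reflexive x y p))

  +-mono-≤ : ∀ {x y u v} → x ≤ y → u ≤ v → x + u ≤ y + v
  +-mono-≤ {x} {y} {u} {v} x≤y u≤v ε 0<ε =
    let N , p = x≤y (½ ℚ.* ε) (half-pos 0<ε)
        M , q = u≤v (½ ℚ.* ε) (half-pos 0<ε)
    in N ℕ.⊔ M , λ n N⊔M≤n → begin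
      seq x n ℚ.+ seq u n
        ≤⟨ ℚ.+-mono-≤ (p n (ℕ.m⊔n≤o⇒m≤o N M N⊔M≤n)) (q n (ℕ.m⊔n≤o⇒n≤o N M N⊔M≤n)) ⟩
      (seq y n ℚ.+ ½ ℚ.* ε) ℚ.+ (seq v n ℚ.+ ½ ℚ.* ε)
        ≡⟨ rearrange (seq y n) (seq v n) (½ ℚ.* ε) ⟩
      (seq y n ℚ.+ seq v n) ℚ.+ (½ ℚ.* ε ℚ.+ ½ ℚ.* ε)
        ≡⟨ cong ((seq y n ℚ.+ seq v n) ℚ.+_) (half+half ε) ⟩
      seq y n ℚ.+ seq v n ℚ.+ ε ∎
    where
    open ℚ.≤-Reasoning
    rearrange : ∀ a b d → (a ℚ.+ d) ℚ.+ (b ℚ.+ d) ≡ (a ℚ.+ b) ℚ.+ (d ℚ.+ d)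
    rearrange = solve 3 (λ a b d → (a :+ d) :+ (b :+ d) := (a :+ b) :+ (d :+ d)) refl
      where open +-*-Solver

  +-cong : ∀ {x y u v} → x ≈ y → u ≈ v → x + u ≈ y + v
  +-cong {x} {y} {u} {v} p q = ≤-antisym {x + u} {y + v}
    (+-mono-≤ {x} {y} {u} {v} (≤-reflexive x y p) (≤-reflexive u v q))
    (+-mono-≤ {y} {x} {v} {u} (≥-reflexive x y p) (≥-reflexive u v q))

  -‿mono-≤ : ∀ {x y} → x ≤ y → - y ≤ - x
  -‿mono-≤ {x} {y} x≤y ε 0<ε = let N , p = x≤y ε 0<ε in
    N , λ n N≤n → subst (ℚ._≤ ℚ.- seq x n ℚ.+ ε) (identity (seq x n) (seq y n))
      (ℚ.+-monoʳ-≤ (ℚ.- seq x n) (p≤q+ε⇒p-q≤ε (seq x n) (seq y n) (p n N≤n)))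
    where
    open +-*-Solver
    identity : ∀ a b → (ℚ.- a) ℚ.+ (a ℚ.- b) ≡ ℚ.- b
    identity = solve 2 (λ a b → (:- a) :+ (a :- b) := :- b) refl

  -‿cong : ∀ {x y} → x ≈ y → - x ≈ - y
  -‿cong {x} {y} p = ≤-antisym { - x} { - y} (-‿mono-≤ {y} {x} (≥-reflexive x y p)) (-‿mono-≤ {x} {y} (≤-reflexive x y p))

  bounded : ∀ x → ∃[ N ] ∃[ B ] 0ℚ ℚ.< B × (∀ n → N ℕ.≤ n → ℚ.∣ seq x n ∣ ℚ.≤ B)
  bounded x with cauchy x 1ℚ (ℚ.positive⁻¹ 1ℚ)
  ... | N , close = N , ℚ.∣ seq x N ∣ ℚ.+ 1ℚ , ℚ.+-mono-≤-< (ℚ.0≤∣p∣ (seq x N)) (ℚ.positive⁻¹ 1ℚ) ,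
    λ n N≤n → let d = close n N N≤n ℕ.≤-refl in ∣p∣≤-intro (seq x n)
      (ℚ.≤-trans (∣p-q∣≤⇒≤ (seq x n) (seq x N) d) (ℚ.+-monoˡ-≤ 1ℚ (p≤∣p∣ (seq x N))))
      (ℚ.≤-trans (lower (seq x n) (seq x N) d) (ℚ.+-monoˡ-≤ 1ℚ (-p≤∣p∣ (seq x N))))
    where
    open +-*-Solver
    lower : ∀ a b → ℚ.∣ a ℚ.- b ∣ ℚ.≤ 1ℚ → ℚ.- a ℚ.≤ (ℚ.- b) ℚ.+ 1ℚ
    lower a b d = subst (ℚ._≤ (ℚ.- b) ℚ.+ 1ℚ) (solve 2 (λ a b → (:- b) :+ (b :- a) := :- a) refl a b)
      (ℚ.+-monoʳ-≤ (ℚ.- b) (p≤q+ε⇒p-q≤ε b a (∣p-q∣≤⇒≥ a b d)))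

  divide : ∀ B ε → 0ℚ ℚ.< B → 0ℚ ℚ.< ε → ∃[ δ ] 0ℚ ℚ.< δ × δ ℚ.* B ≡ ε
  divide B ε 0<B 0<ε = ε ℚ.* 1/B , 0<δ , total
    where
    instance
      B-pos : ℚ.Positive B
      B-pos = ℚ.positive 0<B

      B-nonZero : ℚ.NonZero B
      B-nonZero = ℚ.pos⇒nonZero B

    1/B : ℚ
    1/B = ℚ.1/ B

    0<δ : 0ℚ ℚ.< ε ℚ.* 1/B
    0<δ = subst (ℚ._< ε ℚ.* 1/B) (ℚ.*-zeroˡ 1/B) (ℚ.*-monoˡ-<-pos 1/B {{ℚ.1/pos⇒pos B}} 0<ε)

    total : ε ℚ.* 1/B ℚ.* B ≡ ε
    total = trans (ℚ.*-assoc ε 1/B B) (trans (cong (ε ℚ.*_) (ℚ.*-inverseˡ B)) (ℚ.*-identityʳ ε))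

  -- A Cauchy sequence is eventually bounded, so if `y` stays below `B`, it is enough that `x` and
  -- `x′` come within ε / B of each other.
  *-congʳ : ∀ {x x′} y → x ≈ x′ → x * y ≈ x′ * y
  *-congʳ {x} {x′} y x≈x′ ε 0<ε =
    let N , B , 0<B , y≤B = bounded y
        δ , 0<δ , δB≡ε    = divide B ε 0<B 0<ε
        M , p             = x≈x′ δ 0<δ
    in N ℕ.⊔ M , λ n N⊔M≤n → begin
      ℚ.∣ seq x n ℚ.* seq y n ℚ.- seq x′ n ℚ.* seq y n ∣
        ≡⟨ cong ℚ.∣_∣ (factor (seq x n) (seq x′ n) (seq y n)) ⟩
      ℚ.∣ (seq x n ℚ.- seq x′ n) ℚ.* seq y n ∣
        ≡⟨ ℚ.∣p*q∣≡∣p∣*∣q∣ (seq x n ℚ.- seq x′ n) (seq y n) ⟩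
      ℚ.∣ seq x n ℚ.- seq x′ n ∣ ℚ.* ℚ.∣ seq y n ∣
        ≤⟨ ℚ.*-monoʳ-≤-nonNeg ℚ.∣ seq y n ∣ {{ℚ.∣-∣-nonNeg (seq y n)}} (p n (ℕ.m⊔n≤o⇒n≤o N M N⊔M≤n)) ⟩
      δ ℚ.* ℚ.∣ seq y n ∣
        ≤⟨ ℚ.*-monoˡ-≤-nonNeg δ {{ℚ.nonNegative (ℚ.<⇒≤ 0<δ)}} (y≤B n (ℕ.m⊔n≤o⇒m≤o N M N⊔M≤n)) ⟩
      δ ℚ.* B
        ≡⟨ δB≡ε ⟩
      ε ∎
    where
    open ℚ.≤-Reasoning
    factor : ∀ a b c → a ℚ.* c ℚ.- b ℚ.* c ≡ (a ℚ.- b) ℚ.* c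
    factor = solve 3 (λ a b c → a :* c :- b :* c := (a :- b) :* c) refl
      where open +-*-Solver

  *-comm : ∀ x y → x * y ≈ y * x
  *-comm x y = pointwise-≈ (x * y) (y * x) λ n → ℚ.*-comm (seq x n) (seq y n)

  *-cong : ∀ {x x′ y y′} → x ≈ x′ → y ≈ y′ → x * y ≈ x′ * y′
  *-cong {x} {x′} {y} {y′} p q = ≈-trans {x * y} {x′ * y} {x′ * y′} (*-congʳ {x} {x′} y p)
    (≈-trans {x′ * y} {y * x′} {x′ * y′} (*-comm x′ y)
      (≈-trans {y * x′} {y′ * x′} {x′ * y′} (*-congʳ {y} {y′} x′ q) (*-comm y′ x′)))

  ℝ-commutativeRing : CommutativeRing 0ℓ 0ℓ
  ℝ-commutativeRing = record
    { Carrier = ℝ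
    ; _≈_     = _≈_
    ; _+_     = _+_
    ; _*_     = _*_
    ; -_      = -_
    ; 0#      = 0ℝ
    ; 1#      = 1ℝ
    ; isCommutativeRing = record
      { isRing = record
        { +-isAbelianGroup = record
          { isGroup = record
            { isMonoid = record
              { isSemigroup = record
                { isMagma = record
                  { isEquivalence = record
                    { refl  = λ {x} → pointwise-≈ x x λ _ → refl
                    ; sym   = λ {x} {y} → ≈-sym x y
                    ; trans = λ {x} {y} {z} → ≈-trans {x} {y} {z}
                    }
                  ; ∙-cong = λ {x} {y} {u} {v} → +-cong {x} {y} {u} {v}
                  }
                ; assoc = λ x y z → pointwise-≈ ((x + y) + z) (x + (y + z)) λ n → ℚ.+-assoc (seq x n) (seq y n) (seq z n)
                }
              ; identity = (λ x → pointwise-≈ (0ℝ + x) x λ n → ℚ.+-identityˡ (seq x n))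
                         , (λ x → pointwise-≈ (x + 0ℝ) x λ n → ℚ.+-identityʳ (seq x n))
              }
            ; inverse = (λ x → pointwise-≈ (- x + x) 0ℝ λ n → ℚ.+-inverseˡ (seq x n))
                      , (λ x → pointwise-≈ (x + - x) 0ℝ λ n → ℚ.+-inverseʳ (seq x n))
            ; ⁻¹-cong = λ {x} {y} → -‿cong {x} {y}
            }
          ; comm = λ x y → pointwise-≈ (x + y) (y + x) λ n → ℚ.+-comm (seq x n) (seq y n)
          }
        ; *-cong = λ {x} {y} {u} {v} → *-cong {x} {y} {u} {v}
        ; *-assoc = λ x y z → pointwise-≈ ((x * y) * z) (x * (y * z)) λ n → ℚ.*-assoc (seq x n) (seq y n) (seq z n)
        ; *-identity = (λ x → pointwise-≈ (1ℝ * x) x λ n → ℚ.*-identityˡ (seq x n))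
                     , (λ x → pointwise-≈ (x * 1ℝ) x λ n → ℚ.*-identityʳ (seq x n))
        ; distrib = (λ x y z → pointwise-≈ (x * (y + z)) (x * y + x * z) λ n → ℚ.*-distribˡ-+ (seq x n) (seq y n) (seq z n))
                  , (λ x y z → pointwise-≈ ((y + z) * x) (y * x + z * x) λ n → ℚ.*-distribʳ-+ (seq x n) (seq y n) (seq z n))
        }
      ; *-comm = *-comm
      }
    }

  infixl 6 _⊔_

  -- The termwise maximum gives a least upper bound without deciding which argument is larger. It
  -- stands in for totality of the order wherever a real has to be chosen above finitely many
  -- others.
  _⊔_ : ℝ → ℝ → ℝ
  x ⊔ y = mkℝ (λ n → seq x n ℚ.⊔ seq y n) λ ε 0<ε →
    let N , p = cauchy x ε 0<ε
        M , q = cauchy y ε 0<ε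
    in N ℕ.⊔ M , λ m n h h′ → ∣p-q∣≤-intro (seq x m ℚ.⊔ seq y m) (seq x n ℚ.⊔ seq y n)
      (lub (seq x m) (seq y m) (seq x n) (seq y n) (∣p-q∣≤⇒≤ (seq x m) (seq x n) (p m n (ℕ.m⊔n≤o⇒m≤o N M h) (ℕ.m⊔n≤o⇒m≤o N M h′)))
               (∣p-q∣≤⇒≤ (seq y m) (seq y n) (q m n (ℕ.m⊔n≤o⇒n≤o N M h) (ℕ.m⊔n≤o⇒n≤o N M h′))))
      (lub (seq x n) (seq y n) (seq x m) (seq y m) (∣p-q∣≤⇒≥ (seq x m) (seq x n) (p m n (ℕ.m⊔n≤o⇒m≤o N M h) (ℕ.m⊔n≤o⇒m≤o N M h′)))
               (∣p-q∣≤⇒≥ (seq y m) (seq y n) (q m n (ℕ.m⊔n≤o⇒n≤o N M h) (ℕ.m⊔n≤o⇒n≤o N M h′))))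
    where
    lub : ∀ a b c d {ε} → a ℚ.≤ c ℚ.+ ε → b ℚ.≤ d ℚ.+ ε → a ℚ.⊔ b ℚ.≤ (c ℚ.⊔ d) ℚ.+ ε
    lub a b c d {ε} h h′ = ℚ.⊔-lub
      (ℚ.≤-trans h (ℚ.+-monoˡ-≤ ε (ℚ.p≤p⊔q c d)))
      (ℚ.≤-trans h′ (ℚ.+-monoˡ-≤ ε (ℚ.p≤q⊔p c d)))

  x≤x⊔y : ∀ x y → x ≤ x ⊔ y
  x≤x⊔y x y = pointwise-≤ x (x ⊔ y) λ n → ℚ.p≤p⊔q (seq x n) (seq y n)

  y≤x⊔y : ∀ x y → y ≤ x ⊔ y
  y≤x⊔y x y = pointwise-≤ y (x ⊔ y) λ n → ℚ.p≤q⊔p (seq x n) (seq y n)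

  ⊔-lub : ∀ {x y z} → x ≤ z → y ≤ z → x ⊔ y ≤ z
  ⊔-lub {x} {y} x≤z y≤z ε 0<ε =
    let N , p = x≤z ε 0<ε
        M , q = y≤z ε 0<ε
    in N ℕ.⊔ M , λ n h → ℚ.⊔-lub (p n (ℕ.m⊔n≤o⇒m≤o N M h)) (q n (ℕ.m⊔n≤o⇒n≤o N M h))

  0≤x⇒x≈x⊔0 : ∀ {x} → 0ℝ ≤ x → x ≈ x ⊔ 0ℝ
  0≤x⇒x≈x⊔0 {x} 0≤x = ≤-antisym {x} {x ⊔ 0ℝ} (x≤x⊔y x 0ℝ)
    (⊔-lub {x} {0ℝ} {x} (pointwise-≤ x x λ _ → ℚ.≤-refl) 0≤x)

  -- A nonnegative real may have negative terms, so the terms of the product need not be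
  -- nonnegative. Each factor is first replaced by its maximum with 0, which is equal to it as a
  -- real and is nonnegative term by term.
  *-nonNeg : ∀ {x y} → 0ℝ ≤ x → 0ℝ ≤ y → 0ℝ ≤ x * y
  *-nonNeg {x} {y} 0≤x 0≤y = ≤-trans {0ℝ} {(x ⊔ 0ℝ) * (y ⊔ 0ℝ)} {x * y}
    (pointwise-≤ 0ℝ ((x ⊔ 0ℝ) * (y ⊔ 0ℝ)) λ n →
      subst (ℚ._≤ (seq x n ℚ.⊔ 0ℚ) ℚ.* (seq y n ℚ.⊔ 0ℚ)) (ℚ.*-zeroʳ (seq x n ℚ.⊔ 0ℚ))
        (ℚ.*-monoˡ-≤-nonNeg (seq x n ℚ.⊔ 0ℚ) {{ℚ.nonNegative (ℚ.p≤q⊔p (seq x n) 0ℚ)}} (ℚ.p≤q⊔p (seq y n) 0ℚ)))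
    (≥-reflexive (x * y) ((x ⊔ 0ℝ) * (y ⊔ 0ℝ))
      (*-cong {x} {x ⊔ 0ℝ} {y} {y ⊔ 0ℝ} (0≤x⇒x≈x⊔0 {x} 0≤x) (0≤x⇒x≈x⊔0 {y} 0≤y)))

  square-nonNeg : ∀ x → 0ℝ ≤ x * x
  square-nonNeg x = pointwise-≤ 0ℝ (x * x) λ n → nonNeg (seq x n)
    where
    nonNeg : ∀ p → 0ℚ ℚ.≤ p ℚ.* p
    nonNeg p with ℚ.≤-total 0ℚ p
    ... | inj₁ 0≤p = subst (ℚ._≤ p ℚ.* p) (ℚ.*-zeroʳ p) (ℚ.*-monoˡ-≤-nonNeg p {{ℚ.nonNegative 0≤p}} 0≤p)
    ... | inj₂ p≤0 = subst (ℚ._≤ p ℚ.* p) (ℚ.*-zeroʳ p) (ℚ.*-monoˡ-≤-nonPos p {{ℚ.nonPositive p≤0}} p≤0)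

  fromℚ-mono-≤ : ∀ p q → p ℚ.≤ q → fromℚ p ≤ fromℚ q
  fromℚ-mono-≤ p q p≤q = pointwise-≤ (fromℚ p) (fromℚ q) λ _ → p≤q

-- Ordered algebras over the rationals, and Fourier-Motzkin elimination.

module OrderedAlgebras where

  open import Algebra.Bundles using (CommutativeRing)
  import Algebra.Solver.Ring
  open import Algebra.Solver.Ring.AlmostCommutativeRing using (fromCommutativeRing; _-Raw-AlmostCommutative⟶_)
  import Algebra.Properties.Semiring.Sum
  import Algebra.Properties.Ring
  open import Data.Fin using (Fin; zero; suc)
  open import Data.List using (List; []; _∷_; _++_; map; cartesianProductWith)
  open import Data.List.Membership.Propositional using (_∈_)
  open import Data.List.Membership.Propositional.Properties using (∈-cartesianProductWith⁺; ∈-cartesianProductWith⁻; ∈-++⁺ˡ; ∈-++⁺ʳ; ∈-++⁻; ∈-map⁺; ∈-map⁻)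
  open import Data.List.Relation.Unary.Any using (here; there)
  open import Data.Nat as ℕ using (ℕ; zero; suc)
  open import Data.Product using (∃-syntax; _×_; _,_; proj₁; proj₂)
  open import Data.Rational as ℚ using (ℚ; 0ℚ; 1ℚ)
  import Data.Rational.Properties as ℚ
  open import Data.Rational.Solver using (module +-*-Solver)
  open import Data.Sum using (inj₁; inj₂)
  open import Function using (_∘_)
  open import Level using (0ℓ)
  open import Relation.Binary using (tri<; tri≈; tri>)
  open import Relation.Binary.Consequences using (dec⇒weaklyDec)
  open import Relation.Binary.PropositionalEquality as ≡ using (_≡_; cong)
  open import Data.Maybe as Maybe using (Maybe)

  -- The common interface of ℚ, where the system is tested at the vertices, and ℝ, where it is
  -- solved. A join takes the place of a total order, and `ι` embeds the rational coefficients.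
  record OrderedℚAlgebra : Set₁ where
    infix 4 _≤_
    infixl 6 _⊔_
    field
      commutativeRing : CommutativeRing 0ℓ 0ℓ
    open CommutativeRing commutativeRing public hiding (zero)
    field
      _≤_         : Carrier → Carrier → Set
      ≤-reflexive : ∀ {x y} → x ≈ y → x ≤ y
      ≤-trans     : ∀ {x y z} → x ≤ y → y ≤ z → x ≤ z
      ≤-antisym   : ∀ {x y} → x ≤ y → y ≤ x → x ≈ y
      +-mono-≤    : ∀ {x y u v} → x ≤ y → u ≤ v → x + u ≤ y + v
      *-nonNeg    : ∀ {x y} → 0# ≤ x → 0# ≤ y → 0# ≤ x * y
      _⊔_         : Carrier → Carrier → Carrier
      x≤x⊔y       : ∀ x y → x ≤ x ⊔ y
      y≤x⊔y       : ∀ x y → y ≤ x ⊔ y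
      ⊔-lub       : ∀ {x y z} → x ≤ z → y ≤ z → x ⊔ y ≤ z
      ι           : ℚ → Carrier
      ι-+         : ∀ p q → ι (p ℚ.+ q) ≈ ι p + ι q
      ι-*         : ∀ p q → ι (p ℚ.* q) ≈ ι p * ι q
      ι-‿         : ∀ p → ι (ℚ.- p) ≈ - ι p
      ι-0         : ι 0ℚ ≈ 0#
      ι-1         : ι 1ℚ ≈ 1#
      ι-mono-≤    : ∀ {p q} → p ℚ.≤ q → ι p ≤ ι q

    ι-morphism : ℚ.+-*-rawRing -Raw-AlmostCommutative⟶ fromCommutativeRing commutativeRing
    ι-morphism = record
      { ⟦_⟧ = ι ; +-homo = ι-+ ; *-homo = ι-* ; -‿homo = ι-‿ ; 0-homo = ι-0 ; 1-homo = ι-1 }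

    module Solver = Algebra.Solver.Ring ℚ.+-*-rawRing (fromCommutativeRing commutativeRing) ι-morphism
      (λ p q → Maybe.map (reflexive ∘ cong ι) (dec⇒weaklyDec ℚ._≟_ p q))

    open Algebra.Properties.Semiring.Sum semiring public

    ≤-refl : ∀ {x} → x ≤ x
    ≤-refl = ≤-reflexive refl

    ≤-respˡ : ∀ {x y z} → x ≈ y → x ≤ z → y ≤ z
    ≤-respˡ x≈y = ≤-trans (≤-reflexive (sym x≈y))

    ≤-respʳ : ∀ {x y z} → x ≈ y → z ≤ x → z ≤ y
    ≤-respʳ x≈y z≤x = ≤-trans z≤x (≤-reflexive x≈y)

    x≤y⇒0≤y-x : ∀ {x y} → x ≤ y → 0# ≤ y - x
    x≤y⇒0≤y-x {x} {y} x≤y = ≤-respˡ (-‿inverseʳ x) (+-mono-≤ x≤y ≤-refl)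

    0≤y-x⇒x≤y : ∀ {x y} → 0# ≤ y - x → x ≤ y
    0≤y-x⇒x≤y {x} {y} h = ≤-respˡ (+-identityˡ x) (≤-respʳ (cancel y x) (+-mono-≤ h ≤-refl))
      where
      open Solver
      cancel : ∀ y x → y - x + x ≈ y
      cancel = solve 2 (λ y x → y :- x :+ x := y) refl

    *-monoˡ-≤ : ∀ {a x y} → 0# ≤ a → x ≤ y → a * x ≤ a * y
    *-monoˡ-≤ {a} {x} {y} 0≤a x≤y = 0≤y-x⇒x≤y (≤-respʳ (expand a x y) (*-nonNeg 0≤a (x≤y⇒0≤y-x x≤y)))
      where
      open Solver
      expand : ∀ a x y → a * (y - x) ≈ a * y - a * x
      expand = solve 3 (λ a x y → a :* (y :- x) := a :* y :- a :* x) refl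

    -‿anti-≤ : ∀ {x y} → x ≤ y → - y ≤ - x
    -‿anti-≤ {x} {y} x≤y = 0≤y-x⇒x≤y (≤-respʳ (swap x y) (x≤y⇒0≤y-x x≤y))
      where
      open Solver
      swap : ∀ x y → y - x ≈ - x - (- y)
      swap = solve 2 (λ x y → y :- x := :- x :- (:- y)) refl

    0≤ι : ∀ {p} → 0ℚ ℚ.≤ p → 0# ≤ ι p
    0≤ι = ≤-respˡ ι-0 ∘ ι-mono-≤

    sum-nonNeg : ∀ {n} (f : Fin n → Carrier) → (∀ i → 0# ≤ f i) → 0# ≤ sum f
    sum-nonNeg {zero}  f 0≤f = ≤-refl
    sum-nonNeg {suc n} f 0≤f = ≤-respˡ (+-identityˡ 0#) (+-mono-≤ (0≤f zero) (sum-nonNeg (f ∘ suc) (0≤f ∘ suc)))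

    -- The start is a minimum of all upper bounds (and 0), so that there is a point even without
    -- lower bounds; taking the maximum with each lower bound keeps it below the upper ones.
    between : ∀ ls us → (∀ {l u} → l ∈ ls → u ∈ us → l ≤ u) →
      ∃[ x ] (∀ {l} → l ∈ ls → l ≤ x) × (∀ {u} → u ∈ us → x ≤ u)
    between ls us ls≤us = raise ls (proj₁ (floor us)) ls≤us (proj₂ (floor us))
      where
      floor : ∀ us → ∃[ x ] (∀ {u} → u ∈ us → x ≤ u)
      floor []       = 0# , λ ()
      floor (u ∷ us) with floor us
      ... | x , x≤us = - (- u ⊔ - x) , λ where
          (here ≡.refl)  → ≤-respʳ (double-neg u) (-‿anti-≤ (x≤x⊔y (- u) (- x)))
          (there u∈us) → ≤-trans (≤-respʳ (double-neg x) (-‿anti-≤ (y≤x⊔y (- u) (- x)))) (x≤us u∈us)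
        where
        open Solver
        double-neg : ∀ x → - - x ≈ x
        double-neg = solve 1 (λ x → :- (:- x) := x) refl

      raise : ∀ ls x → (∀ {l u} → l ∈ ls → u ∈ us → l ≤ u) → (∀ {u} → u ∈ us → x ≤ u) →
        ∃[ y ] (∀ {l} → l ∈ ls → l ≤ y) × (∀ {u} → u ∈ us → y ≤ u)
      raise []       x ls≤us x≤us = x , (λ ()) , x≤us
      raise (l ∷ ls) x ls≤us x≤us with raise ls x (ls≤us ∘ there) x≤us
      ... | y , ls≤y , y≤us = l ⊔ y
        , (λ { (here ≡.refl) → x≤x⊔y l y ; (there l∈ls) → ≤-trans (ls≤y l∈ls) (y≤x⊔y l y) })
        , (λ u∈us → ⊔-lub (ls≤us (here ≡.refl) u∈us) (y≤us u∈us))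

  ℚ-orderedℚAlgebra : OrderedℚAlgebra
  ℚ-orderedℚAlgebra = record
    { commutativeRing = ℚ.+-*-commutativeRing
    ; _≤_         = ℚ._≤_
    ; ≤-reflexive = ℚ.≤-reflexive
    ; ≤-trans     = ℚ.≤-trans
    ; ≤-antisym   = ℚ.≤-antisym
    ; +-mono-≤    = ℚ.+-mono-≤
    ; *-nonNeg    = λ {x} {y} 0≤x 0≤y → ≡.subst (ℚ._≤ x ℚ.* y) (ℚ.*-zeroʳ x) (ℚ.*-monoˡ-≤-nonNeg x {{ℚ.nonNegative 0≤x}} 0≤y)
    ; _⊔_         = ℚ._⊔_
    ; x≤x⊔y       = ℚ.p≤p⊔q
    ; y≤x⊔y       = ℚ.p≤q⊔p
    ; ⊔-lub       = ℚ.⊔-lub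
    ; ι           = λ p → p
    ; ι-+         = λ _ _ → ≡.refl
    ; ι-*         = λ _ _ → ≡.refl
    ; ι-‿         = λ _ → ≡.refl
    ; ι-0         = ≡.refl
    ; ι-1         = ≡.refl
    ; ι-mono-≤    = λ p≤q → p≤q
    }

  -- Right-hand sides remain symbolic during elimination, so that one and the same derived row can
  -- be evaluated at each vertex over ℚ and at the given point over ℝ.
  record ℚ-Space : Set₁ where
    field
      Carrier : Set
      _⊕_     : Carrier → Carrier → Carrier
      _·_     : ℚ → Carrier → Carrier

  -- A row (a , c) is the inequality Σᵢ aᵢ wᵢ ≤ ⟦ c ⟧ in the unknowns w, the
  -- right-hand sides ranging over a space L of rational functionals.
  module FourierMotzkin (L : ℚ-Space) where
    module L = ℚ-Space L
    open L using (_⊕_; _·_)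

    Row : ℕ → Set
    Row N = (Fin N → ℚ) × L.Carrier

    infixl 6 _⊞_
    _⊞_ : ∀ {N} → Row N → Row N → Row N
    (a , c) ⊞ (b , d) = (λ i → a i ℚ.+ b i) , c ⊕ d

    infixr 7 _⊡_
    _⊡_ : ∀ {N} → ℚ → Row N → Row N
    q ⊡ (a , c) = (λ i → q ℚ.* a i) , q · c

    rest : ∀ {N} → Row (suc N) → Row N
    rest (a , c) = a ∘ suc , c

    -- The rows are normalised so that the coefficient of the eliminated unknown
    -- is 1, -1, 0 respectively.
    record Split (N : ℕ) : Set where
      constructor split
      field
        uppers lowers others : List (Row N)

    open Split

    eliminate : ∀ {N} → Split N → List (Row N)
    eliminate s = others s ++ cartesianProductWith _⊞_ (uppers s) (lowers s)

    splitRows : ∀ {N} → List (Row (suc N)) → Split N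
    splitRows []             = split [] [] []
    splitRows (row@(a , c) ∷ rows) with splitRows rows | ℚ.<-cmp (a zero) 0ℚ
    ... | split us ls os | tri< a₀<0 _ _ = split us (rest (ℚ.1/ (ℚ.- a zero) ⊡ row) ∷ ls) os
      where instance _ = ℚ.pos⇒nonZero (ℚ.- a zero) {{ℚ.positive (ℚ.neg-antimono-< a₀<0)}}
    ... | split us ls os | tri≈ _ _ _    = split us ls (rest row ∷ os)
    ... | split us ls os | tri> _ _ a₀>0 = split (rest (ℚ.1/ (a zero) ⊡ row) ∷ us) ls os
      where instance _ = ℚ.pos⇒nonZero (a zero) {{ℚ.positive a₀>0}}

    0<-a : ∀ {a} → a ℚ.< 0ℚ → 0ℚ ℚ.< ℚ.- a
    0<-a = ℚ.neg-antimono-<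

    1/a*a≡1 : ∀ {a} (a>0 : a ℚ.> 0ℚ) → (ℚ.1/ a) {{ℚ.pos⇒nonZero a {{ℚ.positive a>0}}}} ℚ.* a ≡ 1ℚ
    1/a*a≡1 {a} a>0 = ℚ.*-inverseˡ a {{ℚ.pos⇒nonZero a {{ℚ.positive a>0}}}}

    1/-a*a≡-1 : ∀ {a} (a<0 : a ℚ.< 0ℚ) →
      (ℚ.1/ (ℚ.- a)) {{ℚ.pos⇒nonZero (ℚ.- a) {{ℚ.positive (ℚ.neg-antimono-< a<0)}}}} ℚ.* a ≡ ℚ.- 1ℚ
    1/-a*a≡-1 {a} a<0 = ≡.trans (flip-sign ((ℚ.1/ (ℚ.- a)) {{ℚ.pos⇒nonZero (ℚ.- a) {{ℚ.positive (0<-a a<0)}}}}) a) (cong ℚ.-_ (1/a*a≡1 (0<-a a<0)))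
      where
      open +-*-Solver
      flip-sign : ∀ b a → b ℚ.* a ≡ ℚ.- (b ℚ.* (ℚ.- a))
      flip-sign = solve 2 (λ b a → b :* a := :- (b :* (:- a))) ≡.refl

    -- The additive and ℚ-homogeneous evaluations are those that commute with the two operations by
    -- which elimination forms new right-hand sides.
    record Valuation (R : OrderedℚAlgebra) : Set where
      open OrderedℚAlgebra R
      field
        ⟦_⟧ : L.Carrier → Carrier
        ⟦⊕⟧ : ∀ c d → ⟦ c ⊕ d ⟧ ≈ ⟦ c ⟧ + ⟦ d ⟧
        ⟦·⟧ : ∀ q c → ⟦ q · c ⟧ ≈ ι q * ⟦ c ⟧

    module Satisfaction (R : OrderedℚAlgebra) (V : Valuation R) where
      open OrderedℚAlgebra R
      open Valuation V
      open import Relation.Binary.Reasoning.Setoid setoid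

      dot : ∀ {N} → (Fin N → ℚ) → (Fin N → Carrier) → Carrier
      dot a w = sum λ i → ι (a i) * w i

      dot-+ : ∀ {N} (a b : Fin N → ℚ) w → dot (λ i → a i ℚ.+ b i) w ≈ dot a w + dot b w
      dot-+ a b w = begin
        (sum λ i → ι (a i ℚ.+ b i) * w i)         ≈⟨ sum-cong-≋ (λ i → trans (*-congʳ (ι-+ (a i) (b i))) (distribʳ (w i) (ι (a i)) (ι (b i)))) ⟩
        (sum λ i → ι (a i) * w i + ι (b i) * w i) ≈⟨ ∑-distrib-+ (λ i → ι (a i) * w i) (λ i → ι (b i) * w i) ⟩
        dot a w + dot b w                         ∎

      dot-* : ∀ {N} q (a : Fin N → ℚ) w → dot (λ i → q ℚ.* a i) w ≈ ι q * dot a w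
      dot-* q a w = begin
        (sum λ i → ι (q ℚ.* a i) * w i)   ≈⟨ sum-cong-≋ (λ i → trans (*-congʳ (ι-* q (a i))) (*-assoc (ι q) (ι (a i)) (w i))) ⟩
        (sum λ i → ι q * (ι (a i) * w i)) ≈⟨ *-distribˡ-sum (ι q) (λ i → ι (a i) * w i) ⟨
        ι q * dot a w                     ∎

      Sat : ∀ {N} → (Fin N → Carrier) → Row N → Set
      Sat w (a , c) = dot a w ≤ ⟦ c ⟧

      ⊡-sat : ∀ {N} {w : Fin N → Carrier} {q} r → 0ℚ ℚ.≤ q → Sat w r → Sat w (q ⊡ r)
      ⊡-sat {q = q} (a , c) 0≤q p =
        ≤-respˡ (sym (dot-* q a _)) (≤-respʳ (sym (⟦·⟧ q c)) (*-monoˡ-≤ (0≤ι 0≤q) p))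

      dot-head : ∀ {N} (a : Fin (suc N) → ℚ) w → dot a w ≈ dot (a ∘ suc) (w ∘ suc) + ι (a zero) * w zero
      dot-head a w = +-comm _ _

      1/⊡-sat⁻ : ∀ {N} (w : Fin N → Carrier) q (0<q : 0ℚ ℚ.< q) r →
        let instance _ = ℚ.pos⇒nonZero q {{ℚ.positive 0<q}} in
        Sat w (ℚ.1/ q ⊡ r) → Sat w r
      1/⊡-sat⁻ w q 0<q (a , c) p = ≤-respˡ (cancel (dot-* (ℚ.1/ q) a w)) (≤-respʳ (cancel (⟦·⟧ (ℚ.1/ q) c))
        (*-monoˡ-≤ (0≤ι (ℚ.<⇒≤ 0<q)) p))
        where
        instance
          q-nonZero : ℚ.NonZero q
          q-nonZero = ℚ.pos⇒nonZero q {{ℚ.positive 0<q}}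
        cancel : ∀ {x y} → y ≈ ι (ℚ.1/ q) * x → ι q * y ≈ x
        cancel {x} {y} eq = begin
          ι q * y                 ≈⟨ *-congˡ eq ⟩
          ι q * (ι (ℚ.1/ q) * x)  ≈⟨ *-assoc _ _ _ ⟨
          ι q * ι (ℚ.1/ q) * x    ≈⟨ *-congʳ (ι-* q (ℚ.1/ q)) ⟨
          ι (q ℚ.* ℚ.1/ q) * x    ≈⟨ *-congʳ (reflexive (cong ι (ℚ.*-inverseʳ q))) ⟩
          ι 1ℚ * x                ≈⟨ *-congʳ ι-1 ⟩
          1# * x                  ≈⟨ *-identityˡ x ⟩
          x                       ∎

      1/⊡-sat⁺ : ∀ {N} (w : Fin N → Carrier) q (0<q : 0ℚ ℚ.< q) r →
        let instance _ = ℚ.pos⇒nonZero q {{ℚ.positive 0<q}} in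
        Sat w r → Sat w (ℚ.1/ q ⊡ r)
      1/⊡-sat⁺ w q 0<q r = ⊡-sat r (ℚ.<⇒≤ (ℚ.positive⁻¹ _ {{ℚ.1/pos⇒pos q {{ℚ.positive 0<q}}}}))

      scale : ∀ {N} → (Fin N → ℚ) → ∀ q → 0ℚ ℚ.< q → Fin N → ℚ
      scale a q 0<q i = (ℚ.1/ q) {{ℚ.pos⇒nonZero q {{ℚ.positive 0<q}}}} ℚ.* a i

      dot-upper : ∀ {N} (a : Fin (suc N) → ℚ) w → a zero ≡ 1ℚ →
        dot a w ≈ dot (a ∘ suc) (w ∘ suc) + w zero
      dot-upper a w a₀≡1 = trans (dot-head a w) (+-congˡ (begin
        ι (a zero) * w zero  ≈⟨ *-congʳ (trans (reflexive (cong ι a₀≡1)) ι-1) ⟩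
        1# * w zero          ≈⟨ *-identityˡ _ ⟩
        w zero               ∎))

      dot-lower : ∀ {N} (a : Fin (suc N) → ℚ) w → a zero ≡ ℚ.- 1ℚ →
        dot a w ≈ dot (a ∘ suc) (w ∘ suc) - w zero
      dot-lower a w a₀≡-1 = trans (dot-head a w) (+-congˡ (begin
        ι (a zero) * w zero  ≈⟨ *-congʳ (trans (reflexive (cong ι a₀≡-1)) (trans (ι-‿ 1ℚ) (-‿cong ι-1))) ⟩
        - 1# * w zero        ≈⟨ solve 2 (λ o x → :- o :* x := :- (o :* x)) refl 1# (w zero) ⟩
        - (1# * w zero)      ≈⟨ -‿cong (*-identityˡ _) ⟩
        - w zero             ∎))
        where open Solver

      dot-other : ∀ {N} (a : Fin (suc N) → ℚ) w → a zero ≡ 0ℚ →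
        dot a w ≈ dot (a ∘ suc) (w ∘ suc)
      dot-other a w a₀≡0 = trans (dot-head a w) (trans (+-congˡ (begin
        ι (a zero) * w zero  ≈⟨ *-congʳ (trans (reflexive (cong ι a₀≡0)) ι-0) ⟩
        0# * w zero          ≈⟨ zeroˡ _ ⟩
        0#                   ∎)) (+-identityʳ _))

      record SatSplit {N} (w : Fin (suc N) → Carrier) (s : Split N) : Set where
        field
          upper : ∀ {r} → r ∈ uppers s → dot (proj₁ r) (w ∘ suc) + w zero ≤ ⟦ proj₂ r ⟧
          lower : ∀ {r} → r ∈ lowers s → dot (proj₁ r) (w ∘ suc) - w zero ≤ ⟦ proj₂ r ⟧
          other : ∀ {r} → r ∈ others s → Sat (w ∘ suc) r

      open SatSplit public

      splitRows-sat⁺ : ∀ {N} (w : Fin (suc N) → Carrier) rows → (∀ {r} → r ∈ rows → Sat w r) → SatSplit w (splitRows rows)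
      splitRows-sat⁺ w [] sat = record { upper = λ () ; lower = λ () ; other = λ () }
      splitRows-sat⁺ w (row@(a , c) ∷ rows) sat
        with splitRows rows | splitRows-sat⁺ w rows (sat ∘ there) | ℚ.<-cmp (a zero) 0ℚ
      ... | split us ls os | ih | tri< a₀<0 _ _ = record
        { upper = upper ih
        ; lower = λ { (here ≡.refl) → ≤-respˡ (dot-lower (scale a (ℚ.- a zero) (0<-a a₀<0)) w (1/-a*a≡-1 a₀<0)) (1/⊡-sat⁺ w _ (0<-a a₀<0) row (sat (here ≡.refl)))
                    ; (there r∈) → lower ih r∈ }
        ; other = other ih
        }
      ... | split us ls os | ih | tri≈ _ a₀≡0 _ = record
        { upper = upper ih
        ; lower = lower ih
        ; other = λ { (here ≡.refl) → ≤-respˡ (dot-other a w a₀≡0) (sat (here ≡.refl))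
                    ; (there r∈) → other ih r∈ }
        }
      ... | split us ls os | ih | tri> _ _ a₀>0 = record
        { upper = λ { (here ≡.refl) → ≤-respˡ (dot-upper (scale a (a zero) a₀>0) w (1/a*a≡1 a₀>0)) (1/⊡-sat⁺ w _ a₀>0 row (sat (here ≡.refl)))
                    ; (there r∈) → upper ih r∈ }
        ; lower = lower ih
        ; other = other ih
        }

      splitRows-sat⁻ : ∀ {N} (w : Fin (suc N) → Carrier) rows → SatSplit w (splitRows rows) → ∀ {r} → r ∈ rows → Sat w r
      splitRows-sat⁻ w (row@(a , c) ∷ rows) sat r∈
        with splitRows rows | splitRows-sat⁻ w rows | ℚ.<-cmp (a zero) 0ℚ
      splitRows-sat⁻ w (row@(a , c) ∷ rows) sat (here ≡.refl) | split us ls os | ih | tri< a₀<0 _ _ =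
        1/⊡-sat⁻ w _ (0<-a a₀<0) row (≤-respˡ (sym (dot-lower (scale a (ℚ.- a zero) (0<-a a₀<0)) w (1/-a*a≡-1 a₀<0))) (lower sat (here ≡.refl)))
      splitRows-sat⁻ w (row@(a , c) ∷ rows) sat (there r∈) | split us ls os | ih | tri< a₀<0 _ _ =
        ih (record { upper = upper sat ; lower = lower sat ∘ there ; other = other sat }) r∈
      splitRows-sat⁻ w (row@(a , c) ∷ rows) sat (here ≡.refl) | split us ls os | ih | tri≈ _ a₀≡0 _ =
        ≤-respˡ (sym (dot-other a w a₀≡0)) (other sat (here ≡.refl))
      splitRows-sat⁻ w (row@(a , c) ∷ rows) sat (there r∈) | split us ls os | ih | tri≈ _ a₀≡0 _ =
        ih (record { upper = upper sat ; lower = lower sat ; other = other sat ∘ there }) r∈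
      splitRows-sat⁻ w (row@(a , c) ∷ rows) sat (here ≡.refl) | split us ls os | ih | tri> _ _ a₀>0 =
        1/⊡-sat⁻ w _ a₀>0 row (≤-respˡ (sym (dot-upper (scale a (a zero) a₀>0) w (1/a*a≡1 a₀>0))) (upper sat (here ≡.refl)))
      splitRows-sat⁻ w (row@(a , c) ∷ rows) sat (there r∈) | split us ls os | ih | tri> _ _ a₀>0 =
        ih (record { upper = upper sat ∘ there ; lower = lower sat ; other = other sat }) r∈

      -- Derived rows are nonnegative combinations of the given ones. This direction is applied at
      -- the vertices, where a solution is known beforehand.
      eliminate-sat⁺ : ∀ {N} (w : Fin (suc N) → Carrier) s → SatSplit w s → ∀ {r} → r ∈ eliminate s → Sat (w ∘ suc) r
      eliminate-sat⁺ w s sat r∈ with ∈-++⁻ (others s) r∈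
      ... | inj₁ r∈os = other sat r∈os
      ... | inj₂ r∈us×ls with ∈-cartesianProductWith⁻ _⊞_ (uppers s) (lowers s) r∈us×ls
      ... | (a , c) , (b , d) , u∈ , l∈ , ≡.refl =
        ≤-respˡ (trans (cancel (dot a (w ∘ suc)) (dot b (w ∘ suc)) (w zero)) (sym (dot-+ a b (w ∘ suc))))
          (≤-respʳ (sym (⟦⊕⟧ c d)) (+-mono-≤ (upper sat u∈) (lower sat l∈)))
        where
        open Solver
        cancel : ∀ x y z → x + z + (y - z) ≈ x + y
        cancel = solve 3 (λ x y z → x :+ z :+ (y :- z) := x :+ y) refl

      -- Back-substitution. A row made from an upper and a lower one says that the lower bound on
      -- the eliminated unknown lies below the upper bound, which is what `between` asks for.
      eliminate-sat⁻ : ∀ {N} (w : Fin N → Carrier) s → (∀ {r} → r ∈ eliminate s → Sat w r) →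
        ∃[ x ] (∀ {r} → r ∈ uppers s → dot (proj₁ r) w + x ≤ ⟦ proj₂ r ⟧)
             × (∀ {r} → r ∈ lowers s → dot (proj₁ r) w - x ≤ ⟦ proj₂ r ⟧)
             × (∀ {r} → r ∈ others s → Sat w r)
      eliminate-sat⁻ w s sat =
        let x , ls≤x , x≤us = between (map lowerBound (lowers s)) (map upperBound (uppers s)) compatible
        in x
         , (λ {r} r∈ → ≤-respʳ (cancel₁ ⟦ proj₂ r ⟧ (dot (proj₁ r) w)) (+-mono-≤ ≤-refl (x≤us (∈-map⁺ upperBound r∈))))
         , (λ {r} r∈ → ≤-respʳ (cancel₂ (dot (proj₁ r) w) ⟦ proj₂ r ⟧) (+-mono-≤ ≤-refl (-‿anti-≤ (ls≤x (∈-map⁺ lowerBound r∈)))))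
         , (λ r∈ → sat (∈-++⁺ˡ r∈))
        where
        open Solver using (solve; _:+_; _:-_; _:=_)
        lowerBound upperBound : Row _ → Carrier
        lowerBound (b , d) = dot b w - ⟦ d ⟧
        upperBound (a , c) = ⟦ c ⟧ - dot a w

        cancel₁ : ∀ c y → y + (c - y) ≈ c
        cancel₁ = solve 2 (λ c y → y :+ (c :- y) := c) refl
        cancel₂ : ∀ y c → y - (y - c) ≈ c
        cancel₂ = solve 2 (λ y c → y :- (y :- c) := c) refl
        move : ∀ y z c d → c + d - (y + z) ≈ c - y - (z - d)
        move = solve 4 (λ y z c d → c :+ d :- (y :+ z) := c :- y :- (z :- d)) refl

        compatible : ∀ {l u} → l ∈ map lowerBound (lowers s) → u ∈ map upperBound (uppers s) → l ≤ u
        compatible l∈ u∈ with ∈-map⁻ lowerBound l∈ | ∈-map⁻ upperBound u∈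
        ... | (b , d) , bd∈ , ≡.refl | (a , c) , ac∈ , ≡.refl =
          0≤y-x⇒x≤y (≤-respʳ (trans (+-cong (⟦⊕⟧ c d) (-‿cong (dot-+ a b w))) (move (dot a w) (dot b w) ⟦ c ⟧ ⟦ d ⟧))
            (x≤y⇒0≤y-x (sat (∈-++⁺ʳ (others s) (∈-cartesianProductWith⁺ _⊞_ ac∈ bd∈)))))

    module _ (R : OrderedℚAlgebra) (V : Valuation R) {A : Set} (tests : A → Valuation ℚ-orderedℚAlgebra)
      (nonNeg : ∀ c → (∀ t → 0ℚ ℚ.≤ Valuation.⟦_⟧ (tests t) c) → OrderedℚAlgebra._≤_ R (OrderedℚAlgebra.0# R) (Valuation.⟦_⟧ V c))
      where

      open OrderedℚAlgebra R using (Carrier)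
      open Satisfaction R V using (Sat; splitRows-sat⁻; eliminate-sat⁻)
      private module Test t = Satisfaction ℚ-orderedℚAlgebra (tests t)

      -- Once all unknowns are eliminated, a row reads 0 ≤ `⟦ c ⟧`. The solutions `ω t` carry over
      -- to the projected systems, so `c` is nonnegative under every test, and `nonNeg` transfers
      -- this to `R`. The unknowns are then recovered one at a time.
      solvable : ∀ N (rows : List (Row N)) (ω : A → Fin N → ℚ) →
        (∀ t {r} → r ∈ rows → Test.Sat t (ω t) r) → ∃[ w ] (∀ {r} → r ∈ rows → Sat w r)
      solvable zero rows ω valid = (λ ()) , λ {r} r∈ → nonNeg (proj₂ r) λ t → valid t r∈
      solvable (suc N) rows ω valid =
        let w , sat          = solvable N (eliminate (splitRows rows)) (λ t → ω t ∘ suc) λ t →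
                                 Test.eliminate-sat⁺ t (ω t) (splitRows rows) (Test.splitRows-sat⁺ t (ω t) rows (valid t))
            x , us , ls , os = eliminate-sat⁻ w (splitRows rows) sat
            w′ : Fin (suc N) → Carrier
            w′ = λ { zero → x ; (suc i) → w i }
        in w′ , splitRows-sat⁻ w′ rows (record { upper = us ; lower = ls ; other = os })

-- Finite sums over indices, sequences and lists.

module FiniteSums where

  open import Algebra.Bundles using (CommutativeSemiring)
  import Algebra.Properties.Semiring.Sum
  open import Data.Bool using (Bool; true; false; _∧_; not; if_then_else_)
  open import Data.Fin using (Fin; zero; suc; punchIn)
  import Data.Fin.Properties as Fin
  open import Data.Fin.Permutation as Perm using (Permutation′; _⟨$⟩ʳ_)
  open import Data.List as List using (List; []; _∷_; _++_; filter; deduplicate; cartesianProductWith; allFin)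
  open import Data.List.Membership.Propositional using (_∈_)
  open import Data.List.Relation.Unary.Any using (here; there)
  open import Data.Nat as ℕ using (ℕ; zero; suc)
  open import Data.Vec as Vec using (Vec; []; _∷_; _∷ʳ_)
  open import Function using (_∘_; _⇔_)
  open import Level using (0ℓ)
  open import Relation.Binary using (Rel; Decidable; IsEquivalence)
  open import Relation.Binary.PropositionalEquality as ≡ using (_≡_; cong)
  open import Relation.Nullary using (Dec; does; yes; no; ¬?)
  open import Relation.Nullary.Decidable using (does-⇔; dec-true; dec-false)
  open import Relation.Nullary.Negation using (contradiction)
  import Relation.Unary as Unary
  open import Data.Vec.Relation.Unary.AllPairs using (allPairs?)
  open import Defs using (sequences)

  module Sums (S : CommutativeSemiring 0ℓ 0ℓ) where
    open CommutativeSemiring S hiding (zero)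
    open Algebra.Properties.Semiring.Sum semiring public
    open import Relation.Binary.Reasoning.Setoid setoid

    [_] : Bool → Carrier
    [ b ] = if b then 1# else 0#

    [∧] : ∀ b c → [ b ∧ c ] ≈ [ b ] * [ c ]
    [∧] true  c = sym (*-identityˡ [ c ])
    [∧] false c = sym (zeroˡ [ c ])

    []-*-cong : ∀ b {x y} → (b ≡ true → x ≈ y) → [ b ] * x ≈ [ b ] * y
    []-*-cong true  x≈y = *-congˡ (x≈y ≡.refl)
    []-*-cong false x≈y = trans (zeroˡ _) (sym (zeroˡ _))

    [⇔] : ∀ {P Q : Set} (P? : Dec P) (Q? : Dec Q) → P ⇔ Q → [ does P? ] ≈ [ does Q? ]
    [⇔] P? Q? P⇔Q = reflexive (cong [_] (does-⇔ P⇔Q P? Q?))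

    *-swap : ∀ x y z → x * (y * z) ≈ y * (x * z)
    *-swap x y z = trans (sym (*-assoc x y z)) (trans (*-congʳ (*-comm x y)) (*-assoc y x z))

    +-interchange : ∀ w x y z → (w + x) + (y + z) ≈ (w + y) + (x + z)
    +-interchange w x y z = trans (+-assoc w x (y + z)) (trans (+-congˡ
      (trans (sym (+-assoc x y z)) (trans (+-congʳ (+-comm x y)) (+-assoc y x z)))) (sym (+-assoc w y (x + z))))

    opaque
      ∑ : ∀ {n} → (Fin n → Carrier) → Carrier
      ∑ = sum

      ∑≡sum : ∀ {n} (f : Fin n → Carrier) → ∑ f ≡ sum f
      ∑≡sum f = ≡.refl

      ∑-zero : ∀ (f : Fin 0 → Carrier) → ∑ f ≈ 0#
      ∑-zero f = refl

      ∑-suc : ∀ {n} (f : Fin (suc n) → Carrier) → ∑ f ≈ f zero + ∑ (f ∘ suc)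
      ∑-suc f = refl

      ∑-cong : ∀ {n} {f g : Fin n → Carrier} → (∀ i → f i ≈ g i) → ∑ f ≈ ∑ g
      ∑-cong = sum-cong-≋

      ∑-0 : ∀ {n} {f : Fin n → Carrier} → (∀ i → f i ≈ 0#) → ∑ f ≈ 0#
      ∑-0 {n} f≈0 = trans (sum-cong-≋ f≈0) (sum-replicate-zero n)

      ∑-+ : ∀ {n} (f g : Fin n → Carrier) → (∑ λ i → f i + g i) ≈ ∑ f + ∑ g
      ∑-+ = ∑-distrib-+

      ∑-*ˡ : ∀ {n} c (f : Fin n → Carrier) → (∑ λ i → c * f i) ≈ c * ∑ f
      ∑-*ˡ c f = sym (*-distribˡ-sum c f)

      ∑-swap : ∀ {m n} (f : Fin m → Fin n → Carrier) → (∑ λ i → ∑ λ j → f i j) ≈ (∑ λ j → ∑ λ i → f i j)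
      ∑-swap = ∑-comm

      ∑-reindex : ∀ {n} (π : Permutation′ n) (f : Fin n → Carrier) → ∑ f ≈ ∑ λ i → f (π ⟨$⟩ʳ i)
      ∑-reindex π f = sum-permute f π

      ∑-δ : ∀ {n} (i : Fin n) (f : Fin n → Carrier) → (∑ λ j → [ does (j Fin.≟ i) ] * f j) ≈ f i
      ∑-δ {suc n} i f = begin
        (sum λ j → [ does (j Fin.≟ i) ] * f j)
          ≈⟨ sum-remove {i = i} (λ j → [ does (j Fin.≟ i) ] * f j) ⟩
        [ does (i Fin.≟ i) ] * f i + (sum λ j → [ does (punchIn i j Fin.≟ i) ] * f (punchIn i j))
          ≈⟨ +-cong (trans (*-congʳ (reflexive (cong [_] (dec-true (i Fin.≟ i) ≡.refl)))) (*-identityˡ (f i)))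
                    (∑-0 λ j → trans (*-congʳ (reflexive (cong [_] (dec-false (punchIn i j Fin.≟ i) (Fin.punchInᵢ≢i i j))))) (zeroˡ _)) ⟩
        f i + 0#
          ≈⟨ +-identityʳ (f i) ⟩
        f i ∎

    ∑-*ʳ : ∀ {n} c (f : Fin n → Carrier) → (∑ λ i → f i * c) ≈ ∑ f * c
    ∑-*ʳ c f = trans (∑-cong λ i → *-comm (f i) c) (trans (∑-*ˡ c f) (*-comm c _))

    ∑-1 : ∀ {n} (i : Fin n) → (∑ λ j → [ does (j Fin.≟ i) ]) ≈ 1#
    ∑-1 i = trans (∑-cong λ j → sym (*-identityʳ _)) (∑-δ i λ _ → 1#)

    -- Tours are summed as all sequences weighted by the indicator `distinct`: splitting off first
    -- entries, relabelling vertices and rotating are then mere reindexings of iterated sums, which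
    -- a filtered list would not offer.
    ∑V : ∀ {n} m → (Vec (Fin n) m → Carrier) → Carrier
    ∑V zero    F = F []
    ∑V (suc m) F = ∑ λ x → ∑V m λ xs → F (x ∷ xs)

    ∑V-cong : ∀ {n} m {F G : Vec (Fin n) m → Carrier} → (∀ xs → F xs ≈ G xs) → ∑V m F ≈ ∑V m G
    ∑V-cong zero    F≈G = F≈G []
    ∑V-cong (suc m) F≈G = ∑-cong λ x → ∑V-cong m λ xs → F≈G (x ∷ xs)

    ∑V-+ : ∀ {n} m (F G : Vec (Fin n) m → Carrier) → ∑V m (λ xs → F xs + G xs) ≈ ∑V m F + ∑V m G
    ∑V-+ zero    F G = refl
    ∑V-+ (suc m) F G = trans (∑-cong λ x → ∑V-+ m (F ∘ (x ∷_)) (G ∘ (x ∷_))) (∑-+ _ _)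

    ∑V-*ˡ : ∀ {n} m c (F : Vec (Fin n) m → Carrier) → ∑V m (λ xs → c * F xs) ≈ c * ∑V m F
    ∑V-*ˡ zero    c F = refl
    ∑V-*ˡ (suc m) c F = trans (∑-cong λ x → ∑V-*ˡ m c (F ∘ (x ∷_))) (∑-*ˡ c _)

    ∑V-*ʳ : ∀ {n} m c (F : Vec (Fin n) m → Carrier) → ∑V m (λ xs → F xs * c) ≈ ∑V m F * c
    ∑V-*ʳ m c F = trans (∑V-cong m λ xs → *-comm (F xs) c) (trans (∑V-*ˡ m c F) (*-comm c _))

    ∑V-0 : ∀ {n} m (F : Vec (Fin n) m → Carrier) → (∀ xs → F xs ≈ 0#) → ∑V m F ≈ 0#
    ∑V-0 zero    F F≈0 = F≈0 []
    ∑V-0 (suc m) F F≈0 = ∑-0 λ x → ∑V-0 m (F ∘ (x ∷_)) (F≈0 ∘ (x ∷_))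

    ∑V-sum : ∀ {n k} m (F : Vec (Fin n) m → Fin k → Carrier) →
      ∑V m (λ xs → ∑ (F xs)) ≈ ∑ λ i → ∑V m λ xs → F xs i
    ∑V-sum zero    F = refl
    ∑V-sum (suc m) F = trans (∑-cong λ x → ∑V-sum m (F ∘ (x ∷_))) (∑-swap λ x i → ∑V m λ xs → F (x ∷ xs) i)

    ∑V-map : ∀ {n} m (π : Permutation′ n) (F : Vec (Fin n) m → Carrier) →
      ∑V m F ≈ ∑V m (F ∘ Vec.map (π ⟨$⟩ʳ_))
    ∑V-map zero    π F = refl
    ∑V-map (suc m) π F = trans (∑-reindex π _) (∑-cong λ x → ∑V-map m π (F ∘ ((π ⟨$⟩ʳ x) ∷_)))

    -- The sum over the last entry is moved inwards past the sums over the others. This is the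
    -- rotation invariance of sums over sequences.
    ∑V-snoc : ∀ {n} m (F : Vec (Fin n) (suc m) → Carrier) →
      (∑ λ x → ∑V m λ xs → F (xs ∷ʳ x)) ≈ ∑V (suc m) F
    ∑V-snoc zero    F = refl
    ∑V-snoc (suc m) F = trans (∑-swap _) (∑-cong λ y → ∑V-snoc m (F ∘ (y ∷_)))

    ∑L : ∀ {A : Set} → List A → (A → Carrier) → Carrier
    ∑L []       F = 0#
    ∑L (x ∷ xs) F = F x + ∑L xs F

    ∑L-sum : ∀ {A : Set} (xs : List A) F → sum (F ∘ List.lookup xs) ≈ ∑L xs F
    ∑L-sum []       F = refl
    ∑L-sum (x ∷ xs) F = +-congˡ (∑L-sum xs F)

    module _ {A : Set} where

      ∑L-cong : ∀ (xs : List A) {F G : A → Carrier} → (∀ {x} → x ∈ xs → F x ≈ G x) → ∑L xs F ≈ ∑L xs G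
      ∑L-cong []       F≈G = refl
      ∑L-cong (x ∷ xs) F≈G = +-cong (F≈G (here ≡.refl)) (∑L-cong xs (F≈G ∘ there))

      ∑L-++ : ∀ (xs ys : List A) F → ∑L (xs ++ ys) F ≈ ∑L xs F + ∑L ys F
      ∑L-++ []       ys F = sym (+-identityˡ _)
      ∑L-++ (x ∷ xs) ys F = trans (+-congˡ (∑L-++ xs ys F)) (sym (+-assoc _ _ _))

      ∑L-map : ∀ {B : Set} (f : B → A) xs F → ∑L (List.map f xs) F ≈ ∑L xs (F ∘ f)
      ∑L-map f []       F = refl
      ∑L-map f (x ∷ xs) F = +-congˡ (∑L-map f xs F)

      ∑L-filter : ∀ {P : Unary.Pred A 0ℓ} (P? : Unary.Decidable P) xs F →
        ∑L (filter P? xs) F ≈ ∑L xs λ x → [ does (P? x) ] * F x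
      ∑L-filter P? []       F = refl
      ∑L-filter P? (x ∷ xs) F with does (P? x)
      ... | true  = +-cong (sym (*-identityˡ _)) (∑L-filter P? xs F)
      ... | false = trans (∑L-filter P? xs F) (trans (sym (+-identityˡ _)) (+-congʳ (sym (zeroˡ _))))

      ∑L-*ˡ : ∀ c (xs : List A) F → ∑L xs (λ x → c * F x) ≈ c * ∑L xs F
      ∑L-*ˡ c []       F = sym (zeroʳ c)
      ∑L-*ˡ c (x ∷ xs) F = trans (+-congˡ (∑L-*ˡ c xs F)) (sym (distribˡ c _ _))

      ∑L-*ʳ : ∀ c (xs : List A) F → ∑L xs (λ x → F x * c) ≈ ∑L xs F * c
      ∑L-*ʳ c xs F = trans (∑L-cong xs λ _ → *-comm _ c) (trans (∑L-*ˡ c xs F) (*-comm c _))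

      ∑L-+ : ∀ (xs : List A) F G → ∑L xs (λ x → F x + G x) ≈ ∑L xs F + ∑L xs G
      ∑L-+ []       F G = sym (+-identityˡ 0#)
      ∑L-+ (x ∷ xs) F G = trans (+-congˡ (∑L-+ xs F G)) (+-interchange (F x) (G x) (∑L xs F) (∑L xs G))

      ∑L-0 : ∀ (xs : List A) {F} → (∀ {x} → x ∈ xs → F x ≈ 0#) → ∑L xs F ≈ 0#
      ∑L-0 []       F≈0 = refl
      ∑L-0 (x ∷ xs) F≈0 = trans (+-cong (F≈0 (here ≡.refl)) (∑L-0 xs (F≈0 ∘ there))) (+-identityˡ 0#)

      module _ {R : Rel A 0ℓ} (R? : Decidable R) (R-equiv : IsEquivalence R) where
        private module R = IsEquivalence R-equiv

        -- If the head is related to `a`, filtering removes every later element related to `a`; if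
        -- it is not, filtering removes none of them. So each class keeps exactly one
        -- representative.
        ∑L-deduplicate : ∀ {xs a} → a ∈ xs → ∑L (deduplicate R? xs) (λ y → [ does (R? y a) ]) ≈ 1#
        ∑L-deduplicate {x ∷ xs} {a} a∈ = begin
          [ does (R? x a) ] + ∑L (filter (¬? ∘ R? x) ys) (λ y → [ does (R? y a) ])
            ≈⟨ +-congˡ (∑L-filter (¬? ∘ R? x) ys (λ y → [ does (R? y a) ])) ⟩
          [ does (R? x a) ] + ∑L ys (λ y → [ not (does (R? x y)) ] * [ does (R? y a) ])
            ≈⟨ cases (R? x a) a∈ ⟩
          1# ∎
          where
          ys = deduplicate R? xs
          cases : (d : Dec (R x a)) → a ∈ x ∷ xs →
            [ does d ] + ∑L ys (λ y → [ not (does (R? x y)) ] * [ does (R? y a) ]) ≈ 1#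
          cases (yes xRa) _ = trans (+-congˡ (∑L-0 ys λ {y} _ → vanish y)) (+-identityʳ 1#)
            where
            vanish : ∀ y → [ not (does (R? x y)) ] * [ does (R? y a) ] ≈ 0#
            vanish y with R? x y | R? y a
            ... | yes _   | _       = zeroˡ _
            ... | no _    | no _    = zeroʳ _
            ... | no ¬xRy | yes yRa = contradiction (R.trans xRa (R.sym yRa)) ¬xRy
          cases (no ¬xRa) (here ≡.refl)  = contradiction R.refl ¬xRa
          cases (no ¬xRa) (there a∈xs) = trans (+-identityˡ _) (trans (∑L-cong ys λ {y} _ → keep y) (∑L-deduplicate a∈xs))
            where
            keep : ∀ y → [ not (does (R? x y)) ] * [ does (R? y a) ] ≈ [ does (R? y a) ]
            keep y with R? x y | R? y a
            ... | _       | no _    = zeroʳ _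
            ... | no _    | yes _   = *-identityˡ _
            ... | yes xRy | yes yRa = contradiction (R.trans xRy yRa) ¬xRa

    ∑L-∑V : ∀ {A : Set} {n} m (xs : List A) (F : A → Vec (Fin n) m → Carrier) →
      (∑L xs λ x → ∑V m (F x)) ≈ ∑V m λ v → ∑L xs λ x → F x v
    ∑L-∑V m []       F = sym (∑V-0 m _ λ _ → refl)
    ∑L-∑V m (x ∷ xs) F = trans (+-congˡ (∑L-∑V m xs F)) (sym (∑V-+ m _ _))

    ∑L-tabulate : ∀ {A : Set} {n} (f : Fin n → A) F → ∑L (List.tabulate f) F ≈ ∑ (F ∘ f)
    ∑L-tabulate {n = zero}  f F = sym (∑-zero _)
    ∑L-tabulate {n = suc n} f F = trans (+-congˡ (∑L-tabulate (f ∘ suc) F)) (sym (∑-suc _))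

    ∑L-cartesianProductWith : ∀ {A B C : Set} (f : A → B → C) xs ys F →
      ∑L (cartesianProductWith f xs ys) F ≈ ∑L xs λ x → ∑L ys λ y → F (f x y)
    ∑L-cartesianProductWith f []       ys F = refl
    ∑L-cartesianProductWith f (x ∷ xs) ys F = trans (∑L-++ (List.map (f x) ys) _ F)
      (+-cong (∑L-map (f x) ys F) (∑L-cartesianProductWith f xs ys F))

    ∑L-sequences : ∀ n m F → ∑L (sequences n m) F ≈ ∑V m F
    ∑L-sequences n zero    F = +-identityʳ _
    ∑L-sequences n (suc m) F = begin
      ∑L (cartesianProductWith _∷_ (allFin n) (sequences n m)) F
        ≈⟨ ∑L-cartesianProductWith _∷_ (allFin n) (sequences n m) F ⟩
      (∑L (allFin n) λ x → ∑L (sequences n m) λ xs → F (x ∷ xs))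
        ≈⟨ ∑L-tabulate (λ x → x) _ ⟩
      (∑ λ x → ∑L (sequences n m) λ xs → F (x ∷ xs))
        ≈⟨ ∑-cong (λ x → ∑L-sequences n m λ xs → F (x ∷ xs)) ⟩
      ∑V (suc m) F ∎

    distinct : ∀ {n m} → Vec (Fin n) m → Bool
    distinct σ = does (allPairs? (λ i j → ¬? (i Fin.≟ j)) σ)

-- Hamiltonian cycles and the sequences that describe them.

module Cycles where

  open import Algebra.Bundles using (CommutativeSemiring)
  open import Data.Bool using (Bool; true)
  import Data.Bool.Properties as Bool
  open import Data.Fin as Fin using (Fin; suc; toℕ; inject; fromℕ<; punchOut; Fin′)
  import Data.Fin.Properties as Fin
  open import Data.Fin.Permutation as Perm using (Permutation′; _⟨$⟩ʳ_; _⟨$⟩ˡ_; permutation)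
  open import Data.List as List using (List; []; _∷_; deduplicate)
  open import Data.List.Membership.Propositional using (_∈_)
  open import Data.List.Membership.Propositional.Properties using (∈-deduplicate⁻; ∈-map⁻; ∈-filter⁻; ∈-map⁺; ∈-filter⁺; ∈-cartesianProductWith⁺; ∈-allFin)
  open import Data.List.Relation.Unary.Any using (here)
  open import Data.Nat as ℕ using (ℕ; suc)
  import Data.Nat.Properties as ℕ
  open import Data.Product using (∃; ∃-syntax; Σ-syntax; _×_; _,_; proj₁; proj₂)
  open import Data.Sum as Sum using (_⊎_; inj₁; inj₂; swap)
  open import Data.Vec as Vec using (Vec; []; _∷_)
  import Data.Vec.Properties as Vec
  open import Data.Vec.Relation.Unary.AllPairs using (allPairs?)
  open import Data.Vec.Relation.Unary.Unique.Propositional using (Unique)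
  open import Data.Vec.Relation.Unary.Unique.Propositional.Properties using (lookup-injective; tabulate⁺)
  open import Function using (_∘_; id; _⇔_; mk⇔; Equivalence)
  open import Function.Construct.Symmetry using (⇔-sym)
  open import Level using (0ℓ)
  open import Relation.Binary using (IsEquivalence; tri<; tri≈; tri>)
  open import Relation.Binary.PropositionalEquality as ≡ using (_≡_; _≢_; refl; sym; trans; cong; subst; subst₂)
  open import Relation.Nullary using (Dec; does; yes; no; ¬?)
  open import Relation.Nullary.Decidable using (does-⇔; _×-dec_; _⊎-dec_)
  open import Relation.Nullary.Negation using (contradiction)
  open import Defs using (Edge; uses?; next; cyclicTours; sequences; sameEdges?)
  open FiniteSums

  infixr 5 _⨾_
  _⨾_ : ∀ {A B C : Set} → A ⇔ B → B ⇔ C → A ⇔ C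
  p ⨾ q = mk⇔ (Equivalence.to q ∘ Equivalence.to p) (Equivalence.from p ∘ Equivalence.from q)

  does⁻ : ∀ {P : Set} (P? : Dec P) → does P? ≡ true → P
  does⁻ (yes p) _ = p

  -- Pigeonhole: if `y` were missed, punching it out would inject `Fin (suc n)` into `Fin n`.
  injective⇒surjective : ∀ {n} (f : Fin n → Fin n) → (∀ {i j} → f i ≡ f j → i ≡ j) → ∀ y → ∃[ x ] f x ≡ y
  injective⇒surjective {suc n} f f-inj y with Fin.any? (λ x → f x Fin.≟ y)
  ... | yes found    = found
  ... | no  ¬found = contradiction
    (Fin.injective⇒≤ {f = λ x → punchOut (λ y≡fx → ¬found (x , sym y≡fx))}
      (λ eq → f-inj (Fin.punchOut-injective (λ y≡fx → ¬found (_ , sym y≡fx)) (λ y≡fx → ¬found (_ , sym y≡fx)) eq)))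
    ℕ.1+n≰n

  injective⇒permutation : ∀ {n} (f : Fin n → Fin n) → (∀ {i j} → f i ≡ f j → i ≡ j) → Permutation′ n
  injective⇒permutation f f-inj = permutation f (proj₁ ∘ surj) (proj₂ ∘ surj) (λ x → f-inj (proj₂ (surj (f x))))
    where surj = injective⇒surjective f f-inj

  unique? : ∀ {n m} (σ : Vec (Fin n) m) → Dec (Unique σ)
  unique? = allPairs? λ i j → ¬? (i Fin.≟ j)

  ⟨_⟩ : ∀ {n} {σ : Vec (Fin n) n} → Unique σ → Permutation′ n
  ⟨_⟩ {σ = σ} σ! = injective⇒permutation (Vec.lookup σ) (λ {i} {j} → lookup-injective σ! i j)

  unique-lookup : ∀ {n m} (σ : Vec (Fin n) m) → (∀ {i j} → Vec.lookup σ i ≡ Vec.lookup σ j → i ≡ j) → Unique σ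
  unique-lookup σ inj = subst Unique (Vec.tabulate∘lookup σ) (tabulate⁺ inj)

  -- The relation `Uses` with arbitrary endpoints. An `Edge` carries an order of its ends, which a
  -- permutation of the vertices does not respect, whereas `Adj` is transported by it directly.
  Adj : ∀ {n} → Vec (Fin n) n → Fin n → Fin n → Set
  Adj σ v w = ∃ λ t → (Vec.lookup σ t ≡ v × Vec.lookup σ (next t) ≡ w) ⊎ (Vec.lookup σ t ≡ w × Vec.lookup σ (next t) ≡ v)

  adj? : ∀ {n} (σ : Vec (Fin n) n) v w → Dec (Adj σ v w)
  adj? σ v w = Fin.any? λ t → (Vec.lookup σ t Fin.≟ v ×-dec Vec.lookup σ (next t) Fin.≟ w)
                        ⊎-dec (Vec.lookup σ t Fin.≟ w ×-dec Vec.lookup σ (next t) Fin.≟ v)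

  Adj-sym : ∀ {n} (σ : Vec (Fin n) n) {v w} → Adj σ v w → Adj σ w v
  Adj-sym σ (t , p) = t , swap p

  Adj-map : ∀ {n} (π : Permutation′ n) (σ : Vec (Fin n) n) v w →
    Adj (Vec.map (π ⟨$⟩ʳ_) σ) (π ⟨$⟩ʳ v) (π ⟨$⟩ʳ w) ⇔ Adj σ v w
  Adj-map π σ v w = mk⇔
    (λ { (t , inj₁ (p , q)) → t , inj₁ (down t p , down (next t) q) ; (t , inj₂ (p , q)) → t , inj₂ (down t p , down (next t) q) })
    (λ { (t , inj₁ (p , q)) → t , inj₁ (up t p , up (next t) q) ; (t , inj₂ (p , q)) → t , inj₂ (up t p , up (next t) q) })
    where
    up : ∀ t {v} → Vec.lookup σ t ≡ v → Vec.lookup (Vec.map (π ⟨$⟩ʳ_) σ) t ≡ π ⟨$⟩ʳ v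
    up t eq = trans (Vec.lookup-map t (π ⟨$⟩ʳ_) σ) (cong (π ⟨$⟩ʳ_) eq)
    down : ∀ t {v} → Vec.lookup (Vec.map (π ⟨$⟩ʳ_) σ) t ≡ π ⟨$⟩ʳ v → Vec.lookup σ t ≡ v
    down t eq = trans (sym (Perm.inverseˡ π)) (trans (cong (π ⟨$⟩ˡ_) (trans (sym (Vec.lookup-map t (π ⟨$⟩ʳ_) σ)) eq)) (Perm.inverseˡ π))

  unique-map : ∀ {n m} (π : Permutation′ n) (σ : Vec (Fin n) m) → Unique (Vec.map (π ⟨$⟩ʳ_) σ) ⇔ Unique σ
  unique-map π σ = mk⇔
    (λ πσ! → unique-lookup σ λ {i} {j} eq → lookup-injective πσ! i j
       (trans (Vec.lookup-map i (π ⟨$⟩ʳ_) σ) (trans (cong (π ⟨$⟩ʳ_) eq) (sym (Vec.lookup-map j (π ⟨$⟩ʳ_) σ)))))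
    (λ σ! → unique-lookup _ λ {i} {j} eq → lookup-injective σ! i j
       (trans (sym (Perm.inverseˡ π)) (trans (cong (π ⟨$⟩ˡ_)
         (trans (sym (Vec.lookup-map i (π ⟨$⟩ʳ_) σ)) (trans eq (Vec.lookup-map j (π ⟨$⟩ʳ_) σ)))) (Perm.inverseˡ π))))

  inject-surjective : ∀ {n} {v w : Fin n} → v Fin.< w → Σ[ i ∈ Fin′ w ] inject i ≡ v
  inject-surjective v<w = fromℕ< v<w , Fin.toℕ-injective (trans (Fin.toℕ-inject (fromℕ< v<w)) (Fin.toℕ-fromℕ< v<w))

  inject≢ : ∀ {n} {j : Fin n} (i : Fin′ j) → inject i ≢ j
  inject≢ {j = j} i eq = ℕ.<⇒≢ (Fin.toℕ<n i) (trans (sym (Fin.toℕ-inject i)) (cong toℕ eq))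

  edges : ∀ {n} → Vec (Fin n) n → Edge n → Bool
  edges σ e = does (uses? σ e)

  SameEdges : ∀ {n} → (Edge n → Bool) → (Edge n → Bool) → Set
  SameEdges χ ψ = ∀ j i → χ (j , i) ≡ ψ (j , i)

  SameEdges-isEquivalence : ∀ {n} → IsEquivalence (SameEdges {n})
  SameEdges-isEquivalence = record
    { refl = λ _ _ → refl ; sym = λ p j i → sym (p j i) ; trans = λ p q j i → trans (p j i) (q j i) }

  -- The restriction to `v ≢ w` matches the coordinates, which exist only for pairs of distinct
  -- vertices.
  SameAdj : ∀ {n} → Vec (Fin n) n → Vec (Fin n) n → Set
  SameAdj σ τ = ∀ v w → v ≢ w → Adj σ v w ⇔ Adj τ v w

  SameEdges⇔SameAdj : ∀ {n} (σ τ : Vec (Fin n) n) → SameEdges (edges σ) (edges τ) ⇔ SameAdj σ τ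
  SameEdges⇔SameAdj σ τ = mk⇔ to
    (λ same j i → does-⇔ (same (inject i) j (inject≢ i)) (uses? σ (j , i)) (uses? τ (j , i)))
    where
    does-≡⁻ : ∀ {P Q : Set} (P? : Dec P) (Q? : Dec Q) → does P? ≡ does Q? → P ⇔ Q
    does-≡⁻ (yes p) (yes q) _ = mk⇔ (λ _ → q) (λ _ → p)
    does-≡⁻ (no ¬p) (no ¬q) _ = mk⇔ (λ p → contradiction p ¬p) (λ q → contradiction q ¬q)
    below : SameEdges (edges σ) (edges τ) → ∀ {v w} → v Fin.< w → Adj σ v w ⇔ Adj τ v w
    below same {w = w} v<w with inject-surjective v<w
    ... | i , refl = does-≡⁻ (uses? σ (w , i)) (uses? τ (w , i)) (same w i)
    to : SameEdges (edges σ) (edges τ) → SameAdj σ τ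
    to same v w v≢w with Fin.<-cmp v w
    ... | tri< v<w _ _ = below same v<w
    ... | tri≈ _ v≡w _ = contradiction v≡w v≢w
    ... | tri> _ _ w<v = mk⇔ (Adj-sym τ ∘ Equivalence.to (below same w<v) ∘ Adj-sym σ)
                             (Adj-sym σ ∘ Equivalence.from (below same w<v) ∘ Adj-sym τ)

  SameAdj-map : ∀ {n} (π : Permutation′ n) σ τ → SameAdj (Vec.map (π ⟨$⟩ʳ_) σ) (Vec.map (π ⟨$⟩ʳ_) τ) ⇔ SameAdj σ τ
  SameAdj-map π σ τ = mk⇔
    (λ same v w v≢w → ⇔-sym (Adj-map π σ v w) ⨾ same (π ⟨$⟩ʳ v) (π ⟨$⟩ʳ w) (v≢w ∘ injective) ⨾ Adj-map π τ v w)
    (λ same v w v≢w → subst₂ (λ v w → Adj (Vec.map (π ⟨$⟩ʳ_) σ) v w ⇔ Adj (Vec.map (π ⟨$⟩ʳ_) τ) v w) (Perm.inverseʳ π) (Perm.inverseʳ π)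
      (Adj-map π σ (π ⟨$⟩ˡ v) (π ⟨$⟩ˡ w) ⨾ same (π ⟨$⟩ˡ v) (π ⟨$⟩ˡ w) (v≢w ∘ injective′) ⨾ ⇔-sym (Adj-map π τ (π ⟨$⟩ˡ v) (π ⟨$⟩ˡ w))))
    where
    injective : ∀ {v w} → π ⟨$⟩ʳ v ≡ π ⟨$⟩ʳ w → v ≡ w
    injective eq = trans (sym (Perm.inverseˡ π)) (trans (cong (π ⟨$⟩ˡ_) eq) (Perm.inverseˡ π))
    injective′ : ∀ {v w} → π ⟨$⟩ˡ v ≡ π ⟨$⟩ˡ w → v ≡ w
    injective′ eq = trans (sym (Perm.inverseʳ π)) (trans (cong (π ⟨$⟩ʳ_) eq) (Perm.inverseʳ π))

  cycles : ∀ n → List (Edge n → Bool)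
  cycles n = deduplicate sameEdges? (List.map edges (cyclicTours n))

  ∈-cycles⁻ : ∀ n {χ} → χ ∈ cycles n → ∃[ τ ] Unique τ × χ ≡ edges τ
  ∈-cycles⁻ n {χ} χ∈ with ∈-map⁻ edges (∈-deduplicate⁻ sameEdges? (List.map edges (cyclicTours n)) χ∈)
  ... | τ , τ∈ , eq = τ , proj₂ (∈-filter⁻ unique? {xs = sequences n n} τ∈) , eq

  ∈-cyclicTours : ∀ {n} (σ : Vec (Fin n) n) → Unique σ → σ ∈ cyclicTours n
  ∈-cyclicTours {n} σ σ! = ∈-filter⁺ unique? (∈-sequences σ) σ!
    where
    ∈-sequences : ∀ {m} (v : Vec (Fin n) m) → v ∈ sequences n m
    ∈-sequences []      = here refl
    ∈-sequences (x ∷ v) = ∈-cartesianProductWith⁺ _∷_ (∈-allFin x) (∈-sequences v)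

  -- The indicators of the class of the standard tour add up to 1, which an empty list cannot
  -- achieve. The average over `X` is thereby a genuine one.
  cycles-nonEmpty : ∀ n → ℕ.NonZero (List.length (cycles n))
  cycles-nonEmpty n = nonEmpty (cycles n)
    (∑L-deduplicate sameEdges? SameEdges-isEquivalence (∈-map⁺ edges (∈-cyclicTours (Vec.allFin n) (tabulate⁺ id))))
    where
    open Sums ℕ.+-*-commutativeSemiring
    nonEmpty : ∀ xs → ∑L xs (λ χ → [ does (sameEdges? χ (edges (Vec.allFin n))) ]) ≡ 1 → ℕ.NonZero (List.length xs)
    nonEmpty (x ∷ xs) _ = _

  module Fibres (S : CommutativeSemiring 0ℓ 0ℓ) where
    open CommutativeSemiring S using (Carrier; _≈_; _*_; setoid; *-cong; *-congʳ; *-assoc; *-identityˡ)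
    private module S = CommutativeSemiring S
    open Sums S
    open import Relation.Binary.Reasoning.Setoid setoid

    -- The number of sequences that describe the cycle 0, 1, ..., n - 1. It enters all averages as a
    -- common factor and cancels.
    fibreSize : ∀ n → Carrier
    fibreSize n = ∑V n λ σ → [ distinct σ ] * [ does (sameEdges? (edges (Vec.allFin n)) (edges σ)) ]

    -- Relabelling the vertices permutes the sequences and maps the sequences
    -- describing one cycle to those describing another.
    fibre-constant : ∀ {n} (τ : Vec (Fin n) n) → Unique τ →
      (∑V n λ σ → [ distinct σ ] * [ does (sameEdges? (edges τ) (edges σ)) ]) ≈ fibreSize n
    fibre-constant {n} τ τ! = begin
      (∑V n λ σ → [ distinct σ ] * [ does (sameEdges? (edges τ) (edges σ)) ])
        ≈⟨ ∑V-map n π _ ⟩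
      (∑V n λ σ → [ distinct (Vec.map (π ⟨$⟩ʳ_) σ) ] * [ does (sameEdges? (edges τ) (edges (Vec.map (π ⟨$⟩ʳ_) σ))) ])
        ≈⟨ ∑V-cong n (λ σ → *-cong ([⇔] (unique? _) (unique? σ) (unique-map π σ))
             ([⇔] (sameEdges? (edges τ) (edges (Vec.map (π ⟨$⟩ʳ_) σ))) (sameEdges? (edges (Vec.allFin n)) (edges σ)) (same σ))) ⟩
      fibreSize n ∎
      where
      π = ⟨ τ! ⟩
      same : ∀ σ → SameEdges (edges τ) (edges (Vec.map (π ⟨$⟩ʳ_) σ)) ⇔ SameEdges (edges (Vec.allFin n)) (edges σ)
      same σ = subst (λ τ′ → SameEdges (edges τ′) (edges (Vec.map (π ⟨$⟩ʳ_) σ)) ⇔ SameEdges (edges (Vec.allFin n)) (edges σ))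
        (Vec.map-lookup-allFin τ)
        (SameEdges⇔SameAdj (Vec.map (π ⟨$⟩ʳ_) (Vec.allFin n)) (Vec.map (π ⟨$⟩ʳ_) σ) ⨾ SameAdj-map π (Vec.allFin n) σ ⨾ ⇔-sym (SameEdges⇔SameAdj (Vec.allFin n) σ))

    -- Double counting: each tour is matched with its unique representative in `cycles n`, the two
    -- sums are exchanged, and every cycle collects the same number of tours. The hypothesis on `F`
    -- replaces extensionality of the edge indicators.
    ∑-cycles : ∀ n (F : (Edge n → Bool) → Carrier) → (∀ {χ ψ} → SameEdges χ ψ → F χ ≈ F ψ) →
      (∑V n λ σ → [ distinct σ ] * F (edges σ)) ≈ fibreSize n * ∑L (cycles n) F
    ∑-cycles n F F-resp = begin
      (∑V n λ σ → [ distinct σ ] * F (edges σ))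
        ≈⟨ ∑V-cong n (λ σ → []-*-cong (distinct σ) λ σ! → expand σ (does⁻ (unique? σ) σ!)) ⟩
      (∑V n λ σ → [ distinct σ ] * ∑L (cycles n) λ χ → [ does (sameEdges? χ (edges σ)) ] * F χ)
        ≈⟨ ∑V-cong n (λ σ → S.sym (∑L-*ˡ [ distinct σ ] (cycles n) _)) ⟩
      (∑V n λ σ → ∑L (cycles n) λ χ → [ distinct σ ] * ([ does (sameEdges? χ (edges σ)) ] * F χ))
        ≈⟨ ∑L-∑V n (cycles n) _ ⟨
      (∑L (cycles n) λ χ → ∑V n λ σ → [ distinct σ ] * ([ does (sameEdges? χ (edges σ)) ] * F χ))
        ≈⟨ ∑L-cong (cycles n) (λ {χ} χ∈ → collect χ (∈-cycles⁻ n χ∈)) ⟩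
      (∑L (cycles n) λ χ → fibreSize n * F χ)
        ≈⟨ ∑L-*ˡ (fibreSize n) (cycles n) F ⟩
      fibreSize n * ∑L (cycles n) F ∎
      where
      expand : ∀ σ → Unique σ → F (edges σ) ≈ ∑L (cycles n) λ χ → [ does (sameEdges? χ (edges σ)) ] * F χ
      expand σ σ! = S.sym (begin
        (∑L (cycles n) λ χ → [ does (sameEdges? χ (edges σ)) ] * F χ)
          ≈⟨ ∑L-cong (cycles n) (λ {χ} _ → []-*-cong (does (sameEdges? χ (edges σ))) λ same → F-resp (does⁻ (sameEdges? χ (edges σ)) same)) ⟩
        (∑L (cycles n) λ χ → [ does (sameEdges? χ (edges σ)) ] * F (edges σ))
          ≈⟨ ∑L-*ʳ (F (edges σ)) (cycles n) _ ⟩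
        ∑L (cycles n) (λ χ → [ does (sameEdges? χ (edges σ)) ]) * F (edges σ)
          ≈⟨ *-congʳ (∑L-deduplicate sameEdges? SameEdges-isEquivalence (∈-map⁺ edges (∈-cyclicTours σ σ!))) ⟩
        S.1# * F (edges σ)
          ≈⟨ *-identityˡ _ ⟩
        F (edges σ) ∎)

      collect : ∀ χ → ∃[ τ ] Unique τ × χ ≡ edges τ →
        (∑V n λ σ → [ distinct σ ] * ([ does (sameEdges? χ (edges σ)) ] * F χ)) ≈ fibreSize n * F χ
      collect .(edges τ) (τ , τ! , refl) = begin
        (∑V n λ σ → [ distinct σ ] * ([ does (sameEdges? (edges τ) (edges σ)) ] * F (edges τ)))
          ≈⟨ ∑V-cong n (λ σ → S.sym (*-assoc _ _ _)) ⟩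
        (∑V n λ σ → [ distinct σ ] * [ does (sameEdges? (edges τ) (edges σ)) ] * F (edges τ))
          ≈⟨ ∑V-*ʳ n (F (edges τ)) _ ⟩
        (∑V n λ σ → [ distinct σ ] * [ does (sameEdges? (edges τ) (edges σ)) ]) * F (edges τ)
          ≈⟨ *-congʳ (fibre-constant τ τ!) ⟩
        fibreSize n * F (edges τ) ∎

-- Rotation of tours.

module TourRotations where

  open import Algebra.Bundles using (CommutativeSemiring)
  open import Data.Fin as Fin using (Fin; zero; suc; inject₁; fromℕ)
  import Data.Fin.Properties as Fin
  open import Data.Fin.Induction using (<-weakInduction)
  open import Data.Fin.Permutation as Perm using (Permutation′; permutation)
  open import Data.Fin.Relation.Unary.Top using (view; ‵fromℕ; ‵inject₁)
  open import Data.Nat as ℕ using (ℕ; zero; suc)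
  open import Data.Nat.DivMod using (m<n⇒m%n≡m; n%n≡0)
  import Data.Nat.Properties as ℕ
  open import Data.Product using (_×_; _,_)
  open import Data.Sum as Sum using ()
  open import Data.Vec as Vec using (Vec; []; _∷_; _∷ʳ_)
  open import Data.Vec.Relation.Unary.Unique.Propositional using (Unique)
  open import Data.Vec.Relation.Unary.Unique.Propositional.Properties using (lookup-injective)
  open import Function using (_∘_; _⇔_; mk⇔; Equivalence)
  open import Level using (0ℓ)
  open import Relation.Binary.PropositionalEquality as ≡ using (_≡_; _≢_; refl; sym; trans; cong; cong₂)
  open import Relation.Nullary using (Dec; does; ¬?)
  open import Relation.Nullary.Decidable using (_×-dec_; _→-dec_)
  open import Defs using (next)
  open FiniteSums
  open Cycles

  next-inject₁ : ∀ {m} (i : Fin m) → next (inject₁ i) ≡ suc i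
  next-inject₁ {m} i = Fin.toℕ-injective (trans (Fin.toℕ-fromℕ< _)
    (trans (cong (λ k → suc k ℕ.% suc m) (Fin.toℕ-inject₁ i)) (m<n⇒m%n≡m (ℕ.s≤s (Fin.toℕ<n i)))))

  next-fromℕ : ∀ m → next (fromℕ m) ≡ zero
  next-fromℕ m = Fin.toℕ-injective (trans (Fin.toℕ-fromℕ< _)
    (trans (cong (λ k → suc k ℕ.% suc m) (Fin.toℕ-fromℕ m)) (n%n≡0 (suc m))))

  prev : ∀ {n} → Fin n → Fin n
  prev zero    = fromℕ _
  prev (suc i) = inject₁ i

  next-prev : ∀ {n} (i : Fin n) → next (prev i) ≡ i
  next-prev zero    = next-fromℕ _
  next-prev (suc i) = next-inject₁ i

  prev-next : ∀ {n} (i : Fin n) → prev (next i) ≡ i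
  prev-next {suc n} i with view i
  ... | ‵fromℕ     = cong prev (next-fromℕ n)
  ... | ‵inject₁ j = cong prev (next-inject₁ j)

  nextₚ : ∀ {n} → Permutation′ n
  nextₚ = permutation next prev next-prev prev-next

  rotate : ∀ {A : Set} {n} → Vec A n → Vec A n
  rotate []       = []
  rotate (x ∷ xs) = xs ∷ʳ x

  lookup-rotate : ∀ {A : Set} {n} (xs : Vec A n) i → Vec.lookup (rotate xs) i ≡ Vec.lookup xs (next i)
  lookup-rotate {n = suc n} (x ∷ xs) i with view i
  ... | ‵fromℕ     = trans (last xs) (cong (Vec.lookup (x ∷ xs)) (sym (next-fromℕ n)))
    where
    last : ∀ {m} (ys : Vec _ m) → Vec.lookup (ys ∷ʳ x) (fromℕ m) ≡ x
    last []       = refl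
    last (y ∷ ys) = last ys
  ... | ‵inject₁ j = trans (init xs j) (cong (Vec.lookup (x ∷ xs)) (sym (next-inject₁ j)))
    where
    init : ∀ {m} (ys : Vec _ m) j → Vec.lookup (ys ∷ʳ x) (inject₁ j) ≡ Vec.lookup ys j
    init (y ∷ ys) zero    = refl
    init (y ∷ ys) (suc j) = init ys j

  unique-rotate : ∀ {n} (σ : Vec (Fin n) n) → Unique (rotate σ) ⇔ Unique σ
  unique-rotate σ = mk⇔
    (λ rσ! → unique-lookup σ λ {i} {j} eq → prev-injective (lookup-injective rσ! (prev i) (prev j)
      (trans (at i) (trans eq (sym (at j))))))
    (λ σ! → unique-lookup (rotate σ) λ {i} {j} eq → next-injective (lookup-injective σ! (next i) (next j)
      (trans (sym (lookup-rotate σ i)) (trans eq (lookup-rotate σ j)))))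
    where
    at : ∀ i → Vec.lookup (rotate σ) (prev i) ≡ Vec.lookup σ i
    at i = trans (lookup-rotate σ (prev i)) (cong (Vec.lookup σ) (next-prev i))
    prev-injective : ∀ {i j} → prev i ≡ prev j → i ≡ j
    prev-injective {i} {j} eq = trans (sym (next-prev i)) (trans (cong next eq) (next-prev j))
    next-injective : ∀ {n} {i j : Fin n} → next i ≡ next j → i ≡ j
    next-injective {i = i} {j} eq = trans (sym (prev-next i)) (trans (cong prev eq) (prev-next j))

  Adj-rotate : ∀ {n} (σ : Vec (Fin n) n) v w → Adj (rotate σ) v w ⇔ Adj σ v w
  Adj-rotate σ v w = mk⇔
    (λ (t , p) → next t , Sum.map (transport t) (transport t) p)
    (λ (t , p) → prev t , Sum.map (transport′ t) (transport′ t) p)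
    where
    transport : ∀ t {v w} → Vec.lookup (rotate σ) t ≡ v × Vec.lookup (rotate σ) (next t) ≡ w →
      Vec.lookup σ (next t) ≡ v × Vec.lookup σ (next (next t)) ≡ w
    transport t (p , q) = trans (sym (lookup-rotate σ t)) p , trans (sym (lookup-rotate σ (next t))) q
    transport′ : ∀ t {v w} → Vec.lookup σ t ≡ v × Vec.lookup σ (next t) ≡ w →
      Vec.lookup (rotate σ) (prev t) ≡ v × Vec.lookup (rotate σ) (next (prev t)) ≡ w
    transport′ t (p , q) = trans (lookup-rotate σ (prev t)) (trans (cong (Vec.lookup σ) (next-prev t)) p)
      , trans (lookup-rotate σ (next (prev t))) (trans (cong (Vec.lookup σ ∘ next) (next-prev t)) q)

  -- An involution p encodes the matching {v , p v}, p v ≢ v.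
  Contains : ∀ {n} → (Fin n → Fin n) → Vec (Fin n) n → Set
  Contains p σ = Unique σ × (∀ v → p v ≢ v → Adj σ v (p v))

  contains? : ∀ {n} (p : Fin n → Fin n) σ → Dec (Contains p σ)
  contains? p σ = unique? σ ×-dec Fin.all? λ v → ¬? (p v Fin.≟ v) →-dec adj? σ v (p v)

  Contains-rotate : ∀ {n} (p : Fin n → Fin n) σ → Contains p (rotate σ) ⇔ Contains p σ
  Contains-rotate p σ = mk⇔
    (λ (σ! , adj) → Equivalence.to (unique-rotate σ) σ! , λ v pv≢v → Equivalence.to (Adj-rotate σ v (p v)) (adj v pv≢v))
    (λ (σ! , adj) → Equivalence.from (unique-rotate σ) σ! , λ v pv≢v → Equivalence.from (Adj-rotate σ v (p v)) (adj v pv≢v))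

  module Rotations (S : CommutativeSemiring 0ℓ 0ℓ) where
    open CommutativeSemiring S hiding (zero; refl; sym; trans)
    open Sums S
    open import Relation.Binary.Reasoning.Setoid setoid
    private module S = CommutativeSemiring S

    ∑V-rotate : ∀ n (F : Vec (Fin n) n → Carrier) → ∑V n (F ∘ rotate) ≈ ∑V n F
    ∑V-rotate zero    F = S.refl
    ∑V-rotate (suc m) F = ∑V-snoc m F

    -- By rotation symmetry every step of a tour may be taken to be its first one.
    ∑-steps : ∀ {m} (p : Fin (suc m) → Fin (suc m)) (h : Fin (suc m) → Fin (suc m) → Carrier) →
      (∑V (suc m) λ σ → [ does (contains? p σ) ] * ∑ λ t → h (Vec.lookup σ t) (Vec.lookup σ (next t)))
      ≈ ∑ {suc m} λ _ → ∑V (suc m) λ σ → [ does (contains? p σ) ] * h (Vec.lookup σ zero) (Vec.lookup σ (next zero))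
    ∑-steps {m} p h = begin
      (∑V (suc m) λ σ → [ does (contains? p σ) ] * ∑ λ t → h (Vec.lookup σ t) (Vec.lookup σ (next t)))
        ≈⟨ ∑V-cong (suc m) (λ σ → S.sym (∑-*ˡ [ does (contains? p σ) ] λ t → h (Vec.lookup σ t) (Vec.lookup σ (next t)))) ⟩
      (∑V (suc m) λ σ → ∑ λ t → G t σ)
        ≈⟨ ∑V-sum (suc m) (λ σ t → G t σ) ⟩
      (∑ λ t → ∑V (suc m) (G t))
        ≈⟨ ∑-cong (<-weakInduction (λ t → ∑V (suc m) (G t) ≈ ∑V (suc m) (G zero)) S.refl λ i → S.trans (step i)) ⟩
      (∑ {suc m} λ _ → ∑V (suc m) (G zero)) ∎
      where
      G : Fin (suc m) → Vec (Fin (suc m)) (suc m) → Carrier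
      G t σ = [ does (contains? p σ) ] * h (Vec.lookup σ t) (Vec.lookup σ (next t))

      step : ∀ (i : Fin m) → ∑V (suc m) (G (suc i)) ≈ ∑V (suc m) (G (inject₁ i))
      step i = begin
        ∑V (suc m) (G (suc i))
          ≈⟨ ∑V-cong (suc m) (λ σ → *-cong ([⇔] (contains? p σ) (contains? p (rotate σ)) (mk⇔ (Equivalence.from (Contains-rotate p σ)) (Equivalence.to (Contains-rotate p σ))))
               (reflexive (cong₂ h
                 (trans (cong (Vec.lookup σ) (sym (next-inject₁ i))) (sym (lookup-rotate σ (inject₁ i))))
                 (trans (cong (Vec.lookup σ ∘ next) (sym (next-inject₁ i))) (sym (lookup-rotate σ (next (inject₁ i)))))))) ⟩
        (∑V (suc m) λ σ → G (inject₁ i) (rotate σ))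
          ≈⟨ ∑V-rotate (suc m) (G (inject₁ i)) ⟩
        ∑V (suc m) (G (inject₁ i)) ∎

-- Tours through a matching as walks from block to block.

module BlockWalks where

  open import Data.Bool using (Bool; false; _∨_)
  import Data.Bool.Properties as Bool
  open import Data.Fin as Fin using (Fin; zero; suc; inject₁; fromℕ)
  import Data.Fin.Properties as Fin
  open import Data.Fin.Relation.Unary.Top using (view; ‵fromℕ; ‵inject₁)
  open import Data.Nat as ℕ using (ℕ; zero; suc)
  open import Data.Product using (∃-syntax; _×_; _,_; proj₁; proj₂)
  open import Data.Empty using (⊥)
  open import Data.Unit using (⊤; tt)
  open import Data.Sum as Sum using (_⊎_; inj₁; inj₂)
  open import Data.Vec as Vec using (Vec; []; _∷_)
  open import Data.Vec.Membership.Propositional using (_∈_)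
  open import Data.Vec.Membership.Propositional.Properties using (∈-lookup)
  open import Data.Vec.Relation.Unary.All as All using (All; []; _∷_)
  open import Data.Vec.Relation.Unary.AllPairs using ([]; _∷_)
  open import Data.Vec.Relation.Unary.Any using (here; there)
  open import Data.Vec.Relation.Unary.Unique.Propositional using (Unique)
  open import Data.Vec.Relation.Unary.Unique.Propositional.Properties using (lookup-injective)
  open import Function using (_∘_; _⇔_; mk⇔; Equivalence)
  open import Relation.Binary.PropositionalEquality as ≡ using (_≡_; _≢_; refl; sym; trans; cong; subst)
  open import Relation.Nullary using (Dec; does; yes; no; ¬_; ¬?)
  open import Relation.Nullary.Decidable using (_×-dec_; _⊎-dec_)
  open import Relation.Nullary.Negation using (contradiction)
  open Cycles
  open TourRotations

  mark : ∀ {n} → Fin n → (Fin n → Bool) → Fin n → Bool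
  mark x vis y = vis y ∨ does (y Fin.≟ x)

  mark-false : ∀ {n} (x : Fin n) vis {y} → vis y ≡ false → y ≢ x → mark x vis y ≡ false
  mark-false x vis {y} vy y≢x rewrite vy with y Fin.≟ x
  ... | yes y≡x = contradiction y≡x y≢x
  ... | no  _   = refl

  mark-false⁻ : ∀ {n} (x : Fin n) vis {y} → mark x vis y ≡ false → vis y ≡ false × y ≢ x
  mark-false⁻ x vis {y} my with vis y | y Fin.≟ x
  ... | false | no y≢x = refl , y≢x

  -- Consecutive entries without the wrap-around of `next`; it differs from the steps of a tour only
  -- by the closing step.
  data Succ {n} (v w : Fin n) : ∀ {m} → Vec (Fin n) m → Set where
    here  : ∀ {m} {xs : Vec (Fin n) m} → Succ v w (v ∷ w ∷ xs)
    there : ∀ {m x} {xs : Vec (Fin n) m} → Succ v w xs → Succ v w (x ∷ xs)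

  Succ-∈ : ∀ {n} {v w : Fin n} {m} {xs : Vec (Fin n) m} → Succ v w xs → v ∈ xs × w ∈ xs
  Succ-∈ here      = here refl , there (here refl)
  Succ-∈ (there s) = let v∈ , w∈ = Succ-∈ s in there v∈ , there w∈

  Succ-lookup : ∀ {n} m (xs : Vec (Fin n) (suc m)) i → Succ (Vec.lookup xs (inject₁ i)) (Vec.lookup xs (suc i)) xs
  Succ-lookup (suc m) (x ∷ y ∷ xs) zero    = here
  Succ-lookup (suc m) (x ∷ xs)     (suc i) = there (Succ-lookup m xs i)

  Succ-index : ∀ {n} {v w : Fin n} {m} {xs : Vec (Fin n) (suc m)} → Succ v w xs →
    ∃[ i ] Vec.lookup xs (inject₁ i) ≡ v × Vec.lookup xs (suc i) ≡ w
  Succ-index here = zero , refl , refl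
  Succ-index {m = suc m} (there s) = let i , p , q = Succ-index s in suc i , p , q
  Succ-index {m = zero} (there ())

  Succ-uncons : ∀ {n} {v w x : Fin n} {m} {xs : Vec (Fin n) m} → Succ v w (x ∷ xs) → v ≡ x ⊎ Succ v w xs
  Succ-uncons here      = inj₁ refl
  Succ-uncons (there s) = inj₂ s

  Joined : ∀ {n} → Fin n → Fin n → ∀ {m} → Vec (Fin n) m → Set
  Joined v w xs = Succ v w xs ⊎ Succ w v xs

  module Walks {n : ℕ} (p : Fin n → Fin n) (p-involutive : ∀ v → p (p v) ≡ v) where

    mutual
      -- Traverses the unvisited vertices, each matched vertex directly followed
      -- or preceded by its partner.
      Walk : (Fin n → Bool) → ∀ {m} → Vec (Fin n) m → Set
      Walk vis []       = ⊤
      Walk vis (x ∷ xs) = vis x ≡ false × (p x ≡ x × Walk (mark x vis) xs ⊎ p x ≢ x × Partner vis x xs)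

      Partner : (Fin n → Bool) → Fin n → ∀ {m} → Vec (Fin n) m → Set
      Partner vis x []       = ⊥
      Partner vis x (y ∷ ys) = y ≡ p x × Walk (mark y (mark x vis)) ys

    mutual
      walk? : ∀ vis {m} (xs : Vec (Fin n) m) → Dec (Walk vis xs)
      walk? vis []       = yes tt
      walk? vis (x ∷ xs) = (vis x Bool.≟ false) ×-dec
        ((p x Fin.≟ x ×-dec walk? (mark x vis) xs) ⊎-dec (¬? (p x Fin.≟ x) ×-dec partner? vis x xs))

      partner? : ∀ vis x {m} (xs : Vec (Fin n) m) → Dec (Partner vis x xs)
      partner? vis x []       = no λ ()
      partner? vis x (y ∷ ys) = y Fin.≟ p x ×-dec walk? (mark y (mark x vis)) ys

    Matched : ∀ {m} → Vec (Fin n) m → Set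
    Matched xs = ∀ {v} → v ∈ xs → p v ≢ v → Joined v (p v) xs

    drop-joined : ∀ {v w x m} {xs : Vec (Fin n) m} → v ≢ x → w ≢ x → Joined v w (x ∷ xs) → Joined v w xs
    drop-joined v≢x w≢x (inj₁ here)      = contradiction refl v≢x
    drop-joined v≢x w≢x (inj₁ (there s)) = inj₁ s
    drop-joined v≢x w≢x (inj₂ here)      = contradiction refl w≢x
    drop-joined v≢x w≢x (inj₂ (there s)) = inj₂ s

    -- The head has no predecessor in the list, so its partner can only be the second entry.
    -- Removing the head, or head and partner, leaves the other pairs whole because an involution
    -- sends no remaining vertex to a removed one.
    Matched⇒Walk : ∀ vis {m} (xs : Vec (Fin n) m) → Unique xs → (∀ {x} → x ∈ xs → vis x ≡ false) → Matched xs → Walk vis xs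
    Matched⇒Walk vis [] _ _ _ = tt
    Matched⇒Walk vis (x ∷ xs) (x∉xs ∷ xs!) fresh joined = fresh (here refl) , split (p x Fin.≟ x)
      where
      ≢x : ∀ {y} → y ∈ xs → y ≢ x
      ≢x y∈ y≡x = All.lookup x∉xs y∈ (sym y≡x)

      after : ∀ {m} (ys : Vec (Fin n) m) → (∀ {y} → y ∈ ys → vis y ≡ false × y ≢ x) →
        Joined x (p x) (x ∷ ys) → p x ≢ x → (∀ {v} → v ∈ ys → p v ≢ v → Joined v (p v) (x ∷ ys)) → Unique ys → Partner vis x ys
      after (y ∷ ys) fresh′ (inj₁ here) px≢x joined′ (y∉ys ∷ ys!) = refl ,
        Matched⇒Walk _ ys ys!
          (λ z∈ → mark-false y (mark x vis) (mark-false x vis (proj₁ (fresh′ (there z∈))) (proj₂ (fresh′ (there z∈)))) (λ z≡y → All.lookup y∉ys z∈ (sym z≡y)))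
          (λ {v} v∈ pv≢v →
            let v≢y : v ≢ y
                v≢y v≡y = All.lookup y∉ys v∈ (sym v≡y)
                v≢x = proj₂ (fresh′ (there v∈))
            in drop-joined v≢y (λ pv≡y → v≢x (trans (sym (p-involutive v)) (trans (cong p pv≡y) (p-involutive x))))
              (drop-joined v≢x (λ pv≡x → v≢y (trans (sym (p-involutive v)) (cong p pv≡x)))
                (joined′ (there v∈) pv≢v)))
      after (y ∷ ys) fresh′ (inj₁ (there s)) px≢x joined′ ys! = contradiction refl (proj₂ (fresh′ (proj₁ (Succ-∈ s))))
      after ys fresh′ (inj₂ s) px≢x joined′ ys! with Succ-uncons s
      ... | inj₁ px≡x = contradiction px≡x px≢x
      ... | inj₂ s′   = contradiction refl (proj₂ (fresh′ (proj₂ (Succ-∈ s′))))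
      after [] fresh′ (inj₁ (there ())) px≢x joined′ ys!

      split : Dec (p x ≡ x) → p x ≡ x × Walk (mark x vis) xs ⊎ p x ≢ x × Partner vis x xs
      split (yes px≡x) = inj₁ (px≡x , Matched⇒Walk (mark x vis) xs xs!
        (λ y∈ → mark-false x vis (fresh (there y∈)) (≢x y∈))
        λ {v} v∈ pv≢v → drop-joined (≢x v∈)
          (λ pv≡x → ≢x v∈ (trans (sym (p-involutive v)) (trans (cong p pv≡x) px≡x)))
          (joined (there v∈) pv≢v))
      split (no px≢x) = inj₂ (px≢x , after xs (λ y∈ → fresh (there y∈) , ≢x y∈) (joined (here refl) px≢x) px≢x (λ v∈ → joined (there v∈)) xs!)

    Joined-there : ∀ {v w x m} {xs : Vec (Fin n) m} → Joined v w xs → Joined v w (x ∷ xs)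
    Joined-there = Sum.map there there

    -- The invariant of a walk: the visited vertices form a union of blocks. `Walk` tests only the
    -- first vertex of a pair for freshness; that the second is fresh follows from this.
    Closed : (Fin n → Bool) → Set
    Closed vis = ∀ {v} → vis v ≡ false → vis (p v) ≡ false

    closed-single : ∀ {vis x} → Closed vis → p x ≡ x → Closed (mark x vis)
    closed-single {vis} {x} closed px≡x {v} mv = let vv , v≢x = mark-false⁻ x vis mv in
      mark-false x vis (closed vv) λ pv≡x → v≢x (trans (sym (p-involutive v)) (trans (cong p pv≡x) px≡x))

    closed-pair : ∀ {vis} x → Closed vis → Closed (mark (p x) (mark x vis))
    closed-pair {vis} x closed {v} mv =
      let mv′ , v≢px = mark-false⁻ (p x) (mark x vis) mv
          vv , v≢x   = mark-false⁻ x vis mv′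
      in mark-false (p x) (mark x vis)
           (mark-false x vis (closed vv) λ pv≡x → v≢px (trans (sym (p-involutive v)) (cong p pv≡x)))
           (λ pv≡px → v≢x (trans (sym (p-involutive v)) (trans (cong p pv≡px) (p-involutive x))))

    Walk-fresh : ∀ vis {m} (xs : Vec (Fin n) m) → Closed vis → Walk vis xs → ∀ {x} → x ∈ xs → vis x ≡ false
    Walk-fresh vis (x ∷ xs) closed (vx , _) (here refl) = vx
    Walk-fresh vis (x ∷ xs) closed (vx , inj₁ (px≡x , walk)) (there y∈) =
      proj₁ (mark-false⁻ x vis (Walk-fresh _ xs (closed-single {vis} closed px≡x) walk y∈))
    Walk-fresh vis (x ∷ y ∷ ys) closed (vx , inj₂ (ne , refl , walk)) (there (here refl)) = closed vx
    Walk-fresh vis (x ∷ y ∷ ys) closed (vx , inj₂ (ne , refl , walk)) (there (there z∈)) =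
      proj₁ (mark-false⁻ x vis (proj₁ (mark-false⁻ y (mark x vis) (Walk-fresh _ ys (closed-pair {vis} x closed) walk z∈))))

    ∉⇒All≢ : ∀ {x m} {xs : Vec (Fin n) m} → (∀ {y} → y ∈ xs → y ≢ x) → All (x ≢_) xs
    ∉⇒All≢ {xs = []}     h = []
    ∉⇒All≢ {xs = y ∷ ys} h = (λ x≡y → h (here refl) (sym x≡y)) ∷ ∉⇒All≢ (h ∘ there)

    Walk-unique : ∀ vis {m} (xs : Vec (Fin n) m) → Closed vis → Walk vis xs → Unique xs
    Walk-unique vis []       closed _ = []
    Walk-unique vis (x ∷ xs) closed (vx , inj₁ (px≡x , walk)) =
      ∉⇒All≢ (λ y∈ → proj₂ (mark-false⁻ x vis (Walk-fresh _ xs closed′ walk y∈))) ∷ Walk-unique _ xs closed′ walk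
      where closed′ = closed-single {vis} closed px≡x
    Walk-unique vis (x ∷ y ∷ ys) closed (vx , inj₂ (ne , refl , walk)) =
      ∉⇒All≢ (λ { (here refl) → ne ; (there z∈) → proj₂ (mark-false⁻ x vis (proj₁ (fresh z∈))) })
      ∷ ∉⇒All≢ (λ z∈ → proj₂ (fresh z∈)) ∷ Walk-unique _ ys closed′ walk
      where
      closed′ = closed-pair {vis} x closed
      fresh : ∀ {z} → z ∈ ys → mark x vis z ≡ false × z ≢ p x
      fresh z∈ = mark-false⁻ (p x) (mark x vis) (Walk-fresh _ ys closed′ walk z∈)

    Walk-matched : ∀ vis {m} (xs : Vec (Fin n) m) → Walk vis xs → Matched xs
    Walk-matched vis (x ∷ xs) (vx , inj₁ (px≡x , walk)) (here refl) pv≢v = contradiction px≡x pv≢v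
    Walk-matched vis (x ∷ xs) (vx , inj₁ (px≡x , walk)) (there v∈) pv≢v = Joined-there (Walk-matched _ xs walk v∈ pv≢v)
    Walk-matched vis (x ∷ y ∷ ys) (vx , inj₂ (ne , refl , walk)) (here refl) pv≢v = inj₁ here
    Walk-matched vis (x ∷ y ∷ ys) (vx , inj₂ (ne , refl , walk)) (there (here refl)) pv≢v =
      inj₂ (subst (λ z → Succ z (p x) (x ∷ p x ∷ ys)) (sym (p-involutive x)) here)
    Walk-matched vis (x ∷ y ∷ ys) (vx , inj₂ (ne , refl , walk)) (there (there v∈)) pv≢v =
      Joined-there (Joined-there (Walk-matched _ ys walk v∈ pv≢v))

  none : ∀ {n} → Fin n → Bool
  none _ = false

  -- A tour containing the matching is a walk unless its closing step is a matching edge.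
  module Tours {m : ℕ} (p : Fin (3 ℕ.+ m) → Fin (3 ℕ.+ m)) (p-involutive : ∀ v → p (p v) ≡ v) where
    private
      n : ℕ
      n = suc (suc (suc m))

    open Walks p p-involutive public

    final : Fin n
    final = fromℕ (suc (suc m))

    -- For a tour that contains the matching, the only alternative is that the partner of the first
    -- vertex comes last, so that a pair is split by the closing step.
    Early : Vec (Fin n) n → Set
    Early (x ∷ y ∷ _) = p x ≡ x ⊎ y ≡ p x

    early? : ∀ σ → Dec (Early σ)
    early? (x ∷ y ∷ _) = p x Fin.≟ x ⊎-dec y Fin.≟ p x

    MatchedStart : Vec (Fin n) n → Set
    MatchedStart (x ∷ _) = p x ≢ x

    matchedStart? : ∀ σ → Dec (MatchedStart σ)
    matchedStart? (x ∷ _) = ¬? (p x Fin.≟ x)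

    Joined⇒Adj : ∀ (σ : Vec (Fin n) n) {v w} → Joined v w σ → Adj σ v w
    Joined⇒Adj σ (inj₁ s) = let i , q , r = Succ-index s in
      inject₁ i , inj₁ (q , trans (cong (Vec.lookup σ) (next-inject₁ i)) r)
    Joined⇒Adj σ (inj₂ s) = let i , q , r = Succ-index s in
      inject₁ i , inj₂ (q , trans (cong (Vec.lookup σ) (next-inject₁ i)) r)

    Adj⇒Joined : ∀ (σ : Vec (Fin n) n) {v w} → Adj σ v w → Joined v w σ
      ⊎ (Vec.lookup σ final ≡ v × Vec.lookup σ zero ≡ w)
      ⊎ (Vec.lookup σ final ≡ w × Vec.lookup σ zero ≡ v)
    Adj⇒Joined σ (t , adj) with view t
    Adj⇒Joined σ (_ , inj₁ (refl , refl)) | ‵inject₁ i = inj₁ (inj₁ (subst (λ j → Succ (Vec.lookup σ (inject₁ i)) (Vec.lookup σ j) σ) (sym (next-inject₁ i)) (Succ-lookup _ σ i)))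
    Adj⇒Joined σ (_ , inj₂ (refl , refl)) | ‵inject₁ i = inj₁ (inj₂ (subst (λ j → Succ (Vec.lookup σ (inject₁ i)) (Vec.lookup σ j) σ) (sym (next-inject₁ i)) (Succ-lookup _ σ i)))
    Adj⇒Joined σ (_ , inj₁ (q , r)) | ‵fromℕ = inj₂ (inj₁ (q , trans (cong (Vec.lookup σ) (sym (next-fromℕ (suc (suc m))))) r))
    Adj⇒Joined σ (_ , inj₂ (q , r)) | ‵fromℕ = inj₂ (inj₂ (q , trans (cong (Vec.lookup σ) (sym (next-fromℕ (suc (suc m))))) r))

    -- With at least three vertices the second position is not the last one, so the partner of the
    -- first vertex cannot stand in both.
    early⇒¬closing : ∀ σ → Unique σ → Early σ → p (Vec.lookup σ zero) ≢ Vec.lookup σ zero →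
      Vec.lookup σ final ≢ p (Vec.lookup σ zero)
    early⇒¬closing (x ∷ y ∷ σ) σ! (inj₁ px≡x) px≢x _ = px≢x px≡x
    early⇒¬closing σ@(x ∷ y ∷ _) σ! (inj₂ y≡px) px≢x last≡px
      with () ← lookup-injective σ! final (suc zero) (trans last≡px (sym y≡px))

    -- An early tour closes by a step outside the matching, so all matching edges join consecutive
    -- entries, which is where `Walk` looks for them.
    contains∧early⇔walk : ∀ σ → (Contains p σ × Early σ) ⇔ Walk none σ
    contains∧early⇔walk σ = mk⇔ to from
      where
      to : Contains p σ × Early σ → Walk none σ
      to ((σ! , adj) , early) = Matched⇒Walk none σ σ! (λ _ → refl) λ {v} _ pv≢v → joined v pv≢v (Adj⇒Joined σ (adj v pv≢v))
        where
        joined : ∀ v → p v ≢ v → Joined v (p v) σ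
          ⊎ (Vec.lookup σ final ≡ v × Vec.lookup σ zero ≡ p v)
          ⊎ (Vec.lookup σ final ≡ p v × Vec.lookup σ zero ≡ v) → Joined v (p v) σ
        joined v pv≢v (inj₁ j) = j
        joined v pv≢v (inj₂ (inj₁ (q , r))) = contradiction
          (trans q (trans (sym (p-involutive v)) (cong p (sym r))))
          (early⇒¬closing σ σ! early λ pσ₀≡σ₀ → pv≢v (trans (sym r) (trans (sym pσ₀≡σ₀) (trans (cong p r) (p-involutive v)))))
        joined v pv≢v (inj₂ (inj₂ (q , r))) = contradiction
          (trans q (cong p (sym r)))
          (early⇒¬closing σ σ! early λ pσ₀≡σ₀ → pv≢v (trans (cong p (sym r)) (trans pσ₀≡σ₀ r)))

      early : ∀ σ → Walk none σ → Early σ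
      early (x ∷ y ∷ _) (_ , inj₁ (px≡x , _)) = inj₁ px≡x
      early (x ∷ y ∷ _) (_ , inj₂ (_ , y≡px , _)) = inj₂ y≡px

      from : Walk none σ → Contains p σ × Early σ
      from walk = (σ! , λ v pv≢v → Joined⇒Adj σ {v} {p v} (Walk-matched none σ walk (∈σ v) pv≢v)) , early σ walk
        where
        σ! = Walk-unique none σ (λ _ → refl) walk
        -- A sequence of length `n` without repetitions meets every vertex, so every matching edge
        -- is seen by the walk.
        ∈σ : ∀ v → v ∈ σ
        ∈σ v = let i , eq = injective⇒surjective (Vec.lookup σ) (λ {i} {j} → lookup-injective σ! i j) v
               in subst (_∈ σ) eq (∈-lookup i σ)

    -- A late tour has a pair split between its ends. Writing it as `rotate σ`, its last vertex is
    -- the first of `σ`, so the pair becomes the opening block of `σ`; conversely, rotating a walk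
    -- that opens with a pair splits that pair.
    contains-rotated∧late⇔walk : ∀ σ → (Contains p (rotate σ) × ¬ Early (rotate σ)) ⇔ (Walk none σ × MatchedStart σ)
    contains-rotated∧late⇔walk σ@(x ∷ y ∷ z ∷ zs) = mk⇔ to from
      where
      to : Contains p (rotate σ) × ¬ Early (rotate σ) → Walk none σ × MatchedStart σ
      to (rσ , ¬early) = Equivalence.to (contains∧early⇔walk σ) (contains , inj₂ y≡px)
        , λ px≡x → py≢y (trans (cong p y≡px) (trans (p-involutive x) (trans (sym px≡x) (sym y≡px))))
        where
        contains = Equivalence.to (Contains-rotate p σ) rσ
        σ! = proj₁ contains
        py≢y : p y ≢ y
        py≢y py≡y = ¬early (inj₁ py≡y)
        neighbour : Joined y (p y) σ
          ⊎ (Vec.lookup σ final ≡ y × Vec.lookup σ zero ≡ p y)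
          ⊎ (Vec.lookup σ final ≡ p y × Vec.lookup σ zero ≡ y) → p y ≡ x
        neighbour (inj₁ (inj₁ s)) = let i , q , r = Succ-index s in
          contradiction (after i q r) (¬early ∘ inj₂)
          where
          after : ∀ i → Vec.lookup σ (inject₁ i) ≡ y → Vec.lookup σ (suc i) ≡ p y → z ≡ p y
          after i q r with lookup-injective σ! (inject₁ i) (suc zero) q
          after (suc zero) q r | refl = r
        neighbour (inj₁ (inj₂ s)) = let i , q , r = Succ-index s in before i q r
          where
          before : ∀ i → Vec.lookup σ (inject₁ i) ≡ p y → Vec.lookup σ (suc i) ≡ y → p y ≡ x
          before i q r with lookup-injective σ! (suc i) (suc zero) r
          before zero q r | refl = sym q
        neighbour (inj₂ (inj₁ (q , r))) = sym r
        neighbour (inj₂ (inj₂ (q , r))) with () ← lookup-injective σ! zero (suc zero) r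
        py≡x : p y ≡ x
        py≡x = neighbour (Adj⇒Joined σ (proj₂ contains y py≢y))
        y≡px : y ≡ p x
        y≡px = trans (sym (p-involutive y)) (cong p py≡x)

      from : Walk none σ × MatchedStart σ → Contains p (rotate σ) × ¬ Early (rotate σ)
      from (walk , px≢x) = Equivalence.from (Contains-rotate p σ) contains
        , λ { (inj₁ py≡y) → px≢x (trans (sym y≡px) (trans (sym py≡y) py≡x))
            ; (inj₂ z≡py) → z≢x (trans z≡py py≡x) }
        where
        contains = proj₁ (Equivalence.from (contains∧early⇔walk σ) walk)
        y≡px : y ≡ p x
        y≡px with Equivalence.from (contains∧early⇔walk σ) walk
        ... | _ , inj₁ px≡x = contradiction px≡x px≢x
        ... | _ , inj₂ eq   = eq
        py≡x : p y ≡ x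
        py≡x = trans (cong p y≡px) (p-involutive x)
        z≢x : z ≢ x
        z≢x z≡x with () ← lookup-injective (proj₁ contains) (suc (suc zero)) zero z≡x

-- The number of walks through given blocks.

module WalkCounts where

  open import Data.Bool using (Bool; true; false; _∨_; _∧_; not)
  import Data.Bool.Properties as Bool
  open import Data.Fin as Fin using (Fin; zero; suc)
  import Data.Fin.Properties as Fin
  open import Data.Nat as ℕ using (ℕ; zero; suc; _+_; _*_; _^_; _∸_; _!)
  import Data.Nat.Properties as ℕ
  open import Data.Nat.Solver using (module +-*-Solver)
  open import Data.Product using (_,_)
  open import Data.Sum as Sum using (inj₁; inj₂)
  open import Data.Vec as Vec using (Vec; _∷_)
  open import Function using (mk⇔)
  open import Relation.Binary.PropositionalEquality as ≡ using (_≡_; _≢_; refl; sym; trans; cong; cong₂)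
  open import Relation.Nullary using (Dec; does; yes; no)
  open import Relation.Nullary.Decidable using (_×-dec_; does-⇔; dec-true; dec-false)
  open import Relation.Nullary.Negation using (contradiction)
  open FiniteSums
  open Cycles
  open BlockWalks
  open Sums ℕ.+-*-commutativeSemiring
  open ≡.≡-Reasoning

  module Counting {n : ℕ} (p : Fin n → Fin n) (p-involutive : ∀ v → p (p v) ≡ v) where
    open Walks p p-involutive

    single? : Fin n → Bool
    single? x = does (p x Fin.≟ x)

    -- `pairs` counts unvisited matched vertices, so it is twice the number of unvisited pairs;
    -- hence the comparisons with `2 * j`.
    singles pairs : (Fin n → Bool) → ℕ
    singles vis = ∑ λ x → [ not (vis x) ∧ single? x ]
    pairs   vis = ∑ λ x → [ not (vis x) ∧ not (single? x) ]

    -- With s + j blocks left, opening with a single vertex leaves 2^j (s + j - 1)! continuations,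
    -- opening with a given end of a pair half as many. The weights 2 and 1 record this ratio.
    weight : Fin n → ℕ
    weight x = suc [ single? x ]

    walks : (Fin n → Bool) → ℕ → ℕ
    walks vis m = ∑V m λ xs → [ does (walk? vis xs) ]

    walksFrom : (Fin n → Bool) → Fin n → ℕ → ℕ
    walksFrom vis x m = ∑V m λ xs → [ does (walk? vis (x ∷ xs)) ]

    singles-single : ∀ vis {x} → vis x ≡ false → p x ≡ x → singles vis ≡ suc (singles (mark x vis))
    singles-single vis {x} vx px≡x = begin
      singles vis                                                                   ≡⟨ ∑-cong (λ y → pointwise y (y Fin.≟ x)) ⟩
      (∑ λ y → [ does (y Fin.≟ x) ] + [ not (mark x vis y) ∧ single? y ])           ≡⟨ ∑-+ _ _ ⟩
      (∑ λ y → [ does (y Fin.≟ x) ]) + singles (mark x vis)                         ≡⟨ cong (_+ singles (mark x vis)) (∑-1 x) ⟩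
      suc (singles (mark x vis))                                                    ∎
      where
      pointwise : ∀ y → (d : Dec (y ≡ x)) → [ not (vis y) ∧ single? y ] ≡ [ does d ] + [ not (vis y ∨ does d) ∧ single? y ]
      pointwise y (yes refl) rewrite vx | dec-true (p x Fin.≟ x) px≡x = refl
      pointwise y (no _) rewrite Bool.∨-identityʳ (vis y) = refl

    pairs-single : ∀ vis {x} → p x ≡ x → pairs vis ≡ pairs (mark x vis)
    pairs-single vis {x} px≡x = ∑-cong λ y → pointwise y (y Fin.≟ x)
      where
      pointwise : ∀ y → (d : Dec (y ≡ x)) → [ not (vis y) ∧ not (single? y) ] ≡ [ not (vis y ∨ does d) ∧ not (single? y) ]
      pointwise y (yes refl) rewrite dec-true (p x Fin.≟ x) px≡x | Bool.∧-zeroʳ (not (vis y)) | Bool.∧-zeroʳ (not (vis y ∨ true)) = refl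
      pointwise y (no _) rewrite Bool.∨-identityʳ (vis y) = refl

    singles-paired : ∀ vis {x} → p x ≢ x → singles vis ≡ singles (mark x vis)
    singles-paired vis {x} px≢x = ∑-cong λ y → pointwise y (y Fin.≟ x)
      where
      pointwise : ∀ y → (d : Dec (y ≡ x)) → [ not (vis y) ∧ single? y ] ≡ [ not (vis y ∨ does d) ∧ single? y ]
      pointwise y (yes refl) rewrite dec-false (p x Fin.≟ x) px≢x | Bool.∧-zeroʳ (not (vis y)) | Bool.∧-zeroʳ (not (vis y ∨ true)) = refl
      pointwise y (no _) rewrite Bool.∨-identityʳ (vis y) = refl

    pairs-paired : ∀ vis {x} → vis x ≡ false → p x ≢ x → pairs vis ≡ suc (pairs (mark x vis))
    pairs-paired vis {x} vx px≢x = begin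
      pairs vis                                                                     ≡⟨ ∑-cong (λ y → pointwise y (y Fin.≟ x)) ⟩
      (∑ λ y → [ does (y Fin.≟ x) ] + [ not (mark x vis y) ∧ not (single? y) ])     ≡⟨ ∑-+ _ _ ⟩
      (∑ λ y → [ does (y Fin.≟ x) ]) + pairs (mark x vis)                           ≡⟨ cong (_+ pairs (mark x vis)) (∑-1 x) ⟩
      suc (pairs (mark x vis))                                                      ∎
      where
      pointwise : ∀ y → (d : Dec (y ≡ x)) → [ not (vis y) ∧ not (single? y) ] ≡ [ does d ] + [ not (vis y ∨ does d) ∧ not (single? y) ]
      pointwise y (yes refl) rewrite vx | dec-false (p x Fin.≟ x) px≢x = refl
      pointwise y (no _) rewrite Bool.∨-identityʳ (vis y) = refl

    partner-paired : ∀ {x} → p x ≢ x → p (p x) ≢ p x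
    partner-paired {x} px≢x eq = px≢x (sym (trans (sym (p-involutive x)) eq))

    partner-unvisited : ∀ {vis} x → Closed vis → vis x ≡ false → p x ≢ x → mark x vis (p x) ≡ false
    partner-unvisited {vis} x closed vx px≢x = mark-false x vis (closed vx) px≢x

    walksFrom-visited : ∀ vis x m → vis x ≡ true → walksFrom vis x m ≡ 0
    walksFrom-visited vis x m vx = ∑V-0 m _ λ xs → cong [_] (dec-false (walk? vis (x ∷ xs)) λ (vx′ , _) → contradiction (trans (sym vx) vx′) λ ())

    walksFrom-single : ∀ vis x m → vis x ≡ false → p x ≡ x → walksFrom vis x m ≡ walks (mark x vis) m
    walksFrom-single vis x m vx px≡x = ∑V-cong m λ xs → cong [_] (does-⇔
      (mk⇔ (λ { (_ , inj₁ (_ , walk)) → walk ; (_ , inj₂ (px≢x , _)) → contradiction px≡x px≢x }) (λ walk → vx , inj₁ (px≡x , walk)))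
      (walk? vis (x ∷ xs)) (walk? (mark x vis) xs))

    walks-partner : ∀ vis x y {m} (ys : Vec (Fin n) m) → vis x ≡ false → p x ≢ x →
      [ does (walk? vis (x ∷ y ∷ ys)) ] ≡ [ does (y Fin.≟ p x) ] * [ does (walk? (mark y (mark x vis)) ys) ]
    walks-partner vis x y ys vx px≢x = trans (cong [_] (does-⇔
      (mk⇔ (λ { (_ , inj₁ (px≡x , _)) → contradiction px≡x px≢x ; (_ , inj₂ (_ , y≡px , walk)) → y≡px , walk })
           (λ (y≡px , walk) → vx , inj₂ (px≢x , y≡px , walk)))
      (walk? vis (x ∷ y ∷ ys)) (y Fin.≟ p x ×-dec walk? (mark y (mark x vis)) ys)))
      ([∧] (does (y Fin.≟ p x)) _)

    walksFrom-paired : ∀ vis x m → vis x ≡ false → p x ≢ x → walksFrom vis x (suc m) ≡ walks (mark (p x) (mark x vis)) m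
    walksFrom-paired vis x m vx px≢x = begin
      (∑ λ y → ∑V m λ ys → [ does (walk? vis (x ∷ y ∷ ys)) ])
        ≡⟨ ∑-cong (λ y → trans (∑V-cong m λ ys → walks-partner vis x y ys vx px≢x) (∑V-*ˡ m [ does (y Fin.≟ p x) ] λ ys → [ does (walk? (mark y (mark x vis)) ys) ])) ⟩
      (∑ λ y → [ does (y Fin.≟ p x) ] * walks (mark y (mark x vis)) m)
        ≡⟨ ∑-δ (p x) (λ y → walks (mark y (mark x vis)) m) ⟩
      walks (mark (p x) (mark x vis)) m ∎

    mutual
      -- Each of the s + j remaining blocks comes next in turn, a pair in either order.
      count-walks : ∀ m vis s j → Closed vis → singles vis ≡ s → pairs vis ≡ 2 * j → m ≡ s + 2 * j →
        walks vis m ≡ 2 ^ j * (s + j) !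
      count-walks zero    vis zero zero closed _ _ _ = refl
      count-walks (suc m) vis s j closed s≡ j≡ m≡ = ℕ.*-cancelˡ-≡ _ _ 2 (begin
        2 * walks vis (suc m)
          ≡⟨ ∑-*ˡ 2 (λ x → walksFrom vis x m) ⟨
        (∑ λ x → 2 * walksFrom vis x m)
          ≡⟨ ∑-cong (λ x → trans (count-walksFrom m vis s j x closed s≡ j≡ m≡) (cong (_* (2 ^ j * (s + j ∸ 1) !)) (expand (vis x) (single? x)))) ⟩
        (∑ λ x → (2 * [ not (vis x) ∧ single? x ] + [ not (vis x) ∧ not (single? x) ]) * (2 ^ j * (s + j ∸ 1) !))
          ≡⟨ ∑-*ʳ (2 ^ j * (s + j ∸ 1) !) (λ x → 2 * [ not (vis x) ∧ single? x ] + [ not (vis x) ∧ not (single? x) ]) ⟩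
        (∑ λ x → 2 * [ not (vis x) ∧ single? x ] + [ not (vis x) ∧ not (single? x) ]) * (2 ^ j * (s + j ∸ 1) !)
          ≡⟨ cong (_* (2 ^ j * (s + j ∸ 1) !)) (trans (∑-+ (λ x → 2 * [ not (vis x) ∧ single? x ]) (λ x → [ not (vis x) ∧ not (single? x) ]))
               (cong₂ _+_ (trans (∑-*ˡ 2 (λ x → [ not (vis x) ∧ single? x ])) (cong (2 *_) s≡)) j≡)) ⟩
        (2 * s + 2 * j) * (2 ^ j * (s + j ∸ 1) !)
          ≡⟨ regroup s j (2 ^ j) ((s + j ∸ 1) !) ⟩
        2 * (2 ^ j * ((s + j) * (s + j ∸ 1) !))
          ≡⟨ cong (λ t → 2 * (2 ^ j * t)) (factorial s j m≡) ⟩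
        2 * (2 ^ j * (s + j) !) ∎)
        where
        expand : ∀ b c → [ not b ] * suc [ c ] ≡ 2 * [ not b ∧ c ] + [ not b ∧ not c ]
        expand true  c     = refl
        expand false true  = refl
        expand false false = refl
        regroup : ∀ s j u w → (2 * s + 2 * j) * (u * w) ≡ 2 * (u * ((s + j) * w))
        regroup = solve 4 (λ s j u w → (con 2 :* s :+ con 2 :* j) :* (u :* w) := con 2 :* (u :* ((s :+ j) :* w))) refl
          where open +-*-Solver
        factorial : ∀ s j → suc m ≡ s + 2 * j → (s + j) * (s + j ∸ 1) ! ≡ (s + j) !
        factorial zero    (suc j) _ = refl
        factorial (suc s) j       _ = refl

      -- The doubling clears the power 2^(j - 1) that remains once one pair has been entered from a
      -- prescribed end.
      count-walksFrom : ∀ m vis s j x → Closed vis → singles vis ≡ s → pairs vis ≡ 2 * j → suc m ≡ s + 2 * j →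
        2 * walksFrom vis x m ≡ [ not (vis x) ] * weight x * (2 ^ j * (s + j ∸ 1) !)
      count-walksFrom m vis s j x = count-walksFrom′ m vis s j x (vis x) refl (p x Fin.≟ x)

      count-walksFrom′ : ∀ m vis s j x b → vis x ≡ b → (d : Dec (p x ≡ x)) → Closed vis → singles vis ≡ s → pairs vis ≡ 2 * j → suc m ≡ s + 2 * j →
        2 * walksFrom vis x m ≡ [ not b ] * suc [ does d ] * (2 ^ j * (s + j ∸ 1) !)
      count-walksFrom′ m vis s j x true vx _ closed s≡ j≡ m≡ = trans (cong (2 *_) (walksFrom-visited vis x m vx)) refl
      count-walksFrom′ m vis zero j x false vx (yes px≡x) closed s≡ j≡ m≡ =
        contradiction (trans (sym s≡) (singles-single vis vx px≡x)) λ ()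
      count-walksFrom′ m vis (suc s) j x false vx (yes px≡x) closed s≡ j≡ m≡ = begin
        2 * walksFrom vis x m
          ≡⟨ cong (2 *_) (walksFrom-single vis x m vx px≡x) ⟩
        2 * walks (mark x vis) m
          ≡⟨ cong (2 *_) (count-walks m (mark x vis) s j (closed-single {vis} closed px≡x)
               (ℕ.suc-injective (trans (sym (singles-single vis vx px≡x)) s≡))
               (trans (sym (pairs-single vis px≡x)) j≡) (ℕ.suc-injective m≡)) ⟩
        2 * (2 ^ j * (s + j) !) ∎
      count-walksFrom′ m vis s zero x false vx (no px≢x) closed s≡ j≡ m≡ =
        contradiction (trans (sym j≡) (pairs-paired vis vx px≢x)) λ ()
      count-walksFrom′ zero vis s (suc j) x false vx (no px≢x) closed s≡ j≡ m≡ =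
        contradiction (trans m≡ (trans (ℕ.+-suc s _) (cong suc (trans (cong (s +_) (ℕ.+-suc j _)) (ℕ.+-suc s _))))) λ ()
      count-walksFrom′ (suc m) vis s (suc j) x false vx (no px≢x) closed s≡ j≡ m≡ = begin
        2 * walksFrom vis x (suc m)
          ≡⟨ cong (2 *_) (walksFrom-paired vis x m vx px≢x) ⟩
        2 * walks (mark (p x) (mark x vis)) m
          ≡⟨ cong (2 *_) (count-walks m (mark (p x) (mark x vis)) s j (closed-pair {vis} x closed)
               (trans (sym (trans (singles-paired vis px≢x) (singles-paired (mark x vis) (partner-paired px≢x)))) s≡)
               (ℕ.suc-injective (ℕ.suc-injective (trans
                 (sym (trans (pairs-paired vis vx px≢x) (cong suc (pairs-paired (mark x vis) (partner-unvisited {vis} x closed vx px≢x) (partner-paired px≢x)))))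
                 (trans j≡ (ℕ.*-suc 2 j)))))
               (ℕ.suc-injective (ℕ.suc-injective (trans m≡ (two-less s j))))) ⟩
        2 * (2 ^ j * (s + j) !)
          ≡⟨ regroup (2 ^ j) ((s + j) !) ⟩
        2 ^ suc j * (s + j) ! + 0
          ≡⟨ cong (λ t → 2 ^ suc j * (t ∸ 1) ! + 0) (ℕ.+-suc s j) ⟨
        2 ^ suc j * (s + suc j ∸ 1) ! + 0
          ≡⟨⟩
        1 * (2 ^ suc j * (s + suc j ∸ 1) !) ∎
        where
        regroup : ∀ u w → 2 * (u * w) ≡ 2 * u * w + 0
        regroup = solve 2 (λ u w → con 2 :* (u :* w) := con 2 :* u :* w :+ con 0) refl
          where open +-*-Solver
        two-less : ∀ s j → s + 2 * suc j ≡ suc (suc (s + 2 * j))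
        two-less = solve 2 (λ s j → s :+ con 2 :* (con 1 :+ j) := con 2 :+ (s :+ con 2 :* j)) refl
          where open +-*-Solver

-- The number of tours that contain a matching and use a given step.

module StepCounts where

  open import Algebra.Bundles using (CommutativeSemiring)
  import Algebra.Properties.Semiring.Mult
  open import Data.Bool using (Bool; true; false; _∨_; _∧_; not)
  import Data.Bool.Properties as Bool
  open import Data.Fin as Fin using (Fin; zero; suc)
  import Data.Fin.Properties as Fin
  open import Data.Nat as ℕ using (ℕ; zero; suc; _^_; _∸_; _!)
  import Data.Nat.Properties as ℕ
  open import Data.Nat.Solver using (module +-*-Solver)
  open import Data.Product using (_,_)
  open import Data.Sum as Sum using (inj₁; inj₂)
  open import Data.Vec as Vec using (Vec; _∷_)
  open import Function using (_∘_; mk⇔)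
  open import Level using (0ℓ)
  open import Relation.Binary.PropositionalEquality as ≡ using (_≡_; _≢_; refl; sym; trans; cong; cong₂; subst)
  open import Relation.Nullary using (Dec; does; yes; no; ¬?)
  open import Relation.Nullary.Decidable using (_×-dec_; does-⇔; dec-true; dec-false)
  open import Relation.Nullary.Negation using (contradiction)
  open import Defs using (next)
  open FiniteSums
  open Cycles
  open TourRotations
  open BlockWalks
  open WalkCounts

  module ℕΣ = Sums ℕ.+-*-commutativeSemiring

  module TourCounts {m : ℕ} (p : Fin (3 ℕ.+ m) → Fin (3 ℕ.+ m)) (p-involutive : ∀ v → p (p v) ≡ v) (s k b : ℕ)
    (s≡ : Counting.singles p p-involutive none ≡ s) (k≡ : Counting.pairs p p-involutive none ≡ 2 ℕ.* k)
    (n≡ : 3 ℕ.+ m ≡ s ℕ.+ 2 ℕ.* k) (b≡ : s ℕ.+ k ≡ suc (suc b)) where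
    private
      n : ℕ
      n = suc (suc (suc m))

    open Counting p p-involutive

    open Tours p p-involutive
    open ℕΣ
    open ≡.≡-Reasoning
    open import Data.Nat using (_+_; _*_)

    -- There are b + 2 blocks. If the step joins two single vertices, the other `b` blocks come in
    -- any order and all `k` pairs in either direction. Each matched end fixes the direction of its
    -- pair, which halves the count: hence fourths. If the step is itself a pair, the other b + 1
    -- blocks are free, and 2^(k-1) (b + 1)! is 2b + 2 fourths of `unit`.
    unit : ℕ
    unit = 2 ^ k * b !

    -- The number of tours containing the matching and using the step from y to z
    -- is n · unit · stepWeight y z / 4.
    stepWeight : Fin n → Fin n → ℕ
    stepWeight y z = weight y * weight z + [ not (single? y) ] * [ does (z Fin.≟ p y) ] * suc (2 * b)

    -- Together with `second`, this counts the tours whose first step leads from `y` to `z`: `first`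
    -- the early ones, which are walks, and `second` the late ones, through the walk that starts
    -- with the pair `x`, `y` and goes on to `z`.
    first : Fin n → Fin n → ℕ
    first y z = ∑V (suc m) λ v → [ does (walk? none (y ∷ z ∷ v)) ]

    second : Fin n → Fin n → Fin n → ℕ
    second x y z = ∑V m λ v → [ does (walk? none (x ∷ y ∷ z ∷ v)) ∧ not (single? x) ]

    private
      second-vanishes : ∀ x y z → (x ≡ p y → p x ≡ x) → second x y z ≡ 0
      second-vanishes x y z h = ∑V-0 m _ λ v → cong [_]
        (dec-false (walk? none (x ∷ y ∷ z ∷ v) ×-dec ¬? (p x Fin.≟ x)) λ where
          ((_ , inj₁ (px≡x , _)) , px≢x) → px≢x px≡x
          ((_ , inj₂ (_ , y≡px , _)) , px≢x) → px≢x (h (trans (sym (p-involutive x)) (cong p (sym y≡px)))))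

      ∑-second : ∀ y z → (∑ λ x → second x y z) ≡ second (p y) y z
      ∑-second y z = trans (∑-cong λ x → localise x (x Fin.≟ p y)) (∑-δ (p y) λ x → second x y z)
        where
        localise : ∀ x (d : Dec (x ≡ p y)) → second x y z ≡ [ does d ] * second x y z
        localise x (yes _)     = sym (ℕ.+-identityʳ _)
        localise x (no x≢py) = second-vanishes x y z λ x≡py → contradiction x≡py x≢py

      second-paired : ∀ y z → p y ≢ y → second (p y) y z ≡ walksFrom (mark y (mark (p y) none)) z m
      second-paired y z py≢y = ∑V-cong m λ v → begin
        [ does (walk? none (p y ∷ y ∷ z ∷ v)) ∧ not (single? (p y)) ]
          ≡⟨ cong (λ c → [ does (walk? none (p y ∷ y ∷ z ∷ v)) ∧ not c ]) (dec-false (p (p y) Fin.≟ p y) (partner-paired py≢y)) ⟩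
        [ does (walk? none (p y ∷ y ∷ z ∷ v)) ∧ true ]
          ≡⟨ cong [_] (Bool.∧-identityʳ (does (walk? none (p y ∷ y ∷ z ∷ v)))) ⟩
        [ does (walk? none (p y ∷ y ∷ z ∷ v)) ]
          ≡⟨ walks-partner none (p y) y (z ∷ v) refl (partner-paired py≢y) ⟩
        [ does (y Fin.≟ p (p y)) ] * [ does (walk? (mark y (mark (p y) none)) (z ∷ v)) ]
          ≡⟨ cong (λ c → [ c ] * [ does (walk? (mark y (mark (p y) none)) (z ∷ v)) ]) (dec-true (y Fin.≟ p (p y)) (sym (p-involutive y))) ⟩
        1 * [ does (walk? (mark y (mark (p y) none)) (z ∷ v)) ]
          ≡⟨ ℕ.*-identityˡ _ ⟩
        [ does (walk? (mark y (mark (p y) none)) (z ∷ v)) ] ∎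

      first-single : ∀ y z → p y ≡ y → first y z ≡ walksFrom (mark y none) z (suc m)
      first-single y z py≡y = ∑V-cong (suc m) λ v → cong [_] (does-⇔
        (mk⇔ (λ { (_ , inj₁ (_ , walk)) → walk ; (_ , inj₂ (py≢y , _)) → contradiction py≡y py≢y }) (λ walk → refl , inj₁ (py≡y , walk)))
        (walk? none (y ∷ z ∷ v)) (walk? (mark y none) (z ∷ v)))

      first-paired : ∀ y z → p y ≢ y → first y z ≡ [ does (z Fin.≟ p y) ] * walks (mark z (mark y none)) (suc m)
      first-paired y z py≢y = trans (∑V-cong (suc m) λ v → walks-partner none y z v refl py≢y)
        (∑V-*ˡ (suc m) [ does (z Fin.≟ p y) ] λ v → [ does (walk? (mark z (mark y none)) v) ])

      ≡⇒mark : ∀ {y z : Fin n} vis → z ≡ y → mark y vis z ≡ true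
      ≡⇒mark {y} {z} vis z≡y = trans (cong (vis z ∨_) (dec-true (z Fin.≟ y) z≡y)) (Bool.∨-zeroʳ (vis z))

      mark-true : ∀ {y z : Fin n} vis → vis z ≡ true → mark y vis z ≡ true
      mark-true {y} {z} vis eq = cong (_∨ does (z Fin.≟ y)) eq

      single-case : ∀ y z → y ≢ z → p y ≡ y → ∀ s → singles none ≡ s → n ≡ s + 2 * k → s + k ≡ suc (suc b) →
        4 * (first y z + ∑ λ x → second x y z) ≡ 2 * weight z * unit
      single-case y z y≢z py≡y zero s≡ n≡ b≡ = contradiction (trans (sym s≡) (singles-single none refl py≡y)) λ ()
      single-case y z y≢z py≡y (suc s) s≡ n≡ b≡ = begin
        4 * (first y z + ∑ λ x → second x y z)
          ≡⟨ cong₂ (λ f g → 4 * (f + g)) (first-single y z py≡y)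
               (trans (∑-second y z) (second-vanishes (p y) y z λ _ → trans (p-involutive y) (sym py≡y))) ⟩
        4 * (walksFrom (mark y none) z (suc m) + 0)
          ≡⟨ double (walksFrom (mark y none) z (suc m)) ⟩
        2 * (2 * walksFrom (mark y none) z (suc m))
          ≡⟨ cong (2 *_) (count-walksFrom (suc m) (mark y none) s k z (closed-single {none} (λ _ → refl) py≡y)
               (ℕ.suc-injective (trans (sym (singles-single none refl py≡y)) s≡))
               (trans (sym (pairs-single none py≡y)) k≡) (ℕ.suc-injective n≡)) ⟩
        2 * ([ not (mark y none z) ] * weight z * (2 ^ k * (s + k ∸ 1) !))
          ≡⟨ cong₂ (λ c t → 2 * ([ not c ] * weight z * (2 ^ k * t !))) (mark-false y none refl (y≢z ∘ sym)) (cong (_∸ 2) b≡) ⟩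
        2 * (1 * weight z * unit)
          ≡⟨ regroup (weight z) unit ⟩
        2 * weight z * unit ∎
        where
        double : ∀ f → 4 * (f + 0) ≡ 2 * (2 * f)
        double = solve 1 (λ f → con 4 :* (f :+ con 0) := con 2 :* (con 2 :* f)) refl
          where open +-*-Solver
        regroup : ∀ w u → 2 * (1 * w * u) ≡ 2 * w * u
        regroup = solve 2 (λ w u → con 2 :* (con 1 :* w :* u) := con 2 :* w :* u) refl
          where open +-*-Solver

      -- Exactly one kind of tour contributes. If `z` is the partner of `y`, the pair opens the
      -- walk, and a late tour is impossible because `z` would already be visited as `x`. Otherwise
      -- an early tour is impossible, and the partner of `y` precedes it.
      paired-case : ∀ y z → y ≢ z → p y ≢ y → ∀ k → pairs none ≡ 2 * k → n ≡ s + 2 * k → s + k ≡ suc (suc b) →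
        4 * (first y z + ∑ λ x → second x y z) ≡ (weight z + [ does (z Fin.≟ p y) ] * suc (2 * b)) * (2 ^ k * b !)
      paired-case y z y≢z py≢y zero k≡ n≡ b≡ = contradiction (trans (sym k≡) (pairs-paired none refl py≢y)) λ ()
      paired-case y z y≢z py≢y (suc k) k≡ n≡ b≡ = trans
        (cong₂ (λ f g → 4 * (f + g)) (first-paired y z py≢y) (trans (∑-second y z) (second-paired y z py≢y)))
        (cases (z Fin.≟ p y))
        where
        vis₁ vis₂ : Fin n → Bool
        vis₁ = mark z (mark y none)
        vis₂ = mark y (mark (p y) none)
        s+k≡ : s + k ≡ suc b
        s+k≡ = ℕ.suc-injective (trans (sym (ℕ.+-suc s k)) b≡)
        n≡′ : suc m ≡ s + 2 * k
        n≡′ = ℕ.suc-injective (ℕ.suc-injective (trans n≡ (two-more s k)))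
          where
          two-more : ∀ s k → s + 2 * suc k ≡ suc (suc (s + 2 * k))
          two-more = solve 2 (λ s k → s :+ con 2 :* (con 1 :+ k) := con 2 :+ (s :+ con 2 :* k)) refl
            where open +-*-Solver
        pairs-two : ∀ x → p x ≢ x → pairs (mark (p x) (mark x none)) ≡ 2 * k
        pairs-two x px≢x = ℕ.suc-injective (ℕ.suc-injective (trans
          (sym (trans (pairs-paired none refl px≢x) (cong suc (pairs-paired (mark x none) (partner-unvisited {none} x (λ _ → refl) refl px≢x) (partner-paired px≢x)))))
          (trans k≡ (ℕ.*-suc 2 k))))
        singles-two : ∀ x → p x ≢ x → singles (mark (p x) (mark x none)) ≡ s
        singles-two x px≢x = trans (sym (trans (singles-paired none px≢x) (singles-paired (mark x none) (partner-paired px≢x)))) s≡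
        mark₂ : mark (p (p y)) (mark (p y) none) ≡ vis₂
        mark₂ = cong (λ x → mark x (mark (p y) none)) (p-involutive y)
        count₂ : 2 * walksFrom vis₂ z m ≡ [ not (vis₂ z) ] * weight z * (2 ^ k * (s + k ∸ 1) !)
        count₂ = count-walksFrom m vis₂ s k z
          (subst Closed mark₂ (closed-pair {none} (p y) (λ _ → refl)))
          (subst (λ vis → singles vis ≡ s) mark₂ (singles-two (p y) (partner-paired py≢y)))
          (subst (λ vis → pairs vis ≡ 2 * k) mark₂ (pairs-two (p y) (partner-paired py≢y)))
          n≡′
        cases : (d : Dec (z ≡ p y)) →
          4 * ([ does d ] * walks vis₁ (suc m) + walksFrom vis₂ z m) ≡ (weight z + [ does d ] * suc (2 * b)) * (2 ^ suc k * b !)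
        cases (no z≢py) = begin
          4 * (0 + walksFrom vis₂ z m)
            ≡⟨ double (walksFrom vis₂ z m) ⟩
          2 * (2 * walksFrom vis₂ z m)
            ≡⟨ cong (2 *_) count₂ ⟩
          2 * ([ not (vis₂ z) ] * weight z * (2 ^ k * (s + k ∸ 1) !))
            ≡⟨ cong₂ (λ c t → 2 * ([ not c ] * weight z * (2 ^ k * t !))) (mark-false y (mark (p y) none) (mark-false (p y) none refl z≢py) (y≢z ∘ sym)) (cong (_∸ 1) s+k≡) ⟩
          2 * (1 * weight z * (2 ^ k * b !))
            ≡⟨ regroup (weight z) (2 ^ k) (b !) ⟩
          (weight z + 0) * (2 ^ suc k * b !) ∎
          where
          double : ∀ f → 4 * (0 + f) ≡ 2 * (2 * f)
          double = solve 1 (λ f → con 4 :* (con 0 :+ f) := con 2 :* (con 2 :* f)) refl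
            where open +-*-Solver
          regroup : ∀ w u v → 2 * (1 * w * (u * v)) ≡ (w + 0) * (2 * u * v)
          regroup = solve 3 (λ w u v → con 2 :* (con 1 :* w :* (u :* v)) := (w :+ con 0) :* (con 2 :* u :* v)) refl
            where open +-*-Solver
        cases (yes refl) = begin
          4 * (1 * walks vis₁ (suc m) + walksFrom vis₂ z m)
            ≡⟨ cong (λ t → 4 * (1 * walks vis₁ (suc m) + t)) (walksFrom-visited vis₂ z m (mark-true {y} {z} (mark (p y) none) (≡⇒mark {p y} {p y} none refl))) ⟩
          4 * (1 * walks vis₁ (suc m) + 0)
            ≡⟨ cong (λ t → 4 * (1 * t + 0)) (count-walks (suc m) vis₁ s k (closed-pair {none} y (λ _ → refl)) (singles-two y py≢y) (pairs-two y py≢y) n≡′) ⟩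
          4 * (1 * (2 ^ k * (s + k) !) + 0)
            ≡⟨ cong (λ t → 4 * (1 * (2 ^ k * t !) + 0)) s+k≡ ⟩
          4 * (1 * (2 ^ k * (suc b * b !)) + 0)
            ≡⟨ regroup b (2 ^ k) (b !) ⟩
          (1 + 1 * suc (2 * b)) * (2 ^ suc k * b !)
            ≡⟨ cong (λ c → (suc [ c ] + 1 * suc (2 * b)) * (2 ^ suc k * b !)) (dec-false (p z Fin.≟ z) (partner-paired py≢y)) ⟨
          (weight z + 1 * suc (2 * b)) * (2 ^ suc k * b !) ∎
          where
          regroup : ∀ b u v → 4 * (1 * (u * (suc b * v)) + 0) ≡ (1 + 1 * suc (2 * b)) * (2 * u * v)
          regroup = solve 3 (λ b u v → con 4 :* (con 1 :* (u :* ((con 1 :+ b) :* v)) :+ con 0) := (con 1 :+ con 1 :* (con 1 :+ con 2 :* b)) :* (con 2 :* u :* v)) refl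
            where open +-*-Solver

    count-steps : ∀ y z → y ≢ z → 4 * (first y z + ∑ λ x → second x y z) ≡ stepWeight y z * unit
    count-steps y z y≢z = cases (p y Fin.≟ y)
      where
      cases : (d : Dec (p y ≡ y)) → 4 * (first y z + ∑ λ x → second x y z)
        ≡ (suc [ does d ] * weight z + [ not (does d) ] * [ does (z Fin.≟ p y) ] * suc (2 * b)) * unit
      cases (yes py≡y) = trans (single-case y z y≢z py≡y s s≡ n≡ b≡) (cong (_* unit) (sym (ℕ.+-identityʳ (2 * weight z))))
      cases (no py≢y) = trans (paired-case y z y≢z py≢y k k≡ n≡ b≡)
        (cong₂ (λ t u → (t + u * suc (2 * b)) * unit) (sym (ℕ.*-identityˡ (weight z))) (sym (ℕ.*-identityˡ [ does (z Fin.≟ p y) ])))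

  module Casts (S : CommutativeSemiring 0ℓ 0ℓ) where
    open CommutativeSemiring S hiding (zero; refl; sym; trans)
    open Sums S
    open Algebra.Properties.Semiring.Mult semiring using (×-homo-+; ×1-homo-*) renaming (_×_ to _·_)
    open import Relation.Binary.Reasoning.Setoid setoid
    private module S = CommutativeSemiring S

    ι : ℕ → Carrier
    ι k = k · 1#

    ι-+ : ∀ j k → ι (j ℕ.+ k) ≈ ι j + ι k
    ι-+ = ×-homo-+ 1#

    ι-* : ∀ j k → ι (j ℕ.* k) ≈ ι j * ι k
    ι-* = ×1-homo-*

    ι-1 : ι 1 ≈ 1#
    ι-1 = +-identityʳ 1#

    ι-[] : ∀ c → [ c ] ≈ ι (ℕΣ.[ c ])
    ι-[] true  = S.sym ι-1
    ι-[] false = S.refl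

    ι-∑ : ∀ {n} (f : Fin n → ℕ) → ∑ (λ i → ι (f i)) ≈ ι (ℕΣ.∑ f)
    ι-∑ {zero}  f = S.trans (∑-zero _) (reflexive (cong ι (sym (ℕΣ.∑-zero f))))
    ι-∑ {suc n} f = begin
      ∑ (λ i → ι (f i))                          ≈⟨ ∑-suc _ ⟩
      ι (f zero) + ∑ (λ i → ι (f (suc i)))       ≈⟨ +-congˡ (ι-∑ (f ∘ suc)) ⟩
      ι (f zero) + ι (ℕΣ.∑ (f ∘ suc))            ≈⟨ ι-+ (f zero) _ ⟨
      ι (f zero ℕ.+ ℕΣ.∑ (f ∘ suc))              ≈⟨ reflexive (cong ι (ℕΣ.∑-suc f)) ⟨
      ι (ℕΣ.∑ f)                                 ∎

    ι-∑V : ∀ {n} m (f : Vec (Fin n) m → ℕ) → ∑V m (λ v → ι (f v)) ≈ ι (ℕΣ.∑V m f)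
    ι-∑V zero    f = S.refl
    ι-∑V (suc m) f = S.trans (∑-cong λ x → ι-∑V m (f ∘ (x ∷_))) (ι-∑ λ x → ℕΣ.∑V m (f ∘ (x ∷_)))

    ∑-const : ∀ n c → (∑ {n} λ _ → c) ≈ ι n * c
    ∑-const zero    c = S.trans (∑-zero _) (S.sym (zeroˡ c))
    ∑-const (suc n) c = begin
      (∑ {suc n} λ _ → c)   ≈⟨ ∑-suc _ ⟩
      c + (∑ {n} λ _ → c)   ≈⟨ +-cong (S.sym (*-identityˡ c)) (∑-const n c) ⟩
      1# * c + ι n * c      ≈⟨ distribʳ c 1# (ι n) ⟨
      ι (suc n) * c         ∎

    module _ {m : ℕ} (p : Fin (3 ℕ.+ m) → Fin (3 ℕ.+ m)) (p-involutive : ∀ v → p (p v) ≡ v) (s k b : ℕ)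
      (s≡ : Counting.singles p p-involutive none ≡ s) (k≡ : Counting.pairs p p-involutive none ≡ 2 ℕ.* k)
      (n≡ : 3 ℕ.+ m ≡ s ℕ.+ 2 ℕ.* k) (b≡ : s ℕ.+ k ≡ suc (suc b))
      (h : Fin (3 ℕ.+ m) → Fin (3 ℕ.+ m) → Carrier) (h-diagonal : ∀ x → h x x ≈ 0#) where
      private
        n : ℕ
        n = suc (suc (suc m))

      open Counting p p-involutive

      open Tours p p-involutive
      open TourCounts p p-involutive s k b s≡ k≡ n≡ b≡
      open Rotations S

      ∑V-count : ∀ j (c : Vec (Fin n) j → Bool) (x : Carrier) → ∑V j (λ v → [ c v ] * x) ≈ ι (ℕΣ.∑V j λ v → ℕΣ.[ c v ]) * x
      ∑V-count j c x = S.trans (∑V-*ʳ j x _) (*-congʳ (S.trans (∑V-cong j λ v → ι-[] (c v)) (ι-∑V j _)))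

      -- Early tours are walks already; late ones are replaced by walks one rotation back, at the
      -- price of a sum over the vertex `x` in front. The factor 4 is the common denominator of the
      -- step counts.
      ∑-first-step :
        ι 4 * (∑V n λ σ → [ does (contains? p σ) ] * h (Vec.lookup σ zero) (Vec.lookup σ (suc zero)))
        ≈ ι unit * (∑ λ y → ∑ λ z → ι (stepWeight y z) * h y z)
      ∑-first-step = begin
        ι 4 * (∑V n λ σ → [ does (contains? p σ) ] * h₀ σ)
          ≈⟨ *-congˡ (∑V-cong n λ σ → S.trans (*-congʳ (split-early (contains? p σ) (early? σ))) (distribʳ (h₀ σ) _ _)) ⟩
        ι 4 * (∑V n λ σ → [ does (contains? p σ ×-dec early? σ) ] * h₀ σ + late σ)
          ≈⟨ *-congˡ (∑V-+ n (λ σ → [ does (contains? p σ ×-dec early? σ) ] * h₀ σ) late) ⟩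
        ι 4 * ((∑V n λ σ → [ does (contains? p σ ×-dec early? σ) ] * h₀ σ) + ∑V n late)
          ≈⟨ *-congˡ (+-cong early-part late-part) ⟩
        ι 4 * ((∑ λ y → ∑ λ z → ι (first y z) * h y z) + (∑ λ y → ∑ λ z → ι (ℕΣ.∑ λ x → second x y z) * h y z))
          ≈⟨ *-congˡ (S.trans (S.sym (∑-+ _ _)) (∑-cong λ y → S.sym (∑-+ _ _))) ⟩
        ι 4 * (∑ λ y → ∑ λ z → ι (first y z) * h y z + ι (ℕΣ.∑ λ x → second x y z) * h y z)
          ≈⟨ S.trans (S.sym (∑-*ˡ (ι 4) _)) (∑-cong λ y → S.sym (∑-*ˡ (ι 4) _)) ⟩
        (∑ λ y → ∑ λ z → ι 4 * (ι (first y z) * h y z + ι (ℕΣ.∑ λ x → second x y z) * h y z))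
          ≈⟨ ∑-cong (λ y → ∑-cong λ z → combine y z) ⟩
        (∑ λ y → ∑ λ z → ι unit * (ι (stepWeight y z) * h y z))
          ≈⟨ S.trans (∑-cong λ y → ∑-*ˡ (ι unit) _) (∑-*ˡ (ι unit) _) ⟩
        ι unit * (∑ λ y → ∑ λ z → ι (stepWeight y z) * h y z) ∎
        where
        h₀ late : Vec (Fin n) n → Carrier
        h₀ σ = h (Vec.lookup σ zero) (Vec.lookup σ (suc zero))
        late σ = [ does (contains? p σ ×-dec ¬? (early? σ)) ] * h₀ σ

        split-early : ∀ {P Q : Set} (P? : Dec P) (Q? : Dec Q) → [ does P? ] ≈ [ does (P? ×-dec Q?) ] + [ does (P? ×-dec ¬? Q?) ]
        split-early (no _)  _       = S.sym (+-identityˡ 0#)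
        split-early (yes _) (yes _) = S.sym (+-identityʳ 1#)
        split-early (yes _) (no _)  = S.sym (+-identityˡ 1#)

        early-part : (∑V n λ σ → [ does (contains? p σ ×-dec early? σ) ] * h₀ σ) ≈ ∑ λ y → ∑ λ z → ι (first y z) * h y z
        early-part = begin
          (∑V n λ σ → [ does (contains? p σ ×-dec early? σ) ] * h₀ σ)
            ≈⟨ ∑V-cong n (λ σ → *-congʳ {h₀ σ} ([⇔] (contains? p σ ×-dec early? σ) (walk? none σ) (contains∧early⇔walk σ))) ⟩
          (∑V n λ σ → [ does (walk? none σ) ] * h₀ σ)
            ≈⟨ ∑-cong (λ y → ∑-cong λ z → ∑V-count (suc m) (λ v → does (walk? none (y ∷ z ∷ v))) (h y z)) ⟩
          (∑ λ y → ∑ λ z → ι (first y z) * h y z) ∎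

        late-part : ∑V n late ≈ ∑ λ y → ∑ λ z → ι (ℕΣ.∑ λ x → second x y z) * h y z
        late-part = begin
          ∑V n late
            ≈⟨ ∑V-rotate n late ⟨
          (∑V n λ σ → late (rotate σ))
            ≈⟨ ∑V-cong n (λ σ → *-congʳ {h₀ (rotate σ)} ([⇔] (contains? p (rotate σ) ×-dec ¬? (early? (rotate σ))) (walk? none σ ×-dec matchedStart? σ) (contains-rotated∧late⇔walk σ))) ⟩
          (∑V n λ σ → [ does (walk? none σ ×-dec matchedStart? σ) ] * h₀ (rotate σ))
            ≈⟨ ∑-cong (λ x → ∑-cong λ y → ∑-cong λ z → ∑V-count m (λ v → does (walk? none (x ∷ y ∷ z ∷ v)) ∧ not (single? x)) (h y z)) ⟩
          (∑ λ x → ∑ λ y → ∑ λ z → ι (second x y z) * h y z)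
            ≈⟨ S.trans (∑-swap _) (∑-cong λ y → ∑-swap _) ⟩
          (∑ λ y → ∑ λ z → ∑ λ x → ι (second x y z) * h y z)
            ≈⟨ ∑-cong (λ y → ∑-cong λ z → S.trans (∑-*ʳ (h y z) _) (*-congʳ (ι-∑ λ x → second x y z))) ⟩
          (∑ λ y → ∑ λ z → ι (ℕΣ.∑ λ x → second x y z) * h y z) ∎

        combine : ∀ y z → ι 4 * (ι (first y z) * h y z + ι (ℕΣ.∑ λ x → second x y z) * h y z) ≈ ι unit * (ι (stepWeight y z) * h y z)
        combine y z with y Fin.≟ z
        ... | yes refl = S.trans (*-congˡ (S.trans (+-cong (vanish _) (vanish _)) (+-identityˡ 0#)))
                           (S.trans (zeroʳ _) (S.sym (S.trans (*-congˡ (vanish _)) (zeroʳ _))))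
          where
          vanish : ∀ c → c * h y y ≈ 0#
          vanish c = S.trans (*-congˡ (h-diagonal y)) (zeroʳ c)
        ... | no y≢z = begin
          ι 4 * (ι (first y z) * h y z + ι sec * h y z)  ≈⟨ *-congˡ (distribʳ (h y z) _ _) ⟨
          ι 4 * ((ι (first y z) + ι sec) * h y z)        ≈⟨ *-congˡ (*-congʳ (ι-+ (first y z) sec)) ⟨
          ι 4 * (ι (first y z ℕ.+ sec) * h y z)          ≈⟨ *-assoc _ _ _ ⟨
          ι 4 * ι (first y z ℕ.+ sec) * h y z            ≈⟨ *-congʳ (ι-* 4 (first y z ℕ.+ sec)) ⟨
          ι (4 ℕ.* (first y z ℕ.+ sec)) * h y z          ≈⟨ *-congʳ (reflexive (cong ι (trans (count-steps y z y≢z) (ℕ.*-comm (stepWeight y z) unit)))) ⟩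
          ι (unit ℕ.* stepWeight y z) * h y z            ≈⟨ *-congʳ (ι-* unit (stepWeight y z)) ⟩
          ι unit * ι (stepWeight y z) * h y z            ≈⟨ *-assoc _ _ _ ⟩
          ι unit * (ι (stepWeight y z) * h y z)          ∎
          where sec = ℕΣ.∑ λ x → second x y z

      ∑-tours :
        ι 4 * (∑V n λ σ → [ does (contains? p σ) ] * ∑ λ t → h (Vec.lookup σ t) (Vec.lookup σ (next t)))
        ≈ ι (n ℕ.* unit) * (∑ λ y → ∑ λ z → ι (stepWeight y z) * h y z)
      ∑-tours = begin
        ι 4 * (∑V n λ σ → [ does (contains? p σ) ] * ∑ λ t → h (Vec.lookup σ t) (Vec.lookup σ (next t)))
          ≈⟨ *-congˡ (S.trans (∑-steps p h) (∑-const n first-step)) ⟩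
        ι 4 * (ι n * first-step)
          ≈⟨ *-swap (ι 4) (ι n) first-step ⟩
        ι n * (ι 4 * first-step)
          ≈⟨ *-congˡ ∑-first-step ⟩
        ι n * (ι unit * (∑ λ y → ∑ λ z → ι (stepWeight y z) * h y z))
          ≈⟨ *-assoc _ _ _ ⟨
        ι n * ι unit * (∑ λ y → ∑ λ z → ι (stepWeight y z) * h y z)
          ≈⟨ *-congʳ (ι-* n unit) ⟨
        ι (n ℕ.* unit) * (∑ λ y → ∑ λ z → ι (stepWeight y z) * h y z) ∎
        where
        first-step = ∑V n λ σ → [ does (contains? p σ) ] * h (Vec.lookup σ zero) (Vec.lookup σ (suc zero))

-- Selections of k pairs among the alternate steps.

module PairSelections where

  open import Data.Bool using (Bool; true; false; not; if_then_else_)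
  import Data.Bool.Properties as Bool
  open import Data.Fin as Fin using (Fin; zero; suc; toℕ)
  import Data.Fin.Properties as Fin
  open import Data.List as List using (List; []; _∷_; _++_)
  open import Data.List.Membership.Propositional using (_∈_)
  open import Data.List.Membership.Propositional.Properties using (∈-map⁻; ∈-++⁻)
  open import Data.List.Relation.Unary.Any using (here)
  open import Data.Nat as ℕ using (ℕ; zero; suc; _+_; _*_; ⌊_/2⌋)
  import Data.Nat.Properties as ℕ
  open import Data.Nat.Solver using (module +-*-Solver)
  open import Data.Product using (_×_; _,_)
  open import Data.Sum as Sum using (_⊎_; inj₁; inj₂)
  open import Data.Vec as Vec using (Vec; []; _∷_)
  open import Function using (_∘_)
  open import Relation.Binary.PropositionalEquality as ≡ using (_≡_; _≢_; refl; sym; trans; cong; cong₂)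
  open import Relation.Nullary using (Dec; does; yes; no)
  open import Relation.Nullary.Negation using (contradiction)
  open FiniteSums
  open Sums ℕ.+-*-commutativeSemiring
  open ≡.≡-Reasoning

  fin+2 : ∀ {n} → Fin n → Fin (suc (suc n))
  fin+2 i = suc (suc i)

  ℕ+2 : ℕ → ℕ
  ℕ+2 k = suc (suc k)

  choose : ∀ K → ℕ → List (Vec Bool K)
  choose zero    zero    = [] ∷ []
  choose zero    (suc k) = []
  choose (suc K) zero    = List.map (false ∷_) (choose K zero)
  choose (suc K) (suc k) = List.map (false ∷_) (choose K (suc k)) ++ List.map (true ∷_) (choose K k)

  -- With the value 0 in place of `f` at -1, Pascal's rule holds at `k` equal to 0 as well, and no
  -- case distinction on `k` is needed in its uses.
  shift : (ℕ → ℕ) → ℕ → ℕ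
  shift f zero    = 0
  shift f (suc k) = f k

  shift-cong : ∀ {f g} → (∀ k → f k ≡ g k) → ∀ k → shift f k ≡ shift g k
  shift-cong f≗g zero    = refl
  shift-cong f≗g (suc k) = f≗g k

  ∑-choose-suc : ∀ K k (F : Vec Bool (suc K) → ℕ) →
    ∑L (choose (suc K) k) F ≡ ∑L (choose K k) (λ bs → F (false ∷ bs)) + shift (λ k → ∑L (choose K k) λ bs → F (true ∷ bs)) k
  ∑-choose-suc K zero    F = trans (∑L-map (false ∷_) (choose K zero) F) (sym (ℕ.+-identityʳ _))
  ∑-choose-suc K (suc k) F = trans (∑L-++ (List.map (false ∷_) (choose K (suc k))) (List.map (true ∷_) (choose K k)) F)
    (cong₂ _+_ (∑L-map (false ∷_) (choose K (suc k)) F) (∑L-map (true ∷_) (choose K k) F))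

  binomial : ℕ → ℕ → ℕ
  binomial K k = ∑L (choose K k) λ _ → 1

  binomial-suc : ∀ K k → binomial (suc K) k ≡ binomial K k + shift (binomial K) k
  binomial-suc K k = ∑-choose-suc K k λ _ → 1

  -- The vertices 2i and 2i + 1 form the i-th pair; swapPairs exchanges the
  -- elements of the selected pairs, and an odd last vertex is left over.
  swapPairs : ∀ n → Vec Bool ⌊ n /2⌋ → Fin n → Fin n
  swapPairs (suc zero)    bs       i             = i
  swapPairs (suc (suc n)) (c ∷ bs) zero          = if c then suc zero else zero
  swapPairs (suc (suc n)) (c ∷ bs) (suc zero)    = if c then zero else suc zero
  swapPairs (suc (suc n)) (c ∷ bs) (suc (suc i)) = suc (suc (swapPairs n bs i))

  allPairs : ∀ n → Vec Bool ⌊ n /2⌋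
  allPairs n = Vec.replicate ⌊ n /2⌋ true

  partner : ∀ {n} → Fin n → Fin n
  partner {n} = swapPairs n (allPairs n)

  uncovered : ∀ n → Vec Bool ⌊ n /2⌋ → Fin n → Bool
  uncovered (suc zero)    bs       i             = true
  uncovered (suc (suc n)) (c ∷ bs) zero          = not c
  uncovered (suc (suc n)) (c ∷ bs) (suc zero)    = not c
  uncovered (suc (suc n)) (c ∷ bs) (suc (suc i)) = uncovered n bs i

  leftover : ∀ {n} → Fin n → Bool
  leftover {suc zero}    i             = true
  leftover {suc (suc n)} zero          = false
  leftover {suc (suc n)} (suc zero)    = false
  leftover {suc (suc n)} (suc (suc i)) = leftover i

  samePair : ∀ {n} → Fin n → Fin n → Bool
  samePair {suc zero}    i             j             = true
  samePair {suc (suc n)} (suc (suc i)) (suc (suc j)) = samePair i j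
  samePair {suc (suc n)} (suc (suc i)) j             = false
  samePair {suc (suc n)} i             (suc (suc j)) = false
  samePair {suc (suc n)} i             j             = true

  swapPairs-involutive : ∀ n bs i → swapPairs n bs (swapPairs n bs i) ≡ i
  swapPairs-involutive (suc zero)    bs           i             = refl
  swapPairs-involutive (suc (suc n)) (true  ∷ bs) zero          = refl
  swapPairs-involutive (suc (suc n)) (false ∷ bs) zero          = refl
  swapPairs-involutive (suc (suc n)) (true  ∷ bs) (suc zero)    = refl
  swapPairs-involutive (suc (suc n)) (false ∷ bs) (suc zero)    = refl
  swapPairs-involutive (suc (suc n)) (c ∷ bs)     (suc (suc i)) = cong fin+2 (swapPairs-involutive n bs i)

  swapPairs-fixed : ∀ n bs i → does (swapPairs n bs i Fin.≟ i) ≡ uncovered n bs i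
  swapPairs-fixed (suc zero)    bs           zero          = refl
  swapPairs-fixed (suc (suc n)) (true  ∷ bs) zero          = refl
  swapPairs-fixed (suc (suc n)) (false ∷ bs) zero          = refl
  swapPairs-fixed (suc (suc n)) (true  ∷ bs) (suc zero)    = refl
  swapPairs-fixed (suc (suc n)) (false ∷ bs) (suc zero)    = refl
  swapPairs-fixed (suc (suc n)) (c ∷ bs)     (suc (suc i)) = swapPairs-fixed n bs i

  covered⇒partner : ∀ n bs i → uncovered n bs i ≡ false → swapPairs n bs i ≡ partner i
  covered⇒partner (suc zero)    bs           i             ()
  covered⇒partner (suc (suc n)) (true  ∷ bs) zero          _ = refl
  covered⇒partner (suc (suc n)) (true  ∷ bs) (suc zero)    _ = refl
  covered⇒partner (suc (suc n)) (c ∷ bs)     (suc (suc i)) e = cong fin+2 (covered⇒partner n bs i e)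

  uncovered-partner : ∀ n bs i → uncovered n bs (partner i) ≡ uncovered n bs i
  uncovered-partner (suc zero)    bs       zero          = refl
  uncovered-partner (suc (suc n)) (c ∷ bs) zero          = refl
  uncovered-partner (suc (suc n)) (c ∷ bs) (suc zero)    = refl
  uncovered-partner (suc (suc n)) (c ∷ bs) (suc (suc i)) = uncovered-partner n bs i

  leftover-partner : ∀ {n} (i : Fin n) → leftover i ≡ true → partner i ≡ i
  leftover-partner {suc zero}    i             _ = refl
  leftover-partner {suc (suc n)} (suc (suc i)) e = cong fin+2 (leftover-partner i e)

  partner-adjacent : ∀ {n} (i : Fin n) → leftover i ≡ false →
    toℕ (partner i) ≡ suc (toℕ i) ⊎ toℕ i ≡ suc (toℕ (partner i))
  partner-adjacent {suc (suc n)} zero          _ = inj₁ refl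
  partner-adjacent {suc (suc n)} (suc zero)    _ = inj₂ refl
  partner-adjacent {suc (suc n)} (suc (suc i)) e = Sum.map (cong ℕ+2) (cong ℕ+2) (partner-adjacent i e)

  ∑-two : ∀ {n} (f : Fin (suc (suc n)) → ℕ) → ∑ f ≡ f zero + (f (suc zero) + ∑ (λ i → f (suc (suc i))))
  ∑-two f = trans (∑-suc f) (cong (f zero +_) (∑-suc (f ∘ suc)))

  ∑-one : ∀ (f : Fin 1 → ℕ) → ∑ f ≡ f zero
  ∑-one f = trans (∑-suc f) (trans (cong (f zero +_) (∑-zero (f ∘ suc))) (ℕ.+-identityʳ _))

  count-leftover : ∀ n → 2 * ⌊ n /2⌋ + ∑ (λ (i : Fin n) → [ leftover i ]) ≡ n
  count-leftover zero          = ∑-zero _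
  count-leftover (suc zero)    = ∑-one _
  count-leftover (suc (suc n)) = begin
    2 * suc ⌊ n /2⌋ + ∑ (λ (i : Fin (suc (suc n))) → [ leftover i ])   ≡⟨ cong₂ _+_ (ℕ.*-suc 2 ⌊ n /2⌋) (∑-two _) ⟩
    suc (suc (2 * ⌊ n /2⌋ + ∑ (λ (i : Fin n) → [ leftover i ])))       ≡⟨ cong ℕ+2 (count-leftover n) ⟩
    suc (suc n)                                                        ∎

  count-not-leftover : ∀ n → ∑ (λ (i : Fin n) → [ not (leftover i) ]) ≡ 2 * ⌊ n /2⌋
  count-not-leftover zero          = ∑-zero _
  count-not-leftover (suc zero)    = ∑-one _
  count-not-leftover (suc (suc n)) = trans (∑-two _) (trans (cong ℕ+2 (count-not-leftover n)) (sym (ℕ.*-suc 2 ⌊ n /2⌋)))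

  count-uncovered : ∀ n k {bs} → bs ∈ choose ⌊ n /2⌋ k → ∑ (λ i → [ uncovered n bs i ]) + 2 * k ≡ n
  count-uncovered zero       zero    (here refl) = trans (ℕ.+-identityʳ _) (∑-zero _)
  count-uncovered (suc zero) zero    (here refl) = trans (ℕ.+-identityʳ _) (∑-one _)
  count-uncovered (suc (suc n)) zero bs∈ with ∈-map⁻ (false ∷_) bs∈
  ... | bs , bs∈′ , refl = trans (cong (_+ 0) (∑-two _)) (cong ℕ+2 (count-uncovered n zero bs∈′))
  count-uncovered (suc (suc n)) (suc k) bs∈ with ∈-++⁻ (List.map (false ∷_) (choose ⌊ n /2⌋ (suc k))) bs∈
  ... | inj₁ bs∈₁ with ∈-map⁻ (false ∷_) bs∈₁
  ... | bs , bs∈′ , refl = trans (cong (_+ 2 * suc k) (∑-two _)) (cong ℕ+2 (count-uncovered n (suc k) bs∈′))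
  count-uncovered (suc (suc n)) (suc k) bs∈ | inj₂ bs∈₂ with ∈-map⁻ (true ∷_) bs∈₂
  ... | bs , bs∈′ , refl = trans (cong₂ _+_ (∑-two (λ i → [ uncovered (suc (suc n)) (true ∷ bs) i ])) (ℕ.*-suc 2 k)) (trans (two-more (∑ (λ i → [ uncovered n bs i ])) (2 * k)) (cong ℕ+2 (count-uncovered n k bs∈′)))
    where
    two-more : ∀ a b → a + suc (suc b) ≡ suc (suc (a + b))
    two-more a b = trans (ℕ.+-suc a (suc b)) (cong suc (ℕ.+-suc a b))

  count-covered : ∀ n k {bs} → bs ∈ choose ⌊ n /2⌋ k → ∑ (λ i → [ not (uncovered n bs i) ]) ≡ 2 * k
  count-covered n k {bs} bs∈ = ℕ.+-cancelˡ-≡ (∑ λ i → [ uncovered n bs i ]) _ _ (begin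
    ∑ (λ i → [ uncovered n bs i ]) + ∑ (λ i → [ not (uncovered n bs i) ])   ≡⟨ ∑-+ _ _ ⟨
    ∑ (λ i → [ uncovered n bs i ] + [ not (uncovered n bs i) ])             ≡⟨ ∑-cong (λ i → complement (uncovered n bs i)) ⟩
    ∑ {n} (λ _ → 1)                                                         ≡⟨ ones n ⟩
    n                                                                       ≡⟨ count-uncovered n k bs∈ ⟨
    ∑ (λ i → [ uncovered n bs i ]) + 2 * k                                  ∎)
    where
    complement : ∀ c → [ c ] + [ not c ] ≡ 1
    complement true  = refl
    complement false = refl
    ones : ∀ n → ∑ {n} (λ _ → 1) ≡ n
    ones zero    = ∑-zero _
    ones (suc n) = trans (∑-suc _) (cong suc (ones n))

  ∑uncovered : ∀ n → ℕ → Fin n → ℕ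
  ∑uncovered n k i = ∑L (choose ⌊ n /2⌋ k) λ bs → [ uncovered n bs i ]

  ∑uncovered² : ∀ n → ℕ → Fin n → Fin n → ℕ
  ∑uncovered² n k i j = ∑L (choose ⌊ n /2⌋ k) λ bs → [ uncovered n bs i ] * [ uncovered n bs j ]

  leftover-uncovered : ∀ n bs i → leftover i ≡ true → uncovered n bs i ≡ true
  leftover-uncovered (suc zero)    bs       i             _ = refl
  leftover-uncovered (suc (suc n)) (c ∷ bs) (suc (suc i)) e = leftover-uncovered n bs i e

  ∑uncovered-leftover : ∀ n k i → leftover i ≡ true → ∑uncovered n k i ≡ binomial ⌊ n /2⌋ k
  ∑uncovered-leftover n k i left = ∑L-cong (choose ⌊ n /2⌋ k) λ {bs} _ → cong [_] (leftover-uncovered n bs i left)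

  0-sum : ∀ K k → ∑L (choose K k) (λ _ → 0) ≡ 0
  0-sum K k = ∑L-0 (choose K k) λ _ → refl

  shift-0 : ∀ {f} → (∀ k → f k ≡ 0) → ∀ k → shift f k ≡ 0
  shift-0 f≡0 zero    = refl
  shift-0 f≡0 (suc k) = f≡0 k

  head-uncovered : ∀ n k → ∑L (choose (suc ⌊ n /2⌋) k) (λ bs → [ not (Vec.head bs) ]) ≡ binomial ⌊ n /2⌋ k
  head-uncovered n k = trans (∑-choose-suc ⌊ n /2⌋ k _)
    (trans (cong (binomial ⌊ n /2⌋ k +_) (shift-0 (0-sum ⌊ n /2⌋) k)) (ℕ.+-identityʳ _))

  -- For the front pair this is conditioning on the first bit. For any other pair the induction
  -- hypothesis gives the same two binomials whatever the position, and Pascal's rule adds them up.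
  ∑uncovered-pair : ∀ n k (i : Fin (suc (suc n))) → leftover i ≡ false → ∑uncovered (suc (suc n)) k i ≡ binomial ⌊ n /2⌋ k
  ∑uncovered-pair n k zero       _ = trans (∑L-cong (choose (suc ⌊ n /2⌋) k) λ { {c ∷ bs} _ → refl }) (head-uncovered n k)
  ∑uncovered-pair n k (suc zero) _ = trans (∑L-cong (choose (suc ⌊ n /2⌋) k) λ { {c ∷ bs} _ → refl }) (head-uncovered n k)
  ∑uncovered-pair (suc (suc n)) k (suc (suc i)) e = begin
    ∑uncovered (suc (suc (suc (suc n)))) k (suc (suc i))
      ≡⟨ ∑-choose-suc (suc ⌊ n /2⌋) k _ ⟩
    ∑uncovered (suc (suc n)) k i + shift (λ k → ∑uncovered (suc (suc n)) k i) k
      ≡⟨ cong₂ _+_ (∑uncovered-pair n k i e) (shift-cong (λ k → ∑uncovered-pair n k i e) k) ⟩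
    binomial ⌊ n /2⌋ k + shift (binomial ⌊ n /2⌋) k
      ≡⟨ binomial-suc ⌊ n /2⌋ k ⟨
    binomial (suc ⌊ n /2⌋) k ∎
  ∑uncovered-pair (suc zero) k (suc (suc zero)) ()

  ∑uncovered²-front : ∀ n k j → leftover j ≡ false →
    ∑L (choose (suc (suc ⌊ n /2⌋)) k) (λ bs → [ uncovered (suc (suc (suc (suc n)))) bs zero ] * [ uncovered (suc (suc (suc (suc n)))) bs (suc (suc j)) ]) ≡ binomial ⌊ n /2⌋ k
  ∑uncovered²-front n k j e = begin
    ∑L (choose (suc (suc ⌊ n /2⌋)) k) (λ bs → [ uncovered (suc (suc (suc (suc n)))) bs zero ] * [ uncovered (suc (suc (suc (suc n)))) bs (suc (suc j)) ])
      ≡⟨ ∑-choose-suc (suc ⌊ n /2⌋) k _ ⟩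
    ∑L (choose (suc ⌊ n /2⌋) k) (λ bs → 1 * [ uncovered (suc (suc n)) bs j ]) + shift (λ k → ∑L (choose (suc ⌊ n /2⌋) k) λ bs → 0) k
      ≡⟨ cong₂ _+_ (∑L-cong (choose (suc ⌊ n /2⌋) k) λ _ → ℕ.*-identityˡ _) (shift-0 (0-sum (suc ⌊ n /2⌋)) k) ⟩
    ∑uncovered (suc (suc n)) k j + 0
      ≡⟨ ℕ.+-identityʳ _ ⟩
    ∑uncovered (suc (suc n)) k j
      ≡⟨ ∑uncovered-pair n k j e ⟩
    binomial ⌊ n /2⌋ k ∎

  ∑uncovered²-distinct : ∀ n k (i j : Fin (suc (suc (suc (suc n))))) → samePair i j ≡ false → leftover i ≡ false → leftover j ≡ false →
    ∑uncovered² (suc (suc (suc (suc n)))) k i j ≡ binomial ⌊ n /2⌋ k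
  ∑uncovered²-distinct n k zero zero () _ _
  ∑uncovered²-distinct n k zero (suc zero) () _ _
  ∑uncovered²-distinct n k (suc zero) zero () _ _
  ∑uncovered²-distinct n k (suc zero) (suc zero) () _ _
  ∑uncovered²-distinct n k zero (suc (suc j)) _ _ e = ∑uncovered²-front n k j e
  ∑uncovered²-distinct n k (suc zero) (suc (suc j)) _ _ e =
    trans (∑L-cong (choose (suc (suc ⌊ n /2⌋)) k) λ { {c ∷ bs} _ → refl }) (∑uncovered²-front n k j e)
  ∑uncovered²-distinct n k (suc (suc i)) zero s e e′ =
    trans (∑L-cong (choose (suc (suc ⌊ n /2⌋)) k) λ {bs} _ → ℕ.*-comm [ uncovered _ bs (suc (suc i)) ] [ uncovered _ bs zero ]) (∑uncovered²-front n k i e)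
  ∑uncovered²-distinct n k (suc (suc i)) (suc zero) s e e′ =
    trans (∑L-cong (choose (suc (suc ⌊ n /2⌋)) k) λ { {c ∷ bs} _ → ℕ.*-comm [ uncovered _ bs i ] [ not c ] }) (∑uncovered²-front n k i e)
  ∑uncovered²-distinct (suc (suc n)) k (suc (suc i)) (suc (suc j)) s e e′ = begin
    ∑uncovered² (suc (suc (suc (suc (suc (suc n)))))) k (suc (suc i)) (suc (suc j))
      ≡⟨ ∑-choose-suc (suc (suc ⌊ n /2⌋)) k _ ⟩
    ∑uncovered² (suc (suc (suc (suc n)))) k i j + shift (λ k → ∑uncovered² (suc (suc (suc (suc n)))) k i j) k
      ≡⟨ cong₂ _+_ (∑uncovered²-distinct n k i j s e e′) (shift-cong (λ k → ∑uncovered²-distinct n k i j s e e′) k) ⟩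
    binomial ⌊ n /2⌋ k + shift (binomial ⌊ n /2⌋) k
      ≡⟨ binomial-suc ⌊ n /2⌋ k ⟨
    binomial (suc ⌊ n /2⌋) k ∎
  -- Only two pairs exist here, so two positions behind the first pair share the second pair or
  -- include the leftover vertex.
  ∑uncovered²-distinct zero k (suc (suc zero)) (suc (suc zero)) ()
  ∑uncovered²-distinct zero k (suc (suc zero)) (suc (suc (suc zero))) ()
  ∑uncovered²-distinct zero k (suc (suc (suc zero))) (suc (suc zero)) ()
  ∑uncovered²-distinct zero k (suc (suc (suc zero))) (suc (suc (suc zero))) ()
  ∑uncovered²-distinct (suc zero) k (suc (suc zero)) (suc (suc zero)) ()
  ∑uncovered²-distinct (suc zero) k (suc (suc zero)) (suc (suc (suc zero))) ()
  ∑uncovered²-distinct (suc zero) k (suc (suc (suc zero))) (suc (suc zero)) ()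
  ∑uncovered²-distinct (suc zero) k (suc (suc (suc zero))) (suc (suc (suc zero))) ()
  ∑uncovered²-distinct (suc zero) k (suc (suc (suc (suc zero)))) j s ()
  ∑uncovered²-distinct (suc zero) k (suc (suc i)) (suc (suc (suc (suc zero)))) s e ()

  samePair⇒ : ∀ {n} (i j : Fin n) → samePair i j ≡ true → i ≢ j → j ≡ partner i × leftover i ≡ false × leftover j ≡ false
  samePair⇒ {suc zero}    zero          zero          _ i≢j = contradiction refl i≢j
  samePair⇒ {suc (suc n)} zero          zero          _ i≢j = contradiction refl i≢j
  samePair⇒ {suc (suc n)} zero          (suc zero)    _ i≢j = refl , refl , refl
  samePair⇒ {suc (suc n)} (suc zero)    zero          _ i≢j = refl , refl , refl
  samePair⇒ {suc (suc n)} (suc zero)    (suc zero)    _ i≢j = contradiction refl i≢j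
  samePair⇒ {suc (suc n)} (suc (suc i)) (suc (suc j)) s i≢j =
    let eq , l , l′ = samePair⇒ i j s (i≢j ∘ cong fin+2) in cong fin+2 eq , l , l′

  ¬samePair⇒ : ∀ {n} (i j : Fin n) → samePair i j ≡ false → j ≢ partner i
  ¬samePair⇒ {suc (suc n)} zero          (suc (suc j)) _ ()
  ¬samePair⇒ {suc (suc n)} (suc zero)    (suc (suc j)) _ ()
  ¬samePair⇒ {suc (suc n)} (suc (suc i)) zero          _ ()
  ¬samePair⇒ {suc (suc n)} (suc (suc i)) (suc zero)    _ ()
  ¬samePair⇒ {suc (suc n)} (suc (suc i)) (suc (suc j)) s eq = ¬samePair⇒ i j s (Fin.suc-injective (Fin.suc-injective eq))

  leftover-unique : ∀ {n} (i j : Fin n) → leftover i ≡ true → leftover j ≡ true → i ≡ j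
  leftover-unique {suc zero}    zero          zero          _ _ = refl
  leftover-unique {suc (suc n)} (suc (suc i)) (suc (suc j)) e e′ = cong fin+2 (leftover-unique i j e e′)

  module _ (n k : ℕ) where
    private
      N K : ℕ
      N = suc (suc (suc (suc n)))
      K = ⌊ N /2⌋

    -- With K pairs in all, these are the binomials of K - 2 over k, k - 1 and k - 2: the selections
    -- that contain none of two given pairs, a prescribed one of them only, or both.
    neither one both : ℕ
    neither = binomial ⌊ n /2⌋ k
    one     = shift (binomial ⌊ n /2⌋) k
    both    = shift (shift (binomial ⌊ n /2⌋)) k

    private
      B₁ : ℕ
      B₁ = binomial (suc ⌊ n /2⌋) k

      B₁≡ : B₁ ≡ neither + one
      B₁≡ = binomial-suc ⌊ n /2⌋ k

      shift-B₁ : ∀ k → shift (binomial (suc ⌊ n /2⌋)) k ≡ shift (binomial ⌊ n /2⌋) k + shift (shift (binomial ⌊ n /2⌋)) k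
      shift-B₁ zero    = refl
      shift-B₁ (suc k) = binomial-suc ⌊ n /2⌋ k

      B₀≡ : binomial K k ≡ B₁ + (one + both)
      B₀≡ = trans (binomial-suc (suc ⌊ n /2⌋) k) (cong (B₁ +_) (shift-B₁ k))

    binomial-split : binomial K k ≡ neither + 2 * one + both
    binomial-split = trans B₀≡ (trans (cong (_+ (one + both)) B₁≡)
      (solve 3 (λ c₀ c₁ c₂ → (c₀ :+ c₁) :+ (c₁ :+ c₂) := c₀ :+ con 2 :* c₁ :+ c₂) refl neither one both))
      where open +-*-Solver

    ∑covered : ∀ i → leftover i ≡ false → ∑L (choose K k) (λ bs → [ not (uncovered N bs i) ]) ≡ one + both
    ∑covered i e = ℕ.+-cancelˡ-≡ B₁ _ _ (begin
      B₁ + ∑L (choose K k) (λ bs → [ not (uncovered N bs i) ])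
        ≡⟨ cong (_+ ∑L (choose K k) (λ bs → [ not (uncovered N bs i) ])) (∑uncovered-pair (suc (suc n)) k i e) ⟨
      ∑L (choose K k) (λ bs → [ uncovered N bs i ]) + ∑L (choose K k) (λ bs → [ not (uncovered N bs i) ])
        ≡⟨ ∑L-+ (choose K k) _ _ ⟨
      ∑L (choose K k) (λ bs → [ uncovered N bs i ] + [ not (uncovered N bs i) ])
        ≡⟨ ∑L-cong (choose K k) (λ {bs} _ → complement (uncovered N bs i)) ⟩
      binomial K k
        ≡⟨ B₀≡ ⟩
      B₁ + (one + both) ∎)
      where
      complement : ∀ c → [ c ] + [ not c ] ≡ 1
      complement true  = refl
      complement false = refl

    module _ (b : ℕ) where

      pairWeight : Vec Bool K → Fin N → Fin N → ℕ
      pairWeight bs i j = suc [ uncovered N bs i ] * suc [ uncovered N bs j ]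
        + [ not (uncovered N bs i) ] * [ does (j Fin.≟ partner i) ] * suc (2 * b)

      -- Positions in different pairs weigh 2·2 if both are uncovered, 2·1 if one is (in two ways),
      -- 1·1 if none is. For partners, `neither` and `one` selections leave the pair uncovered
      -- (weight 4), while `one` and `both` cover it (weight 2b + 2). A leftover position always
      -- counts 2. The extras are the differences from the generic value.
      generic extraPartner extraLeftover : ℕ
      generic       = 4 * neither + 4 * one + both
      extraPartner  = one + (one + both) * suc (2 * b)
      extraLeftover = 2 * one + both

      private
        S₁ : Fin N → ℕ
        S₁ = ∑uncovered N k

        S₂ : Fin N → Fin N → ℕ
        S₂ = ∑uncovered² N k

        expand : ∀ i j → ∑L (choose K k) (λ bs → pairWeight bs i j) ≡
          (binomial K k + S₁ i + S₁ j + S₂ i j)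
          + ∑L (choose K k) (λ bs → [ not (uncovered N bs i) ]) * ([ does (j Fin.≟ partner i) ] * suc (2 * b))
        expand i j = begin
          ∑L (choose K k) (λ bs → pairWeight bs i j)
            ≡⟨ ∑L-cong (choose K k) (λ {bs} _ → cong₂ _+_ (product [ uncovered N bs i ] [ uncovered N bs j ]) (ℕ.*-assoc [ not (uncovered N bs i) ] _ _)) ⟩
          ∑L (choose K k) (λ bs → 1 + [ uncovered N bs i ] + [ uncovered N bs j ] + [ uncovered N bs i ] * [ uncovered N bs j ]
            + [ not (uncovered N bs i) ] * ([ does (j Fin.≟ partner i) ] * suc (2 * b)))
            ≡⟨ trans (∑L-+ (choose K k) _ _) (cong₂ _+_
                 (trans (∑L-+ (choose K k) _ _) (cong (_+ S₂ i j) (trans (∑L-+ (choose K k) _ _) (cong (_+ S₁ j) (∑L-+ (choose K k) _ _)))))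
                 (∑L-*ʳ ([ does (j Fin.≟ partner i) ] * suc (2 * b)) (choose K k) _)) ⟩
          (binomial K k + S₁ i + S₁ j + S₂ i j)
            + ∑L (choose K k) (λ bs → [ not (uncovered N bs i) ]) * ([ does (j Fin.≟ partner i) ] * suc (2 * b)) ∎
          where
          product : ∀ x y → suc x * suc y ≡ 1 + x + y + x * y
          product = solve 2 (λ x y → (con 1 :+ x) :* (con 1 :+ y) := con 1 :+ x :+ y :+ x :* y) refl
            where open +-*-Solver

      ∑-pairWeight : ∀ i j → i ≢ j → ∑L (choose K k) (λ bs → pairWeight bs i j) ≡
        generic + [ does (j Fin.≟ partner i) ] * extraPartner + ([ leftover i ] + [ leftover j ]) * extraLeftover
      ∑-pairWeight i j i≢j = trans (expand i j) (cases (samePair i j) refl (leftover i) refl (leftover j) refl (j Fin.≟ partner i))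
        where
        open +-*-Solver
        M = ∑L (choose K k) λ bs → [ not (uncovered N bs i) ]
        cases : ∀ s → samePair i j ≡ s → ∀ l → leftover i ≡ l → ∀ l′ → leftover j ≡ l′ → (d : Dec (j ≡ partner i)) →
          (binomial K k + S₁ i + S₁ j + S₂ i j) + M * ([ does d ] * suc (2 * b))
          ≡ generic + [ does d ] * extraPartner + ([ l ] + [ l′ ]) * extraLeftover
        cases true s l el l′ el′ d with samePair⇒ i j s i≢j
        cases true s l el l′ el′ (no j≢) | eq , _ , _ = contradiction eq j≢
        cases true s false el false el′ (yes _) | eq , _ , _ = begin
          (binomial K k + S₁ i + S₁ j + S₂ i j) + M * (1 * suc (2 * b))
            ≡⟨ cong₂ _+_ (cong₂ _+_ (cong₂ _+_ (cong₂ _+_ B₀≡ (S₁≡ i el)) (S₁≡ j el′)) S₂≡) (cong (_* (1 * suc (2 * b))) (∑covered i el)) ⟩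
          (B₁ + (one + both) + B₁ + B₁ + B₁) + (one + both) * (1 * suc (2 * b))
            ≡⟨ cong (λ B → (B + (one + both) + B + B + B) + (one + both) * (1 * suc (2 * b))) B₁≡ ⟩
          ((neither + one) + (one + both) + (neither + one) + (neither + one) + (neither + one)) + (one + both) * (1 * suc (2 * b))
            ≡⟨ solve 4 (λ c₀ c₁ c₂ b → ((c₀ :+ c₁) :+ (c₁ :+ c₂) :+ (c₀ :+ c₁) :+ (c₀ :+ c₁) :+ (c₀ :+ c₁)) :+ (c₁ :+ c₂) :* (con 1 :* (con 1 :+ con 2 :* b))
                 := con 4 :* c₀ :+ con 4 :* c₁ :+ c₂ :+ con 1 :* (c₁ :+ (c₁ :+ c₂) :* (con 1 :+ con 2 :* b)) :+ (con 0 :+ con 0) :* (con 2 :* c₁ :+ c₂)) refl neither one both b ⟩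
          generic + 1 * extraPartner + (0 + 0) * extraLeftover ∎
          where
          S₁≡ : ∀ i → leftover i ≡ false → S₁ i ≡ B₁
          S₁≡ = ∑uncovered-pair (suc (suc n)) k
          idem : ∀ c → [ c ] * [ c ] ≡ [ c ]
          idem true  = refl
          idem false = refl
          S₂≡ : S₂ i j ≡ B₁
          S₂≡ = trans (∑L-cong (choose K k) λ {bs} _ → trans
              (cong (λ c → [ uncovered N bs i ] * [ c ]) (trans (cong (uncovered N bs) eq) (uncovered-partner N bs i)))
              (idem (uncovered N bs i)))
            (S₁≡ i el)
        cases true s true el l′ el′ (yes _) | _ , el₂ , _ = contradiction (trans (sym el) el₂) λ ()
        cases true s false el true el′ (yes _) | _ , _ , el₂ = contradiction (trans (sym el′) el₂) λ ()
        cases false s l el l′ el′ (yes eq) = contradiction eq (¬samePair⇒ i j s)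
        cases false s true el true el′ (no _) = contradiction (leftover-unique i j el el′) i≢j
        cases false s true el false el′ (no _) = begin
          (binomial K k + S₁ i + S₁ j + S₂ i j) + M * 0
            ≡⟨ cong (_+ M * 0) (cong₂ _+_ (cong₂ _+_ (cong₂ _+_ B₀≡ (trans (∑uncovered-leftover N k i el) B₀≡)) (∑uncovered-pair (suc (suc n)) k j el′))
                 (trans (∑L-cong (choose K k) λ {bs} _ → trans (cong (λ c → [ c ] * [ uncovered N bs j ]) (leftover-uncovered N bs i el)) (ℕ.*-identityˡ _)) (∑uncovered-pair (suc (suc n)) k j el′))) ⟩
          (B₁ + (one + both) + (B₁ + (one + both)) + B₁ + B₁) + M * 0
            ≡⟨ cong (λ B → (B + (one + both) + (B + (one + both)) + B + B) + M * 0) B₁≡ ⟩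
          ((neither + one) + (one + both) + ((neither + one) + (one + both)) + (neither + one) + (neither + one)) + M * 0
            ≡⟨ solve 4 (λ c₀ c₁ c₂ m → ((c₀ :+ c₁) :+ (c₁ :+ c₂) :+ ((c₀ :+ c₁) :+ (c₁ :+ c₂)) :+ (c₀ :+ c₁) :+ (c₀ :+ c₁)) :+ m :* con 0
                 := con 4 :* c₀ :+ con 4 :* c₁ :+ c₂ :+ con 0 :+ (con 1 :+ con 0) :* (con 2 :* c₁ :+ c₂)) refl neither one both M ⟩
          generic + 0 + (1 + 0) * extraLeftover ∎
        cases false s false el true el′ (no _) = begin
          (binomial K k + S₁ i + S₁ j + S₂ i j) + M * 0
            ≡⟨ cong (_+ M * 0) (cong₂ _+_ (cong₂ _+_ (cong₂ _+_ B₀≡ (∑uncovered-pair (suc (suc n)) k i el)) (trans (∑uncovered-leftover N k j el′) B₀≡))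
                 (trans (∑L-cong (choose K k) λ {bs} _ → trans (cong (λ c → [ uncovered N bs i ] * [ c ]) (leftover-uncovered N bs j el′)) (ℕ.*-identityʳ _)) (∑uncovered-pair (suc (suc n)) k i el))) ⟩
          (B₁ + (one + both) + B₁ + (B₁ + (one + both)) + B₁) + M * 0
            ≡⟨ cong (λ B → (B + (one + both) + B + (B + (one + both)) + B) + M * 0) B₁≡ ⟩
          ((neither + one) + (one + both) + (neither + one) + ((neither + one) + (one + both)) + (neither + one)) + M * 0
            ≡⟨ solve 4 (λ c₀ c₁ c₂ m → ((c₀ :+ c₁) :+ (c₁ :+ c₂) :+ (c₀ :+ c₁) :+ ((c₀ :+ c₁) :+ (c₁ :+ c₂)) :+ (c₀ :+ c₁)) :+ m :* con 0
                 := con 4 :* c₀ :+ con 4 :* c₁ :+ c₂ :+ con 0 :+ (con 0 :+ con 1) :* (con 2 :* c₁ :+ c₂)) refl neither one both M ⟩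
          generic + 0 + (0 + 1) * extraLeftover ∎
        cases false s false el false el′ (no _) = begin
          (binomial K k + S₁ i + S₁ j + S₂ i j) + M * 0
            ≡⟨ cong (_+ M * 0) (cong₂ _+_ (cong₂ _+_ (cong₂ _+_ B₀≡ (∑uncovered-pair (suc (suc n)) k i el)) (∑uncovered-pair (suc (suc n)) k j el′))
                 (∑uncovered²-distinct n k i j s el el′)) ⟩
          (B₁ + (one + both) + B₁ + B₁ + neither) + M * 0
            ≡⟨ cong (λ B → (B + (one + both) + B + B + neither) + M * 0) B₁≡ ⟩
          ((neither + one) + (one + both) + (neither + one) + (neither + one) + neither) + M * 0
            ≡⟨ solve 4 (λ c₀ c₁ c₂ m → ((c₀ :+ c₁) :+ (c₁ :+ c₂) :+ (c₀ :+ c₁) :+ (c₀ :+ c₁) :+ c₀) :+ m :* con 0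
                 := con 4 :* c₀ :+ con 4 :* c₁ :+ c₂ :+ con 0 :+ (con 0 :+ con 0) :* (con 2 :* c₁ :+ c₂)) refl neither one both M ⟩
          generic + 0 + (0 + 0) * extraLeftover ∎

-- Averaging over all rotations of the pairing along a tour.

module RotatedPairings where

  open import Algebra.Bundles using (CommutativeSemiring)
  open import Data.Bool using (Bool; true; false; not)
  open import Data.Fin as Fin using (Fin; zero; suc; toℕ)
  import Data.Fin.Properties as Fin
  open import Data.Fin.Induction using (<-weakInduction)
  open import Data.Fin.Permutation as Perm using (Permutation′; _⟨$⟩ʳ_; _⟨$⟩ˡ_; _∘ₚ_)
  open import Data.List as List using (List; []; _∷_)
  open import Data.List.Membership.Propositional using (_∈_)
  open import Data.Nat as ℕ using (ℕ; zero; suc; ⌊_/2⌋)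
  open import Data.Nat.DivMod using (m<n⇒m%n≡m)
  import Data.Nat.Properties as ℕ
  open import Data.Sum as Sum using (_⊎_; inj₁; inj₂)
  open import Data.Vec as Vec using (Vec; []; _∷_)
  open import Data.Vec.Relation.Unary.Unique.Propositional using (Unique)
  open import Function using (_∘_; mk⇔)
  open import Level using (0ℓ)
  open import Relation.Binary.PropositionalEquality as ≡ using (_≡_; refl; sym; trans; cong; cong₂; subst)
  open import Relation.Nullary using (does; yes; no)
  open import Relation.Nullary.Decidable using (does-⇔)
  open import Defs using (next)
  open FiniteSums
  open Cycles
  open TourRotations
  open BlockWalks
  open WalkCounts
  open StepCounts
  open PairSelections

  iterate : ∀ {n} → ℕ → Permutation′ n
  iterate zero    = Perm.id
  iterate (suc r) = iterate r ∘ₚ nextₚ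

  iterate-zero : ∀ {m} (r : Fin (suc m)) → iterate (toℕ r) ⟨$⟩ʳ zero ≡ r
  iterate-zero {m} = <-weakInduction (λ r → iterate (toℕ r) ⟨$⟩ʳ zero ≡ r) refl λ i ih →
    trans (cong next (trans (cong (λ t → iterate t ⟨$⟩ʳ zero) (sym (Fin.toℕ-inject₁ i))) ih)) (next-inject₁ i)

  iterate-next : ∀ {n} r (i : Fin n) → iterate r ⟨$⟩ʳ next i ≡ next (iterate r ⟨$⟩ʳ i)
  iterate-next zero    i = refl
  iterate-next (suc r) i = cong next (iterate-next r i)

  iterate-comm : ∀ {n} q r (i : Fin n) → iterate q ⟨$⟩ʳ (iterate r ⟨$⟩ʳ i) ≡ iterate r ⟨$⟩ʳ (iterate q ⟨$⟩ʳ i)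
  iterate-comm zero    r i = refl
  iterate-comm (suc q) r i = trans (cong next (iterate-comm q r i)) (sym (iterate-next r _))

  -- `iterate (toℕ r)` takes `i` to i + r modulo `n`, so this is commutativity of addition. It turns
  -- a sum over rotations at a fixed position into a sum over positions.
  iterate-swap : ∀ {n} (r i : Fin n) → iterate (toℕ r) ⟨$⟩ʳ i ≡ iterate (toℕ i) ⟨$⟩ʳ r
  iterate-swap {suc n} r i = begin
    iterate (toℕ r) ⟨$⟩ʳ i                                 ≡⟨ cong (iterate (toℕ r) ⟨$⟩ʳ_) (iterate-zero i) ⟨
    iterate (toℕ r) ⟨$⟩ʳ (iterate (toℕ i) ⟨$⟩ʳ zero)       ≡⟨ iterate-comm (toℕ r) (toℕ i) zero ⟩
    iterate (toℕ i) ⟨$⟩ʳ (iterate (toℕ r) ⟨$⟩ʳ zero)       ≡⟨ cong (iterate (toℕ i) ⟨$⟩ʳ_) (iterate-zero r) ⟩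
    iterate (toℕ i) ⟨$⟩ʳ r                                 ∎
    where open ≡.≡-Reasoning

  next-unique : ∀ {n} (i j : Fin n) → toℕ j ≡ suc (toℕ i) → j ≡ next i
  next-unique {suc n} i j eq = Fin.toℕ-injective (trans eq (sym
    (trans (Fin.toℕ-fromℕ< _) (m<n⇒m%n≡m (subst (ℕ._< suc n) eq (Fin.toℕ<n j))))))

  relabel : ∀ {n} → Permutation′ n → (Fin n → Fin n) → Fin n → Fin n
  relabel π p v = π ⟨$⟩ʳ p (π ⟨$⟩ˡ v)

  relabel-involutive : ∀ {n} (π : Permutation′ n) p → (∀ i → p (p i) ≡ i) → ∀ v → relabel π p (relabel π p v) ≡ v
  relabel-involutive π p p-inv v = trans (cong (λ i → π ⟨$⟩ʳ p i) (Perm.inverseˡ π)) (trans (cong (π ⟨$⟩ʳ_) (p-inv _)) (Perm.inverseʳ π))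

  π-injective : ∀ {n} (π : Permutation′ n) {v w} → π ⟨$⟩ʳ v ≡ π ⟨$⟩ʳ w → v ≡ w
  π-injective π eq = trans (sym (Perm.inverseˡ π)) (trans (cong (π ⟨$⟩ˡ_) eq) (Perm.inverseˡ π))

  module _ {n : ℕ} (π : Permutation′ n) (bs : Vec Bool ⌊ n /2⌋) where

    matching : Fin n → Fin n
    matching = relabel π (swapPairs n bs)

    matching-involutive : ∀ v → matching (matching v) ≡ v
    matching-involutive = relabel-involutive π (swapPairs n bs) (swapPairs-involutive n bs)

    open Counting matching matching-involutive

    matching-≟ : ∀ i j → does (π ⟨$⟩ʳ j Fin.≟ matching (π ⟨$⟩ʳ i)) ≡ does (j Fin.≟ swapPairs n bs i)
    matching-≟ i j = does-⇔ (mk⇔ (λ eq → π-injective π (trans eq at)) (λ eq → trans (cong (π ⟨$⟩ʳ_) eq) (sym at))) (_ Fin.≟ _) (_ Fin.≟ _)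
      where
      at : matching (π ⟨$⟩ʳ i) ≡ π ⟨$⟩ʳ swapPairs n bs i
      at = cong (λ j → π ⟨$⟩ʳ swapPairs n bs j) (Perm.inverseˡ π)

    single-matching : ∀ i → single? (π ⟨$⟩ʳ i) ≡ uncovered n bs i
    single-matching i = trans (does-⇔ (mk⇔ sym sym) (matching (π ⟨$⟩ʳ i) Fin.≟ π ⟨$⟩ʳ i) (_ Fin.≟ _))
      (trans (matching-≟ i i) (trans (does-⇔ (mk⇔ sym sym) (i Fin.≟ swapPairs n bs i) (_ Fin.≟ _)) (swapPairs-fixed n bs i)))

    singles-matching : singles none ≡ ℕΣ.∑ λ i → ℕΣ.[ uncovered n bs i ]
    singles-matching = trans (ℕΣ.∑-reindex π _) (ℕΣ.∑-cong λ i → cong ℕΣ.[_] (single-matching i))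

    pairs-matching : ∀ k → bs ∈ choose ⌊ n /2⌋ k → pairs none ≡ 2 ℕ.* k
    pairs-matching k bs∈ = trans (trans (ℕΣ.∑-reindex π _) (ℕΣ.∑-cong λ i → cong (ℕΣ.[_] ∘ not) (single-matching i))) (count-covered n k bs∈)

  module Rotated (S : CommutativeSemiring 0ℓ 0ℓ) (n k b : ℕ) where
    open CommutativeSemiring S hiding (zero; refl; sym; trans)
    open Sums S
    open Casts S
    open import Relation.Binary.Reasoning.Setoid setoid
    private
      module S = CommutativeSemiring S
      N K : ℕ
      N = suc (suc (suc (suc n)))
      K = ⌊ N /2⌋

    ∑L-∑ : ∀ {A : Set} {n} (xs : List A) (f : A → Fin n → Carrier) → (∑L xs λ x → ∑ (f x)) ≈ ∑ λ i → ∑L xs λ x → f x i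
    ∑L-∑ []       f = S.sym (∑-0 λ _ → S.refl)
    ∑L-∑ (x ∷ xs) f = S.trans (+-congˡ (∑L-∑ xs f)) (S.sym (∑-+ _ _))

    ι-∑L : ∀ {A : Set} (xs : List A) (f : A → ℕ) → ∑L xs (λ x → ι (f x)) ≈ ι (ℕΣ.∑L xs f)
    ι-∑L []       f = S.refl
    ι-∑L (x ∷ xs) f = S.trans (+-congˡ (ι-∑L xs f)) (S.sym (ι-+ (f x) _))

    ∑-iterate : ∀ {n} t (f : Fin n → Carrier) → (∑ λ r → f (iterate t ⟨$⟩ʳ r)) ≈ ∑ f
    ∑-iterate t f = S.sym (∑-reindex (iterate t) f)

    ∑-orbit : ∀ {n} (i : Fin n) (f : Fin n → Carrier) → (∑ λ (r : Fin n) → f (iterate (toℕ r) ⟨$⟩ʳ i)) ≈ ∑ f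
    ∑-orbit i f = S.trans (∑-cong λ r → reflexive (cong f (iterate-swap r i))) (∑-iterate (toℕ i) f)

    module _ (τ : Vec (Fin N) N) (τ! : Unique τ) (h : Fin N → Fin N → Carrier)
      (h-sym : ∀ v w → h v w ≈ h w v) (h-diagonal : ∀ v → h v v ≈ 0#) where

      rotation : Fin N → Permutation′ N
      rotation r = iterate (toℕ r) ∘ₚ ⟨ τ! ⟩

      total tourTotal : Carrier
      total     = ∑ λ v → ∑ λ w → h v w
      tourTotal = ∑ λ t → h (Vec.lookup τ t) (Vec.lookup τ (next t))

      private
        h′ : Fin N → Fin N → Fin N → Carrier
        h′ r i j = h (rotation r ⟨$⟩ʳ i) (rotation r ⟨$⟩ʳ j)

        generic-part : (∑ λ r → ∑ λ i → ∑ λ j → ι (generic n k b) * h′ r i j) ≈ ι (N ℕ.* generic n k b) * total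
        generic-part = begin
          (∑ λ r → ∑ λ i → ∑ λ j → ι (generic n k b) * h′ r i j)
            ≈⟨ ∑-cong (λ r → S.trans (∑-cong λ i → ∑-*ˡ (ι (generic n k b)) (h′ r i)) (∑-*ˡ (ι (generic n k b)) _)) ⟩
          (∑ λ r → ι (generic n k b) * (∑ λ i → ∑ λ j → h′ r i j))
            ≈⟨ ∑-cong (λ r → *-congˡ (S.sym (S.trans (∑-reindex (rotation r) _) (∑-cong λ i → ∑-reindex (rotation r) (h (rotation r ⟨$⟩ʳ i)))))) ⟩
          (∑ {N} λ r → ι (generic n k b) * total)
            ≈⟨ ∑-const N _ ⟩
          ι N * (ι (generic n k b) * total)
            ≈⟨ *-assoc _ _ _ ⟨
          ι N * ι (generic n k b) * total
            ≈⟨ *-congʳ (ι-* N (generic n k b)) ⟨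
          ι (N ℕ.* generic n k b) * total ∎

        step : ∀ i → (∑ λ r → h′ r i (next i)) ≈ tourTotal
        step i = begin
          (∑ λ r → h′ r i (next i))
            ≈⟨ ∑-cong (λ r → reflexive (cong (λ j → h (rotation r ⟨$⟩ʳ i) (Vec.lookup τ j)) (iterate-next (toℕ r) i))) ⟩
          (∑ λ (r : Fin N) → h (Vec.lookup τ (iterate (toℕ r) ⟨$⟩ʳ i)) (Vec.lookup τ (next (iterate (toℕ r) ⟨$⟩ʳ i))))
            ≈⟨ ∑-orbit i (λ t → h (Vec.lookup τ t) (Vec.lookup τ (next t))) ⟩
          tourTotal ∎

        -- The partner is the next or the previous position, so under rotation the pair runs over
        -- all steps of the tour, up to the symmetry of `h`. A leftover position is its own partner
        -- and meets the zero diagonal.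
        partner-step : ∀ i → (∑ λ r → h′ r i (partner i)) ≈ [ not (leftover i) ] * tourTotal
        partner-step i = cases (leftover i) refl
          where
          cases : ∀ l → leftover i ≡ l → (∑ λ r → h′ r i (partner i)) ≈ [ not l ] * tourTotal
          cases true el = S.trans (∑-0 λ r → S.trans (reflexive (cong (h′ r i) (leftover-partner i el))) (h-diagonal _)) (S.sym (zeroˡ _))
          cases false el = S.trans (adjacent (partner-adjacent i el)) (S.sym (*-identityˡ _))
            where
            adjacent : toℕ (partner i) ≡ suc (toℕ i) ⊎ toℕ i ≡ suc (toℕ (partner i)) → (∑ λ r → h′ r i (partner i)) ≈ tourTotal
            adjacent (inj₁ eq) = S.trans (∑-cong λ r → reflexive (cong (h′ r i) (next-unique i (partner i) eq))) (step i)
            adjacent (inj₂ eq) = S.trans (∑-cong λ r → S.trans (h-sym _ _) (reflexive (cong (h′ r (partner i)) (next-unique (partner i) i eq)))) (step (partner i))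

        partner-part : ∀ c → (∑ λ r → ∑ λ i → ∑ λ j → [ does (j Fin.≟ partner i) ] * ι c * h′ r i j) ≈ ι (2 ℕ.* K ℕ.* c) * tourTotal
        partner-part c = begin
          (∑ λ r → ∑ λ i → ∑ λ j → [ does (j Fin.≟ partner i) ] * ι c * h′ r i j)
            ≈⟨ ∑-cong (λ r → ∑-cong λ i → S.trans (∑-cong λ j → *-assoc _ _ _) (∑-δ (partner i) λ j → ι c * h′ r i j)) ⟩
          (∑ λ r → ∑ λ i → ι c * h′ r i (partner i))
            ≈⟨ ∑-swap (λ r i → ι c * h′ r i (partner i)) ⟩
          (∑ λ i → ∑ λ r → ι c * h′ r i (partner i))
            ≈⟨ ∑-cong (λ i → S.trans (∑-*ˡ (ι c) _) (*-congˡ (partner-step i))) ⟩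
          (∑ λ (i : Fin N) → ι c * ([ not (leftover i) ] * tourTotal))
            ≈⟨ S.trans (∑-*ˡ (ι c) _) (*-congˡ (∑-*ʳ tourTotal _)) ⟩
          ι c * (∑ (λ (i : Fin N) → [ not (leftover i) ]) * tourTotal)
            ≈⟨ *-congˡ (*-congʳ (S.trans (∑-cong λ (i : Fin N) → ι-[] (not (leftover i))) (S.trans (ι-∑ λ (i : Fin N) → ℕΣ.[ not (leftover i) ]) (reflexive (cong ι (count-not-leftover N)))))) ⟩
          ι c * (ι (2 ℕ.* K) * tourTotal)
            ≈⟨ *-assoc _ _ _ ⟨
          ι c * ι (2 ℕ.* K) * tourTotal
            ≈⟨ *-congʳ (S.trans (*-comm _ _) (S.sym (ι-* (2 ℕ.* K) c))) ⟩
          ι (2 ℕ.* K ℕ.* c) * tourTotal ∎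

        unmatched : ℕ
        unmatched = ℕΣ.∑ λ (i : Fin N) → ℕΣ.[ leftover i ]

        -- Under rotation the leftover position takes every vertex once, so the sums of `h` over the
        -- edges at that vertex add up to `total`; the odd vertex spoils no symmetry.
        leftover-part : ∀ c → (∑ λ r → ∑ λ i → ∑ λ j → [ leftover i ] * ι c * h′ r i j) ≈ ι (unmatched ℕ.* c) * total
        leftover-part c = begin
          (∑ λ r → ∑ λ i → ∑ λ j → [ leftover i ] * ι c * h′ r i j)
            ≈⟨ ∑-cong (λ r → ∑-cong λ i → S.trans (∑-*ˡ _ (h′ r i)) (*-congˡ (S.sym (∑-reindex (rotation r) (h (rotation r ⟨$⟩ʳ i)))))) ⟩
          (∑ λ r → ∑ λ i → [ leftover i ] * ι c * degree (rotation r ⟨$⟩ʳ i))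
            ≈⟨ ∑-swap (λ r i → [ leftover i ] * ι c * degree (rotation r ⟨$⟩ʳ i)) ⟩
          (∑ λ i → ∑ λ r → [ leftover i ] * ι c * degree (rotation r ⟨$⟩ʳ i))
            ≈⟨ ∑-cong (λ i → S.trans (∑-*ˡ _ _) (*-congˡ (S.trans (∑-orbit i (degree ∘ Vec.lookup τ)) (S.sym (∑-reindex ⟨ τ! ⟩ degree))))) ⟩
          (∑ λ (i : Fin N) → [ leftover i ] * ι c * total)
            ≈⟨ S.trans (∑-*ʳ total _) (*-congʳ (∑-*ʳ (ι c) _)) ⟩
          ∑ (λ (i : Fin N) → [ leftover i ]) * ι c * total
            ≈⟨ *-congʳ (*-congʳ (S.trans (∑-cong λ (i : Fin N) → ι-[] (leftover i)) (ι-∑ λ (i : Fin N) → ℕΣ.[ leftover i ]))) ⟩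
          ι unmatched * ι c * total
            ≈⟨ *-congʳ (ι-* unmatched c) ⟨
          ι (unmatched ℕ.* c) * total ∎
          where
          degree : Fin N → Carrier
          degree v = ∑ (h v)

        leftover-part′ : ∀ c → (∑ λ r → ∑ λ i → ∑ λ j → [ leftover j ] * ι c * h′ r i j) ≈ ι (unmatched ℕ.* c) * total
        leftover-part′ c = S.trans (∑-cong λ r → S.trans (∑-swap λ i j → [ leftover j ] * ι c * h′ r i j)
          (∑-cong λ j → ∑-cong λ i → *-congˡ (h-sym _ _))) (leftover-part c)

        P L : ℕ
        P = extraPartner n k b
        L = extraLeftover n k b

        pointwise : ∀ r i j → ι (ℕΣ.∑L (choose K k) λ bs → pairWeight n k b bs i j) * h′ r i j ≈
          ι (generic n k b) * h′ r i j + [ does (j Fin.≟ partner i) ] * ι P * h′ r i j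
          + ([ leftover i ] * ι L * h′ r i j + [ leftover j ] * ι L * h′ r i j)
        pointwise r i j with i Fin.≟ j
        ... | yes refl = S.trans (vanish _) (S.sym (S.trans (+-cong (S.trans (+-cong (vanish _) (vanish _)) (+-identityˡ 0#))
                           (S.trans (+-cong (vanish _) (vanish _)) (+-identityˡ 0#))) (+-identityˡ 0#)))
          where
          vanish : ∀ c → c * h′ r i i ≈ 0#
          vanish c = S.trans (*-congˡ (h-diagonal _)) (zeroʳ c)
        ... | no i≢j = begin
          ι (ℕΣ.∑L (choose K k) λ bs → pairWeight n k b bs i j) * x
            ≈⟨ *-congʳ (reflexive (cong ι (∑-pairWeight n k b i j i≢j))) ⟩
          ι (generic n k b ℕ.+ δ ℕ.* P ℕ.+ (l ℕ.+ l′) ℕ.* L) * x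
            ≈⟨ *-congʳ (S.trans (ι-+ (generic n k b ℕ.+ δ ℕ.* P) _) (+-cong
                 (S.trans (ι-+ (generic n k b) (δ ℕ.* P)) (+-congˡ (S.trans (ι-* δ P) (*-congʳ (S.sym (ι-[] (does (j Fin.≟ partner i))))))))
                 (S.trans (ι-* (l ℕ.+ l′) L) (*-congʳ (S.trans (ι-+ l l′) (+-cong (S.sym (ι-[] (leftover i))) (S.sym (ι-[] (leftover j))))))))) ⟩
          (ι (generic n k b) + [ does (j Fin.≟ partner i) ] * ι P + ([ leftover i ] + [ leftover j ]) * ι L) * x
            ≈⟨ S.trans (distribʳ x _ _) (+-cong (distribʳ x _ _) (S.trans (*-congʳ (distribʳ (ι L) _ _)) (distribʳ x _ _))) ⟩
          ι (generic n k b) * x + [ does (j Fin.≟ partner i) ] * ι P * x + ([ leftover i ] * ι L * x + [ leftover j ] * ι L * x) ∎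
          where
          x = h′ r i j
          δ l l′ : ℕ
          δ  = ℕΣ.[ does (j Fin.≟ partner i) ]
          l  = ℕΣ.[ leftover i ]
          l′ = ℕΣ.[ leftover j ]

      ∑∑∑-+ : ∀ (f g : Fin N → Fin N → Fin N → Carrier) →
        (∑ λ r → ∑ λ i → ∑ λ j → f r i j + g r i j) ≈ (∑ λ r → ∑ λ i → ∑ λ j → f r i j) + (∑ λ r → ∑ λ i → ∑ λ j → g r i j)
      ∑∑∑-+ f g = S.trans (∑-cong λ r → S.trans (∑-cong λ i → ∑-+ (f r i) (g r i)) (∑-+ _ _)) (∑-+ _ _)

      -- The forms attached to all rotations of the cycle and all choices of k of
      -- its alternate steps add up to a combination of total and tourTotal alone.
      ∑-pairWeights :
        (∑ λ r → ∑L (choose K k) λ bs → ∑ λ i → ∑ λ j → ι (pairWeight n k b bs i j) * h (rotation r ⟨$⟩ʳ i) (rotation r ⟨$⟩ʳ j))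
        ≈ ι (N ℕ.* generic n k b ℕ.+ 2 ℕ.* (unmatched ℕ.* L)) * total + ι (2 ℕ.* K ℕ.* P) * tourTotal
      ∑-pairWeights = begin
        (∑ λ r → ∑L (choose K k) λ bs → ∑ λ i → ∑ λ j → ι (pairWeight n k b bs i j) * h′ r i j)
          ≈⟨ ∑-cong (λ r → S.trans (∑L-∑ (choose K k) _) (∑-cong λ i → S.trans (∑L-∑ (choose K k) _) (∑-cong λ j →
               S.trans (∑L-*ʳ (h′ r i j) (choose K k) _) (*-congʳ (ι-∑L (choose K k) λ bs → pairWeight n k b bs i j))))) ⟩
        (∑ λ r → ∑ λ i → ∑ λ j → ι (ℕΣ.∑L (choose K k) λ bs → pairWeight n k b bs i j) * h′ r i j)
          ≈⟨ ∑-cong (λ r → ∑-cong λ i → ∑-cong λ j → pointwise r i j) ⟩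
        (∑ λ r → ∑ λ i → ∑ λ j → ι (generic n k b) * h′ r i j + [ does (j Fin.≟ partner i) ] * ι P * h′ r i j
          + ([ leftover i ] * ι L * h′ r i j + [ leftover j ] * ι L * h′ r i j))
          ≈⟨ S.trans (∑∑∑-+ _ _) (+-cong (∑∑∑-+ _ _) (∑∑∑-+ _ _)) ⟩
        (∑ λ r → ∑ λ i → ∑ λ j → ι (generic n k b) * h′ r i j) + (∑ λ r → ∑ λ i → ∑ λ j → [ does (j Fin.≟ partner i) ] * ι P * h′ r i j)
          + ((∑ λ r → ∑ λ i → ∑ λ j → [ leftover i ] * ι L * h′ r i j) + (∑ λ r → ∑ λ i → ∑ λ j → [ leftover j ] * ι L * h′ r i j))
          ≈⟨ +-cong (+-cong generic-part (partner-part P)) (+-cong (leftover-part L) (leftover-part′ L)) ⟩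
        ι (N ℕ.* generic n k b) * total + ι (2 ℕ.* K ℕ.* P) * tourTotal + (ι uL * total + ι uL * total)
          ≈⟨ S.trans (+-congʳ (+-comm _ _)) (S.trans (+-assoc _ _ _) (+-comm _ _)) ⟩
        ι (N ℕ.* generic n k b) * total + (ι uL * total + ι uL * total) + ι (2 ℕ.* K ℕ.* P) * tourTotal
          ≈⟨ +-congʳ (S.sym (S.trans (*-congʳ (S.trans (ι-+ (N ℕ.* generic n k b) (2 ℕ.* uL)) (+-congˡ (S.trans (reflexive (cong (λ t → ι (uL ℕ.+ t)) (ℕ.+-identityʳ uL))) (ι-+ uL uL)))))
               (S.trans (distribʳ total _ _) (+-congˡ (distribʳ total _ _))))) ⟩
        ι (N ℕ.* generic n k b ℕ.+ 2 ℕ.* uL) * total + ι (2 ℕ.* K ℕ.* P) * tourTotal ∎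
        where
        uL : ℕ
        uL = unmatched ℕ.* L

      -- `stepWeight` looks at the partner in the selected matching, `pairWeight` at the partner in
      -- the full pairing. These agree at covered positions, and elsewhere the term has a factor 0.
      pairForm : ∀ (π : Permutation′ N) bs (s : ℕ) (let open Counting (matching π bs) (matching-involutive π bs))
        (s≡ : singles none ≡ s) (k≡ : pairs none ≡ 2 ℕ.* k) (n≡ : N ≡ s ℕ.+ 2 ℕ.* k) (b≡ : s ℕ.+ k ≡ suc (suc b)) →
        (∑ λ y → ∑ λ z → ι (TourCounts.stepWeight (matching π bs) (matching-involutive π bs) s k b s≡ k≡ n≡ b≡ y z) * h y z)
        ≈ ∑ λ i → ∑ λ j → ι (pairWeight n k b bs i j) * h (π ⟨$⟩ʳ i) (π ⟨$⟩ʳ j)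
      pairForm π bs s s≡ k≡ n≡ b≡ = S.trans (∑-reindex π _) (∑-cong λ i → S.trans (∑-reindex π _) (∑-cong λ j → *-congʳ (reflexive (cong ι (relabelled i j)))))
        where
        open TourCounts (matching π bs) (matching-involutive π bs) s k b s≡ k≡ n≡ b≡ using (stepWeight)
        relabelled : ∀ i j → stepWeight (π ⟨$⟩ʳ i) (π ⟨$⟩ʳ j) ≡ pairWeight n k b bs i j
        relabelled i j = cong₂ ℕ._+_
          (cong₂ (λ c d → suc ℕΣ.[ c ] ℕ.* suc ℕΣ.[ d ]) (single-matching π bs i) (single-matching π bs j))
          (cong (ℕ._* suc (2 ℕ.* b)) (trans (cong₂ (λ c d → ℕΣ.[ not c ] ℕ.* ℕΣ.[ d ]) (single-matching π bs i) (matching-≟ π bs i j))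
            (covered-case (uncovered N bs i) refl)))
          where
          covered-case : ∀ c → uncovered N bs i ≡ c → ℕΣ.[ not c ] ℕ.* ℕΣ.[ does (j Fin.≟ swapPairs N bs i) ] ≡ ℕΣ.[ not c ] ℕ.* ℕΣ.[ does (j Fin.≟ partner i) ]
          covered-case true  _ = refl
          covered-case false e = cong (λ v → 1 ℕ.* ℕΣ.[ does (j Fin.≟ v) ]) (covered⇒partner N bs i e)

-- The numerical inequality between the averaged weights.

module WeightBounds where

  open import Data.Nat as ℕ using (ℕ; zero; suc; _+_; _*_; _∸_; _≤_; _<_; ⌊_/2⌋; s≤s; z≤n)
  import Data.Nat.Properties as ℕ
  open import Data.Nat.Solver using (module +-*-Solver)
  open import Data.Product using (_×_; _,_; proj₁; proj₂)
  open import Data.Sum as Sum using (_⊎_; inj₁; inj₂)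
  open import Relation.Binary.PropositionalEquality as ≡ using (_≡_; refl; sym; trans; cong; cong₂; subst; subst₂)
  open import Data.Fin using (Fin)
  open StepCounts using (module ℕΣ)
  open PairSelections
  open +-*-Solver

  -- The absorption identity of binomial coefficients. Applied twice, it reduces the three pair
  -- statistics to multiples of a single binomial.
  binomial-absorb : ∀ N k → k * binomial (suc N) k ≡ suc N * shift (binomial N) k
  binomial-absorb N       zero    = sym (ℕ.*-zeroʳ (suc N))
  binomial-absorb zero    (suc zero) = refl
  binomial-absorb zero    (suc (suc k)) = trans (cong (suc (suc k) *_) (binomial-suc 0 (suc (suc k)))) (ℕ.*-zeroʳ (suc (suc k)))
  binomial-absorb (suc N) (suc j) = begin
    suc j * binomial (suc (suc N)) (suc j)
      ≡⟨ cong (suc j *_) (binomial-suc (suc N) (suc j)) ⟩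
    suc j * (binomial (suc N) (suc j) + binomial (suc N) j)
      ≡⟨ solve 3 (λ j x y → (con 1 :+ j) :* (x :+ y) := (con 1 :+ j) :* x :+ (y :+ j :* y)) refl j (binomial (suc N) (suc j)) (binomial (suc N) j) ⟩
    suc j * binomial (suc N) (suc j) + (binomial (suc N) j + j * binomial (suc N) j)
      ≡⟨ cong₂ (λ x y → x + (binomial (suc N) j + y)) (binomial-absorb N (suc j)) (binomial-absorb N j) ⟩
    suc N * binomial N j + (binomial (suc N) j + suc N * shift (binomial N) j)
      ≡⟨ solve 4 (λ n x y z → (con 1 :+ n) :* x :+ (y :+ (con 1 :+ n) :* z) := y :+ (con 1 :+ n) :* (x :+ z)) refl N (binomial N j) (binomial (suc N) j) (shift (binomial N) j) ⟩
    binomial (suc N) j + suc N * (binomial N j + shift (binomial N) j)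
      ≡⟨ cong (λ t → binomial (suc N) j + suc N * t) (binomial-suc N j) ⟨
    suc (suc N) * binomial (suc N) j ∎
    where open ≡.≡-Reasoning

  binomial-pos : ∀ K k → k ≤ K → 0 < binomial K k
  binomial-pos zero    zero    _         = s≤s z≤n
  binomial-pos (suc K) zero    _         = subst (0 <_) (sym (binomial-suc K zero)) (ℕ.≤-trans (binomial-pos K zero z≤n) (ℕ.m≤m+n _ _))
  binomial-pos (suc K) (suc k) (s≤s k≤K) = subst (0 <_) (sym (binomial-suc K (suc k))) (ℕ.≤-trans (binomial-pos K k k≤K) (ℕ.m≤n+m _ _))

  -- A random k-subset of K pairs contains both, one, or neither of two given
  -- pairs with probabilities proportional to k(k-1), k(K-k), (K-k)(K-k-1).
  module Ratios (n x d : ℕ) (K≡ : suc (suc ⌊ n /2⌋) ≡ suc x + d) where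
    private
      K″ = ⌊ n /2⌋
      k  = suc x
      B  = binomial (suc (suc K″)) k
      C₀ = neither n k
      C₁ = one n k
      C₂ = both n k

      K″≡ : suc K″ ≡ x + d
      K″≡ = ℕ.suc-injective K≡

      shift-sum : binomial (suc K″) x ≡ C₁ + C₂
      shift-sum = binomial-suc K″ x

    scale : ℕ
    scale = suc (suc K″) * suc K″

    both-ratio : scale * C₂ ≡ x * k * B
    both-ratio = begin
      suc (suc K″) * suc K″ * C₂             ≡⟨ ℕ.*-assoc (suc (suc K″)) (suc K″) C₂ ⟩
      suc (suc K″) * (suc K″ * C₂)           ≡⟨ cong (suc (suc K″) *_) (binomial-absorb K″ x) ⟨
      suc (suc K″) * (x * binomial (suc K″) x) ≡⟨ solve 3 (λ a x c → a :* (x :* c) := x :* (a :* c)) refl (suc (suc K″)) x (binomial (suc K″) x) ⟩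
      x * (suc (suc K″) * binomial (suc K″) x) ≡⟨ cong (x *_) (binomial-absorb (suc K″) k) ⟨
      x * (k * B)                            ≡⟨ ℕ.*-assoc x k B ⟨
      x * k * B                              ∎
      where open ≡.≡-Reasoning

    one-ratio : scale * C₁ ≡ k * d * B
    one-ratio = ℕ.+-cancelʳ-≡ (scale * C₂) _ _ (begin
      scale * C₁ + scale * C₂                       ≡⟨ ℕ.*-distribˡ-+ scale C₁ C₂ ⟨
      scale * (C₁ + C₂)                             ≡⟨ cong (scale *_) shift-sum ⟨
      suc (suc K″) * suc K″ * binomial (suc K″) x   ≡⟨ solve 3 (λ a b c → a :* b :* c := b :* (a :* c)) refl (suc (suc K″)) (suc K″) (binomial (suc K″) x) ⟩
      suc K″ * (suc (suc K″) * binomial (suc K″) x) ≡⟨ cong₂ _*_ K″≡ (sym (binomial-absorb (suc K″) k)) ⟩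
      (x + d) * (k * B)                             ≡⟨ solve 3 (λ x d b → (x :+ d) :* ((con 1 :+ x) :* b) := (con 1 :+ x) :* d :* b :+ x :* (con 1 :+ x) :* b) refl x d B ⟩
      k * d * B + x * k * B                         ≡⟨ cong (k * d * B +_) both-ratio ⟨
      k * d * B + scale * C₂                        ∎)
      where open ≡.≡-Reasoning

    neither-ratio : scale * C₀ ≡ d * (d ∸ 1) * B
    neither-ratio = ℕ.+-cancelʳ-≡ (2 * (scale * C₁) + scale * C₂) _ _ (begin
      scale * C₀ + (2 * (scale * C₁) + scale * C₂)   ≡⟨ solve 4 (λ s a b c → s :* a :+ (con 2 :* (s :* b) :+ s :* c) := s :* (a :+ con 2 :* b :+ c)) refl scale C₀ C₁ C₂ ⟩
      scale * (C₀ + 2 * C₁ + C₂)                     ≡⟨ cong (scale *_) (binomial-split n k) ⟨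
      suc (suc K″) * suc K″ * B                      ≡⟨ cong₂ (λ s t → s * t * B) K≡ K″≡ ⟩
      (suc x + d) * (x + d) * B                      ≡⟨ expand d ⟩
      d * (d ∸ 1) * B + (2 * (k * d * B) + x * k * B) ≡⟨ cong₂ (λ s t → d * (d ∸ 1) * B + (2 * s + t)) one-ratio both-ratio ⟨
      d * (d ∸ 1) * B + (2 * (scale * C₁) + scale * C₂) ∎)
      where
      open ≡.≡-Reasoning
      expand : ∀ d → (suc x + d) * (x + d) * B ≡ d * (d ∸ 1) * B + (2 * (k * d * B) + x * k * B)
      -- Here the truncated `d ∸ 1` differs from d - 1, but the factor `d` makes the term vanish
      -- either way.
      expand zero = solve 2 (λ x b → (con 1 :+ x :+ con 0) :* (x :+ con 0) :* b := con 0 :+ (con 2 :* ((con 1 :+ x) :* con 0 :* b) :+ x :* (con 1 :+ x) :* b)) refl x B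
      expand (suc e) = solve 3 (λ x e b → (con 1 :+ x :+ (con 1 :+ e)) :* (x :+ (con 1 :+ e)) :* b
        := (con 1 :+ e) :* e :* b :+ (con 2 :* ((con 1 :+ x) :* (con 1 :+ e) :* b) :+ x :* (con 1 :+ x) :* b)) refl x e B

  -- total and tourTotal weights in the averaged form, as functions of the three
  -- pair-statistics c₀, c₁, c₂ (neither, one, both).
  totalWeight : (N u c₀ c₁ c₂ : ℕ) → ℕ
  totalWeight N u c₀ c₁ c₂ = N * (4 * c₀ + 4 * c₁ + c₂) + 2 * (u * (2 * c₁ + c₂))

  tourWeight : (K b c₁ c₂ : ℕ) → ℕ
  tourWeight K b c₁ c₂ = 2 * K * (c₁ + (c₁ + c₂) * suc (2 * b))

  module _ where
    private
      -- Here `d` is the number of unselected pairs and `u` that of leftover vertices. Divided by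
      -- kN, the last factor is (N - k)/k + 10/N = a - 1, so the claim is (N - 1) w₁ / w₂ ≤ a - 1
      -- for the total weight w₁ and the tour weight w₂.
      statement : (x d u b : ℕ) → Set
      statement x d u b = let k = suc x ; K = k + d ; N = k + suc (suc b) in
        k * (N * (N ∸ 1)) * totalWeight N u (d * (d ∸ 1)) (k * d) (x * k) ≤
        tourWeight K b (k * d) (x * k) * (N * suc (suc b) + 10 * k)

      module _ {m : ℕ} where
        lhs rhs : (x d d-1 u b : Polynomial m) → Polynomial m
        lhs x d d-1 u b = k :* (N :* (x :+ (con 2 :+ b))) :* (N :* (con 4 :* (d :* d-1) :+ con 4 :* (k :* d) :+ x :* k) :+ con 2 :* (u :* (con 2 :* (k :* d) :+ x :* k)))
          where
          k = con 1 :+ x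
          N = k :+ (con 2 :+ b)
        rhs x d d-1 u b = con 2 :* (k :+ d) :* (k :* d :+ (k :* d :+ x :* k) :* (con 1 :+ con 2 :* b)) :* (N :* (con 2 :+ b) :+ con 10 :* k)
          where
          k = con 1 :+ x
          N = k :+ (con 2 :+ b)

      -- The certificates below are the differences of the two sides as polynomials with nonnegative
      -- coefficients, after `b` has been eliminated through x + 2d + u = b + 1. Odd and even refer
      -- to `N`; "all" means that no pair is left unselected, "some" that one is, and "first" that
      -- `k` is 1. These cases keep `d ∸ 1` and `b` free of subtraction.
      from-≡ : ∀ {l r} s → r ≡ l + s → l ≤ r
      from-≡ {l} s eq = subst (l ≤_) (sym eq) (ℕ.m≤m+n l s)

      odd-all : ∀ x → statement x 0 1 (x + 2 * 0)
      odd-all x = from-≡ ((suc x) * (32 * x * x * x * x + 68 * x * x * x + 38 * x * x + 2 * x))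
        (solve 1 (λ x → rhs x (con 0) (con 0) (con 1) (x :+ con 2 :* con 0) := lhs x (con 0) (con 0) (con 1) (x :+ con 2 :* con 0)
          :+ (con 1 :+ x) :* (con 32 :* x :* x :* x :* x :+ con 68 :* x :* x :* x :+ con 38 :* x :* x :+ con 2 :* x)) refl x)

      odd-some : ∀ x e → statement x (suc e) 1 (x + 2 * suc e)
      odd-some x e = from-≡ ((suc x) * (32 * x * x * x * x + 136 * x * x * x * e + 204 * x * x * x + 176 * x * x * e * e + 628 * x * x * e + 490 * x * x + 72 * x * e * e * e + 504 * x * e * e + 970 * x * e + 540 * x + 80 * e * e * e + 360 * e * e + 520 * e + 240))
        (solve 2 (λ x e → rhs x ((con 1 :+ e)) (e) (con 1) (x :+ con 2 :* (con 1 :+ e)) := lhs x ((con 1 :+ e)) (e) (con 1) (x :+ con 2 :* (con 1 :+ e))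
          :+ (con 1 :+ x) :* (con 32 :* x :* x :* x :* x :+ con 136 :* x :* x :* x :* e :+ con 204 :* x :* x :* x :+ con 176 :* x :* x :* e :* e :+ con 628 :* x :* x :* e :+ con 490 :* x :* x :+ con 72 :* x :* e :* e :* e :+ con 504 :* x :* e :* e :+ con 970 :* x :* e :+ con 540 :* x :+ con 80 :* e :* e :* e :+ con 360 :* e :* e :+ con 520 :* e :+ con 240)) refl x e)

      even-first : ∀ e → statement 0 (suc e) 0 (suc (2 * e))
      even-first e = from-≡ (1 * (80 * e * e * e + 320 * e * e + 400 * e + 160))
        (solve 1 (λ e → rhs (con 0) ((con 1 :+ e)) (e) (con 0) (con 1 :+ con 2 :* e) := lhs (con 0) ((con 1 :+ e)) (e) (con 0) (con 1 :+ con 2 :* e)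
          :+ (con 1 :+ (con 0)) :* (con 80 :* e :* e :* e :+ con 320 :* e :* e :+ con 400 :* e :+ con 160)) refl e)

      even-all : ∀ x → statement (suc x) 0 0 (x + 2 * 0)
      even-all x = from-≡ ((suc (suc x)) * (32 * x * x * x * x + 164 * x * x * x + 276 * x * x + 160 * x + 16))
        (solve 1 (λ x → rhs (con 1 :+ x) (con 0) (con 0) (con 0) (x :+ con 2 :* con 0) := lhs (con 1 :+ x) (con 0) (con 0) (con 0) (x :+ con 2 :* con 0)
          :+ (con 1 :+ (con 1 :+ x)) :* (con 32 :* x :* x :* x :* x :+ con 164 :* x :* x :* x :+ con 276 :* x :* x :+ con 160 :* x :+ con 16)) refl x)

      even-some : ∀ x e → statement (suc x) (suc e) 0 (x + 2 * suc e)
      even-some x e = from-≡ ((suc (suc x)) * (32 * x * x * x * x + 136 * x * x * x * e + 300 * x * x * x + 176 * x * x * e * e + 972 * x * x * e + 1072 * x * x + 72 * x * e * e * e + 824 * x * e * e + 2340 * x * e + 1748 * x + 152 * e * e * e + 968 * e * e + 1904 * e + 1104))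
        (solve 2 (λ x e → rhs (con 1 :+ x) ((con 1 :+ e)) (e) (con 0) (x :+ con 2 :* (con 1 :+ e)) := lhs (con 1 :+ x) ((con 1 :+ e)) (e) (con 0) (x :+ con 2 :* (con 1 :+ e))
          :+ (con 1 :+ (con 1 :+ x)) :* (con 32 :* x :* x :* x :* x :+ con 136 :* x :* x :* x :* e :+ con 300 :* x :* x :* x :+ con 176 :* x :* x :* e :* e :+ con 972 :* x :* x :* e :+ con 1072 :* x :* x :+ con 72 :* x :* e :* e :* e :+ con 824 :* x :* e :* e :+ con 2340 :* x :* e :+ con 1748 :* x :+ con 152 :* e :* e :* e :+ con 968 :* e :* e :+ con 1904 :* e :+ con 1104)) refl x e)

    weights-bound : ∀ x d u b → x + 2 * d + u ≡ suc b → u ≡ 0 ⊎ u ≡ 1 → statement x d u b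
    weights-bound x zero u b eq (inj₂ refl) = subst (statement x 0 1) (ℕ.suc-injective (trans (ℕ.+-comm 1 _) eq)) (odd-all x)
    weights-bound x (suc e) u b eq (inj₂ refl) = subst (statement x (suc e) 1) (ℕ.suc-injective (trans (ℕ.+-comm 1 _) eq)) (odd-some x e)
    weights-bound zero (suc e) u b eq (inj₁ refl) = subst (statement 0 (suc e) 0)
      (ℕ.suc-injective (trans (sym (trans (ℕ.+-identityʳ (2 * suc e)) (ℕ.*-suc 2 e))) eq)) (even-first e)
    weights-bound (suc x) zero u b eq (inj₁ refl) = subst (statement (suc x) 0 0) (ℕ.suc-injective (trans (sym (ℕ.+-identityʳ _)) eq)) (even-all x)
    weights-bound (suc x) (suc e) u b eq (inj₁ refl) = subst (statement (suc x) (suc e) 0) (ℕ.suc-injective (trans (sym (ℕ.+-identityʳ _)) eq)) (even-some x e)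

  leftover-0∨1 : ∀ n → ℕΣ.∑ (λ (i : Fin n) → ℕΣ.[ leftover i ]) ≡ 0 ⊎ ℕΣ.∑ (λ (i : Fin n) → ℕΣ.[ leftover i ]) ≡ 1
  leftover-0∨1 zero          = inj₁ (ℕΣ.∑-zero _)
  leftover-0∨1 (suc zero)    = inj₂ (∑-one _)
  leftover-0∨1 (suc (suc n)) = Sum.map (trans (∑-two _)) (trans (∑-two _)) (leftover-0∨1 n)

  module Weights (n x d b : ℕ) (K≡ : suc (suc ⌊ n /2⌋) ≡ suc x + d) (N≡ : suc (suc (suc (suc n))) ≡ suc x + suc (suc b)) where
    open Ratios n x d K≡
    private
      k N K u : ℕ
      k = suc x
      N = suc (suc (suc (suc n)))
      K = suc (suc ⌊ n /2⌋)
      u = ℕΣ.∑ λ (i : Fin N) → ℕΣ.[ leftover i ]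
      C₀ = neither n k
      C₁ = one n k
      C₂ = both n k
      B = binomial K k

    weight₁ weight₂ : ℕ
    weight₁ = totalWeight N u C₀ C₁ C₂
    weight₂ = tourWeight K b C₁ C₂

    private
      scale-weight₁ : scale * weight₁ ≡ totalWeight N u (d * (d ∸ 1)) (k * d) (x * k) * B
      scale-weight₁ = begin
        scale * weight₁
          ≡⟨ solve 6 (λ s N u a b c → s :* (N :* (con 4 :* a :+ con 4 :* b :+ c) :+ con 2 :* (u :* (con 2 :* b :+ c)))
               := N :* (con 4 :* (s :* a) :+ con 4 :* (s :* b) :+ s :* c) :+ con 2 :* (u :* (con 2 :* (s :* b) :+ s :* c))) refl scale N u C₀ C₁ C₂ ⟩
        totalWeight N u (scale * C₀) (scale * C₁) (scale * C₂)
          ≡⟨ cong₂ (λ a (bc : ℕ × ℕ) → totalWeight N u a (proj₁ bc) (proj₂ bc)) neither-ratio (cong₂ _,_ one-ratio both-ratio) ⟩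
        totalWeight N u (d * (d ∸ 1) * B) (k * d * B) (x * k * B)
          ≡⟨ solve 6 (λ s N u a b c → N :* (con 4 :* (a :* s) :+ con 4 :* (b :* s) :+ c :* s) :+ con 2 :* (u :* (con 2 :* (b :* s) :+ c :* s))
               := (N :* (con 4 :* a :+ con 4 :* b :+ c) :+ con 2 :* (u :* (con 2 :* b :+ c))) :* s) refl B N u (d * (d ∸ 1)) (k * d) (x * k) ⟩
        totalWeight N u (d * (d ∸ 1)) (k * d) (x * k) * B ∎
        where open ≡.≡-Reasoning

      scale-weight₂ : scale * weight₂ ≡ tourWeight K b (k * d) (x * k) * B
      scale-weight₂ = begin
        scale * weight₂
          ≡⟨ solve 5 (λ s K b c₁ c₂ → s :* (con 2 :* K :* (c₁ :+ (c₁ :+ c₂) :* (con 1 :+ con 2 :* b)))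
               := con 2 :* K :* (s :* c₁ :+ (s :* c₁ :+ s :* c₂) :* (con 1 :+ con 2 :* b))) refl scale K b C₁ C₂ ⟩
        tourWeight K b (scale * C₁) (scale * C₂)
          ≡⟨ cong₂ (tourWeight K b) one-ratio both-ratio ⟩
        tourWeight K b (k * d * B) (x * k * B)
          ≡⟨ solve 5 (λ s K b c₁ c₂ → con 2 :* K :* (c₁ :* s :+ (c₁ :* s :+ c₂ :* s) :* (con 1 :+ con 2 :* b))
               := con 2 :* K :* (c₁ :+ (c₁ :+ c₂) :* (con 1 :+ con 2 :* b)) :* s) refl B K b (k * d) (x * k) ⟩
        tourWeight K b (k * d) (x * k) * B ∎
        where open ≡.≡-Reasoning

      -- Both 2K + u and k + b + 2 equal `N`; with K = k + d this determines `b`.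
      parity : x + 2 * d + u ≡ suc b
      parity = ℕ.+-cancelˡ-≡ (2 + x) _ _ (begin
        2 + x + (x + 2 * d + u)       ≡⟨ solve 3 (λ x d u → con 2 :+ x :+ (x :+ con 2 :* d :+ u) := con 2 :* (con 1 :+ x :+ d) :+ u) refl x d u ⟩
        2 * (suc x + d) + u           ≡⟨ cong (λ K → 2 * K + u) K≡ ⟨
        2 * K + u                     ≡⟨ count-leftover N ⟩
        N                             ≡⟨ N≡ ⟩
        suc x + suc (suc b)           ≡⟨ solve 2 (λ x b → con 1 :+ x :+ (con 2 :+ b) := con 2 :+ x :+ (con 1 :+ b)) refl x b ⟩
        2 + x + suc b                 ∎)
        where open ≡.≡-Reasoning

    -- Scaling by K(K - 1) turns `neither`, `one` and `both` into d(d - 1), kd and k(k - 1) times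
    -- the common factor `B`, and so reduces the claim to the polynomial inequality.
    weights-≤ : k * (N * (N ∸ 1)) * weight₁ ≤ weight₂ * (N * suc (suc b) + 10 * k)
    weights-≤ = ℕ.*-cancelˡ-≤ scale (begin
      scale * (k * (N * (N ∸ 1)) * weight₁)
        ≡⟨ solve 3 (λ s a w → s :* (a :* w) := a :* (s :* w)) refl scale (k * (N * (N ∸ 1))) weight₁ ⟩
      k * (N * (N ∸ 1)) * (scale * weight₁)
        ≡⟨ cong (k * (N * (N ∸ 1)) *_) scale-weight₁ ⟩
      k * (N * (N ∸ 1)) * (totalWeight N u (d * (d ∸ 1)) (k * d) (x * k) * B)
        ≡⟨ ℕ.*-assoc (k * (N * (N ∸ 1))) (totalWeight N u (d * (d ∸ 1)) (k * d) (x * k)) B ⟨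
      k * (N * (N ∸ 1)) * totalWeight N u (d * (d ∸ 1)) (k * d) (x * k) * B
        ≤⟨ ℕ.*-monoˡ-≤ B bound ⟩
      tourWeight K b (k * d) (x * k) * (N * suc (suc b) + 10 * k) * B
        ≡⟨ solve 3 (λ w y b → w :* y :* b := w :* b :* y) refl (tourWeight K b (k * d) (x * k)) (N * suc (suc b) + 10 * k) B ⟩
      tourWeight K b (k * d) (x * k) * B * (N * suc (suc b) + 10 * k)
        ≡⟨ cong (_* (N * suc (suc b) + 10 * k)) scale-weight₂ ⟨
      scale * weight₂ * (N * suc (suc b) + 10 * k)
        ≡⟨ ℕ.*-assoc scale weight₂ (N * suc (suc b) + 10 * k) ⟩
      scale * (weight₂ * (N * suc (suc b) + 10 * k)) ∎)
      where
      open ℕ.≤-Reasoning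
      bound : k * (N * (N ∸ 1)) * totalWeight N u (d * (d ∸ 1)) (k * d) (x * k) ≤
        tourWeight K b (k * d) (x * k) * (N * suc (suc b) + 10 * k)
      bound = subst₂ (λ N K → k * (N * (N ∸ 1)) * totalWeight N u (d * (d ∸ 1)) (k * d) (x * k) ≤
        tourWeight K b (k * d) (x * k) * (N * suc (suc b) + 10 * k)) (sym N≡) (sym K≡) (weights-bound x d u b parity (leftover-0∨1 N))

    -- A fixed pair is selected in at least one way because 1 ≤ k ≤ K. Positivity permits the
    -- division that isolates the value at the tour.
    weight₂-pos : 0 < weight₂
    weight₂-pos = ℕ.*-mono-< {0} {2 * K} {0} (s≤s z≤n) (ℕ.≤-trans covered-pos (ℕ.≤-trans (ℕ.m≤m*n (C₁ + C₂) (suc (2 * b))) (ℕ.m≤n+m _ C₁)))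
      where
      covered-pos : 0 < C₁ + C₂
      covered-pos = subst (0 <_) (binomial-suc ⌊ n /2⌋ x) (binomial-pos (suc ⌊ n /2⌋) x (subst (x ≤_) (sym (ℕ.suc-injective K≡)) (ℕ.m≤m+n x d)))

-- The lower bound for a functional at one tour.

module TourBounds where

  open import Data.Bool as Bool using (Bool)
  open import Data.Fin as Fin using (Fin; zero; suc)
  open import Data.Fin.Permutation using (_⟨$⟩ʳ_)
  open import Data.Integer as ℤ using (+_)
  import Data.Integer.Properties as ℤ
  open import Data.List using (List; []; _∷_; length; lookup)
  open import Data.List.Membership.Propositional using (_∈_)
  open import Data.List.Relation.Unary.Any using (here; there)
  open import Data.Nat as ℕ using (ℕ; zero; suc; _^_; _∸_; _!; ⌊_/2⌋)
  import Data.Nat.Properties as ℕ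
  open import Data.Rational as ℚ using (ℚ; 1ℚ)
  import Data.Rational.Properties as ℚ
  open import Data.Rational.Unnormalised as ℚᵘ using (mkℚᵘ; *≡*)
  import Data.Rational.Unnormalised.Properties as ℚᵘ
  open import Data.Vec as Vec using (Vec; []; _∷_)
  open import Data.Vec.Relation.Unary.Unique.Propositional using (Unique)
  open import Function using (_∘_)
  open import Relation.Binary.PropositionalEquality as ≡ using (_≡_; cong)
  open import Relation.Nullary using (does)
  open import Defs using (next)
  open OrderedAlgebras
  open FiniteSums
  open TourRotations
  open BlockWalks
  open WalkCounts
  open StepCounts
  open PairSelections
  open RotatedPairings
  open WeightBounds
  open import Algebra.Bundles using (CommutativeRing)

  module ℚCasts = Casts (CommutativeRing.commutativeSemiring ℚ.+-*-commutativeRing)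

  toℚᵘ-ι : ∀ k → ℚ.toℚᵘ (ℚCasts.ι k) ℚᵘ.≃ + k ℚᵘ./ 1
  toℚᵘ-ι zero    = ℚᵘ.≃-refl
  toℚᵘ-ι (suc k) = ℚᵘ.≃-trans (ℚ.toℚᵘ-homo-+ 1ℚ (ℚCasts.ι k)) (ℚᵘ.≃-trans (ℚᵘ.+-congʳ ℚᵘ.1ℚᵘ (toℚᵘ-ι k))
    (*≡* (cong (λ t → (ℤ.1ℤ ℤ.* ℤ.1ℤ ℤ.+ t) ℤ.* ℤ.1ℤ) (ℤ.*-identityʳ (+ k)))))

  *-/-cancel : ∀ k n .{{_ : ℕ.NonZero k}} → ℚCasts.ι k ℚ.* (+ n ℚ./ k) ≡ ℚCasts.ι n
  *-/-cancel k@(suc k-1) n = ℚ.toℚᵘ-injective (ℚᵘ.≃-trans (ℚ.toℚᵘ-homo-* (ℚCasts.ι k) (+ n ℚ./ k))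
    (ℚᵘ.≃-trans (ℚᵘ.*-cong (toℚᵘ-ι k) (ℚ.toℚᵘ-fromℚᵘ (mkℚᵘ (+ n) k-1)))
      (ℚᵘ.≃-trans (*≡* cross) (ℚᵘ.≃-sym (toℚᵘ-ι n)))))
    where
    cross : + k ℤ.* + n ℤ.* + 1 ≡ + n ℤ.* + (1 ℕ.* k)
    cross = begin
      + k ℤ.* + n ℤ.* + 1       ≡⟨ ℤ.*-identityʳ (+ k ℤ.* + n) ⟩
      + k ℤ.* + n               ≡⟨ ℤ.*-comm (+ k) (+ n) ⟩
      + n ℤ.* + k               ≡⟨ cong (λ t → + n ℤ.* + t) (ℕ.*-identityˡ k) ⟨
      + n ℤ.* + (1 ℕ.* k)       ∎
      where open ≡.≡-Reasoning

  module OrderedSums (R : OrderedℚAlgebra) where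
    open OrderedℚAlgebra R hiding (sum)
    open Sums commutativeSemiring using ([_]; ∑; ∑-zero; ∑-suc; ∑L; ∑V)
    open Casts commutativeSemiring public using () renaming (ι to ν; ι-+ to ν-+; ι-* to ν-*; ι-1 to ν-1)
    open import Relation.Binary.Reasoning.Setoid setoid

    ν-ι : ∀ k → ν k ≈ ι (ℚCasts.ι k)
    ν-ι zero    = sym ι-0
    ν-ι (suc k) = trans (+-cong (sym ι-1) (ν-ι k)) (sym (ι-+ 1ℚ (ℚCasts.ι k)))

    +-nonNeg : ∀ {x y} → 0# ≤ x → 0# ≤ y → 0# ≤ x + y
    +-nonNeg 0≤x 0≤y = ≤-respˡ (+-identityˡ 0#) (+-mono-≤ 0≤x 0≤y)

    0≤1 : 0# ≤ 1#
    0≤1 = ≤-respʳ ι-1 (0≤ι (ℚ.nonNegative⁻¹ 1ℚ))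

    ν-nonNeg : ∀ k → 0# ≤ ν k
    ν-nonNeg zero    = ≤-refl
    ν-nonNeg (suc k) = +-nonNeg 0≤1 (ν-nonNeg k)

    ν-mono : ∀ {j k} → j ℕ.≤ k → ν j ≤ ν k
    ν-mono {j} {k} j≤k = ≤-respˡ (+-identityʳ (ν j)) (≤-respʳ (trans (sym (ν-+ j (k ∸ j))) (reflexive (cong ν (ℕ.m+[n∸m]≡n j≤k))))
      (+-mono-≤ ≤-refl (ν-nonNeg (k ∸ j))))

    [_]-nonNeg : ∀ c → 0# ≤ [ c ]
    [ Bool.true  ]-nonNeg = 0≤1
    [ Bool.false ]-nonNeg = ≤-refl

    ∑-nonNeg : ∀ {n} {f : Fin n → Carrier} → (∀ i → 0# ≤ f i) → 0# ≤ ∑ f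
    ∑-nonNeg {zero}  0≤f = ≤-respʳ (sym (∑-zero _)) ≤-refl
    ∑-nonNeg {suc n} 0≤f = ≤-respʳ (sym (∑-suc _)) (+-nonNeg (0≤f zero) (∑-nonNeg (0≤f ∘ suc)))

    ∑L-nonNeg : ∀ {A : Set} (xs : List A) {F : A → Carrier} → (∀ {x} → x ∈ xs → 0# ≤ F x) → 0# ≤ ∑L xs F
    ∑L-nonNeg []       0≤F = ≤-refl
    ∑L-nonNeg (x ∷ xs) 0≤F = +-nonNeg (0≤F (here ≡.refl)) (∑L-nonNeg xs (0≤F ∘ there))

    ∑V-nonNeg : ∀ {n} m {F : Vec (Fin n) m → Carrier} → (∀ v → 0# ≤ F v) → 0# ≤ ∑V m F
    ∑V-nonNeg zero    0≤F = 0≤F []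
    ∑V-nonNeg (suc m) 0≤F = ∑-nonNeg λ x → ∑V-nonNeg m λ v → 0≤F (x ∷ v)

    ν-*-/ : ∀ k n .{{_ : ℕ.NonZero k}} → ν k * ι (+ n ℚ./ k) ≈ ν n
    ν-*-/ k n = begin
      ν k * ι (+ n ℚ./ k)                     ≈⟨ *-congʳ (ν-ι k) ⟩
      ι (ℚCasts.ι k) * ι (+ n ℚ./ k)          ≈⟨ ι-* (ℚCasts.ι k) (+ n ℚ./ k) ⟨
      ι (ℚCasts.ι k ℚ.* (+ n ℚ./ k))          ≈⟨ reflexive (cong ι (*-/-cancel k n)) ⟩
      ι (ℚCasts.ι n)                          ≈⟨ ν-ι n ⟨
      ν n                                     ∎

    ν-inverse : ∀ k .{{_ : ℕ.NonZero k}} → ι (+ 1 ℚ./ k) * ν k ≈ 1#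
    ν-inverse k = trans (*-comm _ _) (trans (ν-*-/ k 1) ν-1)

    ν-cancel : ∀ k .{{_ : ℕ.NonZero k}} {x y} → ν k * x ≈ ν k * y → x ≈ y
    ν-cancel k {x} {y} eq = begin
      x                              ≈⟨ undo x ⟨
      ι (+ 1 ℚ./ k) * (ν k * x)      ≈⟨ *-congˡ eq ⟩
      ι (+ 1 ℚ./ k) * (ν k * y)      ≈⟨ undo y ⟩
      y                              ∎
      where
      undo : ∀ x → ι (+ 1 ℚ./ k) * (ν k * x) ≈ x
      undo x = trans (sym (*-assoc _ _ _)) (trans (*-congʳ (ν-inverse k)) (*-identityˡ x))

    1/-nonNeg : ∀ k .{{_ : ℕ.NonZero k}} → 0# ≤ ι (+ 1 ℚ./ k)
    1/-nonNeg k = 0≤ι (ℚ.nonNegative⁻¹ (+ 1 ℚ./ k) {{ℚ.normalize-nonNeg 1 k}})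

    ν-cancel-nonNeg : ∀ k .{{_ : ℕ.NonZero k}} {x} → 0# ≤ ν k * x → 0# ≤ x
    ν-cancel-nonNeg k {x} 0≤kx = ≤-respʳ (trans (sym (*-assoc _ _ _)) (trans (*-congʳ (ν-inverse k)) (*-identityˡ x)))
      (*-nonNeg (1/-nonNeg k) 0≤kx)

    mean : ∀ {A : Set} → List A → (A → Carrier) → Carrier
    mean []         f = 0#
    mean xs@(_ ∷ _) f = ι (+ 1 ℚ./ length xs) * OrderedℚAlgebra.sum R (f ∘ lookup xs)

    mean-scaled : ∀ {A : Set} (xs : List A) f → ν (length xs) * mean xs f ≈ OrderedℚAlgebra.sum R (f ∘ lookup xs)
    mean-scaled []         f = zeroˡ 0#
    mean-scaled xs@(_ ∷ _) f = trans (sym (*-assoc _ _ _)) (trans (*-congʳ (trans (*-comm _ _) (ν-inverse (length xs)))) (*-identityˡ _))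

    mean-nonNeg : ∀ {A : Set} (xs : List A) f → 0# ≤ OrderedℚAlgebra.sum R (f ∘ lookup xs) → 0# ≤ mean xs f
    mean-nonNeg []         f _   = ≤-refl
    mean-nonNeg xs@(_ ∷ _) f 0≤Σ = *-nonNeg (1/-nonNeg (length xs)) 0≤Σ

  module TourBound (R : OrderedℚAlgebra) where
    open OrderedℚAlgebra R hiding (sum)
    open OrderedSums R
    open Sums commutativeSemiring using ([_]; ∑; ∑L; ∑V)
    open Rotated commutativeSemiring
    open import Relation.Binary.Reasoning.Setoid setoid

    module _ (n x d b : ℕ) (K≡ : suc (suc ⌊ n /2⌋) ≡ suc x ℕ.+ d) (N≡ : 4 ℕ.+ n ≡ suc x ℕ.+ suc (suc b))
      (τ : Vec (Fin (4 ℕ.+ n)) (4 ℕ.+ n)) (τ! : Unique τ) (h : Fin (4 ℕ.+ n) → Fin (4 ℕ.+ n) → Carrier)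
      (h-sym : ∀ v w → h v w ≈ h w v) (h-diagonal : ∀ v → h v v ≈ 0#)
      (nonNeg : ∀ (p : Fin (4 ℕ.+ n) → Fin (4 ℕ.+ n)) p-involutive → Counting.pairs p p-involutive none ≡ 2 ℕ.* suc x →
        0# ≤ ∑V (4 ℕ.+ n) λ σ → [ does (contains? p σ) ] * ∑ λ t → h (Vec.lookup σ t) (Vec.lookup σ (next t)))
      where

      private
        k N : ℕ
        k = suc x
        N = suc (suc (suc (suc n)))

      open Weights n x d b K≡ N≡

      private
        form : Fin N → Vec Bool ⌊ N /2⌋ → Carrier
        form r bs = ∑ λ i → ∑ λ j → ν (pairWeight n k b bs i j) * h (rotation n k b τ τ! h h-sym h-diagonal r ⟨$⟩ʳ i) (rotation n k b τ τ! h h-sym h-diagonal r ⟨$⟩ʳ j)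

        -- The hypothesis for the rotated matching, rewritten by the tour count as a positive
        -- multiple of the form in positions; the multiple `N ℕ.* unit` is cancelled.
        form-nonNeg : ∀ r {bs} → bs ∈ choose ⌊ N /2⌋ k → 0# ≤ form r bs
        form-nonNeg r {bs} bs∈ = ≤-respʳ (pairForm n k b τ τ! h h-sym h-diagonal π bs s s≡ k≡ n≡ b≡)
          (ν-cancel-nonNeg (N ℕ.* unit) {{N*unit≢0}}
            (≤-respʳ (Casts.∑-tours commutativeSemiring p p-inv s k b s≡ k≡ n≡ b≡ h h-diagonal)
              (*-nonNeg (ν-nonNeg 4) (nonNeg p p-inv k≡))))
          where
          π = rotation n k b τ τ! h h-sym h-diagonal r
          p = matching π bs
          p-inv = matching-involutive π bs
          s = ℕΣ.∑ λ i → ℕΣ.[ uncovered N bs i ]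
          s≡ = singles-matching π bs
          k≡ = pairs-matching π bs k bs∈
          n≡ : N ≡ s ℕ.+ 2 ℕ.* k
          n≡ = ≡.sym (count-uncovered N k bs∈)
          -- The number of blocks is s + k = N - k, whatever the rotation and the selection; hence
          -- all forms share the same `b`.
          b≡ : s ℕ.+ k ≡ suc (suc b)
          b≡ = ℕ.+-cancelˡ-≡ k _ _ (≡.trans (≡.trans (ℕ.+-comm k (s ℕ.+ k)) (≡.trans (ℕ.+-assoc s k k) (cong (λ t → s ℕ.+ (k ℕ.+ t)) (≡.sym (ℕ.+-identityʳ k))))) (≡.trans (≡.sym n≡) N≡))
          open TourCounts p p-inv s k b s≡ k≡ n≡ b≡ using (unit)
          N*unit≢0 : ℕ.NonZero (N ℕ.* unit)
          N*unit≢0 = ℕ.m*n≢0 N unit {{_}} {{ℕ.m*n≢0 (2 ^ k) (b !) {{ℕ.m^n≢0 2 k}} {{b ℕ.!≢0}}}}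

      total-tourTotal-nonNeg : 0# ≤ ν weight₁ * (∑ λ v → ∑ λ w → h v w) + ν weight₂ * (∑ λ t → h (Vec.lookup τ t) (Vec.lookup τ (next t)))
      total-tourTotal-nonNeg = ≤-respʳ (∑-pairWeights n k b τ τ! h h-sym h-diagonal)
        (∑-nonNeg λ r → ∑L-nonNeg (choose ⌊ N /2⌋ k) (form-nonNeg r))

      -- Dividing by kN gives that the value at `τ` is at least 1 - a. The nonnegative combination
      -- of total and tour sum is multiplied by kN, the first weight is raised by `weights-≤`, and
      -- `weight₂` is cancelled.
      tour-bound : (∑ λ v → ∑ λ w → h v w) ≈ ν (N ∸ 1) →
        0# ≤ ν (k ℕ.* N) * (∑ λ t → h (Vec.lookup τ t) (Vec.lookup τ (next t))) + ν (N ℕ.* suc (suc b) ℕ.+ 10 ℕ.* k)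
      tour-bound total≈ = ν-cancel-nonNeg weight₂ {{ℕ.>-nonZero weight₂-pos}} (≤-trans (*-nonNeg (ν-nonNeg (k ℕ.* N)) total-tourTotal-nonNeg)
        (≤-respˡ lower (≤-respʳ upper (+-mono-≤ (ν-mono weights-≤) ≤-refl))))
        where
        A = ∑ λ t → h (Vec.lookup τ t) (Vec.lookup τ (next t))
        X = N ℕ.* suc (suc b) ℕ.+ 10 ℕ.* k
        lower : ν (k ℕ.* (N ℕ.* (N ∸ 1)) ℕ.* weight₁) + ν (k ℕ.* N) * (ν weight₂ * A) ≈
          ν (k ℕ.* N) * (ν weight₁ * (∑ λ v → ∑ λ w → h v w) + ν weight₂ * A)
        lower = sym (begin
          ν (k ℕ.* N) * (ν weight₁ * (∑ λ v → ∑ λ w → h v w) + ν weight₂ * A)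
            ≈⟨ distribˡ _ _ _ ⟩
          ν (k ℕ.* N) * (ν weight₁ * (∑ λ v → ∑ λ w → h v w)) + ν (k ℕ.* N) * (ν weight₂ * A)
            ≈⟨ +-congʳ (*-congˡ (*-congˡ total≈)) ⟩
          ν (k ℕ.* N) * (ν weight₁ * ν (N ∸ 1)) + ν (k ℕ.* N) * (ν weight₂ * A)
            ≈⟨ +-congʳ (trans (*-congˡ (sym (ν-* weight₁ (N ∸ 1)))) (sym (ν-* (k ℕ.* N) (weight₁ ℕ.* (N ∸ 1))))) ⟩
          ν (k ℕ.* N ℕ.* (weight₁ ℕ.* (N ∸ 1))) + ν (k ℕ.* N) * (ν weight₂ * A)
            ≈⟨ +-congʳ (reflexive (cong ν (regroup k N weight₁ (N ∸ 1)))) ⟩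
          ν (k ℕ.* (N ℕ.* (N ∸ 1)) ℕ.* weight₁) + ν (k ℕ.* N) * (ν weight₂ * A) ∎)
          where
          open import Data.Nat.Solver using (module +-*-Solver)
          regroup : ∀ k N w m → k ℕ.* N ℕ.* (w ℕ.* m) ≡ k ℕ.* (N ℕ.* m) ℕ.* w
          regroup = solve 4 (λ k N w m → k :* N :* (w :* m) := k :* (N :* m) :* w) ≡.refl
            where open +-*-Solver
        upper : ν (weight₂ ℕ.* X) + ν (k ℕ.* N) * (ν weight₂ * A) ≈ ν weight₂ * (ν (k ℕ.* N) * A + ν X)
        upper = sym (begin
          ν weight₂ * (ν (k ℕ.* N) * A + ν X)
            ≈⟨ distribˡ _ _ _ ⟩
          ν weight₂ * (ν (k ℕ.* N) * A) + ν weight₂ * ν X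
            ≈⟨ +-comm _ _ ⟩
          ν weight₂ * ν X + ν weight₂ * (ν (k ℕ.* N) * A)
            ≈⟨ +-cong (sym (ν-* weight₂ X)) (trans (sym (*-assoc _ _ _)) (trans (*-congʳ (*-comm _ _)) (*-assoc _ _ _))) ⟩
          ν (weight₂ ℕ.* X) + ν (k ℕ.* N) * (ν weight₂ * A) ∎)

-- Edges, incidence vectors and linear functionals.

module EdgeVectors where

  open import Algebra.Bundles using (CommutativeSemiring)
  import Algebra.Properties.CommutativeMonoid.Sum
  open import Algebra.Definitions.RawSemiring using ()
  open import Data.Bool as Bool using (Bool; true; false; _∧_; not)
  open import Data.Fin as Fin using (Fin; zero; suc; toℕ; inject; inject₁; fromℕ; Fin′)
  import Data.Fin.Properties as Fin
  open import Data.Fin.Relation.Unary.Top using (view; ‵fromℕ; ‵inject₁)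
  open import Data.List as List using (List)
  open import Data.List.Membership.Propositional using (_∈_)
  open import Data.List.Membership.Propositional.Properties using (∈-concat⁺′; ∈-tabulate⁺)
  open import Data.Nat as ℕ using (ℕ; zero; suc)
  import Data.Nat.Properties as ℕ
  open import Data.Product using (_×_; _,_)
  open import Data.Sum as Sum using (_⊎_; inj₁; inj₂)
  open import Data.Vec as Vec using (Vec)
  open import Data.Vec.Relation.Unary.Unique.Propositional using (Unique)
  open import Data.Vec.Relation.Unary.Unique.Propositional.Properties using (lookup-injective)
  open import Function using (_∘_; mk⇔)
  open import Level using (0ℓ)
  open import Relation.Binary using (tri<; tri≈; tri>)
  open import Relation.Binary.PropositionalEquality as ≡ using (_≡_; _≢_; refl; sym; trans; cong; subst)
  open import Relation.Nullary using (Dec; does; yes; no; ¬_; ¬?)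
  open import Relation.Nullary.Decidable using (does-⇔; dec-true; dec-false; _×-dec_; _⊎-dec_; _→-dec_)
  open import Relation.Nullary.Negation using (contradiction)
  open import Defs using (next; Edge; uses?; Uses; foldEdges)
  open FiniteSums
  open Cycles
  open TourRotations
  open BlockWalks
  open WalkCounts
  open StepCounts

  -- False for two vertices. It prevents a tour from using one edge in both directions, so that each
  -- edge belongs to a single step.
  next² : ∀ {m} (t : Fin (suc (suc (suc m)))) → next (next t) ≢ t
  next² {m} t eq with view t
  ... | ‵fromℕ with () ← trans (sym (cong next (next-fromℕ (suc (suc m))))) eq
  ... | ‵inject₁ i with view i
  ...   | ‵fromℕ with () ← trans (sym (trans (cong next (next-inject₁ (fromℕ (suc m)))) (next-fromℕ (suc (suc m))))) eq
  ...   | ‵inject₁ j = ℕ.<⇒≢ (ℕ.m≤n⇒m≤1+n ℕ.≤-refl) (trans (sym toℕ-two) (sym toℕ-next))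
    where
    toℕ-two : toℕ (inject₁ (inject₁ j)) ≡ toℕ j
    toℕ-two = trans (Fin.toℕ-inject₁ (inject₁ j)) (Fin.toℕ-inject₁ j)
    toℕ-next : suc (suc (toℕ j)) ≡ toℕ (inject₁ (inject₁ j))
    toℕ-next = trans (trans (cong (toℕ ∘ suc) (sym (next-inject₁ j))) (cong toℕ step)) (cong toℕ eq)
      where
      step : suc (next (inject₁ j)) ≡ next (next (inject₁ (inject₁ j)))
      step = trans (cong suc (next-inject₁ j)) (sym (trans (cong next (next-inject₁ (inject₁ j))) (next-inject₁ (suc j))))

  -- The second components are compared as numbers because their types differ unless the first
  -- components agree.
  isEdge : ∀ {n} → Edge n → Edge n → Bool
  isEdge (j , i) (j′ , i′) = does (j′ Fin.≟ j) ∧ does (toℕ i′ ℕ.≟ toℕ i)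

  allEdges : ∀ n → List (Edge n)
  allEdges n = List.concat (List.tabulate {n = n} λ j → List.tabulate λ i → (j , i))

  ∈-allEdges : ∀ {n} (e : Edge n) → e ∈ allEdges n
  ∈-allEdges (j , i) = ∈-concat⁺′ (∈-tabulate⁺ i) (∈-tabulate⁺ {f = λ j → List.tabulate λ i → (j , i)} j)

  -- The exponents of the product of the coordinates of the matching edges. Each pair is read off at
  -- its smaller end, and a fixed point gives nothing since `inject i` is never `j`.
  matchingMonomial : ∀ {n} → (Fin n → Fin n) → Edge n → ℕ
  matchingMonomial p (j , i) = ℕΣ.[ does (p (inject i) Fin.≟ j) ]

  module Edges (S : CommutativeSemiring 0ℓ 0ℓ) where
    open CommutativeSemiring S hiding (zero; refl; sym; trans)
    open Sums S
    open Casts S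
    open import Relation.Binary.Reasoning.Setoid setoid
    private module S = CommutativeSemiring S

    ≟-flip : ∀ {n} (x y : Fin n) → [ does (x Fin.≟ y) ] ≈ [ does (y Fin.≟ x) ]
    ≟-flip x y = [⇔] (x Fin.≟ y) (y Fin.≟ x) (mk⇔ sym sym)

    ∑E : ∀ {n} → (Edge n → Carrier) → Carrier
    ∑E {n} f = ∑ λ (j : Fin n) → ∑ λ (i : Fin′ j) → f (j , i)

    foldEdges-∑E : ∀ {n} (f : Edge n → Carrier) → foldEdges +-rawMonoid f ≈ ∑E f
    foldEdges-∑E f = S.trans (reflexive (sym (∑≡sum _))) (∑-cong λ j → reflexive (sym (∑≡sum λ i → f (j , i))))

    -- The zero vector if v ≡ w.
    ε : ∀ {n} → Fin n → Fin n → Edge n → Carrier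
    ε v w (j , i) = [ does (inject i Fin.≟ v) ] * [ does (j Fin.≟ w) ] + [ does (inject i Fin.≟ w) ] * [ does (j Fin.≟ v) ]

    ε-sym : ∀ {n} (v w : Fin n) e → ε v w e ≈ ε w v e
    ε-sym v w e = +-comm _ _

    ε-diagonal : ∀ {n} (v : Fin n) e → ε v v e ≈ 0#
    ε-diagonal v (j , i) = S.trans (+-cong vanish vanish) (+-identityˡ 0#)
      where
      vanish : [ does (inject i Fin.≟ v) ] * [ does (j Fin.≟ v) ] ≈ 0#
      vanish with inject i Fin.≟ v | j Fin.≟ v
      ... | yes i≡v | yes j≡v = contradiction (trans i≡v (sym j≡v)) (inject≢ i)
      ... | yes _   | no _    = zeroʳ _
      ... | no _    | _       = zeroˡ _

    -- The passage between sums over edges and sums over ordered pairs, by splitting off the first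
    -- row and column of a square.
    ∑-triangle : ∀ {n} (f : Fin n → Fin n → Carrier) →
      (∑ λ (j : Fin n) → ∑ λ (i : Fin′ j) → f (inject i) j + f j (inject i)) + (∑ λ j → f j j) ≈ ∑ λ j → ∑ λ i → f i j
    ∑-triangle {zero}  f = S.trans (+-cong (∑-zero _) (∑-zero _)) (S.trans (+-identityˡ 0#) (S.sym (∑-zero _)))
    ∑-triangle {suc n} f = begin
      (∑ λ (j : Fin (suc n)) → ∑ λ (i : Fin′ j) → f (inject i) j + f j (inject i)) + (∑ λ j → f j j)
        ≈⟨ +-cong (S.trans (∑-suc _) (S.trans (+-cong (∑-zero _) (∑-cong λ j → ∑-suc _)) (+-identityˡ _))) (∑-suc _) ⟩
      (∑ λ (j : Fin n) → f zero (suc j) + f (suc j) zero + (∑ λ (i : Fin′ j) → f (suc (inject i)) (suc j) + f (suc j) (suc (inject i))))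
        + (f zero zero + (∑ λ j → f (suc j) (suc j)))
        ≈⟨ +-congʳ (S.trans (∑-+ _ _) (+-congʳ (∑-+ (λ j → f zero (suc j)) (λ j → f (suc j) zero)))) ⟩
      ((∑ λ j → f zero (suc j)) + (∑ λ j → f (suc j) zero)) + T + (f zero zero + (∑ λ j → f (suc j) (suc j)))
        ≈⟨ regroup (∑ λ j → f zero (suc j)) (∑ λ j → f (suc j) zero) T (f zero zero) (∑ λ j → f (suc j) (suc j)) ⟩
      f zero zero + (∑ λ j → f (suc j) zero) + ((∑ λ j → f zero (suc j)) + (T + (∑ λ j → f (suc j) (suc j))))
        ≈⟨ +-cong (S.sym (∑-suc λ i → f i zero)) (+-congˡ (∑-triangle λ i j → f (suc i) (suc j))) ⟩
      (∑ λ i → f i zero) + ((∑ λ j → f zero (suc j)) + (∑ λ j → ∑ λ i → f (suc i) (suc j)))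
        ≈⟨ +-congˡ (S.trans (S.sym (∑-+ _ _)) (∑-cong λ j → S.sym (∑-suc λ i → f i (suc j)))) ⟩
      (∑ λ i → f i zero) + (∑ λ j → ∑ λ i → f i (suc j))
        ≈⟨ ∑-suc (λ j → ∑ λ i → f i j) ⟨
      (∑ λ j → ∑ λ i → f i j) ∎
      where
      T = ∑ λ (j : Fin n) → ∑ λ (i : Fin′ j) → f (suc (inject i)) (suc j) + f (suc j) (suc (inject i))
      open import Algebra.Solver.CommutativeMonoid +-commutativeMonoid using (solve; _⊕_; _⊜_)
      regroup : ∀ a b t c d → a + b + t + (c + d) ≈ c + b + (a + (t + d))
      regroup = solve 5 (λ a b t c d → ((a ⊕ b) ⊕ t) ⊕ (c ⊕ d) ⊜ (c ⊕ b) ⊕ (a ⊕ (t ⊕ d))) S.refl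

    ∑∑-δ : ∀ {n} (v w : Fin n) → (∑ λ j → ∑ λ i → [ does (i Fin.≟ v) ] * [ does (j Fin.≟ w) ]) ≈ 1#
    ∑∑-δ v w = S.trans (∑-cong λ j → S.trans (∑-δ v λ _ → [ does (j Fin.≟ w) ]) S.refl) (∑-1 w)

    ∑E-ε : ∀ {n} (v w : Fin n) → v ≢ w → ∑E (ε v w) ≈ 1#
    ∑E-ε v w v≢w = begin
      ∑E (ε v w)
        ≈⟨ ∑-cong (λ j → ∑-cong λ i → +-congˡ (*-comm _ _)) ⟩
      (∑ λ j → ∑ λ (i : Fin′ j) → f (inject i) j + f j (inject i))
        ≈⟨ +-identityʳ _ ⟨
      (∑ λ j → ∑ λ (i : Fin′ j) → f (inject i) j + f j (inject i)) + 0#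
        ≈⟨ +-congˡ (∑-0 diagonal) ⟨
      (∑ λ j → ∑ λ (i : Fin′ j) → f (inject i) j + f j (inject i)) + (∑ λ j → f j j)
        ≈⟨ ∑-triangle f ⟩
      (∑ λ j → ∑ λ i → f i j)
        ≈⟨ ∑∑-δ v w ⟩
      1# ∎
      where
      f : Fin _ → Fin _ → Carrier
      f i j = [ does (i Fin.≟ v) ] * [ does (j Fin.≟ w) ]
      diagonal : ∀ j → f j j ≈ 0#
      diagonal j with j Fin.≟ v | j Fin.≟ w
      ... | yes j≡v | yes j≡w = contradiction (trans (sym j≡v) j≡w) v≢w
      ... | yes _   | no _    = zeroʳ _
      ... | no _    | _       = zeroˡ _

    ∑∑-ε : ∀ {n} (e : Edge n) → (∑ λ v → ∑ λ w → ε v w e) ≈ ι 2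
    ∑∑-ε (j , i) = begin
      (∑ λ v → ∑ λ w → ε v w (j , i))
        ≈⟨ S.trans (∑-cong λ v → ∑-+ _ _) (∑-+ _ _) ⟩
      (∑ λ v → ∑ λ w → [ does (inject i Fin.≟ v) ] * [ does (j Fin.≟ w) ]) + (∑ λ v → ∑ λ w → [ does (inject i Fin.≟ w) ] * [ does (j Fin.≟ v) ])
        ≈⟨ +-cong (S.trans (∑-cong λ v → ∑-cong λ w → S.trans (*-comm _ _) (*-cong (≟-flip j w) (≟-flip (inject i) v))) (∑∑-δ j (inject i)))
                  (S.trans (∑-cong λ v → ∑-cong λ w → *-cong (≟-flip (inject i) w) (≟-flip j v)) (∑∑-δ (inject i) j)) ⟩
      1# + 1#
        ≈⟨ +-congˡ (S.sym ι-1) ⟩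
      ι 2 ∎

    ∑-any : ∀ {n} {Q : Fin n → Set} (Q? : ∀ t → Dec (Q t)) → (∀ {s t} → Q s → Q t → s ≡ t) →
      [ does (Fin.any? Q?) ] ≈ ∑ λ t → [ does (Q? t) ]
    ∑-any Q? unique with Fin.any? Q?
    ... | yes (t , q) = S.sym (S.trans (∑-cong λ s → [⇔] (Q? s) (s Fin.≟ t) (mk⇔ (λ q′ → unique q′ q) λ { refl → q })) (∑-1 t))
    ... | no ¬q = S.sym (∑-0 λ t → reflexive (cong [_] (dec-false (Q? t) λ q → ¬q (t , q))))

    [∨] : ∀ {P Q : Set} (P? : Dec P) (Q? : Dec Q) → (P → Q → Bool.T false) → [ does (P? ⊎-dec Q?) ] ≈ [ does P? ] + [ does Q? ]
    [∨] (yes p) (yes q) excl = contradiction (excl p q) λ ()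
    [∨] (yes p) (no _)  _    = S.sym (+-identityʳ 1#)
    [∨] (no _)  (yes _) _    = S.sym (+-identityˡ 1#)
    [∨] (no _)  (no _)  _    = S.sym (+-identityˡ 0#)

    -- The indicator that some step uses the edge becomes a sum because at most one step does: two
    -- in the same direction start at the same vertex, and two in opposite directions would follow
    -- each other both ways, contrary to `next²`.
    edges-ε : ∀ {m} (σ : Vec (Fin (suc (suc (suc m)))) (suc (suc (suc m)))) → Unique σ → ∀ e →
      [ edges σ e ] ≈ ∑ λ t → ε (Vec.lookup σ t) (Vec.lookup σ (next t)) e
    edges-ε σ σ! (j , i) = begin
      [ edges σ (j , i) ]
        ≈⟨ ∑-any step? (λ {s} {t} → step-unique {s} {t}) ⟩
      (∑ λ t → [ does (step? t) ])
        ≈⟨ ∑-cong (λ t → S.trans ([∨] (forward? t) (backward? t) (exclusive t)) (+-cong (pair (inject i) j t) (S.trans (pair j (inject i) t) (*-comm _ _)))) ⟩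
      (∑ λ t → ε (Vec.lookup σ t) (Vec.lookup σ (next t)) (j , i)) ∎
      where
      forward? : ∀ t → Dec (Vec.lookup σ t ≡ inject i × Vec.lookup σ (next t) ≡ j)
      forward? t = Vec.lookup σ t Fin.≟ inject i ×-dec Vec.lookup σ (next t) Fin.≟ j
      backward? : ∀ t → Dec (Vec.lookup σ t ≡ j × Vec.lookup σ (next t) ≡ inject i)
      backward? t = Vec.lookup σ t Fin.≟ j ×-dec Vec.lookup σ (next t) Fin.≟ inject i
      step? : ∀ t → Dec ((Vec.lookup σ t ≡ inject i × Vec.lookup σ (next t) ≡ j) ⊎ (Vec.lookup σ t ≡ j × Vec.lookup σ (next t) ≡ inject i))
      step? t = forward? t ⊎-dec backward? t
      injective : ∀ {s t v} → Vec.lookup σ s ≡ v → Vec.lookup σ t ≡ v → s ≡ t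
      injective p q = lookup-injective σ! _ _ (trans p (sym q))
      step-unique : ∀ {s t} → _ → _ → s ≡ t
      step-unique (inj₁ (p , _)) (inj₁ (q , _)) = injective p q
      step-unique (inj₂ (p , _)) (inj₂ (q , _)) = injective p q
      step-unique {s} (inj₁ (p , p′)) (inj₂ (q , q′)) = contradiction (trans (cong next (injective p′ q)) (injective q′ p)) (next² s)
      step-unique {s} (inj₂ (p , p′)) (inj₁ (q , q′)) = contradiction (trans (cong next (injective p′ q)) (injective q′ p)) (next² s)
      exclusive : ∀ t → _ → _ → Bool.T false
      exclusive t (p , _) (q , _) = contradiction (trans (sym p) q) (inject≢ i)
      pair : ∀ v w t → [ does (Vec.lookup σ t Fin.≟ v ×-dec Vec.lookup σ (next t) Fin.≟ w) ] ≈ [ does (v Fin.≟ Vec.lookup σ t) ] * [ does (w Fin.≟ Vec.lookup σ (next t)) ]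
      pair v w t = S.trans ([∧] (does (Vec.lookup σ t Fin.≟ v)) (does (Vec.lookup σ (next t) Fin.≟ w))) (*-cong (≟-flip _ v) (≟-flip _ w))

    ∑E-edges : ∀ {m} (σ : Vec (Fin (suc (suc (suc m)))) (suc (suc (suc m)))) → Unique σ →
      ∑E (λ e → [ edges σ e ]) ≈ ι (suc (suc (suc m)))
    ∑E-edges {m} σ σ! = begin
      ∑E (λ e → [ edges σ e ])
        ≈⟨ ∑-cong (λ j → ∑-cong λ i → edges-ε σ σ! (j , i)) ⟩
      ∑E (λ e → ∑ λ t → ε (Vec.lookup σ t) (Vec.lookup σ (next t)) e)
        ≈⟨ S.trans (∑-cong λ j → ∑-swap _) (∑-swap _) ⟩
      (∑ λ t → ∑E (ε (Vec.lookup σ t) (Vec.lookup σ (next t))))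
        ≈⟨ ∑-cong (λ t → ∑E-ε _ _ λ eq → let fixed = lookup-injective σ! t (next t) eq in
             next² t (trans (cong next (sym fixed)) (sym fixed))) ⟩
      (∑ {suc (suc (suc m))} λ t → 1#)
        ≈⟨ S.trans (∑-const (suc (suc (suc m))) 1#) (*-identityʳ _) ⟩
      ι (suc (suc (suc m))) ∎

    ∑E-δ : ∀ {n} (e : Edge n) (f : Edge n → Carrier) → ∑E (λ e′ → [ isEdge e e′ ] * f e′) ≈ f e
    ∑E-δ (j , i) f = begin
      ∑E (λ e′ → [ isEdge (j , i) e′ ] * f e′)
        ≈⟨ ∑-cong (λ j′ → S.trans (∑-cong λ i′ → S.trans (*-congʳ ([∧] (does (j′ Fin.≟ j)) (does (toℕ i′ ℕ.≟ toℕ i)))) (*-assoc _ _ _))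
             (∑-*ˡ [ does (j′ Fin.≟ j) ] λ i′ → [ does (toℕ i′ ℕ.≟ toℕ i) ] * f (j′ , i′))) ⟩
      (∑ λ j′ → [ does (j′ Fin.≟ j) ] * ∑ λ (i′ : Fin′ j′) → [ does (toℕ i′ ℕ.≟ toℕ i) ] * f (j′ , i′))
        ≈⟨ ∑-δ j (λ j′ → ∑ λ (i′ : Fin′ j′) → [ does (toℕ i′ ℕ.≟ toℕ i) ] * f (j′ , i′)) ⟩
      (∑ λ (i′ : Fin′ j) → [ does (toℕ i′ ℕ.≟ toℕ i) ] * f (j , i′))
        ≈⟨ ∑-cong (λ i′ → *-congʳ ([⇔] (toℕ i′ ℕ.≟ toℕ i) (i′ Fin.≟ i) (mk⇔ Fin.toℕ-injective (cong toℕ)))) ⟩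
      (∑ λ (i′ : Fin′ j) → [ does (i′ Fin.≟ i) ] * f (j , i′))
        ≈⟨ ∑-δ i (λ i′ → f (j , i′)) ⟩
      f (j , i) ∎

    open import Algebra.Definitions.RawSemiring rawSemiring using (_^_)
    private module ∏ = Algebra.Properties.CommutativeMonoid.Sum *-commutativeMonoid

    ∏-1 : ∀ {n} (f : Fin n → Carrier) → (∀ i → f i ≈ 1#) → ∏.sum f ≈ 1#
    ∏-1 {n} f f≈1 = S.trans (∏.sum-cong-≋ f≈1) (∏.sum-replicate-zero n)

    ∏-0 : ∀ {n} (f : Fin n → Carrier) i → f i ≈ 0# → ∏.sum f ≈ 0#
    ∏-0 {suc n} f i fᵢ≈0 = S.trans (∏.sum-remove {i = i} f) (S.trans (*-congʳ fᵢ≈0) (zeroˡ _))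

    -- On a 0/1 vector the product is 1 if all matching edges are present and has a zero factor
    -- otherwise. The missing edge is found by a decidable search over the vertices.
    monomial-contains : ∀ {n} (p : Fin n → Fin n) (p-involutive : ∀ v → p (p v) ≡ v) σ → Unique σ →
      foldEdges *-rawMonoid (λ e → [ edges σ e ] ^ matchingMonomial p e) ≈ [ does (contains? p σ) ]
    monomial-contains {n} p p-involutive σ σ! = cases (contains? p σ)
      where
      factor : Edge n → Carrier
      factor e = [ edges σ e ] ^ matchingMonomial p e

      factor-1 : Contains p σ → ∀ e → factor e ≈ 1#
      factor-1 (_ , adj) (j , i) with p (inject i) Fin.≟ j
      ... | no _     = S.refl
      ... | yes eq   = S.trans (*-identityʳ _) (reflexive (cong [_] (dec-true (uses? σ (j , i))
        (subst (Adj σ (inject i)) eq (adj (inject i) λ fixed → inject≢ i (trans (sym fixed) eq))))))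

      factor-0 : ∀ j i → p (inject i) ≡ j → ¬ Uses σ (j , i) → factor (j , i) ≈ 0#
      factor-0 j i eq ¬uses with p (inject i) Fin.≟ j
      ... | no ≢j = contradiction eq ≢j
      ... | yes _ = S.trans (*-identityʳ _) (reflexive (cong [_] (dec-false (uses? σ (j , i)) ¬uses)))

      zero-factor : ∀ j i → p (inject i) ≡ j → ¬ Uses σ (j , i) → foldEdges *-rawMonoid factor ≈ 0#
      zero-factor j i eq ¬uses = ∏-0 _ j (∏-0 _ i (factor-0 j i eq ¬uses))

      missing : ∀ v → p v ≢ v → ¬ Adj σ v (p v) → foldEdges *-rawMonoid factor ≈ 0#
      missing v pv≢v ¬adj with Fin.<-cmp v (p v)
      ... | tri≈ _ v≡pv _ = contradiction (sym v≡pv) pv≢v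
      ... | tri< v<pv _ _ with inject-surjective v<pv
      ...   | i , eq = zero-factor (p v) i (cong p eq) λ uses → ¬adj (subst (λ u → Adj σ u (p v)) eq uses)
      missing v pv≢v ¬adj | tri> _ _ pv<v with inject-surjective pv<v
      ...   | i , eq = zero-factor v i (trans (cong p eq) (p-involutive v)) λ uses → ¬adj (subst (Adj σ v) eq (Adj-sym σ uses))

      cases : (d : Dec (Contains p σ)) → foldEdges *-rawMonoid factor ≈ [ does d ]
      cases (yes c) = ∏-1 _ λ j → ∏-1 _ λ i → factor-1 c (j , i)
      cases (no ¬c) =
        let v , ¬imp = Fin.¬∀⟶∃¬ n _ (λ v → ¬? (p v Fin.≟ v) →-dec adj? σ v (p v)) (λ all → ¬c (σ! , all))
        in missing v (λ pv≡v → ¬imp λ pv≢v → contradiction pv≡v pv≢v) (λ adj → ¬imp λ _ → adj)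

  module Functionals (S : CommutativeSemiring 0ℓ 0ℓ) where
    open CommutativeSemiring S hiding (zero; refl; sym; trans)
    open Sums S
    open Edges S
    open import Relation.Binary.Reasoning.Setoid setoid
    private module S = CommutativeSemiring S

    record LinearFunctional (n : ℕ) : Set where
      field
        ⟪_⟫    : (Edge n → Carrier) → Carrier
        ⟪⟫-cong : ∀ {x y} → (∀ e → x e ≈ y e) → ⟪ x ⟫ ≈ ⟪ y ⟫
        ⟪⟫-0    : ⟪ (λ _ → 0#) ⟫ ≈ 0#
        ⟪⟫-+    : ∀ x y → ⟪ (λ e → x e + y e) ⟫ ≈ ⟪ x ⟫ + ⟪ y ⟫
        ⟪⟫-*    : ∀ a x → ⟪ (λ e → a * x e) ⟫ ≈ a * ⟪ x ⟫

      ⟪⟫-∑ : ∀ {m} (xs : Fin m → Edge n → Carrier) → ⟪ (λ e → ∑ λ t → xs t e) ⟫ ≈ ∑ λ t → ⟪ xs t ⟫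
      ⟪⟫-∑ {zero}  xs = S.trans (⟪⟫-cong λ e → ∑-zero _) (S.trans ⟪⟫-0 (S.sym (∑-zero _)))
      ⟪⟫-∑ {suc m} xs = S.trans (⟪⟫-cong λ e → ∑-suc _) (S.trans (⟪⟫-+ (xs zero) _) (S.trans (+-congˡ (⟪⟫-∑ (xs ∘ suc))) (S.sym (∑-suc _))))

      edgeValue : Fin n → Fin n → Carrier
      edgeValue v w = ⟪ ε v w ⟫

      edgeValue-sym : ∀ v w → edgeValue v w ≈ edgeValue w v
      edgeValue-sym v w = ⟪⟫-cong (ε-sym v w)

      edgeValue-diagonal : ∀ v → edgeValue v v ≈ 0#
      edgeValue-diagonal v = S.trans (⟪⟫-cong (ε-diagonal v)) ⟪⟫-0

    open LinearFunctional

    ⟪edges⟫ : ∀ {m} (G : LinearFunctional (suc (suc (suc m)))) σ → Unique σ →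
      ⟪ G ⟫ (λ e → [ edges σ e ]) ≈ ∑ λ t → edgeValue G (Vec.lookup σ t) (Vec.lookup σ (next t))
    ⟪edges⟫ G σ σ! = S.trans (⟪⟫-cong G (edges-ε σ σ!)) (⟪⟫-∑ G λ t → ε (Vec.lookup σ t) (Vec.lookup σ (next t)))

  module _ {n : ℕ} (p : Fin n → Fin n) (p-involutive : ∀ v → p (p v) ≡ v) where
    open ℕΣ
    open Edges ℕ.+-*-commutativeSemiring using (∑E; foldEdges-∑E; ∑-triangle; ≟-flip)
    open Counting p p-involutive
    open ≡.≡-Reasoning

    -- The permutation matrix of `p` has one entry 1 per row, is symmetric since `p` is an
    -- involution, and has the fixed points on its diagonal. Hence twice the number of edges plus
    -- the number of fixed points is `n`.
    degree-matchingMonomial : ∀ k → pairs none ≡ 2 ℕ.* k → foldEdges ℕ.+-0-rawMonoid (matchingMonomial p) ≡ k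
    degree-matchingMonomial k k≡ = trans (foldEdges-∑E μ) (ℕ.*-cancelˡ-≡ _ _ 2 (ℕ.+-cancelʳ-≡ (singles none) _ _ (begin
      2 ℕ.* ∑E μ ℕ.+ singles none
        ≡⟨ cong (ℕ._+ singles none) (trans (sym (∑-*ˡ 2 λ j → ∑ λ (i : Fin′ j) → μ (j , i))) (∑-cong λ j → trans (sym (∑-*ˡ 2 λ (i : Fin′ j) → μ (j , i))) (∑-cong λ i → double j i))) ⟩
      (∑ λ j → ∑ λ (i : Fin′ j) → f (inject i) j ℕ.+ f j (inject i)) ℕ.+ (∑ λ j → f j j)
        ≡⟨ ∑-triangle f ⟩
      (∑ λ j → ∑ λ i → f i j)
        ≡⟨ trans (∑-swap (λ j i → f i j)) (∑-cong λ i → trans (∑-cong λ j → ≟-flip (p i) j) (∑-1 (p i))) ⟩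
      (∑ {n} λ i → 1)
        ≡⟨ ∑-cong (λ i → sym (complement (single? i))) ⟩
      (∑ λ i → [ not (single? i) ] ℕ.+ [ single? i ])
        ≡⟨ ∑-+ (λ i → [ not (single? i) ]) (λ i → [ single? i ]) ⟩
      pairs none ℕ.+ singles none
        ≡⟨ cong (ℕ._+ singles none) k≡ ⟩
      2 ℕ.* k ℕ.+ singles none ∎)))
      where
      μ : Edge n → ℕ
      μ = matchingMonomial p
      f : Fin n → Fin n → ℕ
      f i j = [ does (p i Fin.≟ j) ]
      double : ∀ j (i : Fin′ j) → 2 ℕ.* μ (j , i) ≡ f (inject i) j ℕ.+ f j (inject i)
      double j i = cong (f (inject i) j ℕ.+_) (trans (ℕ.+-identityʳ _) (cong [_] (does-⇔
        (mk⇔ (λ eq → trans (cong p (sym eq)) (p-involutive (inject i))) (λ eq → trans (cong p (sym eq)) (p-involutive j)))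
        (p (inject i) Fin.≟ j) (p j Fin.≟ inject i))))
      complement : ∀ c → [ not c ] ℕ.+ [ c ] ≡ 1
      complement true  = refl
      complement false = refl

-- Averages over all Hamiltonian cycles.

module CycleAverages where

  open import Algebra.Bundles using (CommutativeSemiring)
  import Algebra.Properties.CommutativeMonoid.Sum
  open import Data.Bool as Bool using (Bool; true; false; not)
  open import Data.Fin as Fin using (Fin; zero; suc)
  import Data.Fin.Properties as Fin
  open import Data.List as List using (List; []; _∷_; length)
  open import Data.List.Membership.Propositional using (_∈_)
  open import Data.Nat as ℕ using (ℕ; zero; suc; _∸_; _!; ⌊_/2⌋)
  import Data.Nat.Properties as ℕ
  open import Data.Nat.Solver using (module +-*-Solver)
  open import Data.Product using (_,_; proj₁)
  open import Data.Vec as Vec using (Vec)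
  open import Data.Vec.Relation.Unary.Unique.Propositional using (Unique)
  open import Data.Vec.Relation.Unary.Unique.Propositional.Properties using (lookup-injective)
  open import Function using (_∘_; mk⇔; id)
  open import Relation.Binary.PropositionalEquality as ≡ using (_≡_; cong; cong₂)
  open import Relation.Nullary using (Dec; does; yes; no)
  open import Relation.Nullary.Decidable using (does-⇔; dec-true; dec-false)
  open import Relation.Nullary.Negation using (contradiction)
  open import Defs using (next; Edge; foldEdges; sameEdges?)
  open OrderedAlgebras
  open FiniteSums
  open Cycles
  open TourRotations
  open BlockWalks
  open WalkCounts
  open StepCounts
  open TourBounds
  open EdgeVectors

  module CycleSums (R : OrderedℚAlgebra) where
    open OrderedℚAlgebra R hiding (sum)
    open OrderedSums R
    open Sums commutativeSemiring using ([_]; [⇔]; []-*-cong; *-swap; ∑; ∑-cong; ∑-*ˡ; ∑-+; ∑-1; ∑L; ∑V; ∑V-cong; ∑V-*ʳ; distinct)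
    open Casts commutativeSemiring using (∑-const; ι-∑; ι-[]; ∑-tours)
    open Fibres commutativeSemiring
    open Edges commutativeSemiring
    open Functionals commutativeSemiring
    open LinearFunctional
    open import Algebra.Definitions.RawSemiring (CommutativeSemiring.rawSemiring commutativeSemiring) using () renaming (_^_ to _^ᴿ_)
    open import Relation.Binary.Reasoning.Setoid setoid
    private module ∏ = Algebra.Properties.CommutativeMonoid.Sum *-commutativeMonoid

    ∑L-1 : ∀ {A : Set} (xs : List A) → ∑L xs (λ _ → 1#) ≈ ν (length xs)
    ∑L-1 []       = refl
    ∑L-1 (x ∷ xs) = +-congˡ (∑L-1 xs)

    point : ∀ {n} → (Edge n → Bool) → Edge n → Carrier
    point χ e = [ χ e ]

    module _ (m : ℕ) where
      private
        N u : ℕ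
        N = suc (suc (suc m))
        u = N ℕ.* suc m !

        instance
          u≢0 : ℕ.NonZero u
          u≢0 = ℕ.m*n≢0 N (suc m !) {{_}} {{suc m ℕ.!≢0}}

      D : List (Edge N → Bool)
      D = cycles N

      φ : Carrier
      φ = fibreSize N

      -- The tour count for the empty matching, encoded by `id`: all blocks are single, all step
      -- weights are 4, and so each ordered pair of distinct vertices is a step of N (N - 2)! tours,
      -- counted with multiplicity.
      ∑-distinct : ∀ (h : Fin N → Fin N → Carrier) → (∀ v → h v v ≈ 0#) →
        (∑V N λ σ → [ distinct σ ] * ∑ λ t → h (Vec.lookup σ t) (Vec.lookup σ (next t))) ≈ ν u * ∑ λ v → ∑ λ w → h v w
      ∑-distinct h h-diagonal = ν-cancel 4 (begin
        ν 4 * (∑V N λ σ → [ distinct σ ] * steps σ)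
          ≈⟨ *-congˡ (∑V-cong N λ σ → *-congʳ {steps σ} ([⇔] (unique? σ) (contains? id σ) (mk⇔ (λ σ! → σ! , λ v v≢v → contradiction ≡.refl v≢v) proj₁))) ⟩
        ν 4 * (∑V N λ σ → [ does (contains? id σ) ] * steps σ)
          ≈⟨ ∑-tours id (λ _ → ≡.refl) N 0 (suc m) singles≡ pairs≡ (≡.sym (ℕ.+-identityʳ N)) (ℕ.+-identityʳ N) h h-diagonal ⟩
        ν (N ℕ.* TC.unit) * (∑ λ v → ∑ λ w → ν (TC.stepWeight v w) * h v w)
          ≈⟨ *-cong (reflexive (cong (λ t → ν (N ℕ.* t)) (ℕ.*-identityˡ (suc m !))))
               (trans (∑-cong λ v → trans (∑-cong λ w → *-congʳ (reflexive (cong ν (weight≡4 v w)))) (∑-*ˡ (ν 4) (h v))) (∑-*ˡ (ν 4) _)) ⟩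
        ν u * (ν 4 * (∑ λ v → ∑ λ w → h v w))
          ≈⟨ *-swap _ _ _ ⟩
        ν 4 * (ν u * (∑ λ v → ∑ λ w → h v w)) ∎)
        where
        open Counting {N} id (λ _ → ≡.refl)
        steps : Vec (Fin N) N → Carrier
        steps σ = ∑ λ t → h (Vec.lookup σ t) (Vec.lookup σ (next t))
        single : ∀ x → single? x ≡ true
        single x = dec-true (x Fin.≟ x) ≡.refl
        ones : ∀ n → ℕΣ.∑ {n} (λ _ → 1) ≡ n
        ones zero    = ℕΣ.∑-zero _
        ones (suc n) = ≡.trans (ℕΣ.∑-suc _) (cong suc (ones n))
        singles≡ : singles none ≡ N
        singles≡ = ≡.trans (ℕΣ.∑-cong λ x → cong ℕΣ.[_] (single x)) (ones N)
        pairs≡ : pairs none ≡ 2 ℕ.* 0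
        pairs≡ = ℕΣ.∑-0 λ x → cong (ℕΣ.[_] ∘ not) (single x)
        module TC = TourCounts {m} id (λ _ → ≡.refl) N 0 (suc m) singles≡ pairs≡ (≡.sym (ℕ.+-identityʳ N)) (ℕ.+-identityʳ N)
        weight≡4 : ∀ v w → TC.stepWeight v w ≡ 4
        weight≡4 v w = cong₂ (λ c d → suc ℕΣ.[ c ] ℕ.* suc ℕΣ.[ d ] ℕ.+ ℕΣ.[ not c ] ℕ.* ℕΣ.[ does (w Fin.≟ v) ] ℕ.* suc (2 ℕ.* suc m)) (single v) (single w)

      ∑∑-≢ : (∑ λ (v : Fin N) → ∑ λ w → [ not (does (v Fin.≟ w)) ]) ≈ ν (N ℕ.* (N ∸ 1))
      ∑∑-≢ = begin
        (∑ λ (v : Fin N) → ∑ λ w → [ not (does (v Fin.≟ w)) ])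
          ≈⟨ ∑-cong (λ v → trans (∑-cong λ w → ι-[] (not (does (v Fin.≟ w)))) (trans (ι-∑ λ w → ℕΣ.[ not (does (v Fin.≟ w)) ]) (reflexive (cong ν (others v))))) ⟩
        (∑ λ (v : Fin N) → ν (N ∸ 1))
          ≈⟨ ∑-const N (ν (N ∸ 1)) ⟩
        ν N * ν (N ∸ 1)
          ≈⟨ ν-* N (N ∸ 1) ⟨
        ν (N ℕ.* (N ∸ 1)) ∎
        where
        ones : ∀ n → ℕΣ.∑ {n} (λ _ → 1) ≡ n
        ones zero    = ℕΣ.∑-zero _
        ones (suc n) = ≡.trans (ℕΣ.∑-suc _) (cong suc (ones n))
        complement : ∀ c → ℕΣ.[ c ] ℕ.+ ℕΣ.[ not c ] ≡ 1
        complement true  = ≡.refl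
        complement false = ≡.refl
        others : ∀ v → ℕΣ.∑ (λ (w : Fin N) → ℕΣ.[ not (does (v Fin.≟ w)) ]) ≡ N ∸ 1
        others v = ℕ.suc-injective (≡.trans
          (cong (ℕ._+ ℕΣ.∑ (λ (w : Fin N) → ℕΣ.[ not (does (v Fin.≟ w)) ])) (≡.sym (≡.trans (ℕΣ.∑-cong λ w → cong ℕΣ.[_] (does-⇔ (mk⇔ ≡.sym ≡.sym) (v Fin.≟ w) (w Fin.≟ v))) (ℕΣ.∑-1 v))))
          (≡.trans (≡.sym (ℕΣ.∑-+ (λ w → ℕΣ.[ does (v Fin.≟ w) ]) (λ w → ℕΣ.[ not (does (v Fin.≟ w)) ])))
            (≡.trans (ℕΣ.∑-cong λ w → complement (does (v Fin.≟ w))) (ones N))))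

      -- The number N! of tours, deduced from the step count: each tour has `N` steps, all between
      -- distinct vertices, and there are N (N - 1) such ordered pairs.
      count-distinct : (∑V N λ σ → [ distinct σ ]) ≈ ν (u ℕ.* (N ∸ 1))
      count-distinct = ν-cancel N (begin
        ν N * (∑V N λ σ → [ distinct σ ])
          ≈⟨ *-comm _ _ ⟩
        (∑V N λ σ → [ distinct σ ]) * ν N
          ≈⟨ ∑V-*ʳ N (ν N) (λ σ → [ distinct σ ]) ⟨
        (∑V N λ σ → [ distinct σ ] * ν N)
          ≈⟨ ∑V-cong N (λ σ → []-*-cong (distinct σ) λ σ! → sym (all-steps σ (does⁻ (unique? σ) σ!))) ⟩
        (∑V N λ σ → [ distinct σ ] * ∑ λ t → h (Vec.lookup σ t) (Vec.lookup σ (next t)))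
          ≈⟨ ∑-distinct h (λ v → reflexive (cong ([_] ∘ not) (dec-true (v Fin.≟ v) ≡.refl))) ⟩
        ν u * (∑ λ v → ∑ λ w → h v w)
          ≈⟨ *-congˡ ∑∑-≢ ⟩
        ν u * ν (N ℕ.* (N ∸ 1))
          ≈⟨ ν-* u (N ℕ.* (N ∸ 1)) ⟨
        ν (u ℕ.* (N ℕ.* (N ∸ 1)))
          ≈⟨ reflexive (cong ν (solve 3 (λ u n p → u :* (n :* p) := n :* (u :* p)) ≡.refl u N (N ∸ 1))) ⟩
        ν (N ℕ.* (u ℕ.* (N ∸ 1)))
          ≈⟨ ν-* N (u ℕ.* (N ∸ 1)) ⟩
        ν N * ν (u ℕ.* (N ∸ 1)) ∎)
        where
        open +-*-Solver
        h : Fin N → Fin N → Carrier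
        h v w = [ not (does (v Fin.≟ w)) ]
        all-steps : ∀ σ → Unique σ → (∑ λ t → h (Vec.lookup σ t) (Vec.lookup σ (next t))) ≈ ν N
        all-steps σ σ! = trans (∑-cong λ t → reflexive (cong ([_] ∘ not) (dec-false (_ Fin.≟ _) λ eq →
            next² t (≡.trans (cong next (≡.sym (lookup-injective σ! t (next t) eq))) (≡.sym (lookup-injective σ! t (next t) eq))))))
          (trans (∑-const N 1#) (*-identityʳ (ν N)))

      φ-cycles : φ * ν (length D) ≈ ν (u ℕ.* (N ∸ 1))
      φ-cycles = begin
        φ * ν (length D)                          ≈⟨ *-congˡ (∑L-1 D) ⟨
        φ * ∑L D (λ _ → 1#)                       ≈⟨ ∑-cycles N (λ _ → 1#) (λ _ → refl) ⟨
        (∑V N λ σ → [ distinct σ ] * 1#)          ≈⟨ ∑V-cong N (λ σ → *-identityʳ [ distinct σ ]) ⟩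
        (∑V N λ σ → [ distinct σ ])               ≈⟨ count-distinct ⟩
        ν (u ℕ.* (N ∸ 1))                         ∎

      -- The fibre size divides the nonzero number of all tours, so it can be cancelled like a
      -- natural number.
      φ-cancel : ∀ {x y} → φ * x ≈ φ * y → x ≈ y
      φ-cancel {x} {y} eq = ν-cancel (u ℕ.* (N ∸ 1)) {{ℕ.m*n≢0 u (N ∸ 1)}} (begin
        ν (u ℕ.* (N ∸ 1)) * x       ≈⟨ *-congʳ φ-cycles ⟨
        φ * ν (length D) * x        ≈⟨ trans (*-assoc _ _ _) (*-swap _ _ _) ⟩
        ν (length D) * (φ * x)      ≈⟨ *-congˡ eq ⟩
        ν (length D) * (φ * y)      ≈⟨ trans (*-assoc _ _ _) (*-swap _ _ _) ⟨
        φ * ν (length D) * y        ≈⟨ *-congʳ φ-cycles ⟩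
        ν (u ℕ.* (N ∸ 1)) * y       ∎)

      ∑-functional : ∀ (G : LinearFunctional N) → φ * ∑L D (⟪ G ⟫ ∘ point) ≈ ν u * ∑ λ v → ∑ λ w → edgeValue G v w
      ∑-functional G = begin
        φ * ∑L D (⟪ G ⟫ ∘ point)
          ≈⟨ ∑-cycles N (⟪ G ⟫ ∘ point) (λ same → ⟪⟫-cong G λ (j , i) → reflexive (cong [_] (same j i))) ⟨
        (∑V N λ σ → [ distinct σ ] * ⟪ G ⟫ (point (edges σ)))
          ≈⟨ ∑V-cong N (λ σ → []-*-cong (distinct σ) λ σ! → ⟪edges⟫ G σ (does⁻ (unique? σ) σ!)) ⟩
        (∑V N λ σ → [ distinct σ ] * ∑ λ t → edgeValue G (Vec.lookup σ t) (Vec.lookup σ (next t)))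
          ≈⟨ ∑-distinct (edgeValue G) (edgeValue-diagonal G) ⟩
        ν u * (∑ λ v → ∑ λ w → edgeValue G v w) ∎

      -- Each edge lies in the fraction 2 / (N - 1) of all cycles, and the double sum counts each
      -- edge twice; so average 1 means total N - 1.
      normalised-total : ∀ (G : LinearFunctional N) → ∑L D (⟪ G ⟫ ∘ point) ≈ ν (length D) → (∑ λ v → ∑ λ w → edgeValue G v w) ≈ ν (N ∸ 1)
      normalised-total G avg = ν-cancel u (begin
        ν u * (∑ λ v → ∑ λ w → edgeValue G v w)   ≈⟨ ∑-functional G ⟨
        φ * ∑L D (⟪ G ⟫ ∘ point)                  ≈⟨ *-congˡ avg ⟩
        φ * ν (length D)                          ≈⟨ φ-cycles ⟩
        ν (u ℕ.* (N ∸ 1))                         ≈⟨ ν-* u (N ∸ 1) ⟩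
        ν u * ν (N ∸ 1)                           ∎)

      coordinate : Edge N → LinearFunctional N
      coordinate e = record
        { ⟪_⟫ = λ x → x e ; ⟪⟫-cong = λ x≈y → x≈y e ; ⟪⟫-0 = refl ; ⟪⟫-+ = λ _ _ → refl ; ⟪⟫-* = λ _ _ → refl }

      -- The coordinate at `e` is itself a linear functional, whose double sum over edge values is
      -- 2.
      ∑-coordinate : ∀ e → ν (N ∸ 1) * ∑L D (λ χ → [ χ e ]) ≈ ν 2 * ν (length D)
      ∑-coordinate e = φ-cancel (begin
        φ * (ν (N ∸ 1) * ∑L D (λ χ → [ χ e ]))     ≈⟨ *-swap _ _ _ ⟩
        ν (N ∸ 1) * (φ * ∑L D (λ χ → [ χ e ]))     ≈⟨ *-congˡ (trans (∑-functional (coordinate e)) (*-congˡ (∑∑-ε e))) ⟩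
        ν (N ∸ 1) * (ν u * ν 2)                    ≈⟨ trans (sym (*-assoc _ _ _)) (trans (*-comm _ _) (*-congˡ (trans (*-comm _ _) (sym (ν-* u (N ∸ 1)))))) ⟩
        ν 2 * ν (u ℕ.* (N ∸ 1))                    ≈⟨ *-congˡ φ-cycles ⟨
        ν 2 * (φ * ν (length D))                   ≈⟨ *-swap _ _ _ ⟩
        φ * (ν 2 * ν (length D))                   ∎)

      monomialValue : (Fin N → Fin N) → (Edge N → Bool) → Carrier
      monomialValue p χ = foldEdges *-rawMonoid λ e → point χ e ^ᴿ matchingMonomial p e

      φ-nonNeg : 0# ≤ φ
      φ-nonNeg = ∑V-nonNeg N λ σ → *-nonNeg ([ distinct σ ]-nonNeg) ([ does (sameEdges? (edges (Vec.allFin N)) (edges σ)) ]-nonNeg)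

      -- Multiplication by the nonnegative fibre size turns the sum over cycles into one over tours.
      -- There the monomial is an indicator and equals its square.
      square-contains : ∀ (G : LinearFunctional N) p → (∀ v → p (p v) ≡ v) →
        0# ≤ ∑L D (λ χ → ⟪ G ⟫ (point χ) * (monomialValue p χ * monomialValue p χ)) →
        0# ≤ ∑V N λ σ → [ does (contains? p σ) ] * ∑ λ t → edgeValue G (Vec.lookup σ t) (Vec.lookup σ (next t))
      square-contains G p p-involutive 0≤ = ≤-respʳ (begin
        φ * ∑L D F
          ≈⟨ ∑-cycles N F (λ {χ} {ψ} → F-resp {χ} {ψ}) ⟨
        (∑V N λ σ → [ distinct σ ] * F (edges σ))
          ≈⟨ ∑V-cong N pointwise ⟩
        (∑V N λ σ → [ does (contains? p σ) ] * ∑ λ t → edgeValue G (Vec.lookup σ t) (Vec.lookup σ (next t))) ∎)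
        (*-nonNeg φ-nonNeg 0≤)
        where
        F : (Edge N → Bool) → Carrier
        F χ = ⟪ G ⟫ (point χ) * (monomialValue p χ * monomialValue p χ)

        monomial-resp : ∀ {χ ψ} → SameEdges χ ψ → monomialValue p χ ≈ monomialValue p ψ
        monomial-resp same = ∏.sum-cong-≋ λ j → ∏.sum-cong-≋ λ i → reflexive (cong (λ c → [ c ] ^ᴿ matchingMonomial p (j , i)) (same j i))

        F-resp : ∀ {χ ψ} → SameEdges χ ψ → F χ ≈ F ψ
        F-resp {χ} {ψ} same = *-cong (⟪⟫-cong G λ (j , i) → reflexive (cong [_] (same j i))) (*-cong (monomial-resp {χ} {ψ} same) (monomial-resp {χ} {ψ} same))

        pointwise : ∀ σ → [ distinct σ ] * F (edges σ) ≈ [ does (contains? p σ) ] * ∑ λ t → edgeValue G (Vec.lookup σ t) (Vec.lookup σ (next t))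
        pointwise σ = cases (unique? σ)
          where
          steps = ∑ λ t → edgeValue G (Vec.lookup σ t) (Vec.lookup σ (next t))
          idem : ∀ c → [ c ] * [ c ] ≈ [ c ]
          idem true  = *-identityˡ 1#
          idem false = zeroˡ 0#
          cases : (d : Dec (Unique σ)) → [ does d ] * F (edges σ) ≈ [ does (contains? p σ) ] * steps
          cases (no ¬σ!) = trans (zeroˡ _) (sym (trans (*-congʳ (reflexive (cong [_] (dec-false (contains? p σ) (¬σ! ∘ proj₁))))) (zeroˡ _)))
          cases (yes σ!) = begin
            1# * F (edges σ)
              ≈⟨ *-identityˡ _ ⟩
            ⟪ G ⟫ (point (edges σ)) * (monomialValue p (edges σ) * monomialValue p (edges σ))
              ≈⟨ *-cong (⟪edges⟫ G σ σ!) (trans (*-cong (monomial-contains p p-involutive σ σ!) (monomial-contains p p-involutive σ σ!)) (idem _)) ⟩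
            steps * [ does (contains? p σ) ]
              ≈⟨ *-comm _ _ ⟩
            [ does (contains? p σ) ] * steps ∎

    cycle-bound : ∀ n x d b (let k = suc x ; N = suc (suc (suc (suc n)))) →
      suc (suc ⌊ n /2⌋) ≡ k ℕ.+ d → N ≡ k ℕ.+ suc (suc b) → (G : LinearFunctional N) →
      ∑L (D (suc n)) (⟪ G ⟫ ∘ point) ≈ ν (length (D (suc n))) →
      (∀ p (p-involutive : ∀ v → p (p v) ≡ v) → foldEdges ℕ.+-0-rawMonoid (matchingMonomial p) ≡ k →
        0# ≤ ∑L (D (suc n)) λ χ → ⟪ G ⟫ (point χ) * (monomialValue (suc n) p χ * monomialValue (suc n) p χ)) →
      ∀ {χ} → χ ∈ D (suc n) → 0# ≤ ν (k ℕ.* N) * ⟪ G ⟫ (point χ) + ν (N ℕ.* suc (suc b) ℕ.+ 10 ℕ.* k)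
    cycle-bound n x d b K≡ N≡ G avg psd {χ} χ∈ with ∈-cycles⁻ (suc (suc (suc (suc n)))) χ∈
    ... | τ , τ! , ≡.refl = ≤-respʳ (+-congʳ (*-congˡ (sym (⟪edges⟫ G τ τ!))))
      (TourBound.tour-bound R n x d b K≡ N≡ τ τ! (edgeValue G) (edgeValue-sym G) (edgeValue-diagonal G)
        (λ p p-inv k≡ → square-contains (suc n) G p p-inv (psd p p-inv (degree-matchingMonomial p p-inv (suc x) k≡)))
        (normalised-total (suc n) G avg))

-- The polytope, its barycentre and the two inclusions over an ordered algebra.

module Polytopes where

  open import Algebra.Bundles using (CommutativeSemiring)
  open import Data.Bool as Bool using (Bool; true; false; if_then_else_)
  open import Data.Fin as Fin using (Fin; zero; suc)
  open import Data.Integer using (+_)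
  open import Data.List as List using (List; _∷_; length; map; lookup)
  open import Data.List.Membership.Propositional using (_∈_)
  open import Data.List.Membership.Propositional.Properties using (∈-map⁺; ∈-map⁻; ∈-++⁺ˡ; ∈-++⁺ʳ; ∈-++⁻; ∈-tabulate⁺; ∈-tabulate⁻)
  open import Data.List.Relation.Unary.Any using (here; there)
  open import Data.Sum using (_⊎_; inj₁; inj₂)
  open import Relation.Nullary using (Dec; does; yes; no)
  open import Data.Vec.Relation.Unary.Unique.Propositional using (Unique)
  open import Data.List.Properties using (length-map)
  open import Data.Nat as ℕ using (ℕ; zero; suc; _∸_; ⌊_/2⌋)
  import Data.Nat.Properties as ℕ
  open import Data.Product using (∃-syntax; _×_; _,_; proj₁; proj₂)
  open import Data.Rational as ℚ using (ℚ; 0ℚ; 1ℚ)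
  import Data.Rational.Properties as ℚ
  open import Function using (_∘_)
  open import Relation.Binary.PropositionalEquality as ≡ using (_≡_; cong; subst)
  open import Defs using (Edge; foldEdges)
  open OrderedAlgebras
  open FiniteSums
  open Cycles
  open StepCounts
  open PairSelections using (count-leftover)
  open TourBounds
  open EdgeVectors
  open CycleAverages

  opaque
    inverse : ∀ q → 0ℚ ℚ.< q → ∃[ r ] q ℚ.* r ≡ 1ℚ × 0ℚ ℚ.≤ r
    inverse q 0<q = ℚ.1/ q , ℚ.*-inverseʳ q , ℚ.<⇒≤ (ℚ.positive⁻¹ (ℚ.1/ q) {{ℚ.1/pos⇒pos q}})
      where
      instance
        q-pos : ℚ.Positive q
        q-pos = ℚ.positive 0<q
        q-nonZero : ℚ.NonZero q
        q-nonZero = ℚ.pos⇒nonZero q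

    unitFraction : ∀ k .{{_ : ℕ.NonZero k}} → ℚ
    unitFraction k = + 1 ℚ./ k

    unitFraction-inverse : ∀ k .{{_ : ℕ.NonZero k}} → unitFraction k ℚ.* ℚCasts.ι k ≡ 1ℚ
    unitFraction-inverse k = ≡.trans (ℚ.*-comm (+ 1 ℚ./ k) (ℚCasts.ι k)) (≡.trans (*-/-cancel k 1) (ℚ.+-identityʳ 1ℚ))

  module Polytope (R : OrderedℚAlgebra) where
    open OrderedℚAlgebra R
    open OrderedSums R
    open Sums commutativeSemiring using (∑; ∑-cong; ∑-+; ∑-*ˡ; ∑L; ∑L-sum; ∑L-map; ∑L-cong; ∑≡sum)
    open Functionals commutativeSemiring
    open LinearFunctional
    open CycleSums R hiding (D)
    open import Relation.Binary.Reasoning.Setoid setoid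

    module _ (m : ℕ) where
      private
        N : ℕ
        N = suc (suc (suc m))

      vertices : List (Edge N → Carrier)
      vertices = map (λ χ e → if χ e then 1# else 0#) (cycles N)

      combine : (Fin (length vertices) → Carrier) → Edge N → Carrier
      combine w e = sum λ t → w t * lookup vertices t e

      Affine Hull : (Edge N → Carrier) → Set
      Affine z = ∃[ w ] sum w ≈ 1# × ∀ e → z e ≈ combine w e
      Hull z = ∃[ w ] (∀ t → 0# ≤ w t) × sum w ≈ 1# × ∀ e → z e ≈ combine w e

      barycentre : Edge N → Carrier
      barycentre e = ι (+ 2 ℚ./ suc (suc m))

      Normalised : LinearFunctional N → Set
      Normalised G = ∑L (cycles N) (⟪ G ⟫ ∘ point) ≈ ν (length (cycles N))

      MonomialPsd : LinearFunctional N → ℕ → Set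
      MonomialPsd G k = ∀ p (p-involutive : ∀ v → p (p v) ≡ v) → foldEdges ℕ.+-0-rawMonoid (matchingMonomial p) ≡ k →
        0# ≤ ∑L (cycles N) λ χ → ⟪ G ⟫ (point χ) * (monomialValue m p χ * monomialValue m p χ)

      sum-≈ : ∀ {n} {f g : Fin n → Carrier} → (∀ i → f i ≈ g i) → sum f ≈ sum g
      sum-≈ = sum-cong-≋

      vertex-point : ∀ t → ∃[ χ ] χ ∈ cycles N × lookup vertices t ≡ point χ
      vertex-point t = go (cycles N) t
        where
        go : ∀ (χs : List (Edge N → Bool)) t → ∃[ χ ] χ ∈ χs × lookup (map (λ χ e → if χ e then 1# else 0#) χs) t ≡ point χ
        go (χ ∷ χs) zero    = χ , here ≡.refl , ≡.refl
        go (χ ∷ χs) (suc t) = let ψ , ψ∈ , eq = go χs t in ψ , there ψ∈ , eq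

      sum-vertices : ∀ (F : (Edge N → Carrier) → Carrier) → sum (F ∘ lookup vertices) ≈ ∑L (cycles N) (F ∘ point)
      sum-vertices F = trans (∑L-sum vertices F) (∑L-map (λ χ e → if χ e then 1# else 0#) (cycles N) F)

      ⟪combine⟫ : ∀ (G : LinearFunctional N) w → ⟪ G ⟫ (combine w) ≈ sum λ t → w t * ⟪ G ⟫ (lookup vertices t)
      ⟪combine⟫ G w = begin
        ⟪ G ⟫ (combine w)                                          ≈⟨ ⟪⟫-cong G (λ e → reflexive (≡.sym (∑≡sum _))) ⟩
        ⟪ G ⟫ (λ e → ∑ λ t → w t * lookup vertices t e)            ≈⟨ ⟪⟫-∑ G _ ⟩
        (∑ λ t → ⟪ G ⟫ (λ e → w t * lookup vertices t e))          ≈⟨ ∑-cong (λ t → ⟪⟫-* G (w t) (lookup vertices t)) ⟩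
        (∑ λ t → w t * ⟪ G ⟫ (lookup vertices t))                  ≈⟨ reflexive (∑≡sum _) ⟩
        (sum λ t → w t * ⟪ G ⟫ (lookup vertices t))                ∎

      private
        L : ℕ
        L = length (cycles N)
        instance _ = cycles-nonEmpty N

      1/L : Carrier
      1/L = ι (+ 1 ℚ./ L)

      sum-uniform : sum {length vertices} (λ _ → 1/L) ≈ 1#
      sum-uniform = begin
        sum {length vertices} (λ _ → 1/L)       ≈⟨ reflexive (≡.sym (∑≡sum _)) ⟩
        (∑ {length vertices} λ _ → 1/L)         ≈⟨ Casts.∑-const commutativeSemiring (length vertices) 1/L ⟩
        ν (length vertices) * 1/L               ≈⟨ *-congʳ (reflexive (cong ν (length-map _ (cycles N)))) ⟩
        ν L * 1/L                               ≈⟨ trans (*-comm _ _) (ν-inverse L) ⟩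
        1#                                      ∎

      -- By symmetry each coordinate has mean 2 / (N - 1) over the vertices; both denominators are
      -- cleared and then cancelled.
      barycentre-combine : ∀ e → barycentre e ≈ combine (λ _ → 1/L) e
      barycentre-combine e = ν-cancel L (ν-cancel (suc (suc m)) (begin
        ν (suc (suc m)) * (ν L * barycentre e)                      ≈⟨ *-swap _ _ _ ⟩
        ν L * (ν (suc (suc m)) * barycentre e)                      ≈⟨ *-congˡ (ν-*-/ (suc (suc m)) 2) ⟩
        ν L * ν 2                                                   ≈⟨ *-comm _ _ ⟩
        ν 2 * ν L                                                   ≈⟨ ∑-coordinate m e ⟨
        ν (suc (suc m)) * ∑L (cycles N) (λ χ → point χ e)           ≈⟨ *-congˡ uniform ⟨
        ν (suc (suc m)) * (ν L * combine (λ _ → 1/L) e)             ∎))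
        where
        open Sums commutativeSemiring using (*-swap)
        uniform : ν L * combine (λ _ → 1/L) e ≈ ∑L (cycles N) (λ χ → point χ e)
        uniform = begin
          ν L * combine (λ _ → 1/L) e                               ≈⟨ *-congˡ (*-distribˡ-sum 1/L (λ t → lookup vertices t e)) ⟨
          ν L * (1/L * (sum λ t → lookup vertices t e))             ≈⟨ *-assoc _ _ _ ⟨
          ν L * 1/L * (sum λ t → lookup vertices t e)               ≈⟨ *-congʳ (trans (*-comm _ _) (ν-inverse L)) ⟩
          1# * (sum λ t → lookup vertices t e)                      ≈⟨ *-identityˡ _ ⟩
          (sum λ t → lookup vertices t e)                           ≈⟨ sum-vertices (λ x → x e) ⟩
          ∑L (cycles N) (λ χ → point χ e)                           ∎

      ⟪-⟫ : ∀ (G : LinearFunctional N) y → ⟪ G ⟫ (λ e → - y e) ≈ - ⟪ G ⟫ y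
      ⟪-⟫ G y = trans (⟪⟫-cong G λ e → sym (-1*x≈-x (y e))) (trans (⟪⟫-* G (- 1#) y) (-1*x≈-x (⟪ G ⟫ y)))
        where open import Algebra.Properties.Ring ring using (-1*x≈-x)

      -- The homothety about the barycentre. That T - Z lies in a (P° - Z) means that the homothety
      -- of ratio 1/a carries T into P°.
      module Shrinking (centre : Edge N → Carrier) (centre≈ : ∀ e → centre e ≈ combine (λ _ → 1/L) e) where

        ⟪centre⟫ : ∀ G → Normalised G → ⟪ G ⟫ centre ≈ 1#
        ⟪centre⟫ G avg = begin
          ⟪ G ⟫ centre                                     ≈⟨ ⟪⟫-cong G centre≈ ⟩
          ⟪ G ⟫ (combine λ _ → 1/L)                            ≈⟨ ⟪combine⟫ G (λ _ → 1/L) ⟩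
          (sum λ t → 1/L * ⟪ G ⟫ (lookup vertices t))          ≈⟨ *-distribˡ-sum 1/L (λ t → ⟪ G ⟫ (lookup vertices t)) ⟨
          1/L * (sum λ t → ⟪ G ⟫ (lookup vertices t))          ≈⟨ *-congˡ (trans (sum-vertices ⟪ G ⟫) avg) ⟩
          1/L * ν L                                            ≈⟨ ν-inverse L ⟩
          1#                                                   ∎

        -- Used with c = 1/a.
        opaque
          shrink : Carrier → (Edge N → Carrier) → Edge N → Carrier
          shrink c z e = c * z e + (1# - c) * centre e

          shrink-≈ : ∀ c z e → shrink c z e ≈ c * z e + (1# - c) * centre e
          shrink-≈ c z e = refl

        ⟪shrink⟫ : ∀ G c z → ⟪ G ⟫ (shrink c z) ≈ c * ⟪ G ⟫ z + (1# - c) * ⟪ G ⟫ centre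
        ⟪shrink⟫ G c z = trans (⟪⟫-cong G (shrink-≈ c z)) (trans (⟪⟫-+ G (λ e → c * z e) (λ e → (1# - c) * centre e)) (+-cong (⟪⟫-* G c z) (⟪⟫-* G (1# - c) centre)))

        shrink-affine : ∀ c z → Hull z → Affine (shrink c z)
        shrink-affine c z (w , _ , Σw≈1 , z≈) = w′ , Σw′≈1 , λ e → begin
          shrink c z e
            ≈⟨ shrink-≈ c z e ⟩
          c * z e + (1# - c) * centre e
            ≈⟨ +-cong (*-congˡ (z≈ e)) (*-congˡ (centre≈ e)) ⟩
          c * combine w e + (1# - c) * combine (λ _ → 1/L) e
            ≈⟨ +-cong (*-distribˡ-sum c (λ t → w t * lookup vertices t e)) (*-distribˡ-sum (1# - c) (λ t → 1/L * lookup vertices t e)) ⟩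
          (sum λ t → c * (w t * lookup vertices t e)) + (sum λ t → (1# - c) * (1/L * lookup vertices t e))
            ≈⟨ ∑-distrib-+ (λ t → c * (w t * lookup vertices t e)) (λ t → (1# - c) * (1/L * lookup vertices t e)) ⟨
          (sum λ t → c * (w t * lookup vertices t e) + (1# - c) * (1/L * lookup vertices t e))
            ≈⟨ sum-≈ (λ t → factor c (w t) (lookup vertices t e) (1# - c) 1/L) ⟩
          combine w′ e ∎
          where
          open Solver
          w′ : Fin (length vertices) → Carrier
          w′ t = c * w t + (1# - c) * 1/L
          factor : ∀ c w x d l → c * (w * x) + d * (l * x) ≈ (c * w + d * l) * x
          factor = solve 5 (λ c w x d l → c :* (w :* x) :+ d :* (l :* x) := (c :* w :+ d :* l) :* x) refl
          Σw′≈1 : sum w′ ≈ 1#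
          Σw′≈1 = begin
            sum w′                                                    ≈⟨ ∑-distrib-+ (λ t → c * w t) (λ _ → (1# - c) * 1/L) ⟩
            (sum λ t → c * w t) + sum {length vertices} (λ _ → (1# - c) * 1/L) ≈⟨ +-cong (sym (*-distribˡ-sum c w)) (sym (*-distribˡ-sum (1# - c) λ (_ : Fin (length vertices)) → 1/L)) ⟩
            c * sum w + (1# - c) * sum {length vertices} (λ _ → 1/L)  ≈⟨ +-cong (*-congˡ Σw≈1) (*-congˡ sum-uniform) ⟩
            c * 1# + (1# - c) * 1#                                    ≈⟨ +-cong (*-identityʳ c) (*-identityʳ _) ⟩
            c + (1# - c)                                              ≈⟨ solve 2 (λ c o → c :+ (o :- c) := o) refl c 1# ⟩
            1#                                                        ∎

        -- A normalised functional is at least 1 - a on T, hence nonnegative on the shrunk polytope.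
        shrink-nonNeg : ∀ G a c → Normalised G → 0# ≤ c → c * a ≈ 1# →
          (∀ {χ} → χ ∈ cycles N → 0# ≤ ⟪ G ⟫ (point χ) + (a - 1#)) → ∀ z → Hull z → 0# ≤ ⟪ G ⟫ (shrink c z)
        shrink-nonNeg G a c avg 0≤c ca≈1 bound z (w , 0≤w , Σw≈1 , z≈) = ≤-respʳ (sym (begin
          ⟪ G ⟫ (shrink c z)
            ≈⟨ ⟪shrink⟫ G c z ⟩
          c * ⟪ G ⟫ z + (1# - c) * ⟪ G ⟫ centre
            ≈⟨ +-congˡ (trans (*-congˡ (⟪centre⟫ G avg)) (*-identityʳ _)) ⟩
          c * ⟪ G ⟫ z + (1# - c)
            ≈⟨ +-congˡ (+-congʳ ca≈1) ⟨
          c * ⟪ G ⟫ z + (c * a - c)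
            ≈⟨ +-congˡ (+-congˡ (-‿cong (*-identityʳ c))) ⟨
          c * ⟪ G ⟫ z + (c * a - c * 1#)
            ≈⟨ solve 4 (λ c g a o → c :* g :+ (c :* a :- c :* o) := c :* (g :+ (a :- o))) refl c (⟪ G ⟫ z) a 1# ⟩
          c * (⟪ G ⟫ z + (a - 1#)) ∎)) (*-nonNeg 0≤c (≤-respʳ (sym value) (sum-nonNeg _ λ t → *-nonNeg (0≤w t) (at-vertex t))))
          where
          open Solver
          at-vertex : ∀ t → 0# ≤ ⟪ G ⟫ (lookup vertices t) + (a - 1#)
          at-vertex t = let χ , χ∈ , eq = vertex-point t in ≤-respʳ (+-congʳ (reflexive (cong ⟪ G ⟫ (≡.sym eq)))) (bound χ∈)
          value : ⟪ G ⟫ z + (a - 1#) ≈ sum λ t → w t * (⟪ G ⟫ (lookup vertices t) + (a - 1#))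
          value = begin
            ⟪ G ⟫ z + (a - 1#)
              ≈⟨ +-cong (trans (⟪⟫-cong G z≈) (⟪combine⟫ G w)) (sym (trans (*-congʳ Σw≈1) (*-identityˡ _))) ⟩
            (sum λ t → w t * ⟪ G ⟫ (lookup vertices t)) + sum w * (a - 1#)
              ≈⟨ +-congˡ (*-distribʳ-sum (a - 1#) w) ⟩
            (sum λ t → w t * ⟪ G ⟫ (lookup vertices t)) + (sum λ t → w t * (a - 1#))
              ≈⟨ ∑-distrib-+ (λ t → w t * ⟪ G ⟫ (lookup vertices t)) (λ t → w t * (a - 1#)) ⟨
            (sum λ t → w t * ⟪ G ⟫ (lookup vertices t) + w t * (a - 1#))
              ≈⟨ sum-≈ (λ t → distribˡ (w t) (⟪ G ⟫ (lookup vertices t)) (a - 1#)) ⟨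
            (sum λ t → w t * (⟪ G ⟫ (lookup vertices t) + (a - 1#))) ∎


        shrink-scale : ∀ a c z e → c * a ≈ 1# → z e - centre e ≈ a * (shrink c z e - centre e)
        shrink-scale a c z e ca≈1 = begin
          z e - centre e                                     ≈⟨ *-identityˡ _ ⟨
          1# * (z e - centre e)                              ≈⟨ *-congʳ ca≈1 ⟨
          c * a * (z e - centre e)                           ≈⟨ solve 4 (λ c a z y → c :* a :* (z :- y) := a :* (c :* z :+ (con 1ℚ :- c) :* y :- y)) refl c a (z e) (centre e) ⟩
          a * (c * z e + (ι 1ℚ - c) * centre e - centre e) ≈⟨ *-congˡ (+-congʳ (trans (+-congˡ (*-congʳ (+-congʳ ι-1))) (sym (shrink-≈ c z e)))) ⟩
          a * (shrink c z e - centre e)                      ∎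
          where open Solver

      private
        module ℚ-Alg = OrderedℚAlgebra ℚ-orderedℚAlgebra
        module Eᴿ = Edges commutativeSemiring
        module ∑ᴿ = Sums commutativeSemiring
        module Eℚ = Edges ℚ-Alg.commutativeSemiring
        module ∑ℚ = Sums ℚ-Alg.commutativeSemiring

        M : ℕ
        M = length vertices

      ι-[] : ∀ c → ι (∑ℚ.[ c ]) ≈ ∑ᴿ.[ c ]
      ι-[] true  = ι-1
      ι-[] false = ι-0

      ι-sum : ∀ {n} (f : Fin n → ℚ) → ι (ℚ-Alg.sum f) ≈ sum (ι ∘ f)
      ι-sum {zero}  f = ι-0
      ι-sum {suc n} f = trans (ι-+ (f zero) _) (+-congˡ (ι-sum (f ∘ suc)))

      ι-∑E : ∀ (f : Edge N → ℚ) → ι (Eℚ.∑E f) ≈ Eᴿ.∑E (ι ∘ f)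
      ι-∑E f = trans (ι-∑ _) (∑-cong λ j → ι-∑ λ i → f (j , i))
        where
        ι-∑ : ∀ {n} (f : Fin n → ℚ) → ι (∑ℚ.∑ f) ≈ ∑ (ι ∘ f)
        ι-∑ f = trans (reflexive (cong ι (∑ℚ.∑≡sum f))) (trans (ι-sum f) (reflexive (≡.sym (∑≡sum _))))

      bits : Fin M → Edge N → Bool
      bits t = proj₁ (vertex-point t)

      -- The value at the vertex `t` of the functional with coefficients `c`. Vertices have 0/1
      -- coordinates, so it is rational and its sign is decidable.
      test : Fin M → (Edge N → ℚ) → ℚ
      test t c = Eℚ.∑E λ e → c e ℚ.* ∑ℚ.[ bits t e ]

      rational : (Edge N → ℚ) → LinearFunctional N
      rational c = record
        { ⟪_⟫     = λ x → Eᴿ.∑E λ e → ι (c e) * x e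
        ; ⟪⟫-cong = λ x≈y → ∑-cong λ j → ∑-cong λ i → *-congˡ (x≈y (j , i))
        ; ⟪⟫-0    = ∑ᴿ.∑-0 λ j → ∑ᴿ.∑-0 λ i → zeroʳ _
        ; ⟪⟫-+    = λ x y → trans (∑-cong λ j → trans (∑-cong λ i → distribˡ _ _ _) (∑-+ _ _)) (∑-+ _ _)
        ; ⟪⟫-*    = λ a x → trans (∑-cong λ j → trans (∑-cong λ i → ∑ᴿ.*-swap _ _ _) (∑-*ˡ a _)) (∑-*ˡ a _)
        }

      rational-vertex : ∀ c t → ⟪ rational c ⟫ (lookup vertices t) ≈ ι (test t c)
      rational-vertex c t = begin
        ⟪ rational c ⟫ (lookup vertices t)
          ≈⟨ reflexive (cong ⟪ rational c ⟫ (proj₂ (proj₂ (vertex-point t)))) ⟩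
        Eᴿ.∑E (λ e → ι (c e) * ∑ᴿ.[ bits t e ])
          ≈⟨ ∑-cong (λ j → ∑-cong λ i → trans (*-congˡ (sym (ι-[] (bits t (j , i))))) (sym (ι-* (c (j , i)) ∑ℚ.[ bits t (j , i) ]))) ⟩
        Eᴿ.∑E (λ e → ι (c e ℚ.* ∑ℚ.[ bits t e ]))
          ≈⟨ ι-∑E (λ e → c e ℚ.* ∑ℚ.[ bits t e ]) ⟨
        ι (test t c) ∎

      affine-value : ∀ c z (affine : Affine z) → ⟪ rational c ⟫ z ≈ sum λ t → proj₁ affine t * ι (test t c)
      affine-value c z (w , _ , z≈) = trans (⟪⟫-cong (rational c) z≈) (trans (⟪combine⟫ (rational c) w)
        (sum-≈ λ t → *-congˡ (rational-vertex c t)))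

      -- A tour has `N` edges, so this functional is 1 at every vertex and, by affinity, at `z`. It
      -- expresses the constant 1 in the condition that the weights sum to 1 as a linear functional,
      -- the only kind of right-hand side a row can have.
      edgeShare : Edge N → ℚ
      edgeShare _ = unitFraction N

      test-edgeShare : ∀ t → test t edgeShare ≡ 1ℚ
      test-edgeShare t = count (∈-cycles⁻ N (proj₁ (proj₂ (vertex-point t))))
        where
        count : ∃[ τ ] Unique τ × bits t ≡ edges τ → test t edgeShare ≡ 1ℚ
        count (τ , τ! , eq) = ≡.trans
          (≡.trans (∑ℚ.∑-cong λ j → ∑ℚ.∑-*ˡ (unitFraction N) λ i → ∑ℚ.[ bits t (j , i) ]) (∑ℚ.∑-*ˡ (unitFraction N) λ j → ∑ℚ.∑ λ i → ∑ℚ.[ bits t (j , i) ]))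
          (≡.trans (cong (unitFraction N ℚ.*_) (≡.trans (cong (λ χ → Eℚ.∑E λ e → ∑ℚ.[ χ e ]) eq) (Eℚ.∑E-edges τ τ!))) (unitFraction-inverse N))

      -- The hypothesis speaks only of functionals of mean 1, as the definition of P° does, while
      -- elimination produces functionals of any mean; bridging this needs rational coefficients and
      -- `z` in the affine span.
      module Farkas (z : Edge N → Carrier) (affine : Affine z)
        (nonNeg : ∀ G → Normalised G → (∀ t → 0# ≤ ⟪ G ⟫ (lookup vertices t)) → 0# ≤ ⟪ G ⟫ z) where

        space : ℚ-Space
        space = record { Carrier = Edge N → ℚ ; _⊕_ = λ c d e → c e ℚ.+ d e ; _·_ = λ q c e → q ℚ.* c e }

        open FourierMotzkin space
        open ℚ-Space space

        value : (Edge N → ℚ) → OrderedℚAlgebra.Carrier R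
        value c = ⟪ rational c ⟫ z

        value-⊕ : ∀ c d → value (c ⊕ d) ≈ value c + value d
        value-⊕ c d = trans (∑-cong λ j → trans (∑-cong λ i → trans (*-congʳ (ι-+ _ _)) (distribʳ _ _ _)) (∑-+ _ _)) (∑-+ _ _)

        value-· : ∀ q c → value (q · c) ≈ ι q * value c
        value-· q c = trans (∑-cong λ j → trans (∑-cong λ i → trans (*-congʳ (ι-* _ _)) (*-assoc _ _ _)) (∑-*ˡ _ _)) (∑-*ˡ _ _)

        test-⊕ : ∀ t c d → test t (c ⊕ d) ≡ test t c ℚ.+ test t d
        test-⊕ t c d = ≡.trans (∑ℚ.∑-cong λ j → ≡.trans (∑ℚ.∑-cong λ i → ℚ.*-distribʳ-+ _ (c (j , i)) (d (j , i))) (∑ℚ.∑-+ _ _)) (∑ℚ.∑-+ _ _)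

        test-· : ∀ t q c → test t (q · c) ≡ q ℚ.* test t c
        test-· t q c = ≡.trans (∑ℚ.∑-cong λ j → ≡.trans (∑ℚ.∑-cong λ i → ℚ.*-assoc q (c (j , i)) _) (∑ℚ.∑-*ˡ q _)) (∑ℚ.∑-*ˡ q _)

        -- The case of positive vertex sum `S`, with `r` its inverse: a multiple of `c` has mean 1,
        -- so the hypothesis applies to it, and the factor is then removed.
        rescaled : ∀ c S r → ℚ-Alg.sum (λ t → test t c) ≡ S → S ℚ.* r ≡ 1ℚ → 0ℚ ℚ.≤ S → 0ℚ ℚ.≤ r →
          (∀ t → 0ℚ ℚ.≤ test t c) → 0# ≤ value c
        rescaled c S r S≡ Sr≡1 0≤S 0≤r 0≤test = ≤-respʳ unscale (*-nonNeg (0≤ι 0≤S)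
          (nonNeg-r (nonNeg (rational (q · c)) normalised λ t → ≤-respʳ (sym (rational-vertex (q · c) t))
            (0≤ι (≡.subst (0ℚ ℚ.≤_) (≡.sym (test-· t q c)) (ℚ-Alg.*-nonNeg 0≤q (0≤test t)))))))
          where
          q : ℚ
          -- The factor L / S brings the sum over the `L` vertices to `L`, that is, the mean to 1.
          q = ℚCasts.ι L ℚ.* r
          0≤q : 0ℚ ℚ.≤ q
          0≤q = ℚ-Alg.*-nonNeg (OrderedSums.ν-nonNeg ℚ-orderedℚAlgebra L) 0≤r
          qS≡L : q ℚ.* S ≡ ℚCasts.ι L
          qS≡L = ≡.trans (ℚ.*-assoc (ℚCasts.ι L) r S) (≡.trans (cong (ℚCasts.ι L ℚ.*_) (≡.trans (ℚ.*-comm r S) Sr≡1)) (ℚ.*-identityʳ (ℚCasts.ι L)))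
          scaled : value (q · c) ≈ ν L * (ι r * value c)
          scaled = trans (value-· q c) (trans (*-congʳ (trans (ι-* (ℚCasts.ι L) r) (*-congʳ (sym (ν-ι L))))) (*-assoc (ν L) (ι r) (value c)))
          nonNeg-r : 0# ≤ value (q · c) → 0# ≤ ι r * value c
          nonNeg-r 0≤v = ν-cancel-nonNeg L (≤-respʳ scaled 0≤v)
          unscale : ι S * (ι r * value c) ≈ value c
          unscale = trans (sym (*-assoc (ι S) (ι r) (value c))) (trans (*-congʳ (trans (sym (ι-* S r)) (trans (reflexive (cong ι Sr≡1)) ι-1))) (*-identityˡ (value c)))
          normalised : Normalised (rational (q · c))
          normalised = begin
            ∑L (cycles N) (⟪ rational (q · c) ⟫ ∘ point)           ≈⟨ sum-vertices ⟪ rational (q · c) ⟫ ⟨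
            (sum λ t → ⟪ rational (q · c) ⟫ (lookup vertices t))   ≈⟨ sum-≈ (λ t → trans (rational-vertex (q · c) t) (trans (reflexive (cong ι (test-· t q c))) (ι-* q (test t c)))) ⟩
            (sum λ t → ι q * ι (test t c))                         ≈⟨ *-distribˡ-sum (ι q) (λ t → ι (test t c)) ⟨
            ι q * (sum λ t → ι (test t c))                         ≈⟨ *-congˡ (trans (sym (ι-sum λ t → test t c)) (reflexive (cong ι S≡))) ⟩
            ι q * ι S                                              ≈⟨ ι-* q S ⟨
            ι (q ℚ.* S)                                            ≈⟨ reflexive (cong ι qS≡L) ⟩
            ι (ℚCasts.ι L)                                         ≈⟨ ν-ι L ⟨
            ν L                                                    ∎

        -- Rescaling makes the average over the vertices equal to 1 unless it is 0,
        -- in which case the functional vanishes on all vertices and so at z.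
        value-nonNeg : ∀ c → (∀ t → 0ℚ ℚ.≤ test t c) → 0# ≤ value c
        value-nonNeg c 0≤test = cases (ℚ-Alg.sum λ t → test t c) ≡.refl (0ℚ ℚ.<? _)
          where
          vanish : ∀ {n} (f : Fin n → ℚ) → (∀ i → 0ℚ ℚ.≤ f i) → ℚ-Alg.sum f ℚ.≤ 0ℚ → ∀ i → f i ≡ 0ℚ
          vanish f 0≤f Σ≤0 i = ℚ.≤-antisym (ℚ.≤-trans (term≤sum f 0≤f i) Σ≤0) (0≤f i)
            where
            term≤sum : ∀ {n} (f : Fin n → ℚ) → (∀ i → 0ℚ ℚ.≤ f i) → ∀ i → f i ℚ.≤ ℚ-Alg.sum f
            term≤sum f 0≤f zero    = ≡.subst (ℚ._≤ ℚ-Alg.sum f) (ℚ.+-identityʳ (f zero)) (ℚ.+-monoʳ-≤ (f zero) (ℚ-Alg.sum-nonNeg (f ∘ suc) (0≤f ∘ suc)))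
            term≤sum f 0≤f (suc i) = ℚ.≤-trans (term≤sum (f ∘ suc) (0≤f ∘ suc) i)
              (≡.subst (ℚ._≤ ℚ-Alg.sum f) (ℚ.+-identityˡ (ℚ-Alg.sum (f ∘ suc))) (ℚ.+-monoˡ-≤ (ℚ-Alg.sum (f ∘ suc)) (0≤f zero)))

          cases : ∀ S → ℚ-Alg.sum (λ t → test t c) ≡ S → Dec (0ℚ ℚ.< S) → 0# ≤ value c
          cases S S≡ (yes 0<S) = let r , Sr≡1 , 0≤r = inverse S 0<S in rescaled c S r S≡ Sr≡1 (ℚ.<⇒≤ 0<S) 0≤r 0≤test
          cases S S≡ (no ¬0<S) = ≤-reflexive (sym (trans (affine-value c z affine) (trans (sum-≈ λ t →
              trans (*-congˡ (trans (reflexive (cong ι (vanish (λ t → test t c) 0≤test (≡.subst (ℚ._≤ 0ℚ) (≡.sym S≡) (ℚ.≮⇒≥ ¬0<S)) t))) ι-0)) (zeroʳ (proj₁ affine t)))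
            (sum-replicate-zero M))))

        signRow : Fin M → Row M
        signRow s = (λ t → ℚ.- ∑ℚ.[ does (t Fin.≟ s) ]) , λ _ → 0ℚ

        -- One half of the equation between the coordinate of the combination and that of `z`. The
        -- right-hand side is the functional that reads the coordinate `e`, so the real numbers in
        -- `z` never enter the elimination.
        coordinateRow : Edge N → Row M
        coordinateRow e = (λ t → ∑ℚ.[ bits t e ]) , λ e′ → ∑ℚ.[ isEdge e e′ ]

        sumRow : Row M
        sumRow = (λ _ → 1ℚ) , edgeShare

        equations rows : List (Row M)
        equations = sumRow ∷ map coordinateRow (allEdges N)
        rows      = List.tabulate signRow List.++ (equations List.++ map ((ℚ.- 1ℚ) ⊡_) equations)

        tests : Fin M → Valuation ℚ-orderedℚAlgebra
        tests t = record { ⟦_⟧ = test t ; ⟦⊕⟧ = test-⊕ t ; ⟦·⟧ = test-· t }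

        valuation : Valuation R
        valuation = record { ⟦_⟧ = value ; ⟦⊕⟧ = value-⊕ ; ⟦·⟧ = value-· }

        -- The solution at the vertex `t`: a vertex is the convex combination of the vertices that
        -- puts all weight on itself.
        unitVector : Fin M → Fin M → ℚ
        unitVector t s = ∑ℚ.[ does (s Fin.≟ t) ]

        private
          module Test t = Satisfaction ℚ-orderedℚAlgebra (tests t)

        dot-unitVector : ∀ t (a : Fin M → ℚ) → Test.dot t a (unitVector t) ≡ a t
        dot-unitVector t a = ≡.trans (ℚ-Alg.sum-cong-≋ λ s → ℚ.*-comm (a s) (unitVector t s)) (≡.trans (≡.sym (∑ℚ.∑≡sum λ s → unitVector t s ℚ.* a s)) (∑ℚ.∑-δ t a))

        equations-hold : ∀ t {r} → r ∈ equations → Test.dot t (proj₁ r) (unitVector t) ≡ test t (proj₂ r)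
        equations-hold t (here ≡.refl) = ≡.trans (dot-unitVector t (λ _ → 1ℚ)) (≡.sym (test-edgeShare t))
        equations-hold t (there r∈) = coordinate-holds (∈-map⁻ coordinateRow r∈)
          where
          coordinate-holds : ∀ {r} → ∃[ e ] e ∈ allEdges N × r ≡ coordinateRow e → Test.dot t (proj₁ r) (unitVector t) ≡ test t (proj₂ r)
          coordinate-holds (e , _ , ≡.refl) = ≡.trans (dot-unitVector t (λ t → ∑ℚ.[ bits t e ])) (≡.sym (Eℚ.∑E-δ e λ e′ → ∑ℚ.[ bits t e′ ]))

        signs-valid : ∀ t s → Test.Sat t (unitVector t) (signRow s)
        signs-valid t s = ≡.subst₂ ℚ._≤_ (≡.sym (dot-unitVector t (proj₁ (signRow s)))) (≡.sym (∑ℚ.∑-0 λ j → ∑ℚ.∑-0 λ i → ℚ.*-zeroˡ ∑ℚ.[ bits t (j , i) ])) (sign (does (t Fin.≟ s)))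
          where
          sign : ∀ c → ℚ.- ∑ℚ.[ c ] ℚ.≤ 0ℚ
          sign true  = ℚ.nonPositive⁻¹ (ℚ.- 1ℚ)
          sign false = ℚ.≤-refl

        opposite-valid : ∀ t r → r ∈ equations → Test.Sat t (unitVector t) ((ℚ.- 1ℚ) ⊡ r)
        opposite-valid t (a , c) r∈ = ℚ.≤-reflexive (≡.trans (Test.dot-* t (ℚ.- 1ℚ) a (unitVector t))
          (≡.trans (cong ((ℚ.- 1ℚ) ℚ.*_) (equations-hold t r∈)) (≡.sym (test-· t (ℚ.- 1ℚ) c))))

        valid : ∀ t {r} → r ∈ rows → Test.Sat t (unitVector t) r
        valid t {r} r∈ = signs (∈-++⁻ (List.tabulate signRow) r∈)
          where
          sign : ∃[ s ] r ≡ signRow s → Test.Sat t (unitVector t) r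
          sign (s , eq) = ≡.subst (Test.Sat t (unitVector t)) (≡.sym eq) (signs-valid t s)
          opposite : ∃[ r′ ] r′ ∈ equations × r ≡ (ℚ.- 1ℚ) ⊡ r′ → Test.Sat t (unitVector t) r
          opposite (r′ , r′∈ , eq) = ≡.subst (Test.Sat t (unitVector t)) (≡.sym eq) (opposite-valid t r′ r′∈)
          equalities : r ∈ equations ⊎ r ∈ map ((ℚ.- 1ℚ) ⊡_) equations → Test.Sat t (unitVector t) r
          equalities (inj₁ r∈₁) = ℚ.≤-reflexive (equations-hold t r∈₁)
          equalities (inj₂ r∈₂) = opposite (∈-map⁻ ((ℚ.- 1ℚ) ⊡_) r∈₂)
          signs : r ∈ List.tabulate signRow ⊎ r ∈ equations List.++ map ((ℚ.- 1ℚ) ⊡_) equations → Test.Sat t (unitVector t) r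
          signs (inj₁ r∈₁) = sign (∈-tabulate⁻ r∈₁)
          signs (inj₂ r∈₂) = equalities (∈-++⁻ equations r∈₂)

        hull : Hull z
        hull = w , 0≤w , Σw≈1 , z≈
          where
          open Satisfaction R valuation
          solution = solvable R valuation tests value-nonNeg M rows unitVector valid
          w = proj₁ solution

          equality : ∀ {r} → r ∈ equations → dot (proj₁ r) w ≈ value (proj₂ r)
          equality {a , c} r∈ = ≤-antisym (proj₂ solution (∈-++⁺ʳ (List.tabulate signRow) (∈-++⁺ˡ r∈)))
            (≤-respˡ (flip (value-· (ℚ.- 1ℚ) c)) (≤-respʳ (flip (dot-* (ℚ.- 1ℚ) a w))
              (-‿anti-≤ (proj₂ solution (∈-++⁺ʳ (List.tabulate signRow) (∈-++⁺ʳ equations (∈-map⁺ ((ℚ.- 1ℚ) ⊡_) r∈)))))))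
            where
            open Solver using (solve; _:*_; _:=_; :-_)
            flip : ∀ {x y} → y ≈ ι (ℚ.- 1ℚ) * x → - y ≈ x
            flip {x} {y} eq = begin
              - y                    ≈⟨ -‿cong (trans eq (*-congʳ (trans (ι-‿ 1ℚ) (-‿cong ι-1)))) ⟩
              - (- 1# * x)           ≈⟨ solve 2 (λ o x → :- (:- o :* x) := o :* x) refl 1# x ⟩
              1# * x                 ≈⟨ *-identityˡ x ⟩
              x                      ∎

          0≤w : ∀ t → 0# ≤ w t
          0≤w s = 0≤y-x⇒x≤y (≤-respʳ negate (x≤y⇒0≤y-x (≤-respʳ (trans (∑ᴿ.∑-0 λ j → ∑ᴿ.∑-0 λ i → trans (*-congʳ ι-0) (zeroˡ _)) refl)
              (proj₂ solution (∈-++⁺ˡ (∈-tabulate⁺ {f = signRow} s))))))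
            where
            open Solver using (solve; _:*_; _:=_; :-_; _:-_; _:+_)
            picked : dot (proj₁ (signRow s)) w ≈ - w s
            picked = begin
              (sum λ t → ι (ℚ.- ∑ℚ.[ does (t Fin.≟ s) ]) * w t)
                ≈⟨ sum-≈ (λ t → trans (*-congʳ (trans (ι-‿ _) (-‿cong (ι-[] (does (t Fin.≟ s)))))) (solve 2 (λ a b → :- a :* b := a :* (:- b)) refl ∑ᴿ.[ does (t Fin.≟ s) ] (w t))) ⟩
              (sum λ t → ∑ᴿ.[ does (t Fin.≟ s) ] * - w t)
                ≈⟨ reflexive (≡.sym (∑≡sum _)) ⟩
              (∑ λ t → ∑ᴿ.[ does (t Fin.≟ s) ] * - w t)
                ≈⟨ ∑ᴿ.∑-δ s (λ t → - w t) ⟩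
              - w s ∎
            negate : 0# - dot (proj₁ (signRow s)) w ≈ w s - 0#
            negate = trans (+-congˡ (-‿cong picked)) (trans (solve 2 (λ z x → z :- (:- x) := x :+ z) refl 0# (w s)) (+-congˡ (trans (sym (-‿inverseʳ 0#)) (+-identityˡ _))))

          Σw≈1 : sum w ≈ 1#
          Σw≈1 = begin
            sum w                     ≈⟨ sum-≈ (λ t → trans (*-congʳ ι-1) (*-identityˡ (w t))) ⟨
            dot (λ _ → 1ℚ) w          ≈⟨ equality (here ≡.refl) ⟩
            value edgeShare           ≈⟨ affine-value edgeShare z affine ⟩
            (sum λ t → proj₁ affine t * ι (test t edgeShare))
                                      ≈⟨ sum-≈ (λ t → trans (*-congˡ (trans (reflexive (cong ι (test-edgeShare t))) ι-1)) (*-identityʳ _)) ⟩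
            sum (proj₁ affine)        ≈⟨ proj₁ (proj₂ affine) ⟩
            1#                        ∎

          z≈ : ∀ e → z e ≈ combine w e
          z≈ e = begin
            z e
              ≈⟨ Eᴿ.∑E-δ e z ⟨
            Eᴿ.∑E (λ e′ → ∑ᴿ.[ isEdge e e′ ] * z e′)
              ≈⟨ ∑-cong (λ j → ∑-cong λ i → *-congʳ (ι-[] (isEdge e (j , i)))) ⟨
            value (λ e′ → ∑ℚ.[ isEdge e e′ ])
              ≈⟨ equality (there (∈-map⁺ coordinateRow (∈-allEdges e))) ⟨
            (sum λ t → ι ∑ℚ.[ bits t e ] * w t)
              ≈⟨ sum-≈ (λ t → trans (*-congʳ (trans (ι-[] (bits t e)) (reflexive (cong (λ x → x e) (≡.sym (proj₂ (proj₂ (vertex-point t)))))))) (*-comm _ _)) ⟩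
            combine w e ∎

      normalised⁺ : ∀ G → mean vertices ⟪ G ⟫ ≈ 1# → Normalised G
      normalised⁺ G mean≈1 = begin
        ∑L (cycles N) (⟪ G ⟫ ∘ point)             ≈⟨ sum-vertices ⟪ G ⟫ ⟨
        sum (⟪ G ⟫ ∘ lookup vertices)             ≈⟨ mean-scaled vertices ⟪ G ⟫ ⟨
        ν (length vertices) * mean vertices ⟪ G ⟫ ≈⟨ trans (*-congˡ mean≈1) (*-identityʳ _) ⟩
        ν (length vertices)                       ≈⟨ reflexive (cong ν (length-map _ (cycles N))) ⟩
        ν L                                       ∎

      normalised⁻ : ∀ G → Normalised G → mean vertices ⟪ G ⟫ ≈ 1#
      normalised⁻ G avg = ν-cancel L (begin
        ν L * mean vertices ⟪ G ⟫                 ≈⟨ *-congʳ (reflexive (cong ν (length-map _ (cycles N)))) ⟨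
        ν (length vertices) * mean vertices ⟪ G ⟫ ≈⟨ mean-scaled vertices ⟪ G ⟫ ⟩
        sum (⟪ G ⟫ ∘ lookup vertices)             ≈⟨ trans (sum-vertices ⟪ G ⟫) avg ⟩
        ν L                                       ≈⟨ *-identityʳ _ ⟨
        ν L * 1#                                  ∎)

      private
        monomialAt : (Fin N → Fin N) → (Edge N → Carrier) → Carrier
        monomialAt p y = foldEdges *-rawMonoid λ e → y e ^ᴿ matchingMonomial p e
          where open import Algebra.Definitions.RawSemiring (CommutativeSemiring.rawSemiring commutativeSemiring) using () renaming (_^_ to _^ᴿ_)

        form : LinearFunctional N → ((Edge N → Carrier) → Carrier) → (Edge N → Carrier) → Carrier
        form G h y = ⟪ G ⟫ y * (h y * h y)

      -- The shape `1# * _ + 0#` is what `eval` yields for a polynomial with a single term of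
      -- coefficient 1, so the hypothesis is the value of `q` at that polynomial.
      mean-square : ∀ G p → 0# ≤ mean vertices (form G λ y → 1# * monomialAt p y + 0#) →
        0# ≤ ∑L (cycles N) λ χ → ⟪ G ⟫ (point χ) * (monomialValue m p χ * monomialValue m p χ)
      mean-square G p 0≤mean = ≤-respʳ (begin
        ν (length vertices) * mean vertices h                ≈⟨ mean-scaled vertices h ⟩
        sum (h ∘ lookup vertices)                            ≈⟨ sum-vertices h ⟩
        ∑L (cycles N) (h ∘ point)                            ≈⟨ ∑L-cong (cycles N) (λ {χ} _ → *-congˡ {⟪ G ⟫ (point χ)} (*-cong (simplify χ) (simplify χ))) ⟩
        ∑L (cycles N) (λ χ → ⟪ G ⟫ (point χ) * (monomialValue m p χ * monomialValue m p χ)) ∎)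
        (*-nonNeg (ν-nonNeg (length vertices)) 0≤mean)
        where
        h = form G λ y → 1# * monomialAt p y + 0#
        simplify : ∀ χ → 1# * monomialAt p (point χ) + 0# ≈ monomialValue m p χ
        simplify χ = trans (+-identityʳ _) (*-identityˡ (monomialValue m p χ))

      mean-form-nonNeg : ∀ G h → (∀ t → 0# ≤ ⟪ G ⟫ (lookup vertices t)) → (∀ y → 0# ≤ h y * h y) → 0# ≤ mean vertices (form G h)
      mean-form-nonNeg G h 0≤G 0≤h² = mean-nonNeg vertices (form G h) (sum-nonNeg _ λ t → *-nonNeg (0≤G t) (0≤h² (lookup vertices t)))

    -- `p` and `q` stand for N/k and 10/N and are given by their products with `k` and `N`, the form
    -- in which they enter the inequalities. Their sum `factor` is the constant a; being rational
    -- and positive, it has an inverse in ℚ.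
    module Scaling (n x : ℕ) (k≤K : suc x ℕ.≤ ⌊ suc (suc (suc (suc n))) /2⌋)
      (p q : ℚ) (0<p : 0ℚ ℚ.< p) (0<q : 0ℚ ℚ.< q)
      (centre : Edge (suc (suc (suc (suc n)))) → Carrier) (centre≈ : ∀ e → centre e ≈ combine (suc n) (λ _ → 1/L (suc n)) e)
      (kp≡N : ℚCasts.ι (suc x) ℚ.* p ≡ ℚCasts.ι (suc (suc (suc (suc n)))))
      (Nq≡10 : ℚCasts.ι (suc (suc (suc (suc n)))) ℚ.* q ≡ ℚCasts.ι 10) where
      open Shrinking (suc n) centre centre≈ public

      private
        k N : ℕ
        k = suc x
        N = suc (suc (suc (suc n)))

        d b : ℕ
        d = suc (suc ⌊ n /2⌋) ∸ k
        b = N ∸ k ∸ 2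

        K≡ : suc (suc ⌊ n /2⌋) ≡ k ℕ.+ d
        K≡ = ≡.sym (ℕ.m+[n∸m]≡n k≤K)

        -- Since 2K ≤ N and k ≤ K, the number N - k of blocks is at least K, and four vertices
        -- already give two pairs. This makes `b` a natural number.
        2≤N∸k : 2 ℕ.≤ N ∸ k
        2≤N∸k = ℕ.≤-trans (ℕ.≤-trans (ℕ.s≤s (ℕ.s≤s ℕ.z≤n)) (ℕ.≤-reflexive (≡.sym (ℕ.m+n∸m≡n K K)))) (ℕ.∸-mono 2K≤N k≤K)
          where
          K : ℕ
          K = suc (suc ⌊ n /2⌋)
          2K≤N : K ℕ.+ K ℕ.≤ N
          2K≤N = ℕ.≤-trans (ℕ.≤-reflexive (cong (K ℕ.+_) (≡.sym (ℕ.+-identityʳ K)))) (ℕ.≤-trans (ℕ.m≤m+n (2 ℕ.* K) _) (ℕ.≤-reflexive (count-leftover N)))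

        N≡ : N ≡ k ℕ.+ suc (suc b)
        N≡ = ≡.trans (≡.sym (ℕ.m+[n∸m]≡n (ℕ.≤-trans k≤K (ℕ.⌊n/2⌋≤n N)))) (cong (k ℕ.+_) (≡.sym (ℕ.m+[n∸m]≡n 2≤N∸k)))

        0<p+q : 0ℚ ℚ.< p ℚ.+ q
        0<p+q = ℚ.+-mono-< 0<p 0<q

        ν-*-ι : ∀ {j l r} → ℚCasts.ι j ℚ.* r ≡ ℚCasts.ι l → ν j * ι r ≈ ν l
        ν-*-ι {j} {l} {r} eq = trans (*-congʳ (ν-ι j)) (trans (sym (ι-* (ℚCasts.ι j) r)) (trans (reflexive (cong ι eq)) (sym (ν-ι l))))

      factor factor⁻¹ : Carrier
      factor   = ι p + ι q
      factor⁻¹ = ι (proj₁ (inverse (p ℚ.+ q) 0<p+q))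

      factor⁻¹-nonNeg : 0# ≤ factor⁻¹
      factor⁻¹-nonNeg = 0≤ι (proj₂ (proj₂ (inverse (p ℚ.+ q) 0<p+q)))

      factor⁻¹*factor : factor⁻¹ * factor ≈ 1#
      factor⁻¹*factor = let r , ar≡1 , _ = inverse (p ℚ.+ q) 0<p+q in begin
        ι r * factor                              ≈⟨ *-congˡ (ι-+ p q) ⟨
        ι r * ι (p ℚ.+ q)                         ≈⟨ trans (*-comm _ _) (sym (ι-* (p ℚ.+ q) r)) ⟩
        ι ((p ℚ.+ q) ℚ.* r)                       ≈⟨ trans (reflexive (cong ι ar≡1)) ι-1 ⟩
        1#                                        ∎

      private
        -- This is kN (a - 1) = N (N - k) + 10k, with N - k written as b + 2: the constant in the
        -- bound at a tour is a - 1 after clearing denominators.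
        deficit : ν (k ℕ.* N) * (factor - 1#) ≈ ν (N ℕ.* suc (suc b) ℕ.+ 10 ℕ.* k)
        deficit = begin
          ν (k ℕ.* N) * (factor - 1#)
            ≈⟨ *-congʳ (ν-* k N) ⟩
          ν k * ν N * (ι p + ι q - 1#)
            ≈⟨ solve 5 (λ k n s t o → k :* n :* (s :+ t :- o) := n :* (k :* s) :+ k :* (n :* t) :- k :* n :* o) refl (ν k) (ν N) (ι p) (ι q) 1# ⟩
          ν N * (ν k * ι p) + ν k * (ν N * ι q) - ν k * ν N * 1#
            ≈⟨ +-cong (+-cong (*-congˡ (ν-*-ι {k} {N} kp≡N)) (*-congˡ (ν-*-ι {N} {10} Nq≡10))) (-‿cong (*-identityʳ _)) ⟩
          ν N * ν N + ν k * ν 10 - ν k * ν N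
            ≈⟨ +-congʳ (+-congʳ (*-congˡ (trans (reflexive (cong ν N≡)) (ν-+ k (suc (suc b)))))) ⟩
          ν N * (ν k + ν (suc (suc b))) + ν k * ν 10 - ν k * ν N
            ≈⟨ solve 4 (λ n k b t → n :* (k :+ b) :+ k :* t :- k :* n := n :* b :+ t :* k) refl (ν N) (ν k) (ν (suc (suc b))) (ν 10) ⟩
          ν N * ν (suc (suc b)) + ν 10 * ν k
            ≈⟨ trans (ν-+ (N ℕ.* suc (suc b)) (10 ℕ.* k)) (+-cong (ν-* N (suc (suc b))) (ν-* 10 k)) ⟨
          ν (N ℕ.* suc (suc b) ℕ.+ 10 ℕ.* k) ∎
          where open Solver

      shrunk-nonNeg : ∀ G → Normalised (suc n) G → MonomialPsd (suc n) G k →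
        ∀ z → Hull (suc n) z → 0# ≤ ⟪ G ⟫ (shrink factor⁻¹ z)
      shrunk-nonNeg G avg psd = shrink-nonNeg G factor factor⁻¹ avg factor⁻¹-nonNeg factor⁻¹*factor λ χ∈ →
        ν-cancel-nonNeg (k ℕ.* N) (≤-respʳ (trans (+-congˡ (sym deficit)) (sym (distribˡ (ν (k ℕ.* N)) _ _)))
          (cycle-bound n x d b K≡ N≡ G avg psd χ∈))

-- The theorem over the Cauchy reals.

open import Data.Integer using (+_)
open import Data.Nat as ℕ using (ℕ; NonZero; ⌊_/2⌋)
open import Data.Product using (_×_; ∃-syntax)
open import Data.Rational as ℚ using ()
open import Relation.Unary using (_⊆_)
open import Defs
open import Algebra.Module.Morphism.Structures using (module LeftModuleMorphisms)
open import Data.Bool using (Bool)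
open import Data.Fin using (Fin; suc)
open import Data.List as List using (List; []; _∷_)
open import Data.List.Relation.Unary.All using ([]; _∷_)
open import Data.Nat as ℕ using (ℕ; suc; NonZero; ⌊_/2⌋; s≤s)
import Data.Nat.Properties as ℕ
open import Data.Product using (_×_; ∃-syntax; _,_)
open import Data.Rational using (ℚ; 0ℚ)
import Data.Rational.Properties as ℚ
open import Relation.Binary.PropositionalEquality as ≡ using (_≡_; cong)
open OrderedAlgebras
open TourBounds
open EdgeVectors
open Polytopes

ℝ-orderedℚAlgebra : OrderedℚAlgebra
ℝ-orderedℚAlgebra = record
  { commutativeRing = Reals.ℝ-commutativeRing
  ; _≤_         = _≤_
  ; ≤-reflexive = λ {x} {y} → Reals.≤-reflexive x y
  ; ≤-trans     = λ {x} {y} {z} → Reals.≤-trans {x} {y} {z}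
  ; ≤-antisym   = λ {x} {y} → Reals.≤-antisym {x} {y}
  ; +-mono-≤    = λ {x} {y} {u} {v} → Reals.+-mono-≤ {x} {y} {u} {v}
  ; *-nonNeg    = λ {x} {y} → Reals.*-nonNeg {x} {y}
  ; _⊔_         = Reals._⊔_
  ; x≤x⊔y       = Reals.x≤x⊔y
  ; y≤x⊔y       = Reals.y≤x⊔y
  ; ⊔-lub       = λ {x} {y} {z} → Reals.⊔-lub {x} {y} {z}
  ; ι           = fromℚ
  ; ι-+         = λ p q → Reals.pointwise-≈ (fromℚ (p ℚ.+ q)) (fromℚ p + fromℚ q) λ _ → ≡.refl
  ; ι-*         = λ p q → Reals.pointwise-≈ (fromℚ (p ℚ.* q)) (fromℚ p * fromℚ q) λ _ → ≡.refl
  ; ι-‿         = λ p → Reals.pointwise-≈ (fromℚ (ℚ.- p)) (- fromℚ p) λ _ → ≡.refl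
  ; ι-0         = Reals.pointwise-≈ 0ℝ 0ℝ λ _ → ≡.refl
  ; ι-1         = Reals.pointwise-≈ 1ℝ 1ℝ λ _ → ≡.refl
  ; ι-mono-≤    = λ {p} {q} → Reals.fromℚ-mono-≤ p q
  }

open OrderedℚAlgebra ℝ-orderedℚAlgebra using (commutativeSemiring)
open OrderedSums ℝ-orderedℚAlgebra using (mean)
open Functionals commutativeSemiring using (LinearFunctional)
open LinearFunctional
open Polytope ℝ-orderedℚAlgebra

average-mean : ∀ {A : Set} (xs : List A) f → average xs f ≡ mean xs f
average-mean []      f = ≡.refl
average-mean (_ ∷ _) f = ≡.refl

fromLinear : ∀ {n} (g : Point n → ℝ) → IsLinear g → LinearFunctional n
fromLinear g g-linear = record
  { ⟪_⟫     = g
  ; ⟪⟫-cong = ⟦⟧-cong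
  ; ⟪⟫-0    = 0ᴹ-homo
  ; ⟪⟫-+    = +ᴹ-homo
  ; ⟪⟫-*    = *ₗ-homo
  }
  where open LeftModuleMorphisms.IsLeftModuleHomomorphism g-linear

module _ {m : ℕ} where
  private
    N : ℕ
    N = suc (suc (suc m))

  toLinear : ∀ (G : LinearFunctional N) → IsLinear ⟪ G ⟫
  toLinear G = record
    { +ᴹ-isGroupHomomorphism = record
      { isMonoidHomomorphism = record
        { isMagmaHomomorphism = record
          { isRelHomomorphism = record { cong = ⟪⟫-cong G }
          ; homo = ⟪⟫-+ G
          }
        ; ε-homo = ⟪⟫-0 G
        }
      ; ⁻¹-homo = ⟪-⟫ m G
      }
    ; *ₗ-homo = ⟪⟫-* G
    }

  normalised : ∀ {k g} (g∈P : P N k g) → Normalised m (fromLinear g (P.linear g∈P))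
  normalised {g = g} g∈P = normalised⁺ m (fromLinear g (P.linear g∈P))
    (≡.subst (_≈ 1ℝ) (average-mean (X N) g) (P.average-1 g∈P))

  monomial-psd : ∀ {k g} (g∈P : P N k g) → MonomialPsd m (fromLinear g (P.linear g∈P)) k
  monomial-psd {g = g} g∈P p _ degree≡k = mean-square m (fromLinear g (P.linear g∈P)) p
    (≡.subst (0ℝ ≤_) (average-mean (X N) λ x → g x * (eval h x * eval h x)) (P.psd g∈P h (ℕ.≤-reflexive degree≡k ∷ [])))
    where
    h : Polynomial N
    h = (1ℝ , matchingMonomial p) ∷ []

  -- The quadratic form is a mean of terms that are each a nonnegative value of `G` times a square,
  -- so it is nonnegative on polynomials of every degree.
  nonNeg∈P : ∀ k (G : LinearFunctional N) → Normalised m G → (∀ t → 0ℝ ≤ ⟪ G ⟫ (List.lookup (X N) t)) → P N k ⟪ G ⟫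
  nonNeg∈P k G avg 0≤G = record
    { linear    = toLinear G
    ; average-1 = ≡.subst (_≈ 1ℝ) (≡.sym (average-mean (X N) ⟪ G ⟫)) (normalised⁻ m G avg)
    ; psd       = λ h _ → ≡.subst (0ℝ ≤_) (≡.sym (average-mean (X N) λ x → ⟪ G ⟫ x * (eval h x * eval h x)))
                    (mean-form-nonNeg m G (eval h) 0≤G λ x → Reals.square-nonNeg (eval h x))
    }

  T⇒Hull : ∀ z → T N z → Hull m z
  T⇒Hull z z∈T = z∈T

  Affine⇒AffineSpan : ∀ z → Affine m z → AffineSpan (X N) z
  Affine⇒AffineSpan z affine = affine

  P°⊆T : ∀ k → P° N k ⊆ T N
  P°⊆T k {z} (affine , nonNeg) = Farkas.hull m z affine λ G avg 0≤G → nonNeg ⟪ G ⟫ (nonNeg∈P k G avg 0≤G)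

≈-refl : ∀ x → x ≈ x
≈-refl x = Reals.pointwise-≈ x x λ _ → ≡.refl

module _ (n x : ℕ) (k≤⌊N/2⌋ : suc x ℕ.≤ ⌊ 4 ℕ.+ n /2⌋)
  (p q : ℚ) (0<p : 0ℚ ℚ.< p) (0<q : 0ℚ ℚ.< q)
  (centre : Point (4 ℕ.+ n)) (centre≈ : ∀ e → centre e ≈ combine (suc n) (λ _ → 1/L (suc n)) e)
  (kp≡N : ℚCasts.ι (suc x) ℚ.* p ≡ ℚCasts.ι (4 ℕ.+ n)) (Nq≡10 : ℚCasts.ι (4 ℕ.+ n) ℚ.* q ≡ ℚCasts.ι 10) where

  private
    k N : ℕ
    k = suc x
    N = suc (suc (suc (suc n)))

  open Scaling n x k≤⌊N/2⌋ p q 0<p 0<q centre centre≈ kp≡N Nq≡10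

  shrunk∈P° : ∀ z → T N z → P° N k (shrink factor⁻¹ z)
  shrunk∈P° z z∈T = Affine⇒AffineSpan (shrink factor⁻¹ z) (shrink-affine factor⁻¹ z (T⇒Hull z z∈T)) , λ g g∈P →
    shrunk-nonNeg (fromLinear g (P.linear g∈P)) (normalised g∈P) (monomial-psd g∈P) z (T⇒Hull z z∈T)

  T-contained : T N ⊖ centre ⊆ (fromℚ p + fromℚ q) ⊙ (P° N k ⊖ centre)
  T-contained {v} (z , z∈T , v≋) = (λ e → shrunk e - centre e) , (shrunk , shrunk∈P° z z∈T , λ e → ≈-refl (shrunk e - centre e)) ,
    λ e → Reals.≈-trans {v e} {z e - centre e} {(fromℚ p + fromℚ q) * (shrunk e - centre e)} (v≋ e)
      (shrink-scale (fromℚ p + fromℚ q) factor⁻¹ z e factor⁻¹*factor)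
    where
    shrunk : Point N
    shrunk = shrink factor⁻¹ z

theorem2 : ∀ (n k : ℕ) .{{_ : NonZero n}} .{{_ : NonZero k}} →
    9 ℕ.≤ n → k ℕ.≤ ⌊ n /2⌋ →
    ∃[ a ] ∃[ α ]
    (a ≈ fromℚ (+ n ℚ./ k) + α)
    × (∣ α ∣ ≤ fromℚ (+ 10 ℚ./ n))
    × (P° n k ⊖ Z n ⊆ T n ⊖ Z n)
    × (T n ⊖ Z n ⊆ a ⊙ (P° n k ⊖ Z n))
theorem2 n@(suc (suc (suc (suc n′)))) k@(suc x) (s≤s (s≤s (s≤s (s≤s _)))) k≤⌊n/2⌋ =
  -- The witness for α is 10 / n for every `k`, so its bound holds with equality.
  fromℚ (+ n ℚ./ k) + fromℚ (+ 10 ℚ./ n) , fromℚ (+ 10 ℚ./ n) , ≈-refl (fromℚ (+ n ℚ./ k) + fromℚ (+ 10 ℚ./ n)) , abs≤ (+ 10 ℚ./ n) (ℚ.<⇒≤ 0<10/n) ,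
  (λ (z , z∈P° , v≋) → z , P°⊆T k z∈P° , v≋) ,
  λ {v} → T-contained n′ x k≤⌊n/2⌋ (+ n ℚ./ k) (+ 10 ℚ./ n) (ℚ.positive⁻¹ (+ n ℚ./ k) {{ℚ.normalize-pos n k}}) 0<10/n (Z n) (barycentre-combine (suc n′))
    (*-/-cancel k n) (*-/-cancel n 10) {v}
  where
  0<10/n : 0ℚ ℚ.< + 10 ℚ./ n
  0<10/n = ℚ.positive⁻¹ (+ 10 ℚ./ n) {{ℚ.normalize-pos 10 n}}
  abs≤ : ∀ q → 0ℚ ℚ.≤ q → ∣ fromℚ q ∣ ≤ fromℚ q
  abs≤ q 0≤q = Reals.pointwise-≤ ∣ fromℚ q ∣ (fromℚ q) λ _ → ℚ.≤-reflexive (ℚ.0≤p⇒∣p∣≡p 0≤q)
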